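{- Let $M$ be a moon polyomino and $\sigma$ a permutation of its column indices such that $\sigma M$ is again a moon polyomino. Then the maximal rectangles of $M$ and of $\sigma M$ (each identified by its pair (height, width)) are the same, and for every function $\Lambda$ from these maximal rectangles to partitions and all vectors $\mathbf r,\mathbf c$ of non-negative integers there is an explicit bijection between $\mathcal F^{ne}(M,\Lambda,\mathbf r,\mathbf c)$ and $\mathcal F^{ne}(\sigma M,\Lambda,\mathbf r,\sigma\mathbf c)$, where $\sigma\mathbf c$ is $\mathbf c$ with entries permuted according to $\sigma$ (so that the entry for the column at position $\sigma(i)$ is $\mathbf c_i$). Furthermore, for every $n$ and every $\Lambda$, the cardinality of $\mathcal F^{ne}(M,\Lambda,n)$ depends only on $\Lambda$, $n$ and the content of $M$, not on $M$ itself. The analogous statements hold with ne-chains replaced by NE-chains, by nE-chains, and by Ne-chains (for nE- and Ne-chains the fillings are $0$-$1$-fillings).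
   Context: A polyomino is a finite subset of $\mathbb Z^2$ (cells); columns/rows are the sets of cells on vertical/horizontal lines. A moon polyomino is a polyomino that is convex (cells between two cells of a column, or of a row, belong to it) and intersection-free (for any two columns the set of row coordinates of one contains that of the other). $\sigma M=\{(\sigma i,j):(i,j)\in M\}$. The content of $M$ is the multiset of its column heights. A maximal rectangle of $M$ is a rectangle contained in $M$ and not contained in a larger rectangle contained in $M$; in a moon polyomino it is determined by its height and width. An (arbitrary) filling assigns a non-negative integer to each cell. View a filling as a multiset of units, a cell with entry $e$ contributing $e$ units. A chain is a sequence of units in cells with non-zero entries such that the smallest rectangle containing them lies in $M$. In an ne-chain each unit lies in a cell strictly right of and strictly above the cell of the previous unit; in an NE-chain weakly right and weakly above. For $0$-$1$-fillings: in an nE-chain each element is weakly right (same column allowed) and strictly above the previous one; in an Ne-chain strictly right and weakly above (same row allowed). A partition is a weakly decreasing sequence of positive integers $\lambda_1\ge\lambda_2\ge\cdots$, and $\lambda_i=0$ beyond its length. $\mathcal F^{ne}(M,\Lambda,\mathbf r,\mathbf c)$ is the set of fillings of $M$ such that the sum of entries in row $i$ is $\mathbf r_i$, the sum of entries in column $i$ is $\mathbf c_i$, and for every maximal rectangle $R$ and every $k\ge1$, with $\Lambda(R)=(\lambda^R_1,\lambda^R_2,\dots)$, the maximum number of units in a union of $k$ pairwise disjoint ne-chains of units lying in $R$ equals $\lambda^R_1+\cdots+\lambda^R_k$ (equivalently, a multiset union of $k$ ne-chains in which a cell with entry $e$ occurs at most $e$ times). $\mathcal F^{ne}(M,\Lambda,n)$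 is the set of fillings satisfying the condition on maximal rectangles and having total sum of entries $n$ (no condition on row/column sums). $\mathcal F^{NE},\mathcal F^{nE},\mathcal F^{Ne}$ are defined in the same way using NE-, nE-, Ne-chains (pairwise disjoint unions). -}

module Defs where

open import Data.Nat as ℕ using (ℕ; zero; suc; _≥_)
open import Data.Integer as ℤ using (ℤ; +_)
open import Data.Fin as Fin using (Fin; toℕ)
open import Data.Fin.Properties as FinP using ()
open import Data.Integer.Properties as ℤP using ()
open import Data.Fin.Permutation using (Permutation′; _⟨$⟩ˡ_)
open import Data.List using (List; []; _∷_; length; filter; map; concat; take; allFin; upTo)
open import Data.Nat.ListAction using (sum)
open import Data.List.Relation.Unary.All using (All)
open import Data.List.Relation.Unary.Linked using (Linked)
open import Data.List.Relation.Binary.Permutation.Propositional using (_↭_)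
open import Data.Vec as Vec using (Vec)
open import Data.Vec.Relation.Unary.All using () renaming (All to VAll)
open import Data.Product using (Σ; _×_; _,_; proj₁; proj₂)
open import Data.Product.Properties using (≡-dec)
open import Data.Sum using (_⊎_)
open import Data.Unit using (⊤)
open import Relation.Binary.PropositionalEquality using (_≡_)
open import Relation.Nullary using (Dec; ¬_)

-- Polyominoes given column by column.
-- Columns sit at the consecutive horizontal positions 0,1,…,m-1
-- (indexed by Fin m); column i consists of the cells (i , y) with
-- bot i ≤ y < bot i + ht i  (rows are integers).

record Poly : Set where
  field
    m   : ℕ
    bot : Fin m → ℤ
    ht  : Fin m → ℕ
open Poly public

InM : (M : Poly) → Fin (m M) → ℤ → Set
InM M i y = (bot M i ℤ.≤ y) × (y ℤ.< bot M i ℤ.+ + ht M i)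

record IsMoon (M : Poly) : Set where
  field
    colNonEmpty : ∀ i → 0 ℕ.< ht M i
    colConvex   : ∀ i y₁ y₂ y₃ → y₁ ℤ.≤ y₂ → y₂ ℤ.≤ y₃ →
                  InM M i y₁ → InM M i y₃ → InM M i y₂
    rowConvex   : ∀ (i₁ i₂ i₃ : Fin (m M)) y → i₁ Fin.≤ i₂ → i₂ Fin.≤ i₃ →
                  InM M i₁ y → InM M i₃ y → InM M i₂ y
    interFree   : ∀ i i' → (∀ y → InM M i y → InM M i' y)
                         ⊎ (∀ y → InM M i' y → InM M i y)

-- σM : the column at position i of M is moved to position σ(i)
permPoly : (M : Poly) → Permutation′ (m M) → Poly
permPoly M σ = record
  { m   = m M
  ; bot = λ j → bot M (σ ⟨$⟩ˡ j)
  ; ht  = λ j → ht M (σ ⟨$⟩ˡ j) }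

-- σc : entry at position σ(i) is c i
permVec : ∀ {n} → Permutation′ n → (Fin n → ℕ) → (Fin n → ℕ)
permVec σ c j = c (σ ⟨$⟩ˡ j)

colHeights : Poly → List ℕ
colHeights M = map (ht M) (allFin (m M))

SameContent : Poly → Poly → Set
SameContent M M' = colHeights M ↭ colHeights M'

record Rect : Set where
  field
    left   : ℕ
    width  : ℕ
    bottom : ℤ
    height : ℕ
open Rect public

InRect : Rect → ℕ → ℤ → Set
InRect R x y = (left R ℕ.≤ x) × (x ℕ.< left R ℕ.+ width R)
             × (bottom R ℤ.≤ y) × (y ℤ.< bottom R ℤ.+ + height R)

RectIn : Poly → Rect → Set
RectIn M R = (0 ℕ.< width R) × (0 ℕ.< height R) × (left R ℕ.+ width R ℕ.≤ m M)
           × (∀ (i : Fin (m M)) y → InRect R (toℕ i) y → InM M i y)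

-- R ⊆ R' (for non-empty rectangles, containment of cell sets)
SubRect : Rect → Rect → Set
SubRect R R' = (left R' ℕ.≤ left R) × (left R ℕ.+ width R ℕ.≤ left R' ℕ.+ width R')
             × (bottom R' ℤ.≤ bottom R)
             × (bottom R ℤ.+ + height R ℤ.≤ bottom R' ℤ.+ + height R')

MaxRect : Poly → Rect → Set
MaxRect M R = RectIn M R
            × (∀ R' → RectIn M R' → SubRect R R' → (width R' ≡ width R) × (height R' ≡ height R))

HasMaxRect : Poly → ℕ → ℕ → Set
HasMaxRect M h w = Σ Rect λ R → MaxRect M R × (height R ≡ h) × (width R ≡ w)

record Partition : Set where
  field
    parts    : List ℕ
    decr     : Linked _≥_ parts
    positive : All (0 ℕ.<_) parts
open Partition public

-- λ₁ + ⋯ + λₖ  (λᵢ = 0 beyond the length)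
partSum : ℕ → Partition → ℕ
partSum k λ' = sum (take k (parts λ'))

-- Fillings, viewed as functions on all cells (support required in M)

Filling : Poly → Set
Filling M = Fin (m M) → ℤ → ℕ

_≈F_ : ∀ {M} → Filling M → Filling M → Set
F ≈F G = ∀ i y → F i y ≡ G i y

Supported : (M : Poly) → Filling M → Set
Supported M F = ∀ i y → ¬ InM M i y → F i y ≡ 0

rowSum : (M : Poly) → Filling M → ℤ → ℕ
rowSum M F y = sum (map (λ i → F i y) (allFin (m M)))

colSum : (M : Poly) → Filling M → Fin (m M) → ℕ
colSum M F i = sum (map (λ k → F i (bot M i ℤ.+ + k)) (upTo (ht M i)))

totalSum : (M : Poly) → Filling M → ℕ
totalSum M F = sum (map (colSum M F) (allFin (m M)))

data ChainType : Set where
  ne NE nE Ne : ChainType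

Cell : ℕ → Set
Cell n = Fin n × ℤ

Step : ∀ {n} → ChainType → Cell n → Cell n → Set
Step ne (i , y) (i' , y') = (toℕ i ℕ.< toℕ i') × (y ℤ.< y')
Step NE (i , y) (i' , y') = (toℕ i ℕ.≤ toℕ i') × (y ℤ.≤ y')
Step nE (i , y) (i' , y') = (toℕ i ℕ.≤ toℕ i') × (y ℤ.< y')
Step Ne (i , y) (i' , y') = (toℕ i ℕ.< toℕ i') × (y ℤ.≤ y')

_≟c_ : ∀ {n} (a b : Cell n) → Dec (a ≡ b)
_≟c_ = ≡-dec FinP._≟_ ℤP._≟_

occ : ∀ {n} → Cell n → List (Cell n) → ℕ
occ c xs = length (filter (λ x → x ≟c c) xs)

-- a family of k chains (of units, recorded by their cells) lying in R,
-- forming a multiset union in which each cell c is used at most F c times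
-- (this encodes k pairwise disjoint chains of units)
ValidChains : (t : ChainType) (M : Poly) → Filling M → Rect → ∀ {k} → Vec (List (Cell (m M))) k → Set
ValidChains t M F R cs =
    VAll (λ xs → Linked (Step t) xs × All (λ c → InRect R (toℕ (proj₁ c)) (proj₂ c)) xs) cs
  × (∀ (c : Cell (m M)) → occ c (concat (Vec.toList cs)) ℕ.≤ F (proj₁ c) (proj₂ c))

chainsSize : ∀ {n k} → Vec (List (Cell n)) k → ℕ
chainsSize cs = length (concat (Vec.toList cs))

ChainCond : (t : ChainType) (M : Poly) → Filling M → Rect → Partition → Set
ChainCond t M F R λ' = ∀ k → 1 ℕ.≤ k →
    (Σ (Vec (List (Cell (m M))) k) λ cs → ValidChains t M F R cs × (chainsSize cs ≡ partSum k λ'))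
  × (∀ (cs : Vec (List (Cell (m M))) k) → ValidChains t M F R cs → chainsSize cs ℕ.≤ partSum k λ')

EntryCond : (t : ChainType) (M : Poly) → Filling M → Set
EntryCond ne M F = ⊤
EntryCond NE M F = ⊤
EntryCond nE M F = ∀ i y → F i y ℕ.≤ 1
EntryCond Ne M F = ∀ i y → F i y ℕ.≤ 1

-- Λ assigns a partition to each maximal rectangle, identified by (height, width)
Shape : Set
Shape = ℕ → ℕ → Partition

GoodFilling : ChainType → (M : Poly) → Shape → Filling M → Set
GoodFilling t M Λ F = Supported M F × EntryCond t M F
                    × (∀ R → MaxRect M R → ChainCond t M F R (Λ (height R) (width R)))

FRC : ChainType → (M : Poly) → Shape → (ℤ → ℕ) → (Fin (m M) → ℕ) → Filling M → Set
FRC t M Λ r c F = GoodFilling t M Λ F × (∀ y → rowSum M F y ≡ r y) × (∀ i → colSum M F i ≡ c i)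

FN : ChainType → (M : Poly) → Shape → ℕ → Filling M → Set
FN t M Λ n F = GoodFilling t M Λ F × (totalSum M F ≡ n)

record FBij (M M' : Poly) (P : Filling M → Set) (Q : Filling M' → Set) : Set where
  field
    to      : (F : Filling M) → P F → Filling M'
    from    : (G : Filling M') → Q G → Filling M
    to-Q    : ∀ F p → Q (to F p)
    from-P  : ∀ G q → P (from G q)
    to-cong   : ∀ F F' p p' → _≈F_ {M} F F' → _≈F_ {M'} (to F p) (to F' p')
    from-cong : ∀ G G' q q' → _≈F_ {M'} G G' → _≈F_ {M} (from G q) (from G' q')
    from-to : ∀ F p q → _≈F_ {M} (from (to F p) q) F
    to-from : ∀ G q p → _≈F_ {M'} (to (from G q) p) G

-- The units of a filling in a rectangle form a matrix on which two commuting families of crystal operators act, one on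
-- columns and one on rows; matrices highest for both families are determined by their row sums, which makes it possible
-- to replace the first column of a matrix by a new last column so that the row class of all columns but the moved one and
-- the column class of the whole matrix are kept. An operator moves a single unit between adjacent lines, and every family
-- of chains survives the move after exchanging tails of chains at the two lines, so Greene-type invariants depend on the
-- classes only. Applied to the maximal rectangle through the smallest column of a moon polyomino, the replacement moves
-- that column to the right end; a maximal rectangle either contains no more rows than the moved column, where the column
-- class counts, or avoids the moved column, where the row class counts. Sorting the columns by such moves connects any two
-- arrangements. For the cardinalities, the transposed move lowers columns by one row, and so turns a sorted polyomino into
-- a Ferrers shape, which depends on the content only.
module Submission where

-- No tableaux occur. The role of the RSK correspondence is played by the fact that a matrix is
-- determined by its column class together with its row normal form (`PQ-unique`). The new last
-- column exists by a Pieri rule: passing from a row-highest matrix to the row normal form of its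
-- tail removes a horizontal strip from the row sums, or a vertical strip for 0-1-matrices, and this
-- strip is the new column. Whatever concerns the opposite direction comes from half a turn, which
-- reverses all edges. Two crystal structures serve four types of chains: `kind` selects the
-- structure, and for chains that are weak in the horizontal direction the rows are read from top to
-- bottom. For the chains the obstacle is that an exchange of tails must work inside every
-- rectangle, where only part of the two lines is visible. The brackets that control it are
-- intervals, and convexity keeps them inside the rectangle. Fillings are matched by relations that
-- are shown to be functional in both directions, so that steps compose and are inverted without
-- choosing maps.

open import Data.Bool as Bool using (Bool; true; false; if_then_else_; _∧_)
open import Data.Bool.Properties using (∧-comm)
open import Data.Empty
open import Data.Fin as Fin using (Fin; toℕ; fromℕ<)
open import Data.Fin.Permutation using (Permutation′; _⟨$⟩ˡ_; _⟨$⟩ʳ_; inverseˡ; inverseʳ)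
import Data.Fin.Properties as FinP
open import Data.Integer as ℤ using (ℤ)
import Data.Integer.Properties as ℤP
open import Data.List using (List; []; _∷_; _++_; map; length; filter; replicate; concat; allFin; tabulate; upTo; applyUpTo)
open import Data.List.Membership.Propositional using (_∈_)
open import Data.List.Membership.Propositional.Properties using (∈-filter⁻; ∈-++⁻; ∈-map⁺; ∈-map⁻; ∈-∃++; ∈-++⁺ˡ; ∈-++⁺ʳ; ∈-allFin)
open import Data.List.Properties using (++-assoc; ++-identityʳ; length-++; length-replicate; length-map; map-∘; map-tabulate; map-upTo; length-tabulate; filter-++)
open import Data.List.Relation.Binary.Permutation.Propositional as Perm using (_↭_; ↭-sym; ↭-trans; ↭-refl; ↭-reflexive)
open import Data.List.Relation.Binary.Permutation.Propositional.Properties as PermP using (∈-resp-↭; drop-mid; shift; ↭-length; ∷↭∷ʳ)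
open import Data.List.Relation.Unary.All as All using (All; []; _∷_; all?)
import Data.List.Relation.Unary.All.Properties as AllP
open import Data.List.Relation.Unary.AllPairs as AllPairs using (AllPairs; []; _∷_)
import Data.List.Relation.Unary.AllPairs.Properties as AllPairsP
open import Data.List.Relation.Unary.Any as Any using (Any; here; there; any?)
open import Data.List.Relation.Unary.Linked as Linked using (Linked)
import Data.List.Relation.Unary.Linked.Properties as LinkedP
open import Data.List.Relation.Unary.Unique.Propositional using (Unique)
open import Data.List.Relation.Unary.Unique.Propositional.Properties using (map⁺; allFin⁺)
open import Data.Nat
open import Data.Nat.Induction using (<-wellFounded; <-rec)
open import Data.Nat.ListAction using (sum)
open import Data.Nat.Properties renaming (m≤n⇒m<n∨m≡n to ≤-split; m≤n⇒m≤1+n to ≤-suc; ≤-reflexive to ≡⇒≤)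
open import Data.Product hiding (map)
open import Data.Sum using (_⊎_; inj₁; inj₂; [_,_]′)
open import Data.Unit using (⊤; tt)
open import Data.Vec as Vec using (Vec; []; _∷_)
import Data.Vec.Properties as VecP
import Data.Vec.Relation.Unary.All.Properties as VAllP
open import Function using (_∘_; id)
open import Function.Bundles using (_⇔_; mk⇔)
open import Induction.WellFounded using (Acc; acc)
open import Relation.Binary.Definitions using (tri<; tri≈; tri>)
open import Relation.Binary.PropositionalEquality
open import Relation.Nullary
open import Relation.Nullary.Decidable using (map′)
open import Relation.Unary using (Decidable)

-- Linear arithmetic over ℕ

infixl 6 _⊕_
infix 4 _≼_ _≐_ _≑_

data Exp (n : ℕ) : Set where
  var : Fin n → Exp n
  con : ℕ → Exp n
  _⊕_ : Exp n → Exp n → Exp n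

-- In a problem, l ≑ r is the hypothesis l ≡ r to be used as r ≤ l.
data Ineq (n : ℕ) : Set where
  _≼_ _≐_ _≑_ : Exp n → Exp n → Ineq n

⟦_⟧ : ∀ {n} → Exp n → Vec ℕ n → ℕ
⟦ var i ⟧ ρ = Vec.lookup ρ i
⟦ con c ⟧ ρ = c
⟦ e ⊕ f ⟧ ρ = ⟦ e ⟧ ρ + ⟦ f ⟧ ρ

⟦_⟧ᵢ : ∀ {n} → Ineq n → Vec ℕ n → Set
⟦ l ≼ r ⟧ᵢ ρ = ⟦ l ⟧ ρ ≤ ⟦ r ⟧ ρ
⟦ l ≐ r ⟧ᵢ ρ = ⟦ l ⟧ ρ ≡ ⟦ r ⟧ ρ
⟦ l ≑ r ⟧ᵢ ρ = ⟦ l ⟧ ρ ≡ ⟦ r ⟧ ρ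

lower upper : ∀ {n} → Ineq n → Exp n
lower (l ≼ r) = l
lower (l ≐ r) = l
lower (l ≑ r) = r
upper (l ≼ r) = r
upper (l ≐ r) = r
upper (l ≑ r) = l

lower≤upper : ∀ {n} (i : Ineq n) ρ → ⟦ i ⟧ᵢ ρ → ⟦ lower i ⟧ ρ ≤ ⟦ upper i ⟧ ρ
lower≤upper (l ≼ r) ρ h = h
lower≤upper (l ≐ r) ρ h = ≡⇒≤ h
lower≤upper (l ≑ r) ρ h = ≡⇒≤ (sym h)

bump : ∀ {n} → Fin n → Vec ℕ n → Vec ℕ n
bump Fin.zero (c ∷ cs) = suc c ∷ cs
bump (Fin.suc i) (c ∷ cs) = c ∷ bump i cs

dot : ∀ {n} → Vec ℕ n → Vec ℕ n → ℕ
dot [] [] = 0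
dot (c ∷ cs) (x ∷ xs) = c * x + dot cs xs

dot-bump : ∀ {n} (i : Fin n) cs xs → dot (bump i cs) xs ≡ Vec.lookup xs i + dot cs xs
dot-bump Fin.zero (c ∷ cs) (x ∷ xs) = +-assoc x (c * x) _
dot-bump (Fin.suc i) (c ∷ cs) (x ∷ xs)
  rewrite dot-bump i cs xs | sym (+-assoc (c * x) (Vec.lookup xs i) (dot cs xs))
      | +-comm (c * x) (Vec.lookup xs i) = +-assoc (Vec.lookup xs i) (c * x) _

norm : ∀ {n} → Exp n → ℕ × Vec ℕ n → ℕ × Vec ℕ n
norm (var i) (c , cs) = c , bump i cs
norm (con k) (c , cs) = k + c , cs
norm (e ⊕ f) a = norm e (norm f a)

value : ∀ {n} → ℕ × Vec ℕ n → Vec ℕ n → ℕ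
value (c , cs) ρ = c + dot cs ρ

norm-sound : ∀ {n} (e : Exp n) a ρ → value (norm e a) ρ ≡ ⟦ e ⟧ ρ + value a ρ
norm-sound (var i) (c , cs) ρ
  rewrite dot-bump i cs ρ | sym (+-assoc c (Vec.lookup ρ i) (dot cs ρ))
      | +-comm c (Vec.lookup ρ i) = +-assoc (Vec.lookup ρ i) c _
norm-sound (con k) (c , cs) ρ = +-assoc k c _
norm-sound (e ⊕ f) a ρ
  rewrite norm-sound e (norm f a) ρ | norm-sound f a ρ = sym (+-assoc (⟦ e ⟧ ρ) _ _)

_≤ᵛ_ : ∀ {n} → Vec ℕ n → Vec ℕ n → Bool
[] ≤ᵛ [] = true
(x ∷ xs) ≤ᵛ (y ∷ ys) = (x ≤ᵇ y) ∧ (xs ≤ᵛ ys)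

≤ᵛ-sound : ∀ {n} (cs ds ρ : Vec ℕ n) → Bool.T (cs ≤ᵛ ds) → dot cs ρ ≤ dot ds ρ
≤ᵛ-sound [] [] [] _ = z≤n
≤ᵛ-sound (c ∷ cs) (d ∷ ds) (x ∷ xs) t with c ≤ᵇ d in eq
... | true = +-mono-≤ (*-monoˡ-≤ x (≤ᵇ⇒≤ c d (subst Bool.T (sym eq) tt))) (≤ᵛ-sound cs ds xs t)

total : ∀ {n} → (Ineq n → Exp n) → List (Ineq n) → Exp n
total f [] = con 0
total f (i ∷ is) = f i ⊕ total f is

zeros : ∀ {n} → ℕ × Vec ℕ n
zeros = 0 , Vec.replicate _ 0

_≤ₙ_ : ∀ {n} → ℕ × Vec ℕ n → ℕ × Vec ℕ n → Bool
(c , cs) ≤ₙ (d , ds) = (c ≤ᵇ d) ∧ (cs ≤ᵛ ds)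

≤ₙ-sound : ∀ {n} (a b : ℕ × Vec ℕ n) ρ → Bool.T (a ≤ₙ b) → value a ρ ≤ value b ρ
≤ₙ-sound (c , cs) (d , ds) ρ t with c ≤ᵇ d in eq
... | true = +-mono-≤ (≤ᵇ⇒≤ c d (subst Bool.T (sym eq) tt)) (≤ᵛ-sound cs ds ρ t)

check : ∀ {n} → List (Ineq n) → Exp n → Exp n → Bool
check hs l r = norm (l ⊕ total upper hs) zeros ≤ₙ norm (r ⊕ total lower hs) zeros

checkGoal : ∀ {n} → List (Ineq n) → Ineq n → Bool
checkGoal hs (l ≼ r) = check hs l r
checkGoal hs (l ≐ r) = false
checkGoal hs (l ≑ r) = false

Holds : ∀ {n} → List (Ineq n) → Ineq n → Vec ℕ n → Set
Holds [] g ρ = ⟦ g ⟧ᵢ ρ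
Holds (h ∷ hs) g ρ = ⟦ h ⟧ᵢ ρ → Holds hs g ρ

AllHold : ∀ {n} → List (Ineq n) → Vec ℕ n → Set
AllHold hs ρ = ⟦ total lower hs ⟧ ρ ≤ ⟦ total upper hs ⟧ ρ

dot-zero : ∀ {n} (ρ : Vec ℕ n) → dot (Vec.replicate _ 0) ρ ≡ 0
dot-zero [] = refl
dot-zero (x ∷ ρ) = dot-zero ρ

final : ∀ {n} (e : Exp n) {ρ} → value (norm e zeros) ρ ≡ ⟦ e ⟧ ρ
final e {ρ} = trans (norm-sound e zeros ρ)
    (trans (cong (⟦ e ⟧ ρ +_) (dot-zero ρ)) (+-identityʳ _))

-- The coefficientwise test gives `l` plus the upper sides at most `r` plus the lower sides; the
-- hypotheses bound the lower sides by the upper ones, and these cancel.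
check-sound : ∀ {n} (hs : List (Ineq n)) l r ρ → Bool.T (check hs l r) → AllHold hs ρ → ⟦ l ⟧ ρ ≤ ⟦ r ⟧ ρ
check-sound hs l r ρ t h = +-cancelʳ-≤ ⟦U⟧ _ _ (begin
    ⟦ l ⟧ ρ + ⟦U⟧ ≡⟨ final (l ⊕ total upper hs) ⟨
    value (norm (l ⊕ total upper hs) zeros) ρ ≤⟨ ≤ₙ-sound (norm (l ⊕ total upper hs) zeros) (norm (r ⊕ total lower hs) zeros) ρ t ⟩
    value (norm (r ⊕ total lower hs) zeros) ρ ≡⟨ final (r ⊕ total lower hs) ⟩
    ⟦ r ⟧ ρ + ⟦ total lower hs ⟧ ρ ≤⟨ +-monoʳ-≤ (⟦ r ⟧ ρ) h ⟩
    ⟦ r ⟧ ρ + ⟦U⟧ ∎)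
  where
  open ≤-Reasoning
  ⟦U⟧ = ⟦ total upper hs ⟧ ρ

fold-hyps : ∀ {n} (hs : List (Ineq n)) g ρ → (AllHold hs ρ → ⟦ g ⟧ᵢ ρ) → Holds hs g ρ
fold-hyps [] g ρ k = k z≤n
fold-hyps (i ∷ hs) g ρ k h = fold-hyps hs g ρ (λ a → k (+-mono-≤ (lower≤upper i ρ h) a))

Curry : ∀ n → (Vec ℕ n → Set) → Set
Curry zero P = P []
Curry (suc n) P = (x : ℕ) → Curry n (λ xs → P (x ∷ xs))

curryⁿ : ∀ n {P : Vec ℕ n → Set} → (∀ ρ → P ρ) → Curry n P
curryⁿ zero f = f []
curryⁿ (suc n) f x = curryⁿ n (λ xs → f (x ∷ xs))

Fun : ℕ → Set → Set → Set
Fun zero A B = B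
Fun (suc n) A B = A → Fun n A B

apply : ∀ {A B} n → Fun n A B → Vec A n → B
apply zero f [] = f
apply (suc n) f (x ∷ xs) = apply n (f x) xs

infix 3 _⊢_
record Problem (n : ℕ) : Set where
  constructor _⊢_
  field
    hyps : List (Ineq n)
    goal : Ineq n
open Problem

vars : ∀ n → Vec (Exp n) n
vars n = Vec.map var (Vec.allFin n)

-- The sum of all hypotheses, each taken once, has to dominate the goal coefficientwise.
lin : ∀ n (f : Fun n (Exp n) (Problem n)) →
    let p = apply n f (vars n) in
    {_ : Bool.T (checkGoal (hyps p) (goal p))} → Curry n (Holds (hyps p) (goal p))
lin n f {t} = curryⁿ n (λ ρ → fold-hyps (hyps p) (goal p) ρ (sound (hyps p) (goal p) ρ t))
  where
  p = apply n f (vars n)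
  sound : ∀ (hs : List (Ineq n)) g ρ → Bool.T (checkGoal hs g) → AllHold hs ρ → ⟦ g ⟧ᵢ ρ
  sound hs (l ≼ r) ρ t h = check-sound hs l r ρ t h

isEq : ∀ {n} → List (Ineq n) → Bool
isEq [] = true
isEq ((_ ≼ _) ∷ _) = false
isEq ((_ ≐ _) ∷ hs) = isEq hs
isEq ((_ ≑ _) ∷ hs) = isEq hs

checkEq : ∀ {n} → List (Ineq n) → Exp n → Exp n → Bool
checkEq hs l r = isEq hs ∧
  (norm (l ⊕ total upper hs) zeros ≤ₙ norm (r ⊕ total lower hs) zeros) ∧
  (norm (r ⊕ total lower hs) zeros ≤ₙ norm (l ⊕ total upper hs) zeros)

∧-elim : ∀ a b → Bool.T (a ∧ b) → Bool.T a × Bool.T b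
∧-elim true b t = tt , t

-- The same combination is used in both directions. Hence all hypotheses have to be equations and
-- the coefficients have to agree exactly.
lin≡ : ∀ n (f : Fun n (Exp n) (Problem n)) →
    let p = apply n f (vars n) in
    {_ : Bool.T (checkEq (hyps p) (lower (goal p)) (upper (goal p)))} →
    Curry n (Holds (hyps p) (lower (goal p) ≐ upper (goal p)))
lin≡ n f {t} = curryⁿ n (λ ρ → go (hyps p) ρ (proj₁ t₁) (eqs ρ))
  where
  p = apply n f (vars n)
  l = lower (goal p)
  r = upper (goal p)
  t₁ = ∧-elim (isEq (hyps p)) _ t
  t₂ = ∧-elim (norm (l ⊕ total upper (hyps p)) zeros ≤ₙ norm (r ⊕ total lower (hyps p)) zeros) _ (proj₂ t₁)
  go : ∀ hs ρ → Bool.T (isEq hs) → (⟦ total lower hs ⟧ ρ ≡ ⟦ total upper hs ⟧ ρ → ⟦ l ⟧ ρ ≡ ⟦ r ⟧ ρ) →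
      Holds hs (l ≐ r) ρ
  go [] ρ t k = k refl
  go ((a ≐ b) ∷ hs) ρ t k h = go hs ρ t (λ e → k (cong₂ _+_ h e))
  go ((a ≑ b) ∷ hs) ρ t k h = go hs ρ t (λ e → k (cong₂ _+_ (sym h) e))
  eqs : ∀ ρ → ⟦ total lower (hyps p) ⟧ ρ ≡ ⟦ total upper (hyps p) ⟧ ρ → ⟦ l ⟧ ρ ≡ ⟦ r ⟧ ρ
  eqs ρ e = ≤-antisym
    (check-sound (hyps p) l r ρ (proj₁ t₂) (≡⇒≤ e))
    (+-cancelʳ-≤ (⟦ total lower (hyps p) ⟧ ρ) _ _
      (subst (⟦ r ⟧ ρ + ⟦ total lower (hyps p) ⟧ ρ ≤_) (cong (⟦ l ⟧ ρ +_) (sym e))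
        (subst₂ _≤_ (final (r ⊕ total lower (hyps p))) (final (l ⊕ total upper (hyps p)))
          (≤ₙ-sound (norm (r ⊕ total lower (hyps p)) zeros) (norm (l ⊕ total upper (hyps p)) zeros) ρ (proj₂ t₂)))))

-- Partial sums, Kronecker deltas and indicator functions

S : (ℕ → ℕ) → ℕ → ℕ
S f zero = 0
S f (suc n) = S f n + f n

S-cong : ∀ {f g} n → (∀ k → k < n → f k ≡ g k) → S f n ≡ S g n
S-cong zero h = refl
S-cong (suc n) h = cong₂ _+_ (S-cong n (λ k l → h k (≤-suc l))) (h n ≤-refl)

S-+ : ∀ f g n → S (λ k → f k + g k) n ≡ S f n + S g n
S-+ f g zero = refl
S-+ f g (suc n) rewrite S-+ f g n =
  lin≡ 4 (λ a b c d → [] ⊢ (a ⊕ b) ⊕ (c ⊕ d) ≐ (a ⊕ c) ⊕ (b ⊕ d)) (S f n) (S g n) (f n) (g n)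

S-mono : ∀ f {m n} → m ≤ n → S f m ≤ S f n
S-mono f {n = zero} z≤n = ≤-refl
S-mono f {m} {suc n} l with ≤-split l
... | inj₁ (s≤s l') = ≤-trans (S-mono f l') (m≤m+n _ _)
... | inj₂ refl = ≤-refl

S-zero : ∀ f n → (∀ k → k < n → f k ≡ 0) → S f n ≡ 0
S-zero f zero h = refl
S-zero f (suc n) h rewrite h n ≤-refl = trans (+-identityʳ _) (S-zero f n (λ k l → h k (≤-suc l)))

S-one : ∀ f n k → k < n → f k ≤ S f n
S-one f (suc n) k l with ≤-split l
... | inj₁ (s≤s l') = ≤-trans (S-one f n k l') (m≤m+n _ _)
... | inj₂ refl = m≤n+m _ _

S-*ˡ : ∀ c f n → S (λ k → c * f k) n ≡ c * S f n
S-*ˡ c f zero = sym (*-zeroʳ c)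
S-*ˡ c f (suc n) rewrite S-*ˡ c f n = sym (*-distribˡ-+ c (S f n) (f n))

e : ℕ → ℕ → ℕ
e zero zero = 1
e zero (suc b) = 0
e (suc a) zero = 0
e (suc a) (suc b) = e a b

lt : ℕ → ℕ → ℕ
lt a zero = 0
lt zero (suc b) = 1
lt (suc a) (suc b) = lt a b

e-refl : ∀ a → e a a ≡ 1
e-refl zero = refl
e-refl (suc a) = e-refl a

e-≢ : ∀ a b → a ≢ b → e a b ≡ 0
e-≢ zero zero n = ⊥-elim (n refl)
e-≢ zero (suc b) n = refl
e-≢ (suc a) zero n = refl
e-≢ (suc a) (suc b) n = e-≢ a b (n ∘ cong suc)

lt-yes : ∀ {a b} → a < b → lt a b ≡ 1
lt-yes {zero} (s≤s l) = refl
lt-yes {suc a} (s≤s l) = lt-yes l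

lt-no : ∀ {a b} → b ≤ a → lt a b ≡ 0
lt-no z≤n = refl
lt-no (s≤s l) = lt-no l

S-e : ∀ a n → S (e a) n ≡ lt a n
S-e a zero = refl
S-e a (suc n) with <-cmp a n
... | tri< l neq _ rewrite S-e a n | lt-yes l | e-≢ a n neq = sym (lt-yes (≤-suc l))
... | tri≈ _ refl _ rewrite S-e a a | lt-no (≤-refl {a}) | e-refl a = sym (lt-yes (n<1+n a))
... | tri> _ neq g rewrite S-e a n | lt-no (<⇒≤ g) | e-≢ a n neq = sym (lt-no g)

-- Matrices and moves of a single unit

Mat : Set
Mat = ℕ → ℕ → ℕ

infix 4 _≈_
_≈_ : Mat → Mat → Set
F ≈ G = ∀ i k → F i k ≡ G i k

≈-refl : ∀ {F} → F ≈ F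
≈-refl i k = refl
≈-sym : ∀ {F G} → F ≈ G → G ≈ F
≈-sym p i k = sym (p i k)
≈-trans : ∀ {F G H} → F ≈ G → G ≈ H → F ≈ H
≈-trans p q i k = trans (p i k) (q i k)

tr : Mat → Mat
tr F i k = F k i

Pos : Set
Pos = ℕ × ℕ

δ : Pos → Mat
δ (a , b) i k = e a i * e b k

-- A unit moves from `s` to `d`. The balanced equation avoids truncated subtraction, so that
-- compositions of moves are settled by linear arithmetic.
record Mv (s d : Pos) (F F' : Mat) : Set where
  constructor mk
  field
    un : ∀ i k → F' i k + δ s i k ≡ F i k + δ d i k
open Mv public

Mv-tr : ∀ {s d F F'} → Mv s d F F' → Mv (swap s) (swap d) (tr F) (tr F')
Mv-tr {a , b} {c , d} {F} {F'} m = mk go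
  where
  go : ∀ i k → F' k i + δ (b , a) i k ≡ F k i + δ (d , c) i k
  go i k rewrite *-comm (e b i) (e a k) | *-comm (e d i) (e c k) = un m k i

Mv-resp : ∀ {s d F F' G G'} → F ≈ G → F' ≈ G' → Mv s d F F' → Mv s d G G'
Mv-resp {s} {d} p q m = mk (λ i k → subst₂ (λ x y → x + δ s i k ≡ y + δ d i k) (q i k) (p i k) (un m i k))

Mv-det : ∀ {s d F F' G G'} → Mv s d F F' → Mv s d G G' → F ≈ G → F' ≈ G'
Mv-det {s} m m' p i k = +-cancelʳ-≡ (δ s i k) _ _
  (trans (un m i k) (trans (cong (_+ _) (p i k)) (sym (un m' i k))))

Mv-col : ∀ {s d F F'} → Mv s d F F' → ∀ i n →
    S (F' i) n + e (proj₁ s) i * lt (proj₂ s) n ≡ S (F i) n + e (proj₁ d) i * lt (proj₂ d) n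
Mv-col {a , b} {c , d} {F} {F'} m i n = begin
  S (F' i) n + e a i * lt b n ≡⟨ cong (S (F' i) n +_) (side a b) ⟨
  S (F' i) n + S (δ (a , b) i) n ≡⟨ S-+ (F' i) (δ (a , b) i) n ⟨
  S (λ k → F' i k + δ (a , b) i k) n ≡⟨ S-cong n (λ k _ → un m i k) ⟩
  S (λ k → F i k + δ (c , d) i k) n ≡⟨ S-+ (F i) (δ (c , d) i) n ⟩
  S (F i) n + S (δ (c , d) i) n ≡⟨ cong (S (F i) n +_) (side c d) ⟩
  S (F i) n + e c i * lt d n ∎
  where
  open ≡-Reasoning
  side : ∀ a b → S (δ (a , b) i) n ≡ e a i * lt b n
  side a b = trans (S-*ˡ (e a i) (e b) n) (cong (e a i *_) (S-e b n))

module _ {s d F F'} (m : Mv s d F F') where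

  Mv-col-other : ∀ {i} n → proj₁ s ≢ i → proj₁ d ≢ i → S (F' i) n ≡ S (F i) n
  Mv-col-other {i} n p q with Mv-col m i n
  ... | r rewrite e-≢ _ _ p | e-≢ _ _ q = trans (sym (+-identityʳ _)) (trans r (+-identityʳ _))

  Mv-col-from : ∀ n → proj₁ s ≢ proj₁ d → S (F' (proj₁ s)) n + lt (proj₂ s) n ≡ S (F (proj₁ s)) n
  Mv-col-from n p with Mv-col m (proj₁ s) n
  ... | r rewrite e-refl (proj₁ s) | e-≢ _ _ (p ∘ sym) | +-identityʳ (lt (proj₂ s) n) = trans r (+-identityʳ _)

  Mv-col-to : ∀ n → proj₁ s ≢ proj₁ d → S (F' (proj₁ d)) n ≡ S (F (proj₁ d)) n + lt (proj₂ d) n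
  Mv-col-to n p with Mv-col m (proj₁ d) n
  ... | r rewrite e-refl (proj₁ d) | e-≢ _ _ p | +-identityʳ (lt (proj₂ d) n) = trans (sym (+-identityʳ _)) r

  Mv-col-both : ∀ n → proj₁ s ≡ proj₁ d →
      S (F' (proj₁ d)) n + lt (proj₂ s) n ≡ S (F (proj₁ d)) n + lt (proj₂ d) n
  Mv-col-both n refl with Mv-col m (proj₁ d) n
  ... | r rewrite e-refl (proj₁ d) | +-identityʳ (lt (proj₂ d) n) | +-identityʳ (lt (proj₂ s) n) = r

δ-pos : ∀ (F : Mat) s → 0 < F (proj₁ s) (proj₂ s) → ∀ i k → δ s i k ≤ F i k
δ-pos F (a , b) p i k with a ≟ i
... | no n rewrite e-≢ _ _ n = z≤n
... | yes refl with b ≟ k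
... | no n rewrite e-≢ _ _ n | *-zeroʳ (e a a) = z≤n
... | yes refl rewrite e-refl a | e-refl b = p

move : Pos → Pos → Mat → Mat
move s d F i k = (F i k + δ d i k) ∸ δ s i k

move-Mv : ∀ {s d F} → 0 < F (proj₁ s) (proj₂ s) → Mv s d F (move s d F)
move-Mv {s} {d} {F} p = mk (λ i k → m∸n+n≡m (≤-trans (δ-pos F s p i k) (m≤m+n _ _)))

-- First minimisers of A - B, provided the minimum is negative.

record FM (A B : ℕ → ℕ) (y : ℕ) : Set where
  constructor fm
  field
    neg : A y < B y
    bef : ∀ k → k < y → A y + B k < A k + B y
    aft : ∀ k → y ≤ k → A y + B k ≤ A k + B y
open FM public

HI : (A B : ℕ → ℕ) → Set
HI A B = ∀ k → B k ≤ A k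

module _ {A B A' B' : ℕ → ℕ} where

  FM-same : (∀ k → A' k + B k ≡ A k + B' k) → ∀ {y} → FM A B y → FM A' B' y
  FM-same s {y} (fm n b a) = fm
    (lin 4 (λ A B A' B' → (A' ⊕ B ≐ A ⊕ B') ∷ (con 1 ⊕ A ≼ B) ∷ [] ⊢ con 1 ⊕ A' ≼ B')
      (A y) (B y) (A' y) (B' y) (s y) n)
    (λ k l → lin 8 (λ A B A' B' C D C' D' → (A' ⊕ B ≐ A ⊕ B') ∷ (C' ⊕ D ≑ C ⊕ D') ∷ (con 1 ⊕ A ⊕ D ≼ C ⊕ B) ∷ [] ⊢ con 1 ⊕ A' ⊕ D' ≼ C' ⊕ B')
      (A y) (B y) (A' y) (B' y) (A k) (B k) (A' k) (B' k) (s y) (s k) (b k l))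
    (λ k l → lin 8 (λ A B A' B' C D C' D' → (A' ⊕ B ≐ A ⊕ B') ∷ (C' ⊕ D ≑ C ⊕ D') ∷ (A ⊕ D ≼ C ⊕ B) ∷ [] ⊢ A' ⊕ D' ≼ C' ⊕ B')
      (A y) (B y) (A' y) (B' y) (A k) (B k) (A' k) (B' k) (s y) (s k) (a k l))

  module _ {i : ℕ} (s : ∀ k → k ≢ i → A' k + B k ≡ A k + B' k) where

    private
      keep : ∀ {y k} → y ≢ i → k ≢ i →
          (A y + B k < A k + B y → A' y + B' k < A' k + B' y) ×
          (A y + B k ≤ A k + B y → A' y + B' k ≤ A' k + B' y)
      keep {y} {k} p q =
        lin 8 (λ A B A' B' C D C' D' → (A' ⊕ B ≐ A ⊕ B') ∷ (C' ⊕ D ≑ C ⊕ D') ∷ (con 1 ⊕ A ⊕ D ≼ C ⊕ B) ∷ [] ⊢ con 1 ⊕ A' ⊕ D' ≼ C' ⊕ B')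
          (A y) (B y) (A' y) (B' y) (A k) (B k) (A' k) (B' k) (s y p) (s k q) ,
        lin 8 (λ A B A' B' C D C' D' → (A' ⊕ B ≐ A ⊕ B') ∷ (C' ⊕ D ≑ C ⊕ D') ∷ (A ⊕ D ≼ C ⊕ B) ∷ [] ⊢ A' ⊕ D' ≼ C' ⊕ B')
          (A y) (B y) (A' y) (B' y) (A k) (B k) (A' k) (B' k) (s y p) (s k q)

      keep-neg : ∀ {y} → y ≢ i → A y < B y → A' y < B' y
      keep-neg {y} p = lin 4 (λ A B A' B' → (A' ⊕ B ≐ A ⊕ B') ∷ (con 1 ⊕ A ≼ B) ∷ [] ⊢ con 1 ⊕ A' ≼ B')
        (A y) (B y) (A' y) (B' y) (s y p)

      build : ∀ {y} → y ≢ i → FM A B y →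
          (i < y → A' y + B' i < A' i + B' y) → (y ≤ i → A' y + B' i ≤ A' i + B' y) → FM A' B' y
      build {y} p (fm n b a) u v = fm (keep-neg p n) b' a'
        where
        b' : ∀ k → k < y → _
        b' k l with k ≟ i
        ... | yes refl = u l
        ... | no q = proj₁ (keep p q) (b k l)
        a' : ∀ k → y ≤ k → _
        a' k l with k ≟ i
        ... | yes refl = v l
        ... | no q = proj₂ (keep p q) (a k l)

    module _ (up : A' i + B i ≡ suc (A i + B' i)) where

      FM-up : ∀ {y} → y ≢ i → FM A B y → FM A' B' y
      FM-up {y} p f@(fm n b a) = build p f
        (λ l → lin 8 (λ A B A' B' C D C' D' → (A' ⊕ B ≐ A ⊕ B') ∷ (C' ⊕ D ≑ con 1 ⊕ (C ⊕ D')) ∷ (con 1 ⊕ A ⊕ D ≼ C ⊕ B) ∷ [] ⊢ con 1 ⊕ A' ⊕ D' ≼ C' ⊕ B')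
          (A y) (B y) (A' y) (B' y) (A i) (B i) (A' i) (B' i) (s y p) up (b i l))
        (λ l → lin 8 (λ A B A' B' C D C' D' → (A' ⊕ B ≐ A ⊕ B') ∷ (C' ⊕ D ≑ con 1 ⊕ (C ⊕ D')) ∷ (A ⊕ D ≼ C ⊕ B) ∷ [] ⊢ A' ⊕ D' ≼ C' ⊕ B')
          (A y) (B y) (A' y) (B' y) (A i) (B i) (A' i) (B' i) (s y p) up (a i l))

      -- The values at `i` and `suc i` are tied. Raising the one at `i` leaves the same minimum,
      -- which is now attained first at `suc i`.
      FM-up-shift : A (suc i) + B i ≡ A i + B (suc i) → FM A B i → FM A' B' (suc i)
      FM-up-shift q (fm n b a) = fm
        (lin 6 (λ A B C D C' D' → (C' ⊕ D ≐ C ⊕ D') ∷ (C ⊕ B ≐ A ⊕ D) ∷ (con 1 ⊕ A ≼ B) ∷ [] ⊢ con 1 ⊕ C' ≼ D')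
          (A i) (B i) (A (suc i)) (B (suc i)) (A' (suc i)) (B' (suc i)) (s _ ≢i) q n)
        b' a'
        where
        ≢i : suc i ≢ i
        ≢i ()
        b' : ∀ k → k < suc i → _
        b' k (s≤s l) with ≤-split l
        ... | inj₁ l' = lin 10 (λ A B C D C' D' E F E' F' → (C' ⊕ D ≐ C ⊕ D') ∷ (E' ⊕ F ≑ E ⊕ F') ∷ (C ⊕ B ≐ A ⊕ D) ∷ (con 1 ⊕ A ⊕ F ≼ E ⊕ B) ∷ [] ⊢ con 1 ⊕ C' ⊕ F' ≼ E' ⊕ D')
            (A i) (B i) (A (suc i)) (B (suc i)) (A' (suc i)) (B' (suc i)) (A k) (B k) (A' k) (B' k) (s _ ≢i) (s k (<⇒≢ l')) q (b k l')
        ... | inj₂ refl = lin 8 (λ A B C D C' D' A' B' → (C' ⊕ D ≐ C ⊕ D') ∷ (A' ⊕ B ≑ con 1 ⊕ (A ⊕ B')) ∷ (C ⊕ B ≐ A ⊕ D) ∷ [] ⊢ con 1 ⊕ C' ⊕ B' ≼ A' ⊕ D')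
            (A i) (B i) (A (suc i)) (B (suc i)) (A' (suc i)) (B' (suc i)) (A' i) (B' i) (s _ ≢i) up q
        a' : ∀ k → suc i ≤ k → _
        a' k l = lin 10 (λ A B C D C' D' E F E' F' → (C' ⊕ D ≐ C ⊕ D') ∷ (E' ⊕ F ≑ E ⊕ F') ∷ (C ⊕ B ≐ A ⊕ D) ∷ (A ⊕ F ≼ E ⊕ B) ∷ [] ⊢ C' ⊕ F' ≼ E' ⊕ D')
            (A i) (B i) (A (suc i)) (B (suc i)) (A' (suc i)) (B' (suc i)) (A k) (B k) (A' k) (B' k) (s _ ≢i) (s k (>⇒≢ l)) q (a k (<⇒≤ l))

      HI-up : HI A B → HI A' B'
      HI-up h k with k ≟ i
      ... | yes refl = lin 4 (λ A B A' B' → (A' ⊕ B ≑ con 1 ⊕ (A ⊕ B')) ∷ (B ≼ A) ∷ [] ⊢ B' ≼ A') (A i) (B i) (A' i) (B' i) up (h i)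
      ... | no p = lin 4 (λ A B A' B' → (A' ⊕ B ≑ A ⊕ B') ∷ (B ≼ A) ∷ [] ⊢ B' ≼ A') (A k) (B k) (A' k) (B' k) (s k p) (h k)

    module _ (down : suc (A' i + B i) ≡ A i + B' i) where

      FM-down-< : ∀ {y} → y ≢ i → A y + B i < suc (A i + B y) → (i < y → suc (A y + B i) < A i + B y) →
          suc (A y + B i) ≤ A i + B y → FM A B y → FM A' B' y
      FM-down-< {y} p _ u v f@(fm n b a) = build p f
        (λ l → lin 8 (λ A B A' B' C D C' D' → (A' ⊕ B ≐ A ⊕ B') ∷ (con 1 ⊕ (C' ⊕ D) ≑ C ⊕ D') ∷ (con 2 ⊕ A ⊕ D ≼ C ⊕ B) ∷ [] ⊢ con 1 ⊕ A' ⊕ D' ≼ C' ⊕ B')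
          (A y) (B y) (A' y) (B' y) (A i) (B i) (A' i) (B' i) (s y p) down (u l))
        (λ l → lin 8 (λ A B A' B' C D C' D' → (A' ⊕ B ≐ A ⊕ B') ∷ (con 1 ⊕ (C' ⊕ D) ≑ C ⊕ D') ∷ (con 1 ⊕ A ⊕ D ≼ C ⊕ B) ∷ [] ⊢ A' ⊕ D' ≼ C' ⊕ B')
          (A y) (B y) (A' y) (B' y) (A i) (B i) (A' i) (B' i) (s y p) down v)

      -- A decrease at i is harmless if the value at i exceeds a value elsewhere (or 0).
      FM-down : ∀ {y} → y ≢ i →
          (∃ λ k → (k < i ⊎ (k ≡ suc i × y ≢ suc i)) × A k + B i < A i + B k) ⊎ B i < A i →
          FM A B y → FM A' B' y
      FM-down {y} p (inj₂ q) f@(fm n b a) = FM-down-< p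
         (lin 4 (λ A B C D → (con 1 ⊕ A ≼ B) ∷ (con 1 ⊕ D ≼ C) ∷ [] ⊢ con 1 ⊕ A ⊕ D ≼ con 1 ⊕ C ⊕ B) (A y) (B y) (A i) (B i) n q)
         (λ l → lin 4 (λ A B C D → (con 1 ⊕ A ≼ B) ∷ (con 1 ⊕ D ≼ C) ∷ [] ⊢ con 2 ⊕ A ⊕ D ≼ C ⊕ B) (A y) (B y) (A i) (B i) n q)
         (lin 4 (λ A B C D → (con 1 ⊕ A ≼ B) ∷ (con 1 ⊕ D ≼ C) ∷ [] ⊢ con 1 ⊕ A ⊕ D ≼ C ⊕ B) (A y) (B y) (A i) (B i) n q)
         f
      FM-down {y} p (inj₁ (k , w , q)) f@(fm n b a) = FM-down-< p (s≤s (<⇒≤ v)) u v f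
        where
        y≤k : A y + B k ≤ A k + B y
        y≤k with ≤-total y k
        ... | inj₁ l = a k l
        ... | inj₂ l with ≤-split l
        ... | inj₁ l' = <⇒≤ (b k l')
        ... | inj₂ refl = ≤-refl
        v : A y + B i < A i + B y
        v = lin 6 (λ A B C D E F → (A ⊕ F ≼ E ⊕ B) ∷ (con 1 ⊕ E ⊕ D ≼ C ⊕ F) ∷ [] ⊢ con 1 ⊕ A ⊕ D ≼ C ⊕ B)
            (A y) (B y) (A i) (B i) (A k) (B k) y≤k q
        y<k : (k < i ⊎ (k ≡ suc i × y ≢ suc i)) → i < y → A y + B k < A k + B y
        y<k (inj₁ m) l = b k (<-trans m l)
        y<k (inj₂ (refl , m)) l = b k (≤∧≢⇒< l (m ∘ sym))
        u : i < y → suc (A y + B i) < A i + B y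
        u l = lin 6 (λ A B C D E F → (con 1 ⊕ A ⊕ F ≼ E ⊕ B) ∷ (con 1 ⊕ E ⊕ D ≼ C ⊕ F) ∷ [] ⊢ con 2 ⊕ A ⊕ D ≼ C ⊕ B)
            (A y) (B y) (A i) (B i) (A k) (B k) (y<k w l) q

      -- The value at `i` exceeds the minimum, attained at `suc i`, by exactly one. After the
      -- decrease the minimum is attained one index earlier.
      FM-down-shift : suc (A (suc i) + B i) ≡ A i + B (suc i) → FM A B (suc i) → FM A' B' i
      FM-down-shift q (fm n b a) = fm
        (lin 6 (λ A B C D A' B' → (con 1 ⊕ (A' ⊕ B) ≐ A ⊕ B') ∷ (con 1 ⊕ (C ⊕ B) ≑ A ⊕ D) ∷ (con 1 ⊕ C ≼ D) ∷ [] ⊢ con 1 ⊕ A' ≼ B')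
          (A i) (B i) (A (suc i)) (B (suc i)) (A' i) (B' i) down q n)
        (λ k l → lin 10 (λ A B C D A' B' E F E' F' → (con 1 ⊕ (A' ⊕ B) ≐ A ⊕ B') ∷ (con 1 ⊕ (C ⊕ B) ≑ A ⊕ D) ∷ (E' ⊕ F ≑ E ⊕ F') ∷ (con 1 ⊕ C ⊕ F ≼ E ⊕ D) ∷ [] ⊢ con 1 ⊕ A' ⊕ F' ≼ E' ⊕ B')
          (A i) (B i) (A (suc i)) (B (suc i)) (A' i) (B' i) (A k) (B k) (A' k) (B' k) down q (s k (<⇒≢ l)) (b k (≤-suc l)))
        a'
        where
        a' : ∀ k → i ≤ k → _
        a' k l with ≤-split l
        ... | inj₂ refl = ≤-refl
        ... | inj₁ l' = lin 10 (λ A B C D A' B' E F E' F' → (con 1 ⊕ (A' ⊕ B) ≐ A ⊕ B') ∷ (con 1 ⊕ (C ⊕ B) ≑ A ⊕ D) ∷ (E' ⊕ F ≑ E ⊕ F') ∷ (C ⊕ F ≼ E ⊕ D) ∷ [] ⊢ A' ⊕ F' ≼ E' ⊕ B')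
          (A i) (B i) (A (suc i)) (B (suc i)) (A' i) (B' i) (A k) (B k) (A' k) (B' k) down q (s k (>⇒≢ l')) (a k l')

      HI-down : (∃ λ k → A k + B i < A i + B k) ⊎ B i < A i → HI A B → HI A' B'
      HI-down w h k with k ≟ i
      ... | no p = lin 4 (λ A B A' B' → (A' ⊕ B ≑ A ⊕ B') ∷ (B ≼ A) ∷ [] ⊢ B' ≼ A') (A k) (B k) (A' k) (B' k) (s k p) (h k)
      HI-down (inj₂ q) h k | yes refl = lin 4 (λ A B A' B' → (con 1 ⊕ (A' ⊕ B) ≑ A ⊕ B') ∷ (con 1 ⊕ B ≼ A) ∷ [] ⊢ B' ≼ A') (A i) (B i) (A' i) (B' i) down q
      HI-down (inj₁ (k , q)) h _ | yes refl = lin 6 (λ A B A' B' C D → (con 1 ⊕ (A' ⊕ B) ≑ A ⊕ B') ∷ (con 1 ⊕ C ⊕ B ≼ A ⊕ D) ∷ (D ≼ C) ∷ [] ⊢ B' ≼ A') (A i) (B i) (A' i) (B' i) (A k) (B k) down q (h k)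

FM-unique : ∀ {A B y y'} → FM A B y → FM A B y' → y ≡ y'
FM-unique {A} {B} {y} {y'} f g with <-cmp y y'
... | tri≈ _ p _ = p
... | tri< l _ _ = ⊥-elim (<-irrefl refl (≤-trans (s≤s (aft f y' (<⇒≤ l))) (bef g y l)))
... | tri> _ _ l = ⊥-elim (<-irrefl refl (≤-trans (s≤s (aft g y (<⇒≤ l))) (bef f y' l)))

FM-HI : ∀ {A B y} → FM A B y → ¬ HI A B
FM-HI {y = y} f h = <⇒≱ (neg f) (h y)

-- Crystal operators on columns and on rows

-- st is the crystal structure of ℕ-matrices, wk that of 0-1-matrices.
data Kind : Set where
  st wk : Kind

sh : Kind → ℕ → ℕ
sh st k = k
sh wk k = suc k

-- The bracketing rule as partial sums. A unit of `b` in row `k` may be matched with a unit of `a`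
-- in a row below `k` for `st`, in a row up to `k` for `wk`. If the minimum of `opening` minus
-- `closing` is negative, its absolute value counts the unmatched units of `b`, and the first
-- minimiser is the row of the last of them.
opening closing : Kind → (ℕ → ℕ) → ℕ → ℕ
opening κ a k = S a (sh κ k)
closing κ b k = S b (suc k)

FMκ : Kind → (a b : ℕ → ℕ) → ℕ → Set
FMκ κ a b = FM (opening κ a) (closing κ b)

HIκ : Kind → (a b : ℕ → ℕ) → Set
HIκ κ a b = HI (opening κ a) (closing κ b)

-- The raising operator of the crystal of columns, given by its graph: the last unmatched unit of
-- column `suc j` goes to column `j`.
record C (κ : Kind) (j : ℕ) (F F' : Mat) : Set where
  constructor edge
  field
    at : ℕ
    first : FMκ κ (F j) (F (suc j)) at
    mv : Mv (suc j , at) (j , at) F F'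

-- The row that receives and the row that gives a unit.
rowTo rowFrom : Kind → ℕ → ℕ
rowTo st i = i
rowTo wk i = suc i
rowFrom st i = suc i
rowFrom wk i = i

-- For `wk` the units go to the row with the larger index, as in the dual version of RSK. `bound`
-- keeps that row inside the window of `n` rows.
record R (κ : Kind) (n i : ℕ) (F F' : Mat) : Set where
  constructor edge
  field
    at : ℕ
    bound : suc i < n
    first : FMκ κ (tr F (rowTo κ i)) (tr F (rowFrom κ i)) at
    mv : Mv (at , rowFrom κ i) (at , rowTo κ i) F F'

HC : Kind → ℕ → Mat → Set
HC κ j F = HIκ κ (F j) (F (suc j))

HR : Kind → ℕ → Mat → Set
HR κ i F = HIκ κ (tr F (rowTo κ i)) (tr F (rowFrom κ i))

Adm : Kind → Mat → Set
Adm st F = ⊤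
Adm wk F = ∀ i k → F i k ≤ 1

first-src : ∀ κ {a b y} → FMκ κ a b y → 0 < b y
first-src st {a} {b} {zero} f = neg f
first-src st {a} {b} {suc y} f = lin 5 (λ A B p q r → (con 1 ⊕ (A ⊕ p) ⊕ (B ⊕ q) ≼ A ⊕ (B ⊕ q ⊕ r)) ∷ [] ⊢ con 1 ≼ r)
  (S a y) (S b y) (a y) (b y) (b (suc y)) (bef f y ≤-refl)
first-src wk {a} {b} {zero} f = ≤-trans (s≤s z≤n) (neg f)
first-src wk {a} {b} {suc y} f = lin 6 (λ A B p q r s → (con 1 ⊕ (A ⊕ p ⊕ r) ⊕ (B ⊕ q) ≼ A ⊕ p ⊕ (B ⊕ q ⊕ s)) ∷ [] ⊢ con 1 ≼ s)
  (S a y) (S b y) (a y) (b y) (a (suc y)) (b (suc y)) (bef f y ≤-refl)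

wk-first : ∀ {a b y} → FMκ wk a b y → a y < b y
wk-first {y = zero} f = neg f
wk-first {a} {b} {suc y} f = lin 6 (λ A B p q r s → (con 1 ⊕ (A ⊕ p ⊕ r) ⊕ (B ⊕ q) ≼ A ⊕ p ⊕ (B ⊕ q ⊕ s)) ∷ [] ⊢ con 1 ⊕ r ≼ s)
  (S a y) (S b y) (a y) (b y) (a (suc y)) (b (suc y)) (bef f y ≤-refl)

wk-vals : ∀ {a b y} → (∀ k → b k ≤ 1) → FMκ wk a b y → a y ≡ 0 × b y ≡ 1
wk-vals {a} {b} {y} z f with a y | b y | wk-first {a} {b} {y} f | z y
... | zero | suc zero | _ | _ = refl , refl
... | zero | suc (suc _) | _ | s≤s ()
... | suc _ | suc zero | s≤s () | _
... | suc _ | suc (suc _) | _ | s≤s ()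

-- Minimality against a neighbouring index bounds the entries next to the moved unit. These local
-- inequalities exclude most of the ways in which a row and a column operator could meet.
st-lo : ∀ {a b i} → FMκ st a b i → b (suc i) ≤ a i
st-lo {a} {b} {i} f = lin 5 (λ A B p q r → (A ⊕ (B ⊕ q ⊕ r) ≼ (A ⊕ p) ⊕ (B ⊕ q)) ∷ [] ⊢ r ≼ p)
  (S a i) (S b i) (a i) (b i) (b (suc i)) (aft f (suc i) (n≤1+n i))

st-hi : ∀ {a b i} → FMκ st a b (suc i) → a i < b (suc i)
st-hi {a} {b} {i} f = lin 5 (λ A B p q r → (con 1 ⊕ (A ⊕ p) ⊕ (B ⊕ q) ≼ A ⊕ (B ⊕ q ⊕ r)) ∷ [] ⊢ con 1 ⊕ p ≼ r)
  (S a i) (S b i) (a i) (b i) (b (suc i)) (bef f i ≤-refl)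

wk-next : ∀ {a b i} → FMκ wk a b i → b (suc i) ≤ a (suc i)
wk-next {a} {b} {i} f = lin 6 (λ A B p q r s → (A ⊕ p ⊕ (B ⊕ q ⊕ s) ≼ A ⊕ p ⊕ r ⊕ (B ⊕ q)) ∷ [] ⊢ s ≼ r)
  (S a i) (S b i) (a i) (b i) (a (suc i)) (b (suc i)) (aft f (suc i) (n≤1+n i))

wk-prev : ∀ {a b i} → FMκ wk a b (suc i) → a i + a (suc i) < b i + b (suc i)
wk-prev {i = zero} f = neg f
wk-prev {a} {b} {suc i} f = lin 8 (λ A B o o' p q r s → (con 1 ⊕ (A ⊕ o ⊕ p ⊕ r) ⊕ (B ⊕ o') ≼ A ⊕ o ⊕ (B ⊕ o' ⊕ q ⊕ s)) ∷ [] ⊢ con 1 ⊕ p ⊕ r ≼ q ⊕ s)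
  (S a i) (S b i) (a i) (b i) (a (suc i)) (b (suc i)) (a (2 + i)) (b (2 + i)) (bef f i (n≤1+n _))

Neighbour : (A B : ℕ → ℕ) → ℕ → Set
Neighbour A B i = (∃ λ k → k < i × A k + B i < A i + B k) ⊎ B i < A i

wk-nb : ∀ {a b i} → b i < a i → Neighbour (opening wk a) (closing wk b) i
wk-nb {i = zero} l = inj₂ l
wk-nb {a} {b} {suc i} l = inj₁ (i , ≤-refl ,
  lin 4 (λ A B p q → (con 1 ⊕ q ≼ p) ∷ [] ⊢ con 1 ⊕ A ⊕ (B ⊕ q) ≼ (A ⊕ p) ⊕ B) (S a (suc i)) (S b (suc i)) (a (suc i)) (b (suc i)) l)

-- How an operator of one family affects the brackets of the other

lt-suc : ∀ i n → n ≢ suc i → lt (suc i) n ≡ lt i n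
lt-suc i n p with <-cmp n (suc i)
... | tri< (s≤s l) _ _ = trans (lt-no (≤-trans l (n≤1+n i))) (sym (lt-no l))
... | tri≈ _ q _ = ⊥-elim (p q)
... | tri> _ _ l = trans (lt-yes l) (sym (lt-yes (<⇒≤ l)))

module _ {f f' : ℕ → ℕ} {i : ℕ} (h : ∀ n → S f' n + lt (suc i) n ≡ S f n + lt i n) where

  adj-≢ : ∀ n → n ≢ suc i → S f' n ≡ S f n
  adj-≢ n p = +-cancelʳ-≡ (lt i n) _ _ (trans (cong (S f' n +_) (sym (lt-suc i n p))) (h n))

  adj-≡ : S f' (suc i) ≡ suc (S f (suc i))
  adj-≡ with h (suc i)
  ... | q rewrite lt-no (≤-refl {i}) | lt-yes (n<1+n i) = trans (sym (+-identityʳ _)) (trans q (+-comm _ 1))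

adj' : ∀ {f f' : ℕ → ℕ} {i} → (∀ n → S f' n + lt i n ≡ S f n + lt (suc i) n) →
    ∀ n → S f n + lt (suc i) n ≡ S f' n + lt i n
adj' h n = sym (h n)

suc≢ : ∀ {j : ℕ} → suc j ≢ j
suc≢ ()

suc≢' : ∀ {j : ℕ} → j ≢ suc j
suc≢' ()

-- The positions in which the two operators interfere. For `st` both take a unit of
-- `(suc j , suc i)` while the entry there exceeds the one at `(j , i)` by just one. For `wk` they
-- compete for the source `(suc j , i)` or for the target `(j , suc i)`. In these cases the second
-- operator acts in the other row or column of the same 2-by-2 square.
Shift : Kind → (j i y x : ℕ) → Mat → Set
Shift st j i y x F = y ≡ suc i × x ≡ suc j × F (suc j) (suc i) ≡ suc (F j i)
Shift wk j i y x F = (y ≡ i × x ≡ suc j) ⊎ (y ≡ suc i × x ≡ j)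

shift? : ∀ κ j i y x F → Dec (Shift κ j i y x F)
shift? st j i y x F = (y ≟ suc i) ×-dec ((x ≟ suc j) ×-dec (F (suc j) (suc i) ≟ suc (F j i)))
shift? wk j i y x F = ((y ≟ i) ×-dec (x ≟ suc j)) ⊎-dec ((y ≟ suc i) ×-dec (x ≟ j))

-- Only the effect of a row move on two columns is computed. For `st` transposition exchanges the
-- two families, so the module applied to `tr F` gives the effect of a column move on two rows.
module Strict (j i y x : ℕ) (F F' : Mat)
    (c : FMκ st (F j) (F (suc j)) y) (r : FMκ st (tr F i) (tr F (suc i)) x)
    (m : Mv (x , suc i) (x , i) F F') where

  private
    A = opening st (F j)
    A' = opening st (F' j)
    B = closing st (F (suc j))
    B' = closing st (F' (suc j))

    -- The row unit moves inside the left column j.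
    module Left (q : x ≡ j) where
      h : ∀ n → S (F' j) n + lt (suc i) n ≡ S (F j) n + lt i n
      h n = subst (λ z → S (F' z) n + lt (suc i) n ≡ S (F z) n + lt i n) q (Mv-col-both m n refl)
      b : ∀ k → B' k ≡ B k
      b k = Mv-col-other m (suc k) (subst (_≢ suc j) (sym q) suc≢') (subst (_≢ suc j) (sym q) suc≢')
      s : ∀ k → k ≢ suc i → A' k + B k ≡ A k + B' k
      s k p = cong₂ _+_ (adj-≢ h k p) (sym (b k))
      up : A' (suc i) + B (suc i) ≡ suc (A (suc i) + B' (suc i))
      up = cong₂ _+_ (adj-≡ h) (sym (b (suc i)))

    module Right (q : x ≡ suc j) where
      h : ∀ n → S (F' (suc j)) n + lt (suc i) n ≡ S (F (suc j)) n + lt i n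
      h n = subst (λ z → S (F' z) n + lt (suc i) n ≡ S (F z) n + lt i n) q (Mv-col-both m n refl)
      a : ∀ k → A' k ≡ A k
      a k = Mv-col-other m k (subst (_≢ j) (sym q) suc≢) (subst (_≢ j) (sym q) suc≢)
      s : ∀ k → k ≢ i → A' k + B k ≡ A k + B' k
      s k p = cong₂ _+_ (a k) (sym (adj-≢ h (suc k) (p ∘ suc-injective)))
      down : suc (A' i + B i) ≡ A i + B' i
      down = trans (sym (+-suc (A' i) (B i))) (cong₂ _+_ (a i) (sym (adj-≡ h)))

    module Other (q : x ≢ j) (q' : x ≢ suc j) where
      s : ∀ k → A' k + B k ≡ A k + B' k
      s k = cong₂ _+_ (Mv-col-other m k q q) (sym (Mv-col-other m (suc k) q' q'))

    pq : F j i < F (suc j) (suc i) → A (suc i) + B i < A i + B (suc i)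
    pq = lin 5 (λ A B p q r → (con 1 ⊕ p ≼ r) ∷ [] ⊢ con 1 ⊕ (A ⊕ p) ⊕ (B ⊕ q) ≼ A ⊕ (B ⊕ q ⊕ r))
        (S (F j) i) (S (F (suc j)) i) (F j i) (F (suc j) i) (F (suc j) (suc i))

  kept : ¬ Shift st j i y x F → FMκ st (F' j) (F' (suc j)) y
  kept ns with x ≟ j
  ... | yes refl = FM-up s up y≢ c
    where
    open Left refl
    y≢ : y ≢ suc i
    y≢ refl = <⇒≱ (st-hi {F j} {F (suc j)} c) (st-lo {tr F i} {tr F (suc i)} r)
  ... | no q with x ≟ suc j
  ... | no q' = FM-same (Other.s q q') c
  ... | yes refl with y ≟ suc i
  ... | no y≢ = FM-down s down y≢i (inj₁ (suc i , inj₂ (refl , y≢) , pq (st-hi {tr F i} {tr F (suc i)} r))) c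
    where
    open Right refl
    y≢i : y ≢ i
    y≢i refl = <⇒≱ (st-hi {tr F i} {tr F (suc i)} r) (st-lo {F j} {F (suc j)} c)
  -- Outside `Shift` the entry at `(suc j , suc i)` exceeds the one at `(j , i)` by at least two, so
  -- lowering the value at `i` by one leaves it above the minimum.
  ... | yes refl = FM-down-< s down suc≢
      (≤-suc (≤-trans (n≤1+n _) gap)) (λ _ → gap) (≤-trans (n≤1+n _) gap) c
    where
    open Right refl
    gap : suc (suc (A (suc i) + B i)) ≤ A i + B (suc i)
    gap = lin 5 (λ A B p q r → (con 2 ⊕ p ≼ r) ∷ [] ⊢ con 2 ⊕ ((A ⊕ p) ⊕ (B ⊕ q)) ≼ A ⊕ (B ⊕ q ⊕ r))
        (S (F j) i) (S (F (suc j)) i) (F j i) (F (suc j) i) (F (suc j) (suc i))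
        (≤∧≢⇒< (st-hi {tr F i} {tr F (suc i)} r) (λ z → ns (refl , refl , sym z)))

  shifted : Shift st j i y x F → FMκ st (F' j) (F' (suc j)) i
  shifted (refl , refl , z) = FM-down-shift s down
      (lin≡ 5 (λ A B p q r → (r ≑ con 1 ⊕ p) ∷ [] ⊢ con 1 ⊕ ((A ⊕ p) ⊕ (B ⊕ q)) ≐ A ⊕ (B ⊕ q ⊕ r))
          (S (F j) i) (S (F (suc j)) i) (F j i) (F (suc j) i) (F (suc j) (suc i)) z) c
    where open Right refl

module StrictHI (j i x : ℕ) (F F' : Mat)
    (r : FMκ st (tr F i) (tr F (suc i)) x) (m : Mv (x , suc i) (x , i) F F') where

  highest : HC st j F → HC st j F'
  highest h k with x ≟ j
  ... | yes refl = ≤-trans (≡⇒≤ (Mv-col-other m (suc k) suc≢' suc≢')) (≤-trans (h k) (le k))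
    where
    hh : ∀ n → S (F' j) n + lt (suc i) n ≡ S (F j) n + lt i n
    hh n = Mv-col-both m n refl
    le : ∀ k → S (F j) k ≤ S (F' j) k
    le k with k ≟ suc i
    ... | yes refl rewrite adj-≡ {F j} {F' j} hh = n≤1+n _
    ... | no p = ≡⇒≤ (sym (adj-≢ {F j} {F' j} hh k p))
  ... | no q with x ≟ suc j
  ... | no q' = subst₂ _≤_ (sym (Mv-col-other m (suc k) q' q')) (sym (Mv-col-other m k q q)) (h k)
  ... | yes refl with k ≟ i
  ... | no p = subst₂ _≤_ (sym (adj-≢ {F (suc j)} {F' (suc j)} (λ n → Mv-col-both m n refl) (suc k) (p ∘ suc-injective)))
      (sym (Mv-col-other m k q q)) (h k)
  ... | yes refl = subst₂ _≤_ (sym (adj-≡ {F (suc j)} {F' (suc j)} {i} (λ n → Mv-col-both m n refl)))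
      (sym (Mv-col-other m i q q))
      (lin 5 (λ A B p q r → (con 1 ⊕ p ≼ r) ∷ (B ⊕ q ⊕ r ≼ A ⊕ p) ∷ [] ⊢ con 1 ⊕ (B ⊕ q) ≼ A)
          (S (F j) i) (S (F (suc j)) i) (F j i) (F (suc j) i) (F (suc j) (suc i)) (st-hi {tr F i} {tr F (suc i)} r) (h (suc i)))

bit : ∀ {b} → b ≤ 1 → b ≡ 0 ⊎ b ≡ 1
bit z≤n = inj₁ refl
bit (s≤s z≤n) = inj₂ refl

down-nb : ∀ {A B i y} → y ≢ suc i → Neighbour A B i ⊎ A (suc i) + B i < A i + B (suc i) →
    (∃ λ k → (k < i ⊎ (k ≡ suc i × y ≢ suc i)) × A k + B i < A i + B k) ⊎ B i < A i
down-nb p (inj₁ (inj₁ (k , l , q))) = inj₁ (k , inj₁ l , q)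
down-nb p (inj₁ (inj₂ q)) = inj₂ q
down-nb p (inj₂ q) = inj₁ (_ , inj₂ (refl , p) , q)

hi-nb : ∀ {A B i} → Neighbour A B i ⊎ A (suc i) + B i < A i + B (suc i) →
    (∃ λ k → A k + B i < A i + B k) ⊎ B i < A i
hi-nb (inj₁ (inj₁ (k , l , q))) = inj₁ (k , q)
hi-nb (inj₁ (inj₂ q)) = inj₂ q
hi-nb (inj₂ q) = inj₁ (_ , q)

wk-step : ∀ {a b i} → a (suc i) < b (suc i) →
    opening wk a (suc i) + closing wk b i < opening wk a i + closing wk b (suc i)
wk-step {a} {b} {i} = lin 4 (λ A B r s → (con 1 ⊕ r ≼ s) ∷ [] ⊢ con 1 ⊕ ((A ⊕ r) ⊕ B) ≼ A ⊕ (B ⊕ s))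
  (S a (suc i)) (S b (suc i)) (a (suc i)) (b (suc i))

wk-flat : ∀ {a b i} → a (suc i) ≡ b (suc i) →
    opening wk a (suc i) + closing wk b i ≡ opening wk a i + closing wk b (suc i)
wk-flat {a} {b} {i} = lin≡ 4 (λ A B r s → (r ≐ s) ∷ [] ⊢ ((A ⊕ r) ⊕ B) ≐ A ⊕ (B ⊕ s))
  (S a (suc i)) (S b (suc i)) (a (suc i)) (b (suc i))

wk-drop : ∀ {a b i} → a (suc i) ≡ 0 → b (suc i) ≡ 1 →
    suc (opening wk a (suc i) + closing wk b i) ≡ opening wk a i + closing wk b (suc i)
wk-drop {a} {b} {i} p q rewrite p | q = lin≡ 2 (λ A B → [] ⊢ con 1 ⊕ ((A ⊕ con 0) ⊕ B) ≐ A ⊕ (B ⊕ con 1))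
  (S a (suc i)) (S b (suc i))

-- For `wk` transposition does not exchange the families, since the row operators run the other way.
-- The effects of rows on columns and of columns on rows are therefore treated separately, here and
-- in `WeakRow`.
module WeakCol (j i x : ℕ) (F F' : Mat) (z : Adm wk F)
    (r : FMκ wk (tr F (suc i)) (tr F i) x) (m : Mv (x , i) (x , suc i) F F') where

  private
    A = opening wk (F j)
    A' = opening wk (F' j)
    B = closing wk (F (suc j))
    B' = closing wk (F' (suc j))

    vals : F x (suc i) ≡ 0 × F x i ≡ 1
    vals = wk-vals {tr F (suc i)} {tr F i} (λ k → z k i) r

    module Left (q : x ≡ j) where
      h : ∀ n → S (F j) n + lt (suc i) n ≡ S (F' j) n + lt i n
      h n = adj' {F j} {F' j} (λ n → subst (λ z → S (F' z) n + lt i n ≡ S (F z) n + lt (suc i) n) q (Mv-col-both m n refl)) n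
      b : ∀ k → B' k ≡ B k
      b k = Mv-col-other m (suc k) (subst (_≢ suc j) (sym q) suc≢') (subst (_≢ suc j) (sym q) suc≢')
      s : ∀ k → k ≢ i → A' k + B k ≡ A k + B' k
      s k p = cong₂ _+_ (sym (adj-≢ h (suc k) (p ∘ suc-injective))) (sym (b k))
      down : suc (A' i + B i) ≡ A i + B' i
      down = cong₂ _+_ (sym (adj-≡ h)) (sym (b i))
      nb : Neighbour A B i ⊎ A (suc i) + B i < A i + B (suc i)
      -- In the only case without a smaller neighbour, column `suc j` has a unit in row `i` and none
      -- in row `suc i`. That contradicts the minimality of the row operator at `j`.
      nb with bit (z (suc j) (suc i))
      ... | inj₂ s≡1 = inj₂ (wk-step {F j} {F (suc j)} (subst₂ _<_ (sym (subst (λ x → F x (suc i) ≡ 0) q (proj₁ vals))) (sym s≡1) ≤-refl))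
      ... | inj₁ s≡0 with bit (z (suc j) i)
      ... | inj₁ q≡0 = inj₁ (wk-nb {F j} {F (suc j)} (subst₂ _<_ (sym q≡0) (sym (subst (λ x → F x i ≡ 1) q (proj₂ vals))) ≤-refl))
      ... | inj₂ q≡1 = ⊥-elim (<⇒≱ (subst₂ _<_ (sym s≡0) (sym q≡1) ≤-refl)
          (wk-next {tr F (suc i)} {tr F i} (subst (FMκ wk (tr F (suc i)) (tr F i)) q r)))

    module Right (q : x ≡ suc j) where
      h : ∀ n → S (F (suc j)) n + lt (suc i) n ≡ S (F' (suc j)) n + lt i n
      h n = adj' {F (suc j)} {F' (suc j)} (λ n → subst (λ z → S (F' z) n + lt i n ≡ S (F z) n + lt (suc i) n) q (Mv-col-both m n refl)) n
      a : ∀ k → A' k ≡ A k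
      a k = Mv-col-other m (suc k) (subst (_≢ j) (sym q) suc≢) (subst (_≢ j) (sym q) suc≢)
      s : ∀ k → k ≢ i → A' k + B k ≡ A k + B' k
      s k p = cong₂ _+_ (a k) (adj-≢ h (suc k) (p ∘ suc-injective))
      up : A' i + B i ≡ suc (A i + B' i)
      up = trans (cong₂ _+_ (a i) (adj-≡ h)) (+-suc _ _)

    module Other (q : x ≢ j) (q' : x ≢ suc j) where
      s : ∀ k → A' k + B k ≡ A k + B' k
      s k = cong₂ _+_ (Mv-col-other m (suc k) q q) (sym (Mv-col-other m (suc k) q' q'))

  module _ {y} (c : FMκ wk (F j) (F (suc j)) y) where
    private
      valc : F j y ≡ 0 × F (suc j) y ≡ 1
      valc = wk-vals {F j} {F (suc j)} (z (suc j)) c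

    kept : ¬ Shift wk j i y x F → FMκ wk (F' j) (F' (suc j)) y
    kept ns with x ≟ j
    ... | yes refl = FM-down s down (λ { refl → 0≢1+n (trans (sym (proj₁ valc)) (proj₂ vals)) })
        (down-nb {A} {B} (λ { refl → ns (inj₂ (refl , refl)) }) nb) c
      where open Left refl
    ... | no q with x ≟ suc j
    ... | yes refl = FM-up s up (λ { refl → ns (inj₁ (refl , refl)) }) c
      where open Right refl
    ... | no q' = FM-same (Other.s q q') c

    shifted : Shift wk j i y x F → ∃ λ y' → FMκ wk (F' j) (F' (suc j)) y' × ((y ≡ i × y' ≡ suc i) ⊎ (y ≡ suc i × y' ≡ i))
    shifted (inj₁ (refl , refl)) = suc i ,
        FM-up-shift s up (wk-flat {F j} {F (suc j)} (trans r≡0 (sym (proj₁ vals)))) c , inj₁ (refl , refl)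
      where
      open Right refl
      r≡0 : F j (suc i) ≡ 0
      r≡0 = n<1⇒n≡0 (lin 4 (λ r s p q → (con 1 ⊕ r ⊕ s ≼ p ⊕ q) ∷ (p ≐ con 0) ∷ (q ≐ con 1) ∷ [] ⊢ con 1 ⊕ r ≼ con 1)
          (F j (suc i)) (F (suc j) (suc i)) (F j i) (F (suc j) i) (wk-prev {tr F (suc i)} {tr F i} r) (proj₁ valc) (proj₂ vals))
    shifted (inj₂ (refl , refl)) = i , FM-down-shift s down (wk-drop {F j} {F (suc j)} (proj₁ vals) (proj₂ valc)) c , inj₂ (refl , refl)
      where open Left refl

  highest : HC wk j F → HC wk j F'
  highest hi with x ≟ j
  ... | yes refl = HI-down s down (hi-nb {A} {B} nb) hi
    where open Left refl
  ... | no q with x ≟ suc j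
  ... | yes refl = HI-up s up hi
    where open Right refl
  ... | no q' = λ k → subst₂ _≤_ (sym (Mv-col-other m (suc k) q' q')) (sym (Mv-col-other m (suc k) q q)) (hi k)

module WeakRow (j i y : ℕ) (F F' : Mat) (z : Adm wk F)
    (c : FMκ wk (F j) (F (suc j)) y) (m : Mv (suc j , y) (j , y) F F') where

  private
    A = opening wk (tr F (suc i))
    A' = opening wk (tr F' (suc i))
    B = closing wk (tr F i)
    B' = closing wk (tr F' i)

    mt : Mv (y , suc j) (y , j) (tr F) (tr F')
    mt = Mv-tr m

    vals : F j y ≡ 0 × F (suc j) y ≡ 1
    vals = wk-vals {F j} {F (suc j)} (z (suc j)) c

    module Upper (q : y ≡ suc i) where
      h : ∀ n → S (tr F' (suc i)) n + lt (suc j) n ≡ S (tr F (suc i)) n + lt j n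
      h n = subst (λ z → S (tr F' z) n + lt (suc j) n ≡ S (tr F z) n + lt j n) q (Mv-col-both mt n refl)
      b : ∀ k → B' k ≡ B k
      b k = Mv-col-other mt (suc k) (subst (_≢ i) (sym q) suc≢) (subst (_≢ i) (sym q) suc≢)
      s : ∀ k → k ≢ j → A' k + B k ≡ A k + B' k
      s k p = cong₂ _+_ (adj-≢ h (suc k) (p ∘ suc-injective)) (sym (b k))
      up : A' j + B j ≡ suc (A j + B' j)
      up = cong₂ _+_ (adj-≡ h) (sym (b j))

    module Lower (q : y ≡ i) where
      h : ∀ n → S (tr F' i) n + lt (suc j) n ≡ S (tr F i) n + lt j n
      h n = subst (λ z → S (tr F' z) n + lt (suc j) n ≡ S (tr F z) n + lt j n) q (Mv-col-both mt n refl)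
      a : ∀ k → A' k ≡ A k
      a k = Mv-col-other mt (suc k) (subst (_≢ suc i) (sym q) suc≢') (subst (_≢ suc i) (sym q) suc≢')
      s : ∀ k → k ≢ j → A' k + B k ≡ A k + B' k
      s k p = cong₂ _+_ (a k) (sym (adj-≢ h (suc k) (p ∘ suc-injective)))
      down : suc (A' j + B j) ≡ A j + B' j
      down = trans (sym (+-suc (A' j) (B j))) (cong₂ _+_ (a j) (sym (adj-≡ h)))
      p≡0 : F j i ≡ 0
      p≡0 = subst (λ y → F j y ≡ 0) q (proj₁ vals)
      q≡1 : F (suc j) i ≡ 1
      q≡1 = subst (λ y → F (suc j) y ≡ 1) q (proj₂ vals)
      nb : Neighbour A B j ⊎ A (suc j) + B j < A j + B (suc j)
      nb with bit (z (suc j) (suc i))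
      ... | inj₁ s≡0 = inj₂ (wk-step {tr F (suc i)} {tr F i} (subst₂ _<_ (sym s≡0) (sym q≡1) ≤-refl))
      ... | inj₂ s≡1 = inj₁ (wk-nb {tr F (suc i)} {tr F i} (subst (_< F j (suc i)) (sym p≡0)
          (subst (_≤ F j (suc i)) s≡1 (wk-next {F j} {F (suc j)} (subst (FMκ wk (F j) (F (suc j))) q c)))))

    module Other (q : y ≢ i) (q' : y ≢ suc i) where
      s : ∀ k → A' k + B k ≡ A k + B' k
      s k = cong₂ _+_ (Mv-col-other mt (suc k) q' q') (sym (Mv-col-other mt (suc k) q q))

  module _ {x} (r : FMκ wk (tr F (suc i)) (tr F i) x) where
    private
      valr : F x (suc i) ≡ 0 × F x i ≡ 1
      valr = wk-vals {tr F (suc i)} {tr F i} (λ k → z k i) r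

    kept : ¬ Shift wk j i y x F → FMκ wk (tr F' (suc i)) (tr F' i) x
    kept ns with y ≟ i
    ... | yes refl = FM-down s down (λ { refl → 0≢1+n (trans (sym p≡0) (proj₂ valr)) })
        (down-nb {A} {B} (λ { refl → ns (inj₁ (refl , refl)) }) nb) r
      where open Lower refl
    ... | no q with y ≟ suc i
    ... | yes refl = FM-up s up (λ { refl → ns (inj₂ (refl , refl)) }) r
      where open Upper refl
    ... | no q' = FM-same (Other.s q q') r

    shifted : Shift wk j i y x F → ∃ λ x' → FMκ wk (tr F' (suc i)) (tr F' i) x' × ((y ≡ i × x' ≡ j) ⊎ (y ≡ suc i × x' ≡ suc j))
    shifted (inj₁ (refl , refl)) = j , FM-down-shift s down (wk-drop {tr F (suc i)} {tr F i} (proj₁ valr) q≡1) r , inj₁ (refl , refl)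
      where open Lower refl
    shifted (inj₂ (refl , refl)) = suc j ,
        FM-up-shift s up (wk-flat {tr F (suc i)} {tr F i} (trans (proj₂ vals) (sym q≡1))) r , inj₂ (refl , refl)
      where
      open Upper refl
      q≡1 : F (suc j) i ≡ 1
      q≡1 = ≤-antisym (z (suc j) i) (lin 4 (λ p r q s → (con 1 ⊕ p ⊕ r ≼ q ⊕ s) ∷ (p ≑ con 1) ∷ (s ≐ con 1) ∷ [] ⊢ con 1 ≼ q)
          (F j i) (F j (suc i)) (F (suc j) i) (F (suc j) (suc i)) (wk-prev {F j} {F (suc j)} c) (proj₂ valr) (proj₂ vals))

  highest : HR wk i F → HR wk i F'
  highest hi with y ≟ i
  ... | yes refl = HI-down s down (hi-nb {A} {B} nb) hi
    where open Lower refl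
  ... | no q with y ≟ suc i
  ... | yes refl = HI-up s up hi
    where open Upper refl
  ... | no q' = λ k → subst₂ _≤_ (sym (Mv-col-other mt (suc k) q q)) (sym (Mv-col-other mt (suc k) q' q')) (hi k)

-- The commuting square.

PO : ∀ κ {n i j F F₁ F₂} → Adm κ F → C κ j F F₁ → R κ n i F F₂ → ∃ λ F₃ → C κ j F₂ F₃ × R κ n i F₁ F₃
PO st {n} {i} {j} {F} {F₁} {F₂} _ (edge y c m) (edge x bd r m') with shift? st j i y x F
-- The move on the fourth side is a linear combination of the moves on the other three.
... | no ns = F₃ , edge y c' (mk (λ a b →
    lin≡ 8 (λ f f₁ f₂ f₃ s d s' d' → (f₁ ⊕ s ≐ f ⊕ d) ∷ (f₂ ⊕ s' ≑ f ⊕ d') ∷ (f₃ ⊕ s' ≐ f₁ ⊕ d') ∷ [] ⊢ f₃ ⊕ s ≐ f₂ ⊕ d)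
      (F a b) (F₁ a b) (F₂ a b) (F₃ a b) (δ (suc j , y) a b) (δ (j , y) a b) (δ (x , suc i) a b) (δ (x , i) a b)
      (un m a b) (un m' a b) (un m₃ a b)))
        , edge x bd r' m₃
  where
  c' = Strict.kept j i y x F F₂ c r m' ns
  r' = Strict.kept i j x y (tr F) (tr F₁) r c (Mv-tr m) (λ { (p , q , z) → ns (q , p , z) })
  F₃ = move (x , suc i) (x , i) F₁
  m₃ : Mv (x , suc i) (x , i) F₁ F₃
  m₃ = move-Mv (first-src st {tr F₁ i} {tr F₁ (suc i)} r')
... | yes sh@(refl , refl , z) = F₃ , edge i c' (mk (λ a b →
    lin≡ 8 (λ f f₁ f₂ f₃ s r q p → (f₁ ⊕ s ≐ f ⊕ r) ∷ (f₂ ⊕ s ≑ f ⊕ q) ∷ (f₃ ⊕ r ≐ f₁ ⊕ p) ∷ [] ⊢ f₃ ⊕ q ≐ f₂ ⊕ p)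
      (F a b) (F₁ a b) (F₂ a b) (F₃ a b) (δ (suc j , suc i) a b) (δ (j , suc i) a b) (δ (suc j , i) a b) (δ (j , i) a b)
      (un m a b) (un m' a b) (un m₃ a b)))
        , edge j bd r' m₃
  where
  c' = Strict.shifted j i y x F F₂ c r m' sh
  r' = Strict.shifted i j x y (tr F) (tr F₁) r c (Mv-tr m) (refl , refl , z)
  F₃ = move (j , suc i) (j , i) F₁
  m₃ : Mv (j , suc i) (j , i) F₁ F₃
  m₃ = move-Mv (first-src st {tr F₁ i} {tr F₁ (suc i)} r')
PO wk {n} {i} {j} {F} {F₁} {F₂} ad (edge y c m) (edge x bd r m') with shift? wk j i y x F
... | no ns = F₃ , edge y c' (mk (λ a b →
    lin≡ 8 (λ f f₁ f₂ f₃ s d s' d' → (f₁ ⊕ s ≐ f ⊕ d) ∷ (f₂ ⊕ s' ≑ f ⊕ d') ∷ (f₃ ⊕ s' ≐ f₁ ⊕ d') ∷ [] ⊢ f₃ ⊕ s ≐ f₂ ⊕ d)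
      (F a b) (F₁ a b) (F₂ a b) (F₃ a b) (δ (suc j , y) a b) (δ (j , y) a b) (δ (x , i) a b) (δ (x , suc i) a b)
      (un m a b) (un m' a b) (un m₃ a b)))
        , edge x bd r' m₃
  where
  c' = WeakCol.kept j i x F F₂ ad r m' c ns
  r' = WeakRow.kept j i y F F₁ ad c m r ns
  F₃ = move (x , i) (x , suc i) F₁
  m₃ : Mv (x , i) (x , suc i) F₁ F₃
  m₃ = move-Mv (first-src wk {tr F₁ (suc i)} {tr F₁ i} r')
... | yes s with WeakCol.shifted j i x F F₂ ad r m' c s | WeakRow.shifted j i y F F₁ ad c m r s
... | y' , c' , u | x' , r' , v = go s u v c' r'
  where
  go : Shift wk j i y x F → (y ≡ i × y' ≡ suc i) ⊎ (y ≡ suc i × y' ≡ i) → (y ≡ i × x' ≡ j) ⊎ (y ≡ suc i × x' ≡ suc j) →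
      FMκ wk (F₂ j) (F₂ (suc j)) y' → FMκ wk (tr F₁ (suc i)) (tr F₁ i) x' → ∃ λ F₃ → C wk j F₂ F₃ × R wk n i F₁ F₃
  go (inj₁ (refl , refl)) (inj₂ (() , _)) _ _ _
  go (inj₁ (refl , refl)) _ (inj₂ (() , _)) _ _
  go (inj₂ (refl , refl)) (inj₁ (() , _)) _ _ _
  go (inj₂ (refl , refl)) _ (inj₁ (() , _)) _ _
  go (inj₁ (refl , refl)) (inj₁ (_ , refl)) (inj₁ (_ , refl)) c' r' = F₃ , edge (suc i) c' (mk (λ a b →
      lin≡ 8 (λ f f₁ f₂ f₃ s r q p → (f₁ ⊕ q ≐ f ⊕ p) ∷ (f₂ ⊕ q ≑ f ⊕ s) ∷ (f₃ ⊕ p ≐ f₁ ⊕ r) ∷ [] ⊢ f₃ ⊕ s ≐ f₂ ⊕ r)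
        (F a b) (F₁ a b) (F₂ a b) (F₃ a b) (δ (suc j , suc i) a b) (δ (j , suc i) a b) (δ (suc j , i) a b) (δ (j , i) a b)
        (un m a b) (un m' a b) (un m₃ a b)))
        , edge j bd r' m₃
    where
    F₃ = move (j , i) (j , suc i) F₁
    m₃ : Mv (j , i) (j , suc i) F₁ F₃
    m₃ = move-Mv (first-src wk {tr F₁ (suc i)} {tr F₁ i} r')
  go (inj₂ (refl , refl)) (inj₂ (_ , refl)) (inj₂ (_ , refl)) c' r' = F₃ , edge i c' (mk (λ a b →
      lin≡ 8 (λ f f₁ f₂ f₃ s r q p → (f₁ ⊕ s ≐ f ⊕ r) ∷ (f₂ ⊕ p ≑ f ⊕ r) ∷ (f₃ ⊕ q ≐ f₁ ⊕ s) ∷ [] ⊢ f₃ ⊕ q ≐ f₂ ⊕ p)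
        (F a b) (F₁ a b) (F₂ a b) (F₃ a b) (δ (suc j , suc i) a b) (δ (j , suc i) a b) (δ (suc j , i) a b) (δ (j , i) a b)
        (un m a b) (un m' a b) (un m₃ a b)))
        , edge (suc j) bd r' m₃
    where
    F₃ = move (suc j , i) (suc j , suc i) F₁
    m₃ : Mv (suc j , i) (suc j , suc i) F₁ F₃
    m₃ = move-Mv (first-src wk {tr F₁ (suc i)} {tr F₁ i} r')

HC-R : ∀ κ {n i j F F'} → Adm κ F → HC κ j F → R κ n i F F' → HC κ j F'
HC-R st {i = i} {j} {F} {F'} ad h (edge x _ r m) = StrictHI.highest j i x F F' r m h
HC-R wk {i = i} {j} {F} {F'} ad h (edge x _ r m) = WeakCol.highest j i x F F' ad r m h

HR-C : ∀ κ {i j F F'} → Adm κ F → HR κ i F → C κ j F F' → HR κ i F'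
HR-C st {i} {j} {F} {F'} ad h (edge y c m) = StrictHI.highest i j y (tr F) (tr F') c (Mv-tr m) h
HR-C wk {i} {j} {F} {F'} ad h (edge y c m) = WeakRow.highest j i y F F' ad c m h

S-≗ : ∀ {f g} → (∀ k → f k ≡ g k) → ∀ n → S f n ≡ S g n
S-≗ h n = S-cong n (λ k _ → h k)

FMκ-resp : ∀ κ {a b a' b'} → (∀ k → a k ≡ a' k) → (∀ k → b k ≡ b' k) → ∀ {y} → FMκ κ a b y → FMκ κ a' b' y
FMκ-resp κ p q = FM-same (λ k → cong₂ _+_ (sym (S-≗ p (sh κ k))) (S-≗ q (suc k)))

HIκ-resp : ∀ κ {a b a' b'} → (∀ k → a k ≡ a' k) → (∀ k → b k ≡ b' k) → HIκ κ a b → HIκ κ a' b'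
HIκ-resp κ p q h k = subst₂ _≤_ (S-≗ q (suc k)) (S-≗ p (sh κ k)) (h k)

C-resp : ∀ κ {j F F' G G'} → F ≈ G → F' ≈ G' → C κ j F F' → C κ j G G'
C-resp κ {j} p q (edge y c m) = edge y (FMκ-resp κ (p j) (p (suc j)) c) (Mv-resp p q m)

R-resp : ∀ κ {n i F F' G G'} → F ≈ G → F' ≈ G' → R κ n i F F' → R κ n i G G'
R-resp κ p q (edge x bd r m) = edge x bd (FMκ-resp κ (λ k → p k _) (λ k → p k _) r) (Mv-resp p q m)

HC-resp : ∀ κ {j F G} → F ≈ G → HC κ j F → HC κ j G
HC-resp κ {j} p = HIκ-resp κ (p j) (p (suc j))

HR-resp : ∀ κ {i F G} → F ≈ G → HR κ i F → HR κ i G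
HR-resp κ p = HIκ-resp κ (λ k → p k _) (λ k → p k _)

C-det : ∀ κ {j F F' G G'} → C κ j F F' → C κ j G G' → F ≈ G → F' ≈ G'
C-det κ {j} (edge y c m) (edge y' c' m') p
  with FM-unique (FMκ-resp κ (p j) (p (suc j)) c) c'
... | refl = Mv-det m m' p

R-det : ∀ κ {n i F F' G G'} → R κ n i F F' → R κ n i G G' → F ≈ G → F' ≈ G'
R-det κ (edge y _ c m) (edge y' _ c' m') p
  with FM-unique (FMκ-resp κ (λ k → p k _) (λ k → p k _) c) c'
... | refl = Mv-det m m' p

-- Existence of edges

module _ (A B : ℕ → ℕ) where

  record FMUpTo (N y : ℕ) : Set where
    field
      y≤N : y ≤ N
      neg' : A y < B y
      bef' : ∀ k → k < y → A y + B k < A k + B y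
      aft' : ∀ k → y ≤ k → k ≤ N → A y + B k ≤ A k + B y
  open FMUpTo

  private
    search : ∀ N → (∀ k → k ≤ N → B k ≤ A k) ⊎ ∃ (FMUpTo N)
    search zero with B 0 ≤? A 0
    ... | yes p = inj₁ (λ { .0 z≤n → p })
    ... | no p = inj₂ (0 , record { y≤N = z≤n ; neg' = ≰⇒> p ; bef' = λ _ () ; aft' = λ { .0 _ z≤n → ≤-refl } })
    search (suc N) with search N
    ... | inj₁ h with B (suc N) ≤? A (suc N)
    ... | yes p = inj₁ go
      where
      go : ∀ k → k ≤ suc N → B k ≤ A k
      go k l with ≤-split l
      ... | inj₁ (s≤s l') = h k l'
      ... | inj₂ refl = p
    ... | no p = inj₂ (suc N , record { y≤N = ≤-refl ; neg' = ≰⇒> p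
        ; bef' = λ { k (s≤s l) → lin 4 (λ A B C D → (con 1 ⊕ A ≼ B) ∷ (D ≼ C) ∷ [] ⊢ con 1 ⊕ A ⊕ D ≼ C ⊕ B) (A (suc N)) (B (suc N)) (A k) (B k) (≰⇒> p) (h k l) }
        ; aft' = λ k l l' → subst (λ k → A (suc N) + B k ≤ A k + B (suc N)) (≤-antisym l l') ≤-refl })
    search (suc N) | inj₂ (y , f) with A y + B (suc N) ≤? A (suc N) + B y
    ... | yes p = inj₂ (y , record { y≤N = ≤-suc (y≤N f) ; neg' = neg' f ; bef' = bef' f ; aft' = go })
      where
      go : ∀ k → y ≤ k → k ≤ suc N → A y + B k ≤ A k + B y
      go k l l' with ≤-split l'
      ... | inj₁ (s≤s l'') = aft' f k l l''
      ... | inj₂ refl = p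
    ... | no p = inj₂ (suc N , record { y≤N = ≤-refl
        ; neg' = lin 4 (λ A B C D → (con 1 ⊕ C ⊕ B ≼ A ⊕ D) ∷ (con 1 ⊕ A ≼ B) ∷ [] ⊢ con 1 ⊕ C ≼ D) (A y) (B y) (A (suc N)) (B (suc N)) (≰⇒> p) (neg' f)
        ; bef' = go
        ; aft' = λ k l l' → subst (λ k → A (suc N) + B k ≤ A k + B (suc N)) (≤-antisym l l') ≤-refl })
      where
      all : ∀ k → k ≤ N → A y + B k ≤ A k + B y
      all k l with k <? y
      ... | yes q = <⇒≤ (bef' f k q)
      ... | no q = aft' f k (≮⇒≥ q) l
      go : ∀ k → k < suc N → A (suc N) + B k < A k + B (suc N)
      go k (s≤s l) = lin 6 (λ A B C D E F → (con 1 ⊕ C ⊕ B ≼ A ⊕ D) ∷ (A ⊕ F ≼ E ⊕ B) ∷ [] ⊢ con 1 ⊕ C ⊕ F ≼ E ⊕ D)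
        (A y) (B y) (A (suc N)) (B (suc N)) (A k) (B k) (≰⇒> p) (all k l)

  -- Both functions are constant from `N` on, so a minimiser found up to `N` is a global one.
  first-or-HI : ∀ N → (∀ k → N ≤ k → A k ≡ A N × B k ≡ B N) → HI A B ⊎ ∃ (FM A B)
  first-or-HI N h with search N
  ... | inj₁ p = inj₁ go
    where
    go : HI A B
    go k with k ≤? N
    ... | yes l = p k l
    ... | no l with h k (<⇒≤ (≰⇒> l))
    ... | u , v rewrite u | v = p N ≤-refl
  ... | inj₂ (y , f) = inj₂ (y , fm (neg' f) (bef' f) go)
    where
    go : ∀ k → y ≤ k → A y + B k ≤ A k + B y
    go k m with k ≤? N
    ... | yes l = aft' f k m l
    ... | no l with h k (<⇒≤ (≰⇒> l))
    ... | u , v rewrite u | v = aft' f N (y≤N f) ≤-refl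

S-const : ∀ f n → (∀ k → n ≤ k → f k ≡ 0) → ∀ k → n ≤ k → S f k ≡ S f n
S-const f n h k l with ≤-split l
... | inj₂ refl = refl
S-const f n h (suc k) l | inj₁ (s≤s l') rewrite h k l' = trans (+-identityʳ _) (S-const f n h k l')

firstκ-or-HI : ∀ κ a b n → (∀ k → n ≤ k → a k ≡ 0) → (∀ k → n ≤ k → b k ≡ 0) → HIκ κ a b ⊎ ∃ (FMκ κ a b)
firstκ-or-HI κ a b n p q = first-or-HI (opening κ a) (closing κ b) n
  (λ k l → trans (S-const a n p _ (≤-trans l (sh≥ κ k))) (sym (S-const a n p _ (sh≥ κ n))) ,
      trans (S-const b n q _ (≤-trans l (n≤1+n k))) (sym (S-const b n q _ (n≤1+n n))))
  where
  sh≥ : ∀ κ k → k ≤ sh κ k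
  sh≥ st k = ≤-refl
  sh≥ wk k = n≤1+n k

Win : (w n : ℕ) → Mat → Set
Win w n F = ∀ i k → w ≤ i ⊎ n ≤ k → F i k ≡ 0

Good : Kind → (w n : ℕ) → Mat → Set
Good κ w n F = Win w n F × Adm κ F

Win-tr : ∀ {w n F} → Win w n F → Win n w (tr F)
Win-tr h i k (inj₁ l) = h k i (inj₂ l)
Win-tr h i k (inj₂ l) = h k i (inj₁ l)

Win-pos : ∀ {w n F i k} → Win w n F → 0 < F i k → i < w × k < n
Win-pos {w} {n} {F} {i} {k} h p = ≰⇒> (λ l → <⇒≢ p (sym (h i k (inj₁ l)))) , ≰⇒> (λ l → <⇒≢ p (sym (h i k (inj₂ l))))

δ-out : ∀ {w n a b} → a < w → b < n → Win w n (δ (a , b))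
δ-out {a = a} {b} p q i k (inj₁ l) rewrite e-≢ a i (<⇒≢ (≤-trans p l)) = refl
δ-out {a = a} {b} p q i k (inj₂ l) rewrite e-≢ b k (<⇒≢ (≤-trans q l)) = *-zeroʳ (e a i)

Mv-Win : ∀ {w n s d F F'} → proj₁ d < w → proj₂ d < n → Win w n F → Mv s d F F' → Win w n F'
Mv-Win {s = s} {d} {F} {F'} p q h m i k l = m+n≡0⇒m≡0 (F' i k) (trans (un m i k) (trans (cong₂ _+_ (h i k l) (δ-out p q i k l)) refl))

module _ κ {w n j F F'} (h : Win w n F) (c : C κ j F F') where
  private module c = C c

  C-src : suc j < w × c.at < n
  C-src = Win-pos {F = F} h (first-src κ c.first)

  C-Win : Win w n F'
  C-Win = Mv-Win (<⇒≤ (proj₁ C-src)) (proj₂ C-src) h c.mv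

R-src : ∀ κ {w n i F F'} (h : Win w n F) (r : R κ n i F F') → R.at r < w × rowFrom κ i < n
R-src κ {F = F} h (edge x bd r m) = Win-pos {F = F} h (first-src κ {tr F (rowTo κ _)} {tr F (rowFrom κ _)} r)

rowTo< : ∀ κ {n i} → suc i < n → rowTo κ i < n
rowTo< st l = <⇒≤ l
rowTo< wk l = l

R-Win : ∀ κ {w n i F F'} → Win w n F → R κ n i F F' → Win w n F'
R-Win κ h r@(edge x bd _ m) = Mv-Win (proj₁ (R-src κ h r)) (rowTo< κ bd) h m

Mv-01 : ∀ {a b F F' s} → (∀ i k → F i k ≤ 1) → Mv s (a , b) F F' → F a b ≡ 0 → ∀ i k → F' i k ≤ 1
Mv-01 {a} {b} {F} {F'} {s} z m p i k with un m i k
... | q with a ≟ i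
... | no neq rewrite e-≢ a i neq = ≤-trans (m≤m+n _ _) (≤-trans (≡⇒≤ (trans q (+-identityʳ _))) (z i k))
... | yes refl with b ≟ k
... | no neq rewrite e-≢ b k neq | *-zeroʳ (e a a) = ≤-trans (m≤m+n _ _) (≤-trans (≡⇒≤ (trans q (+-identityʳ _))) (z a k))
... | yes refl rewrite e-refl a | e-refl b | p = ≤-trans (m≤m+n _ _) (≡⇒≤ q)

C-Adm : ∀ κ {j F F'} → Adm κ F → C κ j F F' → Adm κ F'
C-Adm st _ _ = tt
C-Adm wk {j} {F} ad (edge y c m) = Mv-01 ad m (proj₁ (wk-vals {F j} {F (suc j)} (ad (suc j)) c))

R-Adm : ∀ κ {n i F F'} → Adm κ F → R κ n i F F' → Adm κ F'
R-Adm st _ _ = tt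
R-Adm wk {i = i} {F} ad (edge x _ r m) = Mv-01 ad m (proj₁ (wk-vals {tr F (suc i)} {tr F i} (λ k → ad k i) r))

C-Good : ∀ κ {w n j F F'} → Good κ w n F → C κ j F F' → Good κ w n F'
C-Good κ (h , ad) c = C-Win κ h c , C-Adm κ ad c

R-Good : ∀ κ {w n i F F'} → Good κ w n F → R κ n i F F' → Good κ w n F'
R-Good κ (h , ad) c = R-Win κ h c , R-Adm κ ad c

C-or-HC : ∀ κ {w n F} j → Win w n F → HC κ j F ⊎ ∃ (C κ j F)
C-or-HC κ {w} {n} {F} j h with firstκ-or-HI κ (F j) (F (suc j)) n (λ k l → h j k (inj₂ l)) (λ k l → h (suc j) k (inj₂ l))
... | inj₁ p = inj₁ p
... | inj₂ (y , f) = inj₂ (_ , edge y f (move-Mv (first-src κ f)))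

R-or-HR : ∀ κ {w n F} i → suc i < n → Win w n F → HR κ i F ⊎ ∃ (R κ n i F)
R-or-HR κ {w} {n} {F} i bd h with firstκ-or-HI κ (tr F (rowTo κ i)) (tr F (rowFrom κ i)) w (λ k l → h k _ (inj₁ l)) (λ k l → h k _ (inj₁ l))
... | inj₁ p = inj₁ p
... | inj₂ (y , f) = inj₂ (_ , edge y bd f (move-Mv (first-src κ {tr F (rowTo κ i)} {tr F (rowFrom κ i)} f)))

-- A row operator that applies after a column move also applies before it, because row-highest
-- matrices stay row-highest under column moves. The square on these two sides is the one wanted,
-- since operators are deterministic.
MX₁ : ∀ κ {w n i j F F₁ F₃} → Good κ w n F → C κ j F F₁ → R κ n i F₁ F₃ → ∃ λ F₂ → R κ n i F F₂ × C κ j F₂ F₃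
MX₁ κ {i = i} (h , ad) c r with R-or-HR κ i (R.bound r) h
... | inj₁ hi = ⊥-elim (FM-HI (R.first r) (HR-C κ ad hi c))
... | inj₂ (F₂ , r') with PO κ ad c r'
... | F₃' , c' , r'' = F₂ , r' , C-resp κ ≈-refl (R-det κ r'' r ≈-refl) c'

MX₂ : ∀ κ {w n i j F F₂ F₃} → Good κ w n F → R κ n i F F₂ → C κ j F₂ F₃ → ∃ λ F₁ → C κ j F F₁ × R κ n i F₁ F₃
MX₂ κ {j = j} (h , ad) r c with C-or-HC κ j h
... | inj₁ hi = ⊥-elim (FM-HI (C.first c) (HC-R κ ad hi r))
... | inj₂ (F₁ , c') with PO κ ad c' r
... | F₃' , c'' , r' = F₁ , c' , R-resp κ ≈-refl (C-det κ c'' c ≈-refl) r'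

-- Rotation by 180°

rv : ℕ → ℕ → ℕ
rv n k = n ∸ suc k

rv-sum : ∀ {n k} → k < n → suc (k + rv n k) ≡ n
rv-sum l = m+[n∸m]≡n l

rv< : ∀ {n k} → k < n → rv n k < n
rv< {n} {k} l = subst (rv n k <_) (rv-sum l) (s≤s (m≤n+m _ k))

rv-inv : ∀ {n k} → k < n → rv n (rv n k) ≡ k
rv-inv {n} {k} l = +-cancelˡ-≡ (rv n k) _ _ (suc-injective (trans (rv-sum (rv< l)) (trans (sym (rv-sum l)) (cong suc (+-comm k _)))))

rv-anti : ∀ {n a b} → a < b → b < n → rv n b < rv n a
rv-anti {n} {a} {b} l m = lin 5 (λ a b n x y → (con 1 ⊕ (a ⊕ x) ≑ n) ∷ (con 1 ⊕ (b ⊕ y) ≐ n) ∷ (con 1 ⊕ a ≼ b) ∷ [] ⊢ con 1 ⊕ y ≼ x)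
  a b n (rv n a) (rv n b) (rv-sum (<-trans l m)) (rv-sum m) l

rv-suc : ∀ {n k} → suc k < n → suc (rv n (suc k)) ≡ rv n k
rv-suc {n} {k} l = lin≡ 4 (λ k n x y → (con 1 ⊕ (con 1 ⊕ k ⊕ x) ≐ n) ∷ (con 1 ⊕ (k ⊕ y) ≑ n) ∷ [] ⊢ con 1 ⊕ x ≐ y)
  k n (rv n (suc k)) (rv n k) (rv-sum l) (rv-sum (<-trans (n<1+n k) l))

e-rv : ∀ {n a i} → a < n → i < n → e (rv n a) i ≡ e a (rv n i)
e-rv {n} {a} {i} p q with a ≟ rv n i
... | yes refl rewrite rv-inv q | e-refl i | e-refl (rv n i) = refl
... | no neq = trans (e-≢ (rv n a) i (λ { refl → neq (sym (rv-inv p)) })) (sym (e-≢ a (rv n i) neq))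

rot : (w n : ℕ) → Mat → Mat
rot w n F i k with i <? w | k <? n
... | yes _ | yes _ = F (rv w i) (rv n k)
... | _ | _ = 0

module _ {w n : ℕ} where

  rot-in : ∀ F {i k} → i < w → k < n → rot w n F i k ≡ F (rv w i) (rv n k)
  rot-in F {i} {k} p q with i <? w | k <? n
  ... | yes _ | yes _ = refl
  ... | no r | _ = ⊥-elim (r p)
  ... | yes _ | no r = ⊥-elim (r q)

  rot-Win : ∀ F → Win w n (rot w n F)
  rot-Win F i k l with i <? w | k <? n
  ... | no _ | _ = refl
  ... | yes _ | no _ = refl
  rot-Win F i k (inj₁ l) | yes p | yes q = ⊥-elim (<⇒≱ p l)
  rot-Win F i k (inj₂ l) | yes p | yes q = ⊥-elim (<⇒≱ q l)

  window : ∀ {F G} → Win w n F → Win w n G → (∀ i k → i < w → k < n → F i k ≡ G i k) → F ≈ G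
  window f g h i k with i <? w | k <? n
  ... | yes p | yes q = h i k p q
  ... | no p | _ = trans (f i k (inj₁ (≮⇒≥ p))) (sym (g i k (inj₁ (≮⇒≥ p))))
  ... | yes _ | no p = trans (f i k (inj₂ (≮⇒≥ p))) (sym (g i k (inj₂ (≮⇒≥ p))))

  rot-cong : ∀ {F G} → F ≈ G → rot w n F ≈ rot w n G
  rot-cong p i k with i <? w | k <? n
  ... | yes _ | yes _ = p _ _
  ... | no _ | _ = refl
  ... | yes _ | no _ = refl

  rot-rot : ∀ {F} → Win w n F → rot w n (rot w n F) ≈ F
  rot-rot {F} h = window (rot-Win (rot w n F)) h (λ i k p q → trans (rot-in (rot w n F) p q)
    (trans (rot-in F (rv< p) (rv< q)) (cong₂ F (rv-inv p) (rv-inv q))))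

  rot-Mv : ∀ {s d F F'} → proj₁ s < w → proj₂ s < n → proj₁ d < w → proj₂ d < n → Mv s d F F' →
      Mv (rv w (proj₁ d) , rv n (proj₂ d)) (rv w (proj₁ s) , rv n (proj₂ s)) (rot w n F') (rot w n F)
  rot-Mv {a , b} {c , d} {F} {F'} pa pb pc pd m = mk go
    where
    out : ∀ {i k} → w ≤ i ⊎ n ≤ k → rot w n F i k + δ (rv w c , rv n d) i k ≡ rot w n F' i k + δ (rv w a , rv n b) i k
    out {i} {k} l = trans (cong₂ _+_ (rot-Win F i k l) (δ-out (rv< pc) (rv< pd) i k l))
        (sym (cong₂ _+_ (rot-Win F' i k l) (δ-out (rv< pa) (rv< pb) i k l)))
    go : ∀ i k → rot w n F i k + δ (rv w c , rv n d) i k ≡ rot w n F' i k + δ (rv w a , rv n b) i k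
    go i k with i <? w | k <? n | rot-in F {i} {k} | rot-in F' {i} {k} | out {i} {k}
    ... | no p | _ | _ | _ | o = o (inj₁ (≮⇒≥ p))
    ... | yes _ | no p | _ | _ | o = o (inj₂ (≮⇒≥ p))
    ... | yes p | yes q | u | u' | _ rewrite e-rv {w} pa p | e-rv {w} pc p | e-rv {n} pb q | e-rv {n} pd q =
      sym (un m (rv w i) (rv n k))

rot-tr : ∀ w n F → tr (rot w n F) ≈ rot n w (tr F)
rot-tr w n F i k with i <? n | k <? w
... | yes _ | yes _ = refl
... | yes _ | no _ = refl
... | no _ | yes _ = refl
... | no _ | no _ = refl

-- The target of an edge has its last minimiser where the source has its first one.
module FMRot (A* B* α β : ℕ → ℕ) (n y Ta Tb : ℕ) (y<n : y < n)
    (hA : ∀ k → k < n → A* k + β (rv n k) ≡ Tb) (hB : ∀ k → k < n → B* k + α (rv n k) ≡ Ta)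
    (hA' : ∀ k → n ≤ k → A* k ≡ Tb) (hB' : ∀ k → n ≤ k → B* k ≡ Ta)
    (lo : ∀ κ → κ ≤ y → α y + β κ ≤ α κ + β y) (hi : ∀ κ → y < κ → κ < n → α y + β κ < α κ + β y)
    (zr : α y ≤ β y) (ng : Tb + α y < Ta + β y) where

  private
    y* : ℕ
    y* = rv n y
    hAy : A* y* + β y ≡ Tb
    hAy = trans (cong (λ z → A* y* + β z) (sym (rv-inv y<n))) (hA y* (rv< y<n))
    hBy : B* y* + α y ≡ Ta
    hBy = trans (cong (λ z → B* y* + α z) (sym (rv-inv y<n))) (hB y* (rv< y<n))
    b : ∀ k → k < y* → A* y* + B* k < A* k + B* y*
    b k l = lin 10 (λ A B α β a b α' β' Ta Tb → (A ⊕ β ≐ Tb) ∷ (B ⊕ α ≑ Ta) ∷ (a ⊕ β' ≑ Tb) ∷ (b ⊕ α' ≐ Ta) ∷ (con 1 ⊕ α ⊕ β' ≼ α' ⊕ β) ∷ [] ⊢ con 1 ⊕ A ⊕ b ≼ a ⊕ B)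
       (A* y*) (B* y*) (α y) (β y) (A* k) (B* k) (α (rv n k)) (β (rv n k)) Ta Tb hAy hBy (hA k k<n) (hB k k<n)
       (hi (rv n k) (subst (_< rv n k) (rv-inv y<n) (rv-anti l (rv< y<n))) (rv< k<n))
      where k<n = <-trans l (rv< y<n)
    a : ∀ k → y* ≤ k → A* y* + B* k ≤ A* k + B* y*
    a k l with k <? n
    ... | no p = lin 8 (λ A B α β a b Ta Tb → (A ⊕ β ≐ Tb) ∷ (B ⊕ α ≑ Ta) ∷ (a ≑ Tb) ∷ (b ≐ Ta) ∷ (α ≼ β) ∷ [] ⊢ A ⊕ b ≼ a ⊕ B)
       (A* y*) (B* y*) (α y) (β y) (A* k) (B* k) Ta Tb hAy hBy (hA' k (≮⇒≥ p)) (hB' k (≮⇒≥ p)) zr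
    ... | yes k<n = lin 10 (λ A B α β a b α' β' Ta Tb → (A ⊕ β ≐ Tb) ∷ (B ⊕ α ≑ Ta) ∷ (a ⊕ β' ≑ Tb) ∷ (b ⊕ α' ≐ Ta) ∷ (α ⊕ β' ≼ α' ⊕ β) ∷ [] ⊢ A ⊕ b ≼ a ⊕ B)
       (A* y*) (B* y*) (α y) (β y) (A* k) (B* k) (α (rv n k)) (β (rv n k)) Ta Tb hAy hBy (hA k k<n) (hB k k<n)
       (lo (rv n k) le)
      where
      le : rv n k ≤ y
      le = +-cancelˡ-≤ y* _ _ (subst (_≤ y* + y) refl (lin 5 (λ k x y n z → (z ≼ k) ∷ (con 1 ⊕ (k ⊕ x) ≐ n) ∷ (con 1 ⊕ (y ⊕ z) ≑ n) ∷ [] ⊢ z ⊕ x ≼ z ⊕ y) k (rv n k) y n y* l (rv-sum k<n) (rv-sum y<n)))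

  result : FM A* B* y*
  result = fm (lin 6 (λ A B α β Ta Tb → (A ⊕ β ≐ Tb) ∷ (B ⊕ α ≑ Ta) ∷ (con 1 ⊕ Tb ⊕ α ≼ Ta ⊕ β) ∷ [] ⊢ con 1 ⊕ A ≼ B)
      (A* y*) (B* y*) (α y) (β y) Ta Tb hAy hBy ng) b a

S-rv : ∀ {n} f* f → (∀ k → k < n → f* k ≡ f (rv n k)) → ∀ k → k ≤ n → S f* k + S f (n ∸ k) ≡ S f n
S-rv f* f h zero l = refl
S-rv {n} f* f h (suc k) l = begin
  S f* k + f* k + S f (rv n k) ≡⟨ cong (λ z → S f* k + z + S f (rv n k)) (h k l) ⟩
  S f* k + f (rv n k) + S f (rv n k) ≡⟨ lin≡ 3 (λ a b c → [] ⊢ a ⊕ b ⊕ c ≐ a ⊕ (c ⊕ b)) (S f* k) (f (rv n k)) (S f (rv n k)) ⟩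
  S f* k + S f (suc (rv n k)) ≡⟨ cong (λ z → S f* k + S f z) (sym (+-∸-assoc 1 l)) ⟩
  S f* k + S f (n ∸ k) ≡⟨ S-rv f* f h k (<⇒≤ l) ⟩
  S f n ∎
  where open ≡-Reasoning

module _ {n y : ℕ} {a b a' b' a* b* : ℕ → ℕ} (y<n : y < n)
    (ha : ∀ k → S a' k ≡ S a k + lt y k) (hb : ∀ k → S b' k + lt y k ≡ S b k)
    (za : ∀ k → n ≤ k → a* k ≡ 0) (zb : ∀ k → n ≤ k → b* k ≡ 0)
    (ra : ∀ k → k < n → a* k ≡ b' (rv n k)) (rb : ∀ k → k < n → b* k ≡ a' (rv n k)) where

  private
    full : ∀ {f* f} → (∀ k → n ≤ k → f* k ≡ 0) → (∀ k → k < n → f* k ≡ f (rv n k)) → ∀ k → n ≤ k → S f* k ≡ S f n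
    full {f*} {f} z r k l = trans (S-const f* n z k l) (trans (sym (trans (cong (λ z → S f* n + S f z) (n∸n≡0 n)) (+-identityʳ _))) (S-rv f* f r n ≤-refl))
    n∸ : ∀ {k} → k < n → n ∸ k ≡ suc (rv n k)
    n∸ l = +-∸-assoc 1 l
    ha0 : ∀ k → k ≤ y → S a' k ≡ S a k
    ha0 k l = trans (ha k) (trans (cong (S a k +_) (lt-no l)) (+-identityʳ _))
    ha1 : ∀ k → y < k → S a' k ≡ suc (S a k)
    ha1 k l = trans (ha k) (trans (cong (S a k +_) (lt-yes l)) (+-comm _ 1))
    hb0 : ∀ k → k ≤ y → S b' k ≡ S b k
    hb0 k l = trans (sym (trans (cong (S b' k +_) (lt-no l)) (+-identityʳ _))) (hb k)
    hb1 : ∀ k → y < k → suc (S b' k) ≡ S b k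
    hb1 k l = trans (trans (+-comm 1 _) (cong (S b' k +_) (sym (lt-yes l)))) (hb k)

  first-rot : ∀ κ → (κ ≡ wk → a y ≡ 0 × b y ≡ 1) → FMκ κ a b y → FMκ κ a* b* (rv n y)
  first-rot st _ f = FMRot.result _ _ (S a') (λ k → S b' (suc k)) n y (S a' n) (S b' n) y<n
    (λ k l → trans (cong (λ z → S a* k + S b' z) (sym (n∸ l))) (S-rv a* b' ra k (<⇒≤ l)))
    (λ k l → S-rv b* a' rb (suc k) l)
    (full za ra) (λ k l → full zb rb (suc k) (≤-suc l))
    (λ k l → lo k l (≤-split l))
    (λ k l _ → lin 8 (λ A A' B B' C C' D D' → (A' ≐ A) ∷ (con 1 ⊕ B' ≑ B) ∷ (C' ≑ con 1 ⊕ C) ∷ (con 1 ⊕ D' ≐ D) ∷ (A ⊕ D ≼ C ⊕ B) ∷ [] ⊢ con 1 ⊕ A' ⊕ D' ≼ C' ⊕ B')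
       (S a y) (S a' y) (S b (suc y)) (S b' (suc y)) (S a k) (S a' k) (S b (suc k)) (S b' (suc k))
       (ha0 y ≤-refl) (hb1 (suc y) ≤-refl) (ha1 k l) (hb1 (suc k) (≤-suc l)) (aft f k (<⇒≤ l)))
    (lin 4 (λ A A' B B' → (A' ≐ A) ∷ (con 1 ⊕ B' ≑ B) ∷ (con 1 ⊕ A ≼ B) ∷ [] ⊢ A' ≼ B')
       (S a y) (S a' y) (S b (suc y)) (S b' (suc y)) (ha0 y ≤-refl) (hb1 (suc y) ≤-refl) (neg f))
    (lin 8 (λ A A' B B' C C' D D' → (A' ≐ A) ∷ (con 1 ⊕ B' ≑ B) ∷ (C' ≑ con 1 ⊕ C) ∷ (con 1 ⊕ D' ≐ D) ∷ (A ⊕ D ≼ C ⊕ B) ∷ [] ⊢ con 1 ⊕ D' ⊕ A' ≼ C' ⊕ B')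
       (S a y) (S a' y) (S b (suc y)) (S b' (suc y)) (S a n) (S a' n) (S b n) (S b' n)
       (ha0 y ≤-refl) (hb1 (suc y) ≤-refl) (ha1 n y<n) (hb1 n y<n) (≤-trans (+-monoʳ-≤ (S a y) (m≤m+n (S b n) (b n))) (aft f n (<⇒≤ y<n))))
    where
    lo : ∀ k → k ≤ y → k < y ⊎ k ≡ y → S a' y + S b' (suc k) ≤ S a' k + S b' (suc y)
    lo k l (inj₂ refl) = ≤-refl
    lo k l (inj₁ l') = lin 8 (λ A A' B B' C C' D D' → (A' ≐ A) ∷ (con 1 ⊕ B' ≑ B) ∷ (C' ≑ C) ∷ (D' ≐ D) ∷ (con 1 ⊕ A ⊕ D ≼ C ⊕ B) ∷ [] ⊢ A' ⊕ D' ≼ C' ⊕ B')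
       (S a y) (S a' y) (S b (suc y)) (S b' (suc y)) (S a k) (S a' k) (S b (suc k)) (S b' (suc k))
       (ha0 y ≤-refl) (hb1 (suc y) ≤-refl) (ha0 k l) (hb0 (suc k) l') (bef f k l')
  first-rot wk v f = FMRot.result _ _ (S a') (S b') n y (S a' n) (S b' n) y<n
    (λ k l → S-rv a* b' ra (suc k) l)
    (λ k l → S-rv b* a' rb (suc k) l)
    (λ k l → full za ra (suc k) (≤-suc l)) (λ k l → full zb rb (suc k) (≤-suc l))
    lo
    hi
    (lin 8 (λ A A' B B' p q r s → (A' ≐ A) ∷ (B' ≑ B) ∷ (p ≑ con 0) ∷ (q ≐ con 1) ∷ (con 1 ⊕ (A ⊕ p) ≼ B ⊕ q) ∷ [] ⊢ A' ≼ B')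
       (S a y) (S a' y) (S b y) (S b' y) (a y) (b y) 0 0 (ha0 y ≤-refl) (hb0 y ≤-refl) ay by (neg f))
    (lin 10 (λ A A' B B' C C' D D' p q → (A' ≐ A) ∷ (B' ≑ B) ∷ (C' ≑ con 1 ⊕ C) ∷ (con 1 ⊕ D' ≐ D) ∷ (p ≑ con 0) ∷ (q ≐ con 1) ∷ (A ⊕ p ⊕ D ≼ C ⊕ (B ⊕ q)) ∷ [] ⊢ con 1 ⊕ D' ⊕ A' ≼ C' ⊕ B')
       (S a y) (S a' y) (S b y) (S b' y) (S a n) (S a' n) (S b n) (S b' n) (a y) (b y)
       (ha0 y ≤-refl) (hb0 y ≤-refl) (ha1 n y<n) (hb1 n y<n) ay by (at' n y<n))
    where
    ay = proj₁ (v refl)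
    by = proj₂ (v refl)
    at' : ∀ k → y < k → S a (suc y) + S b k ≤ S a k + S b (suc y)
    at' (suc k) (s≤s l) = aft f k l
    be : ∀ k → k ≤ y → S a (suc y) + S b k < S a k + S b (suc y)
    be zero l = subst (λ z → suc z ≤ S b (suc y)) (sym (+-identityʳ _)) (neg f)
    be (suc k) l = bef f k l
    lo : ∀ k → k ≤ y → S a' y + S b' k ≤ S a' k + S b' y
    lo k l = lin 10 (λ A A' B B' C C' D D' p q → (A' ≐ A) ∷ (B' ≑ B) ∷ (C' ≑ C) ∷ (D' ≐ D) ∷ (p ≑ con 0) ∷ (q ≐ con 1) ∷ (con 1 ⊕ (A ⊕ p) ⊕ D ≼ C ⊕ (B ⊕ q)) ∷ [] ⊢ A' ⊕ D' ≼ C' ⊕ B')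
       (S a y) (S a' y) (S b y) (S b' y) (S a k) (S a' k) (S b k) (S b' k) (a y) (b y)
       (ha0 y ≤-refl) (hb0 y ≤-refl) (ha0 k l) (hb0 k l) ay by (be k l)
    hi : ∀ k → y < k → k < n → S a' y + S b' k < S a' k + S b' y
    hi k l _ = lin 10 (λ A A' B B' C C' D D' p q → (A' ≐ A) ∷ (B' ≑ B) ∷ (C' ≑ con 1 ⊕ C) ∷ (con 1 ⊕ D' ≐ D) ∷ (p ≑ con 0) ∷ (q ≐ con 1) ∷ (A ⊕ p ⊕ D ≼ C ⊕ (B ⊕ q)) ∷ [] ⊢ con 1 ⊕ A' ⊕ D' ≼ C' ⊕ B')
       (S a y) (S a' y) (S b y) (S b' y) (S a k) (S a' k) (S b k) (S b' k) (a y) (b y)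
       (ha0 y ≤-refl) (hb0 y ≤-refl) (ha1 k l) (hb1 k l) ay by (at' k l)

-- Half a turn exchanges the two columns and reverses the reading direction, so opening and closing
-- brackets change roles and the edge changes its direction. In this way statements about sources of
-- edges yield those about targets.
C-rot : ∀ κ {w n j F F'} → Good κ w n F → C κ j F F' → C κ (rv w (suc j)) (rot w n F') (rot w n F)
C-rot κ {w} {n} {j} {F} {F'} (h , ad) c@(edge y f m) = edge (rv n y)
    (subst (λ z → FMκ κ (rot w n F' (rv w (suc j))) (rot w n F' z) (rv n y)) (sym (rv-suc j<))
      (first-rot {a = F j} {F (suc j)} {F' j} {F' (suc j)} y<
        (λ k → Mv-col-to m k suc≢) (λ k → Mv-col-from m k suc≢)
        (λ k l → rot-Win {w} {n} F' (rv w (suc j)) k (inj₂ l)) (λ k l → rot-Win {w} {n} F' (rv w j) k (inj₂ l))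
        (λ k l → trans (rot-in F' (rv< j<) l) (cong (λ z → F' z (rv n k)) (rv-inv j<)))
        (λ k l → trans (rot-in F' (rv< j<') l) (cong (λ z → F' z (rv n k)) (rv-inv j<')))
        κ (vals κ ad f) f))
    (subst (λ z → Mv (z , rv n y) (rv w (suc j) , rv n y) (rot w n F') (rot w n F)) (sym (rv-suc j<))
      (rot-Mv j< y< j<' y< m))
  where
  j< = proj₁ (C-src κ h c)
  y< = proj₂ (C-src κ h c)
  j<' = <⇒≤ j<
  vals : ∀ κ → Adm κ F → FMκ κ (F j) (F (suc j)) y → κ ≡ wk → F j y ≡ 0 × F (suc j) y ≡ 1
  vals wk ad f refl = wk-vals {F j} {F (suc j)} (ad (suc j)) f

R-rot : ∀ κ {w n i F F'} → Good κ w n F → R κ n i F F' → R κ n (rv n (suc i)) (rot w n F') (rot w n F)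
R-rot st {w} {n} {i} {F} {F'} (h , ad) (edge x bd r m)
  with C-rot st {n} {w} {i} {tr F} {tr F'} (Win-tr h , tt) (edge x r (Mv-tr m))
... | edge x' f' m' = edge x' (subst (_< n) (sym (rv-suc bd)) (rv< (<⇒≤ bd)))
    (FMκ-resp st (λ k → sym (rot-tr w n F' _ k)) (λ k → sym (rot-tr w n F' _ k)) f')
    (Mv-resp (λ i k → sym (rot-tr w n F' k i)) (λ i k → sym (rot-tr w n F k i)) (Mv-tr m'))
R-rot wk {w} {n} {i} {F} {F'} (h , ad) r@(edge x bd f m) = edge (rv w x) (subst (_< n) (sym (rv-suc bd)) (rv< (<⇒≤ bd)))
    (subst (λ z → FMκ wk (tr (rot w n F') z) (tr (rot w n F') (rv n (suc i))) (rv w x)) (sym (rv-suc bd))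
      (first-rot {a = tr F (suc i)} {tr F i} {tr F' (suc i)} {tr F' i} x<
        (λ k → Mv-col-to mt k suc≢') (λ k → Mv-col-from mt k suc≢')
        (λ k l → rot-Win {w} {n} F' k (rv n i) (inj₁ l)) (λ k l → rot-Win {w} {n} F' k (rv n (suc i)) (inj₁ l))
        (λ k l → trans (rot-in F' l (rv< (<⇒≤ bd))) (cong (F' (rv w k)) (rv-inv (<⇒≤ bd))))
        (λ k l → trans (rot-in F' l (rv< bd)) (cong (F' (rv w k)) (rv-inv bd)))
        wk (λ _ → wk-vals {tr F (suc i)} {tr F i} (λ k → ad k i) f) f))
    (subst (λ z → Mv (rv w x , rv n (suc i)) (rv w x , z) (rot w n F') (rot w n F)) (sym (rv-suc bd))
      (rot-Mv x< (<⇒≤ bd) x< bd m))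
  where
  x< = proj₁ (R-src wk h r)
  mt : Mv (i , x) (suc i , x) (tr F) (tr F')
  mt = Mv-tr m

Good-resp : ∀ κ {w n F G} → F ≈ G → Good κ w n F → Good κ w n G
Good-resp st p (h , ad) = (λ i k l → trans (sym (p i k)) (h i k l)) , tt
Good-resp wk p (h , ad) = (λ i k l → trans (sym (p i k)) (h i k l)) , λ i k → subst (_≤ 1) (p i k) (ad i k)

rot-Good : ∀ κ {w n F} → Good κ w n F → Good κ w n (rot w n F)
rot-Good st {w} {n} {F} (h , ad) = rot-Win F , tt
rot-Good wk {w} {n} {F} (h , ad) = rot-Win F , go
  where
  go : ∀ i k → rot w n F i k ≤ 1
  go i k with i <? w | k <? n
  ... | yes _ | yes _ = ad _ _
  ... | no _ | _ = z≤n
  ... | yes _ | no _ = z≤n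

module _ (κ : Kind) {w n : ℕ} where

  C-rot' : ∀ {j F F'} → Good κ w n F → suc j < w → C κ (rv w (suc j)) F F' → C κ j (rot w n F') (rot w n F)
  C-rot' {j} {F} {F'} g l c = subst (λ z → C κ z (rot w n F') (rot w n F))
    (trans (cong (rv w) (rv-suc l)) (rv-inv (<⇒≤ l))) (C-rot κ g c)

  R-rot' : ∀ {i F F'} → Good κ w n F → suc i < n → R κ n (rv n (suc i)) F F' → R κ n i (rot w n F') (rot w n F)
  R-rot' {i} {F} {F'} g l c = subst (λ z → R κ n z (rot w n F') (rot w n F))
    (trans (cong (rv n) (rv-suc l)) (rv-inv (<⇒≤ l))) (R-rot κ g c)

  -- This is `PO` after half a turn. Here the source of the square is not given and has to be
  -- constructed, together with its goodness.
  PB : ∀ {i j F₁ F₂ F₃} → Good κ w n F₁ → Good κ w n F₂ → R κ n i F₁ F₃ → C κ j F₂ F₃ →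
      ∃ λ F → Good κ w n F × C κ j F F₁ × R κ n i F F₂
  PB {i} {j} {F₁} {F₂} {F₃} g₁ g₂ r c
    with PO κ (proj₂ (rot-Good κ (C-Good κ g₂ c))) (C-rot κ g₂ c) (R-rot κ g₁ r)
  ... | G , c' , r' = rot w n G , rot-Good κ (C-Good κ (rot-Good κ g₁) c')
      , C-resp κ ≈-refl (rot-rot (proj₁ g₁)) (C-rot' (rot-Good κ g₁) (proj₁ (C-src κ (proj₁ g₂) c)) c')
      , R-resp κ ≈-refl (rot-rot (proj₁ g₂)) (R-rot' (rot-Good κ g₂) (R.bound r) r')

  private
    unrot : ∀ {F G} → Good κ w n F → Good κ w n G → rot w n F ≈ rot w n G → F ≈ G
    unrot {F} {G} g g' p = ≈-trans (≈-sym (rot-rot {w} {n} (proj₁ g)))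
      (≈-trans (rot-cong {w} {n} p) (rot-rot {w} {n} (proj₁ g')))

  C-bdet : ∀ {j F F' G G'} → Good κ w n F → Good κ w n F' → C κ j F G → C κ j F' G' → G ≈ G' → F ≈ F'
  C-bdet g g' c c' p = unrot g g' (C-det κ (C-rot κ g c) (C-rot κ g' c') (rot-cong {w} {n} p))

  R-bdet : ∀ {i F F' G G'} → Good κ w n F → Good κ w n F' → R κ n i F G → R κ n i F' G' → G ≈ G' → F ≈ F'
  R-bdet g g' c c' p = unrot g g' (R-det κ (R-rot κ g c) (R-rot κ g' c') (rot-cong {w} {n} p))

-- Labelled paths and zigzags

data Path (E : ℕ → Mat → Mat → Set) : List ℕ → Mat → Mat → Set where
  done : ∀ {F G} → F ≈ G → Path E [] F G
  _∷_ : ∀ {i is F G H} → E i F G → Path E is G H → Path E (i ∷ is) F H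

-- Connectedness in the graph of `E`. A backward edge records `P` of its source, because a target
-- inside the window does not force the source to lie inside it.
data Zig (P : Mat → Set) (E : ℕ → Mat → Mat → Set) : Mat → Mat → Set where
  done : ∀ {F G} → F ≈ G → Zig P E F G
  fwd : ∀ {i F G H} → E i F G → Zig P E G H → Zig P E F H
  bwd : ∀ {i F G H} → P G → E i G F → Zig P E G H → Zig P E F H

module Zigs (P : Mat → Set) (E : ℕ → Mat → Mat → Set)
    (P-resp : ∀ {F G} → F ≈ G → P F → P G)
    (E-resp : ∀ {i F F' G G'} → F ≈ G → F' ≈ G' → E i F F' → E i G G')
    (E-P : ∀ {i F G} → P F → E i F G → P G) where

  Zig-respˡ : ∀ {F G H} → F ≈ G → Zig P E F H → Zig P E G H
  Zig-respˡ p (done q) = done (≈-trans (≈-sym p) q)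
  Zig-respˡ p (fwd e z) = fwd (E-resp p ≈-refl e) z
  Zig-respˡ p (bwd g e z) = bwd g (E-resp ≈-refl p e) z

  Zig-trans : ∀ {F G H} → Zig P E F G → Zig P E G H → Zig P E F H
  Zig-trans (done p) z' = Zig-respˡ (≈-sym p) z'
  Zig-trans (fwd e z) z' = fwd e (Zig-trans z z')
  Zig-trans (bwd g e z) z' = bwd g e (Zig-trans z z')

  Zig-P : ∀ {F G} → P F → Zig P E F G → P G
  Zig-P g (done p) = P-resp p g
  Zig-P g (fwd e z) = Zig-P (E-P g e) z
  Zig-P g (bwd g' e z) = Zig-P g' z

  Zig-sym : ∀ {F G} → P F → Zig P E F G → Zig P E G F
  Zig-sym g (done p) = done (≈-sym p)
  Zig-sym g (fwd e z) = Zig-trans (Zig-sym (E-P g e) z) (bwd g e (done ≈-refl))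
  Zig-sym g (bwd g' e z) = Zig-trans (Zig-sym g' z) (fwd e (done ≈-refl))

  Path-P : ∀ {u F G} → P F → Path E u F G → P G
  Path-P g (done p) = P-resp p g
  Path-P g (e ∷ p) = Path-P (E-P g e) p

  Path-Zig : ∀ {u F G} → Path E u F G → Zig P E F G
  Path-Zig (done p) = done p
  Path-Zig (e ∷ p) = fwd e (Path-Zig p)

  Path-resp : ∀ {u F F' G G'} → F ≈ F' → G ≈ G' → Path E u F G → Path E u F' G'
  Path-resp p q (done r) = done (≈-trans (≈-sym p) (≈-trans r q))
  Path-resp p q (e ∷ r) = E-resp p ≈-refl e ∷ Path-resp ≈-refl q r

  Path-bdet : (∀ {i F F' G G'} → P F → P F' → E i F G → E i F' G' → G ≈ G' → F ≈ F') →
      ∀ {u F F' G G'} → P F → P F' → Path E u F G → Path E u F' G' → G ≈ G' → F ≈ F'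
  Path-bdet b g g' (done p) (done p') q = ≈-trans p (≈-trans q (≈-sym p'))
  Path-bdet b g g' (e ∷ p) (e' ∷ p') q = b g g' e e' (Path-bdet b (E-P g e) (E-P g' e') p p' q)

-- Weighted sums decrease along edges, which gives normal forms.

wsum : (ℕ → ℕ) → ℕ → ℕ → Mat → ℕ
wsum f w n F = S (λ i → f i * S (F i) n) w

S-fe : ∀ (f : ℕ → ℕ) a w → a < w → S (λ i → f i * e a i) w ≡ f a
S-fe f a (suc w) l with ≤-split l
... | inj₁ (s≤s l') rewrite S-fe f a w l' | e-≢ a w (<⇒≢ l') | *-zeroʳ (f w) = +-identityʳ _
... | inj₂ refl rewrite e-refl a | *-identityʳ (f a) =
  cong (_+ f a) (S-zero _ a (λ k l → trans (cong (f k *_) (e-≢ a k (λ { refl → <-irrefl refl l }))) (*-zeroʳ (f k))))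

wsum-Mv : ∀ f {w n s d F F'} → proj₁ s < w → proj₂ s < n → proj₁ d < w → proj₂ d < n → Mv s d F F' →
    wsum f w n F' + f (proj₁ s) ≡ wsum f w n F + f (proj₁ d)
wsum-Mv f {w} {n} {a , b} {c , d} {F} {F'} pa pb pc pd m = begin
  wsum f w n F' + f a ≡⟨ cong (wsum f w n F' +_) (S-fe f a w pa) ⟨
  wsum f w n F' + S (λ i → f i * e a i) w ≡⟨ S-+ (λ i → f i * S (F' i) n) (λ i → f i * e a i) w ⟨
  S (λ i → f i * S (F' i) n + f i * e a i) w ≡⟨ S-≗ eq w ⟩
  S (λ i → f i * S (F i) n + f i * e c i) w ≡⟨ S-+ (λ i → f i * S (F i) n) (λ i → f i * e c i) w ⟩
  wsum f w n F + S (λ i → f i * e c i) w ≡⟨ cong (wsum f w n F +_) (S-fe f c w pc) ⟩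
  wsum f w n F + f c ∎
  where
  open ≡-Reasoning
  eq : ∀ i → f i * S (F' i) n + f i * e a i ≡ f i * S (F i) n + f i * e c i
  eq i with Mv-col m i n
  ... | q rewrite lt-yes pb | lt-yes pd | *-identityʳ (e a i) | *-identityʳ (e c i) =
    trans (sym (*-distribˡ-+ (f i) _ _)) (trans (cong (f i *_) q) (*-distribˡ-+ (f i) _ _))

CHigh : Kind → Mat → Set
CHigh κ F = ∀ j → HC κ j F

RHigh : Kind → ℕ → Mat → Set
RHigh κ n F = ∀ i → suc i < n → HR κ i F

HC-out : ∀ κ {w n F} j → Win w n F → w ≤ suc j → HC κ j F
HC-out κ {F = F} j h l k = ≤-trans (≡⇒≤ (S-zero (F (suc j)) (suc k) (λ k _ → h _ k (inj₁ l)))) z≤n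

module _ (κ : Kind) {w n : ℕ} where

  C-or-CHigh : ∀ {F} o → Win w n F → (∀ j → o ≤ j → HC κ j F) ⊎ ∃₂ λ j G → o ≤ j × C κ j F G
  C-or-CHigh {F} o h with go w
    where
    go : ∀ N → (∀ j → o ≤ j → j < N → HC κ j F) ⊎ ∃₂ λ j G → o ≤ j × C κ j F G
    go zero = inj₁ (λ _ _ ())
    go (suc N) with go N
    ... | inj₂ r = inj₂ r
    ... | inj₁ a with C-or-HC κ N h | o ≤? N
    ... | inj₂ (G , c) | yes l = inj₂ (N , G , l , c)
    ... | inj₁ c | _ = inj₁ ext
      where
      ext : ∀ j → o ≤ j → j < suc N → HC κ j F
      ext j q l with ≤-split l
      ... | inj₁ (s≤s l') = a j q l'
      ... | inj₂ refl = c
    ... | inj₂ _ | no ¬l = inj₁ ext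
      where
      ext : ∀ j → o ≤ j → j < suc N → HC κ j F
      ext j q l with ≤-split l
      ... | inj₁ (s≤s l') = a j q l'
      ... | inj₂ refl = ⊥-elim (¬l q)
  ... | inj₂ r = inj₂ r
  ... | inj₁ a = inj₁ all
    where
    all : ∀ j → o ≤ j → HC κ j F
    all j q with j <? w
    ... | yes l = a j q l
    ... | no l = HC-out κ j h (≤-suc (≮⇒≥ l))

  R-or-RHigh : ∀ {F} → Win w n F → RHigh κ n F ⊎ ∃₂ λ i G → R κ n i F G
  R-or-RHigh {F} h with go n ≤-refl
    where
    go : ∀ N → N ≤ n → (∀ i → i < N → suc i < n → HR κ i F) ⊎ ∃₂ λ i G → R κ n i F G
    go zero _ = inj₁ (λ _ ())
    go (suc N) b with go N (<⇒≤ b)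
    ... | inj₂ r = inj₂ r
    ... | inj₁ a with suc N <? n
    ... | no ¬l = inj₁ ext
      where
      ext : ∀ i → i < suc N → suc i < n → HR κ i F
      ext i l bd with ≤-split l
      ... | inj₁ (s≤s l') = a i l' bd
      ... | inj₂ refl = ⊥-elim (¬l bd)
    ... | yes l with R-or-HR κ N l h
    ... | inj₂ (G , r) = inj₂ (N , G , r)
    ... | inj₁ c = inj₁ ext
      where
      ext : ∀ i → i < suc N → suc i < n → HR κ i F
      ext i l bd with ≤-split l
      ... | inj₁ (s≤s l') = a i l' bd
      ... | inj₂ refl = c
  ... | inj₂ r = inj₂ r
  ... | inj₁ a = inj₁ (λ i bd → a i (<⇒≤ bd) bd)

  -- Each edge lowers the sum of the column indices of all units by one, so the process stops. With
  -- `o = 1` the first column is left alone, which the interlacing needs.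
  nc : ∀ o {F} → Good κ w n F → ∃₂ λ u G → Path (λ j F G → o ≤ j × C κ j F G) u F G × (∀ j → o ≤ j → HC κ j G)
  nc o {F} g = go F g (<-wellFounded (wsum id w n F))
    where
    go : ∀ F → Good κ w n F → Acc _<_ (wsum id w n F) → ∃₂ λ u G → Path (λ j F G → o ≤ j × C κ j F G) u F G × (∀ j → o ≤ j → HC κ j G)
    go F g (acc rs) with C-or-CHigh o (proj₁ g)
    ... | inj₁ hi = [] , F , done ≈-refl , hi
    ... | inj₂ (j , G , q , c) with go G (C-Good κ g c) (rs smaller)
      where
      smaller : wsum id w n G < wsum id w n F
      smaller = lin 3 (λ a b j → (a ⊕ (con 1 ⊕ j) ≐ b ⊕ j) ∷ [] ⊢ con 1 ⊕ a ≼ b) (wsum id w n G) (wsum id w n F) j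
        (wsum-Mv id (proj₁ (C-src κ (proj₁ g) c)) (proj₂ (C-src κ (proj₁ g) c)) (<⇒≤ (proj₁ (C-src κ (proj₁ g) c))) (proj₂ (C-src κ (proj₁ g) c)) (C.mv c))
    ... | u , H , p , hi = j ∷ u , H , (q , c) ∷ p , hi

  private
    -- For `wk` the row index of the moved unit grows, so its complement is used as the decreasing
    -- weight.
    weight : Kind → ℕ → ℕ
    weight st k = k
    weight wk k = n ∸ k

    weight< : ∀ κ i → suc i < n → weight κ (rowTo κ i) < weight κ (rowFrom κ i)
    weight< st i l = ≤-refl
    weight< wk i l = ≡⇒≤ (rv-suc' l)
      where
      rv-suc' : ∀ {i} → suc i < n → suc (n ∸ suc i) ≡ n ∸ i
      rv-suc' l = sym (+-∸-assoc 1 (<⇒≤ l))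

  nr : ∀ {F} → Good κ w n F → ∃₂ λ u G → Path (R κ n) u F G × RHigh κ n G
  nr {F} g = go F g (<-wellFounded _)
    where
    T : Mat → ℕ
    T F = wsum (weight κ) n w (tr F)
    go : ∀ F → Good κ w n F → Acc _<_ (T F) → ∃₂ λ u G → Path (R κ n) u F G × RHigh κ n G
    go F g (acc rs) with R-or-RHigh (proj₁ g)
    ... | inj₁ hi = [] , F , done ≈-refl , hi
    ... | inj₂ (i , G , r) with go G (R-Good κ g r) (rs smaller)
      where
      bd = R.bound r
      from< : ∀ κ → rowFrom κ i < n
      from< st = bd
      from< wk = <⇒≤ bd
      smaller : T G < T F
      smaller = lin 4 (λ a b s d → (a ⊕ s ≐ b ⊕ d) ∷ (con 1 ⊕ d ≼ s) ∷ [] ⊢ con 1 ⊕ a ≼ b) (T G) (T F) (weight κ (rowFrom κ i)) (weight κ (rowTo κ i))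
        (wsum-Mv (weight κ) {n} {w} (from< κ) (proj₁ (R-src κ (proj₁ g) r)) (rowTo< κ bd) (proj₁ (R-src κ (proj₁ g) r)) (Mv-tr (R.mv r)))
        (weight< κ i bd)
    ... | u , H , p , hi = i ∷ u , H , r ∷ p , hi

-- Row and column sums

rs cs : ℕ → Mat → ℕ → ℕ
rs w F k = S (tr F k) w
cs n F i = S (F i) n

cancel-one : ∀ {a b x y} → x ≡ 1 → y ≡ 1 → a + x ≡ b + y → a ≡ b
cancel-one refl refl = +-cancelʳ-≡ 1 _ _

C-rs : ∀ κ {w n j F F'} → Win w n F → C κ j F F' → ∀ k → rs w F' k ≡ rs w F k
C-rs κ {w} {n} {j} h c k with C.at c ≟ k
... | yes refl = cancel-one (lt-yes l) (lt-yes (<⇒≤ l)) (Mv-col-both (Mv-tr (C.mv c)) w refl)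
  where l = proj₁ (C-src κ h c)
... | no neq = Mv-col-other (Mv-tr (C.mv c)) w neq neq

R-cs : ∀ κ {w n i F F'} → Win w n F → R κ n i F F' → ∀ k → cs n F' k ≡ cs n F k
R-cs κ {w} {n} {i} h r k with R.at r ≟ k
... | yes refl = cancel-one (lt-yes (proj₂ (R-src κ h r))) (lt-yes (rowTo< κ (R.bound r))) (Mv-col-both (R.mv r) n refl)
... | no neq = Mv-col-other (R.mv r) n neq neq

-- Matrices that are highest in both directions

-- Outside the band a unit would have to be matched with a unit of the preceding line that is
-- already known not to exist. For `o = 0` the diagonal remains, for `o = 1` the cells `(k , k)` and
-- `(suc k , k)`.
module Band (o w n : ℕ) (F : Mat) (h : Win w n F) (c : ∀ j → o ≤ j → HC st j F) (r : RHigh st n F) where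

  private
    above : ∀ i → (∀ x → x < i → ∀ k → x < k → F x k ≡ 0) → ∀ k → i < k → F i k ≡ 0
    above i ih (suc k) (s≤s l) with suc k <? n
    ... | no p = h i (suc k) (inj₂ (≮⇒≥ p))
    ... | yes p = n≤0⇒n≡0 (≤-trans (m≤n+m _ _) (≤-trans (r k p i)
        (≡⇒≤ (S-zero (tr F k) i (λ x m → ih x m k (≤-trans m l))))))

  upper-zero : ∀ i k → i < k → F i k ≡ 0
  upper-zero = <-rec (λ i → ∀ k → i < k → F i k ≡ 0) (λ i ih → above i (λ x l → ih l))

  lower-zero : ∀ i k → k + o < i → F i k ≡ 0
  lower-zero (suc j) k (s≤s l) = n≤0⇒n≡0 (≤-trans (m≤n+m _ _) (≤-trans (c j (≤-trans (m≤n+m o k) l) k)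
    (≡⇒≤ (S-zero (F j) k (λ k' m → lower-zero j k' (≤-trans (+-monoˡ-< o m) l))))))

S-single : ∀ f n a → a < n → (∀ k → k ≢ a → f k ≡ 0) → S f n ≡ f a
S-single f (suc n) a l h with ≤-split l
... | inj₁ (s≤s l') rewrite h n (λ { refl → <-irrefl refl l' }) = trans (+-identityʳ _) (S-single f n a l' h)
... | inj₂ refl = cong (_+ f a) (S-zero f a (λ k m → h k (<⇒≢ m)))

S-01 : ∀ f n → (∀ k → f k ≤ 1) → S f n ≤ n
S-01 f zero h = z≤n
S-01 f (suc n) h = subst (S f n + f n ≤_) (+-comm n 1) (+-mono-≤ (S-01 f n h) (h n))

threshold-unique : ∀ {f g : ℕ → ℕ} n → (∀ k → f k ≤ 1) → (∀ k → g k ≤ 1) →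
  (∀ k → suc k < n → f k ≤ f (suc k)) → (∀ k → suc k < n → g k ≤ g (suc k)) → S f n ≡ S g n → ∀ k → k < n → f k ≡ g k
threshold-unique {f} {g} (suc n) zf zg mf mg q k l = go k l
  where
  below : ∀ f → (∀ k → suc k < suc n → f k ≤ f (suc k)) → f n ≡ 0 → ∀ k → k ≤ n → f k ≡ 0
  below f m z k l with ≤-split l
  ... | inj₂ refl = z
  ... | inj₁ l' = down n ≤-refl z k l'
    where
    down : ∀ N → N ≤ n → f N ≡ 0 → ∀ k → k < N → f k ≡ 0
    down (suc N) b z k (s≤s l) with n≤0⇒n≡0 (subst (f N ≤_) z (m N (s≤s b)))
    ... | z' with ≤-split l
    ... | inj₂ refl = z'
    ... | inj₁ l' = down N (<⇒≤ b) z' k l'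
  clash : ∀ f g → (∀ k → suc k < suc n → f k ≤ f (suc k)) → S f (suc n) ≡ S g (suc n) → f n ≡ 0 → g n ≡ 1 → ⊥
  clash f g m q z o = 1+n≢0 {S g n} (trans (+-comm 1 (S g n)) (trans (cong (S g n +_) (sym o)) (trans (sym q)
      (S-zero f (suc n) (λ { k (s≤s l) → below f m z k l })))))
  top : f n ≡ g n
  top with bit (zf n) | bit (zg n)
  ... | inj₁ a | inj₁ b = trans a (sym b)
  ... | inj₂ a | inj₂ b = trans a (sym b)
  ... | inj₁ a | inj₂ b = ⊥-elim (clash f g mf q a b)
  ... | inj₂ a | inj₁ b = ⊥-elim (clash g f mg (sym q) b a)
  go : ∀ k → k < suc n → f k ≡ g k
  go k l with ≤-split l
  ... | inj₂ refl = top
  ... | inj₁ (s≤s l') = threshold-unique n zf zg (λ k l → mf k (≤-suc l)) (λ k l → mg k (≤-suc l))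
      (+-cancelʳ-≡ (g n) _ _ (trans (cong (S f n +_) (sym top)) q)) k l'

antitone-unique : ∀ {f g : ℕ → ℕ} n → (∀ k → f k ≤ 1) → (∀ k → g k ≤ 1) →
  (∀ k → f (suc k) ≤ f k) → (∀ k → g (suc k) ≤ g k) → S f n ≡ S g n → ∀ k → k < n → f k ≡ g k
antitone-unique {f} {g} (suc n) zf zg mf mg q k l = go k l
  where
  ones : ∀ f → (∀ k → f k ≤ 1) → (∀ k → f (suc k) ≤ f k) → ∀ n → f n ≡ 1 → S f (suc n) ≡ suc n
  ones f z m zero o = o
  ones f z m (suc n) o = trans (cong₂ _+_ (ones f z m n (≤-antisym (z n) (subst (_≤ f n) o (m n)))) o) (+-comm _ 1)
  clash : ∀ f g → (∀ k → f k ≤ 1) → (∀ k → f (suc k) ≤ f k) → (∀ k → g k ≤ 1) → S f (suc n) ≡ S g (suc n) → f n ≡ 1 → g n ≡ 0 → ⊥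
  clash f g z m z' q o p = <-irrefl refl (≤-trans (≡⇒≤ (trans (sym (ones f z m n o)) (trans q (trans (cong (S g n +_) p) (+-identityʳ _))))) (S-01 g n z'))
  top : f n ≡ g n
  top with bit (zf n) | bit (zg n)
  ... | inj₁ a | inj₁ b = trans a (sym b)
  ... | inj₂ a | inj₂ b = trans a (sym b)
  ... | inj₁ a | inj₂ b = ⊥-elim (clash g f zg mg zf (sym q) b a)
  ... | inj₂ a | inj₁ b = ⊥-elim (clash f g zf mf zg q a b)
  go : ∀ k → k < suc n → f k ≡ g k
  go k l with ≤-split l
  ... | inj₂ refl = top
  ... | inj₁ (s≤s l') = antitone-unique n zf zg mf mg (+-cancelʳ-≡ (g n) _ _ (trans (cong (S f n +_) (sym top)) q)) k l'

-- A doubly highest 0-1-matrix is a diagram pushed into a corner. The two monotonicities are proved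
-- alternately: decrease along the columns up to `i` makes column `i` monotone, and monotone column
-- `i` dominates column `suc i`.
module Corner (w n : ℕ) (F : Mat) (g : Good wk w n F) (c : CHigh wk F) (r : RHigh wk n F) where

  private
    h = proj₁ g
    z = proj₂ g

    Left Up : ℕ → Set
    Left i = ∀ k → F i k ≤ F (pred i) k
    Up i = ∀ k → suc k < n → F i k ≤ F i (suc k)

    up : ∀ i → (∀ x → x ≤ i → Left x) → Up i
    up i ls k l with bit (z i k) | bit (z i (suc k))
    ... | inj₁ a | _ = subst (_≤ F i (suc k)) (sym a) z≤n
    ... | inj₂ a | inj₂ b = ≡⇒≤ (trans a (sym b))
    ... | inj₂ a | inj₁ b = ⊥-elim (<-irrefl refl (≤-trans (≡⇒≤ (sym (full i ls a)))
        (≤-trans (r k l i) (≤-trans (≡⇒≤ (trans (cong (S (tr F (suc k)) i +_) b) (+-identityʳ _))) (S-01 (tr F (suc k)) i (λ x → z x (suc k)))))))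
      where
      full : ∀ i → (∀ x → x ≤ i → Left x) → F i k ≡ 1 → S (tr F k) (suc i) ≡ suc i
      full zero ls o = o
      full (suc i) ls o = trans (cong₂ _+_ (full i (λ x m → ls x (≤-suc m)) (≤-antisym (z i k) (subst (_≤ F i k) o (ls (suc i) ≤-refl k)))) o) (+-comm _ 1)

    left : ∀ i → Up i → Left (suc i)
    left i u k with bit (z (suc i) k) | bit (z i k)
    ... | inj₁ a | _ = subst (_≤ F i k) (sym a) z≤n
    ... | inj₂ a | inj₂ b = ≡⇒≤ (trans a (sym b))
    ... | inj₂ a | inj₁ b with k <? n
    ... | no p = ≤-trans (≡⇒≤ (h (suc i) k (inj₂ (≮⇒≥ p)))) z≤n
    ... | yes p = ⊥-elim (<⇒≱ (≤-trans (≡⇒≤ (sym a)) (m≤n+m (F (suc i) k) (S (F (suc i)) k)))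
        (≤-trans (c i k) (≡⇒≤ (S-zero (F i) (suc k) (λ { x (s≤s m) → zeros' k p b x m })))))
      where
      zeros' : ∀ k → k < n → F i k ≡ 0 → ∀ x → x ≤ k → F i x ≡ 0
      zeros' k p b x m with ≤-split m
      ... | inj₂ refl = b
      zeros' (suc k) p b x m | inj₁ (s≤s m') = zeros' k (<⇒≤ p) (n≤0⇒n≡0 (subst (F i k ≤_) b (u k p))) x m'

    lefts : ∀ i x → x ≤ i → Left x
    lefts i zero m k = ≤-refl
    lefts (suc i) (suc x) (s≤s m) = left x (up x (λ y l → lefts i y (≤-trans l m)))

  left-justified : ∀ i k → F (suc i) k ≤ F i k
  left-justified i = lefts (suc i) (suc i) ≤-refl

  top-justified : ∀ i k → suc k < n → F i k ≤ F i (suc k)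
  top-justified i = up i (lefts i)

module _ where

  DH : Kind → (w n : ℕ) → Mat → Set
  DH κ w n F = Good κ w n F × CHigh κ F × RHigh κ n F

  private
    off : ∀ {w n F} → DH st w n F → ∀ i k → i ≢ k → F i k ≡ 0
    off {w} {n} {F} ((h , _) , c , r) i k neq with <-cmp i k
    ... | tri< l _ _ = Band.upper-zero 0 w n F h (λ j _ → c j) r i k l
    ... | tri≈ _ p _ = ⊥-elim (neq p)
    ... | tri> _ _ l = Band.lower-zero 0 w n F h (λ j _ → c j) r i k (subst (_< i) (sym (+-identityʳ k)) l)

  -- Doubly highest matrices are diagonal for `st` and justified diagrams for `wk`, so either kind
  -- of line sums determines them. They correspond to the shapes in RSK.
  DH-cs : ∀ κ {w n F G} → DH κ w n F → DH κ w n G → (∀ i → cs n F i ≡ cs n G i) → F ≈ G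
  DH-cs st {w} {n} {F} {G} d d' q i k with i ≟ k
  ... | no neq = trans (off d i k neq) (sym (off d' i k neq))
  ... | yes refl with i <? n
  ... | no p = trans (proj₁ (proj₁ d) i i (inj₂ (≮⇒≥ p))) (sym (proj₁ (proj₁ d') i i (inj₂ (≮⇒≥ p))))
  ... | yes p = trans (sym (S-single (F i) n i p (λ k neq → off d i k (neq ∘ sym)))) (trans (q i) (S-single (G i) n i p (λ k neq → off d' i k (neq ∘ sym))))
  DH-cs wk {w} {n} {F} {G} (g , c , r) (g' , c' , r') q = window {w} {n} (proj₁ g) (proj₁ g') λ i k _ l →
    threshold-unique n (proj₂ g i) (proj₂ g' i) (Corner.top-justified w n F g c r i) (Corner.top-justified w n G g' c' r' i) (q i) k l

  DH-rs : ∀ κ {w n F G} → DH κ w n F → DH κ w n G → (∀ k → rs w F k ≡ rs w G k) → F ≈ G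
  DH-rs st {w} {n} {F} {G} d d' q i k with i ≟ k
  ... | no neq = trans (off d i k neq) (sym (off d' i k neq))
  ... | yes refl with i <? w
  ... | no p = trans (proj₁ (proj₁ d) i i (inj₁ (≮⇒≥ p))) (sym (proj₁ (proj₁ d') i i (inj₁ (≮⇒≥ p))))
  ... | yes p = trans (sym (S-single (tr F i) w i p (λ k neq → off d k i neq))) (trans (q i) (S-single (tr G i) w i p (λ k neq → off d' k i neq)))
  DH-rs wk {w} {n} {F} {G} (g , c , r) (g' , c' , r') q = window {w} {n} (proj₁ g) (proj₁ g') λ i k l _ →
    antitone-unique w (λ i → proj₂ g i k) (λ i → proj₂ g' i k) (λ i → Corner.left-justified w n F g c r i k) (λ i → Corner.left-justified w n G g' c' r' i k) (q k) i l

-- Uniqueness of normal forms; column class and row normal form as coordinates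

module NF (κ : Kind) (w n : ℕ) where

  G : Mat → Set
  G = Good κ w n

  CE RE : ℕ → Mat → Mat → Set
  CE = C κ
  RE = R κ n

  CZ RZ : Mat → Mat → Set
  CZ = Zig G CE
  RZ = Zig G RE

  CPath RPath : List ℕ → Mat → Mat → Set
  CPath = Path CE
  RPath = Path RE

  private
    module ZC = Zigs G CE (Good-resp κ) (C-resp κ) (C-Good κ)
    module ZR = Zigs G RE (Good-resp κ) (R-resp κ) (R-Good κ)

  open ZC public renaming (Zig-P to CZ-G; Zig-sym to CZ-sym; Zig-trans to CZ-trans; Path-P to C-pathG;
    Path-Zig to C-path-Z; Path-resp to C-path-resp) hiding (Zig-respˡ; Path-bdet)
  open ZR public renaming (Zig-P to RZ-G; Zig-sym to RZ-sym; Zig-trans to RZ-trans; Path-P to R-pathG;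
    Path-Zig to R-path-Z; Path-resp to R-path-resp) hiding (Zig-respˡ; Path-bdet)

  C-path-bdet : ∀ {u A A' B B'} → G A → G A' → CPath u A B → CPath u A' B' → B ≈ B' → A ≈ A'
  C-path-bdet = ZC.Path-bdet (C-bdet κ)

  R-path-bdet : ∀ {u A A' B B'} → G A → G A' → RPath u A B → RPath u A' B' → B ≈ B' → A ≈ A'
  R-path-bdet = ZR.Path-bdet (R-bdet κ)

  push : ∀ {u j A B D} → G A → C κ j A D → RPath u A B → ∃ λ E → C κ j B E × RPath u D E
  push g c (done p) = _ , C-resp κ p ≈-refl c , done ≈-refl
  push g c (r ∷ rs) =
    let (D' , c' , r') = PO κ (proj₂ g) c r
        (E , c'' , rs') = push (R-Good κ g r) c' rs
    in E , c'' , r' ∷ rs'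

  pull : ∀ {u j A B D} → G D → C κ j D A → RPath u A B → ∃ λ E → C κ j E B × RPath u D E
  pull g c (done p) = _ , C-resp κ ≈-refl p c , done ≈-refl
  pull g c (r ∷ rs) =
    let (D' , r' , c') = MX₁ κ g c r
        (E , c'' , rs') = pull (R-Good κ g r') c' rs
    in E , c'' , r' ∷ rs'

  -- Each commuting square keeps the labels of its sides, so the same word of row operators applies
  -- along the whole column class. The row operators act as isomorphisms between column classes.
  transport : ∀ {u A A' B} → G A → CZ A A' → RPath u A B → ∃ λ B' → RPath u A' B' × CZ B B'
  transport g (done p) rs = _ , R-path-resp p ≈-refl rs , done ≈-refl
  transport g (fwd c z) rs =
    let (E , c' , rs') = push g c rs
        (B' , rs'' , z') = transport (C-Good κ g c) z rs'
    in B' , rs'' , fwd c' z'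
  transport g (bwd g' c z) rs =
    let (E , c' , rs') = pull g' c rs
        (B' , rs'' , z') = transport g' z rs'
    in B' , rs'' , bwd (R-pathG g' rs') c' z'

  push-back : ∀ {u j X A A'} → G X → C κ j A A' → RPath u X A → ∃ λ X' → C κ j X X' × RPath u X' A'
  push-back g c (done p) = _ , C-resp κ (≈-sym p) ≈-refl c , done ≈-refl
  push-back g c (r ∷ rs) =
    let (Y , c' , rs') = push-back (R-Good κ g r) c rs
        (X' , c'' , r') = MX₂ κ g r c'
    in X' , c'' , r' ∷ rs'

  pull-back : ∀ {u j X A A'} → G X → G A' → C κ j A' A → RPath u X A → ∃ λ X' → G X' × C κ j X' X × RPath u X' A'
  pull-back g g' c (done p) = _ , g' , C-resp κ ≈-refl (≈-sym p) c , done ≈-refl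
  pull-back g g' c (r ∷ rs) =
    let (Y , h , c' , rs') = pull-back (R-Good κ g r) g' c rs
        (X' , h' , c'' , r') = PB κ g h r c'
    in X' , h' , c'' , r' ∷ rs'

  -- The target of the row path is moved instead of its source. Going against a column edge needs
  -- the square that is completed from its sink, `PB`.
  transport-back : ∀ {u X A A'} → G X → CZ A A' → RPath u X A → ∃ λ X' → G X' × RPath u X' A' × CZ X X'
  transport-back g (done p) rs = _ , g , R-path-resp ≈-refl p rs , done ≈-refl
  transport-back g (fwd c z) rs =
    let (Y , c' , rs') = push-back g c rs
        (X' , g' , rs'' , z') = transport-back (C-Good κ g c') z rs'
    in X' , g' , rs'' , fwd c' z'
  transport-back g (bwd h c z) rs =
    let (Y , gy , c' , rs') = pull-back g h c rs
        (X' , g' , rs'' , z') = transport-back gy z rs'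
    in X' , g' , rs'' , bwd gy c' z'

  RHigh-resp : ∀ {A B} → A ≈ B → RHigh κ n A → RHigh κ n B
  RHigh-resp p h i l = HR-resp κ p (h i l)

  RHigh-fwd : ∀ {j A B} → G A → C κ j A B → RHigh κ n A → RHigh κ n B
  RHigh-fwd g c h i l = HR-C κ (proj₂ g) (h i l) c

  RHigh-bwd : ∀ {j A B} → G A → C κ j A B → RHigh κ n B → RHigh κ n A
  RHigh-bwd g c h i l with R-or-HR κ i l (proj₁ g)
  ... | inj₁ p = p
  ... | inj₂ (_ , r) =
    let (_ , _ , r') = PO κ (proj₂ g) c r
    in ⊥-elim (FM-HI (R.first r') (h i l))

  -- A row operator applies at one end of a column edge exactly if it applies at the other end:
  -- forwards by preservation of highest rows, backwards by the square.
  RHigh-CZ : ∀ {A B} → G A → CZ A B → RHigh κ n A → RHigh κ n B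
  RHigh-CZ g (done p) h = RHigh-resp p h
  RHigh-CZ g (fwd c z) h = RHigh-CZ (C-Good κ g c) z (RHigh-fwd g c h)
  RHigh-CZ g (bwd g' c z) h = RHigh-CZ g' z (RHigh-bwd g' c h)

  CHigh-path : ∀ {u A B} → G A → RPath u A B → CHigh κ A → CHigh κ B
  CHigh-path g (done p) h j = HC-resp κ p (h j)
  CHigh-path g (r ∷ rs) h = CHigh-path (R-Good κ g r) rs (λ j → HC-R κ (proj₂ g) (h j) r)

  rs-resp : ∀ {A B} → A ≈ B → ∀ k → rs w A k ≡ rs w B k
  rs-resp p k = S-≗ (λ i → p i k) w

  rs-CZ : ∀ {A B} → G A → CZ A B → ∀ k → rs w A k ≡ rs w B k
  rs-CZ g (done p) k = rs-resp p k
  rs-CZ g (fwd c z) k = trans (sym (C-rs κ (proj₁ g) c k)) (rs-CZ (C-Good κ g c) z k)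
  rs-CZ g (bwd g' c z) k = trans (C-rs κ (proj₁ g') c k) (rs-CZ g' z k)

  cs-path : ∀ {u A B} → G A → RPath u A B → ∀ i → cs n A i ≡ cs n B i
  cs-path g (done p) i = S-≗ (p i) n
  cs-path g (r ∷ rs) i = trans (sym (R-cs κ (proj₁ g) r i)) (cs-path (R-Good κ g r) rs i)

  cs-RZ : ∀ {A B} → G A → RZ A B → ∀ i → cs n A i ≡ cs n B i
  cs-RZ g (done p) i = S-≗ (p i) n
  cs-RZ g (fwd r z) i = trans (sym (R-cs κ (proj₁ g) r i)) (cs-RZ (R-Good κ g r) z i)
  cs-RZ g (bwd g' r z) i = trans (R-cs κ (proj₁ g') r i) (cs-RZ g' z i)

  tile : ∀ {u v A B D} → G A → CPath v A D → RPath u A B → ∃ λ E → CPath v B E × RPath u D E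
  tile g (done p) rs = _ , done ≈-refl , R-path-resp p ≈-refl rs
  tile g (c ∷ cs) rs =
    let (E , c' , rs') = push g c rs
        (E' , cs' , rs'') = tile (C-Good κ g c) cs rs'
    in E' , c' ∷ cs' , rs''

  strip : ∀ {u o A B} → Path (λ j F H → o ≤ j × C κ j F H) u A B → CPath u A B
  strip (done p) = done p
  strip ((_ , c) ∷ cs) = c ∷ strip cs

  -- Two row normal forms of A are joined by pushing them along a column normalisation of A.
  nr-unique : ∀ {u u' A B B'} → G A → RPath u A B → RPath u' A B' → RHigh κ n B → RHigh κ n B' → B ≈ B'
  nr-unique {A = A} {B} {B'} g p p' h h' with nc κ 0 g
  ... | v , D , cv , hi with tile g (strip cv) p | tile g (strip cv) p'
  ... | E , q , s | E' , q' , s' = C-path-bdet gB gB' q q' (DH-cs κ (dh gB q s h) (dh gB' q' s' h')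
      (λ i → trans (sym (cs-path gD s i)) (cs-path gD s' i)))
    where
    gB = R-pathG g p
    gB' = R-pathG g p'
    gD = C-pathG g (strip cv)
    dh : ∀ {B E u} → G B → CPath v B E → RPath u D E → RHigh κ n B → DH κ w n E
    dh gb q s h = C-pathG gb q , CHigh-path gD s (λ j → hi j z≤n) , RHigh-CZ gb (C-path-Z q) h

  RZ-nf : ∀ {u u' A A' B B'} → G A → RZ A A' → RPath u A B → RPath u' A' B' → RHigh κ n B → RHigh κ n B' → B ≈ B'
  RZ-nf g (done p) q q' h h' = nr-unique g q (R-path-resp (≈-sym p) ≈-refl q') h h'
  RZ-nf g (fwd r z) q q' h h' with nr κ (R-Good κ g r)
  ... | _ , D , s , hD = ≈-trans (nr-unique g q (r ∷ s) h hD) (RZ-nf (R-Good κ g r) z s q' hD h')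
  RZ-nf g (bwd g' r z) q q' h h' = RZ-nf g' z (r ∷ q) q' h h'

  RZ-high : ∀ {A A'} → G A → RZ A A' → RHigh κ n A → RHigh κ n A' → A ≈ A'
  RZ-high g z = RZ-nf g z (done ≈-refl) (done ≈-refl)

  -- The pair (column class, row normal form) determines a matrix.
  PQ-unique : ∀ {u u' A A' B B'} → G A → CZ A A' → RPath u A B → RPath u' A' B' → RHigh κ n B → B ≈ B' → A ≈ A'
  PQ-unique g z p p' h q =
    let (D , p'' , z') = transport g z p
        gA' = CZ-G g z
        D≈B' = nr-unique gA' p'' p' (RHigh-CZ (R-pathG g p) z' h) (RHigh-resp q h)
    in R-path-bdet g gA' p p'' (≈-trans q (≈-sym D≈B'))

  rs-nr : ∀ {u u' A A' B B'} → G A → CZ A A' → RPath u A B → RPath u' A' B' → RHigh κ n B → RHigh κ n B' → ∀ k → rs w B k ≡ rs w B' k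
  rs-nr g z p p' h h' k =
    let (D , p'' , z') = transport g z p
    in trans (rs-CZ (R-pathG g p) z' k)
        (rs-resp (nr-unique (CZ-G g z) p'' p' (RHigh-CZ (R-pathG g p) z' h) h') k)

  -- Column normalisation keeps the row sums and row-highestness. Both matrices thus reach a doubly
  -- highest matrix with the same row sums, and there is only one.
  CZ-high : ∀ {A B} → G A → G B → RHigh κ n A → RHigh κ n B → (∀ k → rs w A k ≡ rs w B k) → CZ A B
  CZ-high {A} {B} g g' h h' q with nc κ 0 g | nc κ 0 g'
  ... | _ , D , p , hi | _ , D' , p' , hi' = CZ-trans (C-path-Z (strip p)) (CZ-trans (done eq) (CZ-sym g' (C-path-Z (strip p'))))
    where
    zD = C-path-Z (strip p)
    zD' = C-path-Z (strip p')
    eq : D ≈ D'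
    eq = DH-rs κ (CZ-G g zD , (λ j → hi j z≤n) , RHigh-CZ g zD h) (CZ-G g' zD' , (λ j → hi' j z≤n) , RHigh-CZ g' zD' h')
        (λ k → trans (sym (rs-CZ g zD k)) (trans (q k) (rs-CZ g' zD' k)))

-- Deleting the first or the last column

tail : Mat → Mat
tail F i k = F (suc i) k

init : ℕ → Mat → Mat
init w F i k with i <? w
... | yes _ = F i k
... | no _ = 0

init-in : ∀ {w} F {i} → i < w → ∀ k → init w F i k ≡ F i k
init-in {w} F {i} l k with i <? w
... | yes _ = refl
... | no p = ⊥-elim (p l)

init-out : ∀ {w} F {i} → w ≤ i → ∀ k → init w F i k ≡ 0
init-out {w} F {i} l k with i <? w
... | yes p = ⊥-elim (<⇒≱ p l)
... | no _ = refl

tail-cong : ∀ {F H} → F ≈ H → tail F ≈ tail H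
tail-cong p i k = p (suc i) k

init-cong : ∀ {w F H} → F ≈ H → init w F ≈ init w H
init-cong {w} p i k with i <? w
... | yes _ = p i k
... | no _ = refl

tail-Good : ∀ κ {w n F} → Good κ (suc w) n F → Good κ w n (tail F)
tail-Good κ {w} {n} {F} (h , ad) = h' , adm κ ad
  where
  h' : Win w n (tail F)
  h' i k (inj₁ l) = h (suc i) k (inj₁ (s≤s l))
  h' i k (inj₂ l) = h (suc i) k (inj₂ l)
  adm : ∀ κ → Adm κ F → Adm κ (tail F)
  adm st _ = tt
  adm wk z i k = z (suc i) k

init-Good : ∀ κ {w n F} → Good κ (suc w) n F → Good κ w n (init w F)
init-Good κ {w} {n} {F} (h , ad) = h' , adm κ ad
  where
  h' : Win w n (init w F)
  h' i k l with i <? w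
  h' i k l | no _ = refl
  h' i k (inj₁ l) | yes p = ⊥-elim (<⇒≱ p l)
  h' i k (inj₂ l) | yes p = h i k (inj₂ l)
  adm : ∀ κ → Adm κ F → Adm κ (init w F)
  adm st _ = tt
  adm wk z i k with i <? w
  ... | yes _ = z i k
  ... | no _ = z≤n

S-tail : ∀ f n → S (f ∘ suc) n + f 0 ≡ S f (suc n)
S-tail f zero = refl
S-tail f (suc n) = trans (lin≡ 3 (λ a b c → [] ⊢ a ⊕ b ⊕ c ≐ a ⊕ c ⊕ b) (S (f ∘ suc) n) (f (suc n)) (f 0)) (cong (_+ f (suc n)) (S-tail f n))

FM-tail : ∀ κ {a b x} → FMκ κ a b (suc x) → FMκ κ (a ∘ suc) (b ∘ suc) x
FM-tail κ {a} {b} {x} f = fm (ng κ f)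
    (λ k l → lin 10 (λ p q A B A' B' C D C' D' → (A ⊕ p ≐ A') ∷ (B ⊕ q ≑ B') ∷ (C ⊕ p ≑ C') ∷ (D ⊕ q ≐ D') ∷ (con 1 ⊕ A' ⊕ D' ≼ C' ⊕ B') ∷ [] ⊢ con 1 ⊕ A ⊕ D ≼ C ⊕ B)
      (a 0) (b 0) (opening κ (a ∘ suc) x) (closing κ (b ∘ suc) x) (opening κ a (suc x)) (closing κ b (suc x))
      (opening κ (a ∘ suc) k) (closing κ (b ∘ suc) k) (opening κ a (suc k)) (closing κ b (suc k)) (op κ x) (cl x) (op κ k) (cl k) (bef f (suc k) (s≤s l)))
    (λ k l → lin 10 (λ p q A B A' B' C D C' D' → (A ⊕ p ≐ A') ∷ (B ⊕ q ≑ B') ∷ (C ⊕ p ≑ C') ∷ (D ⊕ q ≐ D') ∷ (A' ⊕ D' ≼ C' ⊕ B') ∷ [] ⊢ A ⊕ D ≼ C ⊕ B)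
      (a 0) (b 0) (opening κ (a ∘ suc) x) (closing κ (b ∘ suc) x) (opening κ a (suc x)) (closing κ b (suc x))
      (opening κ (a ∘ suc) k) (closing κ (b ∘ suc) k) (opening κ a (suc k)) (closing κ b (suc k)) (op κ x) (cl x) (op κ k) (cl k) (aft f (suc k) (s≤s l)))
  where
  op : ∀ κ k → opening κ (a ∘ suc) k + a 0 ≡ opening κ a (suc k)
  op st k = S-tail a k
  op wk k = S-tail a (suc k)
  cl : ∀ k → closing κ (b ∘ suc) k + b 0 ≡ closing κ b (suc k)
  cl k = S-tail b (suc k)
  ng : ∀ κ → FMκ κ a b (suc x) → opening κ (a ∘ suc) x < closing κ (b ∘ suc) x
  ng st f = lin 6 (λ p q A B A' B' → (A ⊕ p ≐ A') ∷ (B ⊕ q ≑ B') ∷ (con 1 ⊕ A' ⊕ q ≼ B') ∷ [] ⊢ con 1 ⊕ A ≼ B)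
    (a 0) (b 0) (S (a ∘ suc) x) (S (b ∘ suc) (suc x)) (S a (suc x)) (S b (2 + x)) (op st x) (cl x) (bef f 0 (s≤s z≤n))
  ng wk f = lin 6 (λ p q A B A' B' → (A ⊕ p ≐ A') ∷ (B ⊕ q ≑ B') ∷ (con 1 ⊕ A' ⊕ q ≼ p ⊕ B') ∷ [] ⊢ con 1 ⊕ A ≼ B)
    (a 0) (b 0) (S (a ∘ suc) (suc x)) (S (b ∘ suc) (suc x)) (S a (2 + x)) (S b (2 + x)) (op wk x) (cl x) (bef f 0 (s≤s z≤n))

S-cut : ∀ {f g} w → (∀ k → k < w → g k ≡ f k) → (∀ k → w ≤ k → g k ≡ 0) → ∀ k → (k ≤ w → S g k ≡ S f k) × (w ≤ k → S g k ≡ S f w)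
S-cut {f} {g} w p q k = (λ l → S-cong k (λ i m → p i (≤-trans m l))) ,
  (λ l → trans (S-const g w q k l) (S-cong w p))

FM-init : ∀ κ {a b a' b' x} w → (∀ k → k < w → a' k ≡ a k) → (∀ k → w ≤ k → a' k ≡ 0) →
    (∀ k → k < w → b' k ≡ b k) → (∀ k → w ≤ k → b' k ≡ 0) → x < w → FMκ κ a b x → FMκ κ a' b' x
FM-init κ {a} {b} {a'} {b'} {x} w pa qa pb qb l f = fm
    (subst₂ _<_ (sym (op κ x l)) (sym (cl x l)) (neg f))
    (λ k m → subst₂ _<_ (sym (cong₂ _+_ (op κ x l) (cl k (<-trans m l)))) (sym (cong₂ _+_ (op κ k (<-trans m l)) (cl x l))) (bef f k m))
    after
  where
  op : ∀ κ k → k < w → opening κ a' k ≡ opening κ a k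
  op st k l = proj₁ (S-cut w pa qa k) (<⇒≤ l)
  op wk k l = proj₁ (S-cut w pa qa (suc k)) l
  cl : ∀ k → k < w → closing κ b' k ≡ closing κ b k
  cl k l = proj₁ (S-cut w pb qb (suc k)) l
  sh≥ : ∀ κ k → k ≤ sh κ k
  sh≥ st k = ≤-refl
  sh≥ wk k = n≤1+n k
  after : ∀ k → x ≤ k → opening κ a' x + closing κ b' k ≤ opening κ a' k + closing κ b' x
  after k m with k <? w
  ... | yes p = subst₂ _≤_ (sym (cong₂ _+_ (op κ x l) (cl k p))) (sym (cong₂ _+_ (op κ k p) (cl x l))) (aft f k m)
  ... | no p = subst₂ _≤_ (sym (cong₂ _+_ (op κ x l) (proj₂ (S-cut w pb qb (suc k)) (≤-suc (≮⇒≥ p)))))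
      (sym (cong₂ _+_ (proj₂ (S-cut w pa qa (sh κ k)) (≤-trans (≮⇒≥ p) (sh≥ κ k))) (cl x l)))
      (end w l)
    where
    sh≤ : ∀ κ k → sh κ k ≤ suc k
    sh≤ st k = n≤1+n k
    sh≤ wk k = ≤-refl
    -- Behind the cut the closing part is the one of the last index inside, while the opening part
    -- is at least as large; so minimality at that index suffices.
    end : ∀ w → x < w → opening κ a x + S b w ≤ S a w + closing κ b x
    end (suc w) (s≤s l) = ≤-trans (aft f w l) (+-monoˡ-≤ _ (S-mono a (sh≤ κ w)))

Mv-init : ∀ {w s d F F'} → proj₁ s < w → proj₁ d < w → Mv s d F F' → Mv s d (init w F) (init w F')
Mv-init {w} {a , b} {c , d} {F} {F'} p q m = mk go
  where
  go : ∀ i k → init w F' i k + δ (a , b) i k ≡ init w F i k + δ (c , d) i k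
  go i k with i <? w
  ... | yes l = un m i k
  ... | no l rewrite e-≢ a i (<⇒≢ (≤-trans p (≮⇒≥ l))) | e-≢ c i (<⇒≢ (≤-trans q (≮⇒≥ l))) = refl

Mv-other : ∀ {s d F F' i} → proj₁ s ≢ i → proj₁ d ≢ i → Mv s d F F' → ∀ k → F' i k ≡ F i k
Mv-other {a , b} {c , d} {i = i} p q m k with un m i k
... | r rewrite e-≢ a i p | e-≢ c i q = trans (sym (+-identityʳ _)) (trans r (+-identityʳ _))

-- Row brackets are read along the columns. Without the first column the operator either acts in the
-- same place, or loses its unit and does nothing.
R-tail : ∀ κ {n i F F'} → R κ n i F F' → R κ n i (tail F) (tail F') ⊎ tail F ≈ tail F'
R-tail κ (edge zero bd f m) = inj₂ (λ i k → sym (Mv-other {i = suc i} (λ ()) (λ ()) m k))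
R-tail κ (edge (suc x) bd f m) = inj₁ (edge x bd (FM-tail κ f) (mk (λ i k → un m (suc i) k)))

R-init : ∀ κ {n i F F'} w → R κ n i F F' → R κ n i (init w F) (init w F') ⊎ init w F ≈ init w F'
R-init κ {F = F} {F'} w (edge x bd f m) with x <? w
... | yes l = inj₁ (edge x bd (FM-init κ w (λ k p → init-in F p _) (λ k p → init-out F p _) (λ k p → init-in F p _) (λ k p → init-out F p _) l f) (Mv-init l l m))
... | no l = inj₂ same
  where
  same : init w F ≈ init w F'
  same i k with i <? w
  ... | yes p = sym (Mv-other (λ q → l (subst (_< w) (sym q) p)) (λ q → l (subst (_< w) (sym q) p)) m k)
  ... | no _ = refl

module _ (κ : Kind) {w n : ℕ} where

  private
    module N = NF κ (suc w) n
    module N' = NF κ w n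

  RPath-tail : ∀ {u F H} → N.RPath u F H → N'.RZ (tail F) (tail H)
  RPath-tail (done p) = done (tail-cong p)
  RPath-tail (r ∷ rs) with R-tail κ r
  ... | inj₁ r' = fwd r' (RPath-tail rs)
  ... | inj₂ p = N'.RZ-trans (done p) (RPath-tail rs)

  RPath-init : ∀ {u F H} → N.RPath u F H → N'.RZ (init w F) (init w H)
  RPath-init (done p) = done (init-cong {w} p)
  RPath-init (r ∷ rs) with R-init κ w r
  ... | inj₁ r' = fwd r' (RPath-init rs)
  ... | inj₂ p = N'.RZ-trans (done p) (RPath-init rs)

  CPath-tail : ∀ {u F H} → Path (λ j F H → 1 ≤ j × C κ j F H) u F H → N'.CZ (tail F) (tail H)
  CPath-tail (done p) = done (tail-cong p)
  CPath-tail ((s≤s z≤n , edge y f m) ∷ rs) = fwd (edge y f (mk (λ i k → un m (suc i) k))) (CPath-tail rs)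

-- Interlacing of the row sums of the normal forms of a matrix and of its tail

-- The skew shape of `lam` and `mu` is a horizontal strip for `st` and a vertical strip for `wk`, as
-- in the two Pieri rules.
Interlace : Kind → (n : ℕ) (lam mu : ℕ → ℕ) → Set
Interlace st n lam mu = ∀ k → k < n → mu k ≤ lam k × (suc k < n → lam (suc k) ≤ mu k)
Interlace wk n lam mu = ∀ k → k < n → mu k ≤ lam k × lam k ≤ suc (mu k)

S-two : ∀ f w a → (∀ i → w ≤ i → f i ≡ 0) → (∀ i → i ≢ a → i ≢ suc a → f i ≡ 0) → S f w ≡ f a + f (suc a)
S-two f zero a z h rewrite z a z≤n | z (suc a) z≤n = refl
S-two f (suc w) a z h with <-cmp w a
... | tri< l _ _ rewrite z a l | z (suc a) (≤-suc l) = S-zero f (suc w) (λ k m → h k (<⇒≢ (≤-trans m l)) (<⇒≢ (≤-trans m (≤-suc l))))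
... | tri≈ _ refl _ rewrite z (suc w) ≤-refl = trans (cong (_+ f w) (S-zero f w (λ k m → h k (<⇒≢ m) (<⇒≢ (≤-suc m))))) (+-comm 0 (f w))
... | tri> _ _ l = go (≤-split l)
  where
  base : S f (suc a) ≡ f a
  base = cong (_+ f a) (S-zero f a (λ k m → h k (<⇒≢ m) (<⇒≢ (≤-suc m))))
  upto : ∀ m → S f (suc a + suc m) ≡ f a + f (suc a)
  upto zero rewrite +-comm a 1 = cong (_+ f (suc a)) base
  upto (suc m) rewrite +-suc a (suc m) = trans (cong (S f (suc a + suc m) +_) (h _ (λ q → <-irrefl (sym q) (s≤s (m≤m+n a (suc m)))) (λ q → <-irrefl (sym (suc-injective q)) (subst (a <_) (sym (+-suc a m)) (s≤s (m≤m+n a m)))))) (trans (+-identityʳ _) (upto m))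
  go : suc a < w ⊎ suc a ≡ w → S f (suc w) ≡ f a + f (suc a)
  go (inj₂ refl) = cong (_+ f (suc a)) base
  go (inj₁ l') = trans (cong (S f) (sym (trans (cong suc (+-suc a (w ∸ suc a))) (cong suc (m+[n∸m]≡n l))))) (trans (cong (λ z → S f (suc a + suc z)) refl) (upto (w ∸ suc a)))

-- `N` is supported on two diagonals and `K` on one. Hence `lam k` is `N k k + N (suc k) k`, and
-- `mu k` is the sum of column `suc k` of `N`, that is `N (suc k) k + N (suc k) (suc k)`.
-- Neighbouring terms share an entry, and the inequalities compare the two entries that are left.
module StrictInterlace (w n : ℕ) (N K : Mat) (g : Win (suc w) n N) (c : ∀ j → 1 ≤ j → HC st j N) (r : RHigh st n N)
    (dh : DH st w n K) (q : ∀ i → cs n K i ≡ cs n (tail N) i) where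

  private
    module B = Band 1 (suc w) n N g c r
    module B' = Band 0 w n K (proj₁ (proj₁ dh)) (λ j _ → proj₁ (proj₂ dh) j) (proj₂ (proj₂ dh))

    off : ∀ i k → i ≢ k → i ≢ suc k → N i k ≡ 0
    off i k p q with <-cmp i k
    ... | tri< l _ _ = B.upper-zero i k l
    ... | tri≈ _ e _ = ⊥-elim (p e)
    ... | tri> _ _ l = B.lower-zero i k (subst (_< i) (+-comm 1 k) (≤∧≢⇒< l (q ∘ sym)))

    diag : ∀ i k → i ≢ k → K i k ≡ 0
    diag i k p with <-cmp i k
    ... | tri< l _ _ = B'.upper-zero i k l
    ... | tri≈ _ e _ = ⊥-elim (p e)
    ... | tri> _ _ l = B'.lower-zero i k (subst (_< i) (sym (+-identityʳ k)) l)

    lam : ∀ k → rs (suc w) N k ≡ N k k + N (suc k) k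
    lam k = S-two (tr N k) (suc w) k (λ i l → g i k (inj₁ l)) (λ i → off i k)

    col : ∀ k → cs n N (suc k) ≡ N (suc k) k + N (suc k) (suc k)
    col k = S-two (N (suc k)) n k (λ i l → g (suc k) i (inj₂ l)) (λ i p p' → off (suc k) i (p' ∘ sym) (p ∘ sym ∘ suc-injective))

    mu : ∀ k → k < n → rs w K k ≡ N (suc k) k + N (suc k) (suc k)
    mu k l with k <? w
    ... | yes m = trans (S-single (tr K k) w k m (λ i p → diag i k p))
        (trans (sym (S-single (K k) n k l (λ i p → diag k i (p ∘ sym)))) (trans (q k) (col k)))
    ... | no m = trans (S-zero (tr K k) w (λ i p → diag i k (<⇒≢ (≤-trans p (≮⇒≥ m)))))
        (sym (cong₂ _+_ (g (suc k) k (inj₁ (s≤s (≮⇒≥ m)))) (g (suc k) (suc k) (inj₁ (s≤s (≮⇒≥ m))))))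

    le₁ : ∀ k → N (suc k) (suc k) ≤ N k k
    le₁ k with suc k <? n
    ... | no p = ≤-trans (≡⇒≤ (g _ _ (inj₂ (≮⇒≥ p)))) z≤n
    ... | yes p = ≤-trans (m≤n+m _ (S (tr N (suc k)) (suc k))) (≤-trans (r k p (suc k))
        (≡⇒≤ (cong (_+ N k k) (S-zero (tr N k) k (λ i l → off i k (<⇒≢ l) (<⇒≢ (≤-suc l)))))))

    le₂ : ∀ k → N (2 + k) (suc k) ≤ N (suc k) k
    le₂ k = ≤-trans (m≤n+m _ (S (N (2 + k)) (suc k))) (≤-trans (c (suc k) (s≤s z≤n) (suc k))
        (≡⇒≤ (cong (_+ N (suc k) k) (S-zero (N (suc k)) k (λ i l → off (suc k) i (λ e → <⇒≢ (≤-suc l) (sym e)) (λ e → <⇒≢ l (sym (suc-injective e))))))))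

  interlace : Interlace st n (rs (suc w) N) (rs w K)
  interlace k l = subst₂ _≤_ (sym (mu k l)) (sym (lam k)) (lin 3 (λ a b d → (b ≼ d) ∷ [] ⊢ a ⊕ b ≼ d ⊕ a) (N (suc k) k) (N (suc k) (suc k)) (N k k) (le₁ k))
    , λ l' → subst₂ _≤_ (sym (lam (suc k))) (sym (mu k l)) (lin 3 (λ a b d → (d ≼ a) ∷ [] ⊢ b ⊕ d ≼ a ⊕ b) (N (suc k) k) (N (suc k) (suc k)) (N (2 + k) (suc k)) (le₂ k))

th : ℕ → ℕ → ℕ
th zero k = 1
th (suc m) zero = 0
th (suc m) (suc k) = th m k

th-yes : ∀ {m k} → m ≤ k → th m k ≡ 1
th-yes z≤n = refl
th-yes (s≤s l) = th-yes l

th-no : ∀ {m k} → k < m → th m k ≡ 0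
th-no {suc m} {zero} l = refl
th-no {suc m} {suc k} (s≤s l) = th-no l

th-01 : ∀ m k → th m k ≤ 1
th-01 zero k = ≤-refl
th-01 (suc m) zero = z≤n
th-01 (suc m) (suc k) = th-01 m k

S-zeros : ∀ f {a b} → a ≤ b → (∀ k → a ≤ k → k < b → f k ≡ 0) → S f b ≡ S f a
S-zeros f {a} {b} l h with ≤-split l
... | inj₂ refl = refl
S-zeros f {a} {suc b} l h | inj₁ (s≤s l') = trans (cong (S f b +_) (h b l' ≤-refl)) (trans (+-identityʳ _) (S-zeros f l' (λ k p q → h k p (≤-suc q))))

S-ones : ∀ f {a b} → a ≤ b → (∀ k → a ≤ k → k < b → f k ≡ 1) → S f b + a ≡ S f a + b
S-ones f {a} {b} l h with ≤-split l
... | inj₂ refl = refl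
S-ones f {a} {suc b} l h | inj₁ (s≤s l') = trans (cong (λ z → S f b + z + a) (h b l' ≤-refl))
  (trans (lin≡ 4 (λ x y a b → (x ⊕ a ≐ y ⊕ b) ∷ [] ⊢ x ⊕ con 1 ⊕ a ≐ y ⊕ (con 1 ⊕ b)) (S f b) (S f a) a b (S-ones f l' (λ k p q → h k p (≤-suc q)))) refl)

record Threshold (f : ℕ → ℕ) (lo hi : ℕ) : Set where
  field
    at : ℕ
    lo≤ : lo ≤ at
    ≤hi : at ≤ hi
    isZero : ∀ k → lo ≤ k → k < at → f k ≡ 0
    isOne : ∀ k → at ≤ k → k < hi → f k ≡ 1

threshold : ∀ f lo hi → lo ≤ hi → (∀ k → f k ≤ 1) → (∀ k → lo ≤ k → suc k < hi → f k ≤ f (suc k)) → Threshold f lo hi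
threshold f lo hi l z m with ≤-split l
... | inj₂ refl = record { at = lo ; lo≤ = ≤-refl ; ≤hi = ≤-refl ; isZero = λ k p q → ⊥-elim (<⇒≱ q p) ; isOne = λ k p q → ⊥-elim (<⇒≱ q p) }
threshold f lo (suc hi) l z m | inj₁ (s≤s l') with threshold f lo hi l' z (λ k p q → m k p (≤-suc q)) | bit (z hi)
... | t | inj₂ o = record { at = T.at ; lo≤ = T.lo≤ ; ≤hi = ≤-suc T.≤hi ; isZero = T.isZero ; isOne = go }
  where
  module T = Threshold t
  go : ∀ k → T.at ≤ k → k < suc hi → f k ≡ 1
  go k p (s≤s q) with ≤-split q
  ... | inj₁ q' = T.isOne k p q'
  ... | inj₂ refl = o
... | t | inj₁ o = record { at = suc hi ; lo≤ = ≤-suc l' ; ≤hi = ≤-refl ; isZero = go ; isOne = λ k p q → ⊥-elim (<⇒≱ q p) }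
  where
  down : ∀ h → lo ≤ h → h ≤ hi → f h ≡ 0 → ∀ k → lo ≤ k → k ≤ h → f k ≡ 0
  down h a b e k p q with ≤-split q
  ... | inj₂ refl = e
  down (suc h) a b e k p q | inj₁ (s≤s q') = down h (≤-trans p q') (<⇒≤ b) (n≤0⇒n≡0 (subst (f h ≤_) e (m h (≤-trans p q') (s≤s b)))) k p q'
  go : ∀ k → lo ≤ k → k < suc hi → f k ≡ 0
  go k p (s≤s q) = down hi l' ≤-refl o k p q

module WeakInterlace (w n : ℕ) (N K : Mat) (g : Good wk (suc w) n N) (c : ∀ j → 1 ≤ j → HC wk j N) (r : RHigh wk n N)
    (dh : DH wk w n K) (q : ∀ i → cs n K i ≡ cs n (tail N) i) where

  private
    z = proj₂ g
    zK = proj₂ (proj₁ dh)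

    Lam : ℕ → ℕ → ℕ
    Lam X k = S (tr N k) (suc X)

    -- The state after the columns `0 … X` of `N` and the first `X` columns of `K`. Rows from `t` on
    -- are full in `N`, rows in `[s , t)` lack one unit. The excess of `N` over `K` is one from `t`
    -- on and is marked by `B` below `m`. The last two fields say in advance what holds for a next
    -- column dominated by column `X`; they assume `1 ≤ X` because columns `0` and `1` are not
    -- compared.
    record Inv (X : ℕ) : Set where
      field
        s t m : ℕ
        s≤t : s ≤ t
        t≤n : t ≤ n
        m≤t : m ≤ t
        low : ∀ k → s ≤ k → k < t → Lam X k ≡ X
        high : ∀ k → t ≤ k → k < n → Lam X k ≡ suc X
        B : ℕ → ℕ
        eq : ∀ k → k < n → Lam X k ≡ S (tr K k) X + B k + th t k
        B01 : ∀ k → B k ≤ 1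
        B0 : ∀ k → m ≤ k → B k ≡ 0
        below : ∀ f → (1 ≤ X → ∀ k → S f (suc k) ≤ S (N X) (suc k)) → ∀ k → k < s → f k ≡ 0
        m≤s' : ∀ f s' → s' ≤ t → (1 ≤ X → ∀ k → S f (suc k) ≤ S (N X) (suc k)) → S f t + s' ≡ t → m ≤ s'

    dom : ∀ {f h : ℕ → ℕ} → (∀ k → S f (suc k) ≤ S h (suc k)) → ∀ k → S f k ≤ S h k
    dom p zero = z≤n
    dom p (suc k) = p k

    base : Inv 0
    base = record { s = 0 ; t = T.at ; m = 0 ; s≤t = z≤n ; t≤n = T.≤hi ; m≤t = z≤n
       ; low = λ k _ l → T.isZero k z≤n l ; high = λ k l l' → T.isOne k l l'
       ; B = λ _ → 0 ; eq = eq ; B01 = λ _ → z≤n ; B0 = λ _ _ → refl ; below = λ _ _ _ () ; m≤s' = λ _ _ _ _ _ → z≤n }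
      where
      T : Threshold (N 0) 0 n
      T = threshold (N 0) 0 n z≤n (z 0) (λ k _ l → r k l 0)
      module T = Threshold T
      eq : ∀ k → k < n → N 0 k ≡ th T.at k
      eq k l with k <? T.at
      ... | yes p = trans (T.isZero k z≤n p) (sym (th-no p))
      ... | no p = trans (T.isOne k (≮⇒≥ p) l) (sym (th-yes (≮⇒≥ p)))

    module Next (X : ℕ) (I : Inv X) where
      open Inv I
      f : ℕ → ℕ
      f = N (suc X)
      dm : 1 ≤ X → ∀ k → S f (suc k) ≤ S (N X) (suc k)
      dm l k = c X l k
      zf : ∀ k → k < s → f k ≡ 0
      zf = below f dm
      step : ∀ {L} k → suc k < n → Lam X k ≡ L → Lam X (suc k) ≡ L → f k ≤ f (suc k)
      step {L} k l p p' = +-cancelˡ-≤ L _ _ (subst₂ _≤_ (cong (_+ f k) p) (cong (_+ f (suc k)) p') (r k l (suc X)))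
      T₁ : Threshold f s t
      T₁ = threshold f s t s≤t (z (suc X)) (λ k p l → step k (≤-trans l t≤n) (low k p (<⇒≤ l)) (low (suc k) (≤-suc p) l))
      T₂ : Threshold f t n
      T₂ = threshold f t n t≤n (z (suc X)) (λ k p l → step k l (high k p (<⇒≤ l)) (high (suc k) (≤-suc p) l))
      module T₁ = Threshold T₁
      module T₂ = Threshold T₂
      s' = T₁.at
      t' = T₂.at
      -- The ones of `f` fill `[s' , t)` and `[t' , n)`. The threshold column of `K` with equally
      -- many ones starts at `s' + t' - t`.
      m' : ℕ
      m' = s' + (t' ∸ t)
      m'+t : m' + t ≡ s' + t'
      m'+t = trans (+-assoc s' _ t) (cong (s' +_) (m∸n+n≡m T₂.lo≤))
      zs : ∀ k → k < s' → f k ≡ 0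
      zs k l with k <? s
      ... | yes p = zf k p
      ... | no p = T₁.isZero k (≮⇒≥ p) l
      Ss' : S f s' ≡ 0
      Ss' = S-zero f s' zs
      St : S f t + s' ≡ t
      St = trans (S-ones f T₁.≤hi T₁.isOne) (cong (_+ t) Ss')
      St' : S f t' ≡ S f t
      St' = S-zeros f T₂.lo≤ T₂.isZero
      Sn : S f n + m' ≡ n
      Sn = lin≡ 8 (λ Sn St St' m' t' s' t n → (Sn ⊕ t' ≐ St' ⊕ n) ∷ (St' ≐ St) ∷ (St ⊕ s' ≐ t) ∷ (m' ⊕ t ≐ s' ⊕ t') ∷ [] ⊢ Sn ⊕ m' ≐ n)
          (S f n) (S f t) (S f t') m' t' s' t n (S-ones f T₂.≤hi T₂.isOne) St' St m'+t
      m≤s'' : m ≤ s'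
      m≤s'' = m≤s' f s' T₁.≤hi dm St
      m'≤t' : m' ≤ t'
      m'≤t' = lin 4 (λ m' t s' t' → (m' ⊕ t ≐ s' ⊕ t') ∷ (s' ≼ t) ∷ [] ⊢ m' ≼ t') m' t s' t' m'+t T₁.≤hi
      colK : ∀ k → k < n → K X k ≡ th m' k
      colK = threshold-unique n (zK X) (th-01 m') (Corner.top-justified w n K (proj₁ dh) (proj₁ (proj₂ dh)) (proj₂ (proj₂ dh)) X)
          mono (trans (q X) (+-cancelʳ-≡ m' _ _ (trans Sn (sym Sth))))
        where
        mono : ∀ k → suc k < n → th m' k ≤ th m' (suc k)
        mono k _ with m' ≤? k
        ... | yes p rewrite th-yes p | th-yes (≤-suc p) = ≤-refl
        ... | no p rewrite th-no (≰⇒> p) = z≤n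
        Sth : S (th m') n + m' ≡ n
        Sth = trans (S-ones (th m') (≤-trans m'≤t' T₂.≤hi) (λ k p _ → th-yes p)) (cong (_+ n) (S-zero (th m') m' (λ k l → th-no l)))
      -- The difference is the indicator of `[s' , m')`. As `m ≤ s'`, it lies above all rows marked
      -- before, so the values stay at most one.
      B' : ℕ → ℕ
      B' k = B k + (th s' k ∸ th m' k)
      s'≤m' : s' ≤ m'
      s'≤m' = m≤m+n s' _
      split : ∀ k → f k + th t k ≡ th s' k + th t' k → k < n → Lam (suc X) k ≡ S (tr K k) (suc X) + B' k + th t' k
      split k p l rewrite eq k l | colK k l =
        lin≡ 8 (λ M b tt f ts tm d tt' → (f ⊕ tt ≐ ts ⊕ tt') ∷ (ts ≐ d ⊕ tm) ∷ [] ⊢ M ⊕ b ⊕ tt ⊕ f ≐ M ⊕ tm ⊕ (b ⊕ d) ⊕ tt')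
          (S (tr K k) X) (B k) (th t k) (f k) (th s' k) (th m' k) (th s' k ∸ th m' k) (th t' k) p (sym (m∸n+n≡m thle))
        where
        thle : th m' k ≤ th s' k
        thle with m' ≤? k
        ... | yes u rewrite th-yes u | th-yes (≤-trans s'≤m' u) = ≤-refl
        ... | no u rewrite th-no (≰⇒> u) = z≤n
      cases : ∀ k → k < n → f k + th t k ≡ th s' k + th t' k
      cases k l with k <? s'
      ... | yes p rewrite zs k p | th-no (≤-trans p T₁.≤hi) | th-no p | th-no (≤-trans p (≤-trans T₁.≤hi T₂.lo≤)) = refl
      ... | no p with k <? t
      ... | yes p' rewrite T₁.isOne k (≮⇒≥ p) p' | th-no p' | th-yes (≮⇒≥ p) | th-no (≤-trans p' T₂.lo≤) = refl
      ... | no p' with k <? t'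
      ... | yes p'' rewrite T₂.isZero k (≮⇒≥ p') p'' | th-yes (≮⇒≥ p') | th-yes (≮⇒≥ p) | th-no p'' = refl
      ... | no p'' rewrite T₂.isOne k (≮⇒≥ p'') l | th-yes (≮⇒≥ p') | th-yes (≮⇒≥ p) | th-yes (≮⇒≥ p'') = refl
      next : Inv (suc X)
      next = record { s = s' ; t = t' ; m = m' ; s≤t = ≤-trans T₁.≤hi T₂.lo≤ ; t≤n = T₂.≤hi ; m≤t = m'≤t'
         ; low = low' ; high = high' ; B = B' ; eq = λ k l → split k (cases k l) l ; B01 = B01' ; B0 = B0'
         ; below = λ h d k l → n≤0⇒n≡0 (≤-trans (S-one h s' k l) (≤-trans (dom {h} {f} (d (s≤s z≤n)) s') (≡⇒≤ Ss')))
         ; m≤s' = λ h u u≤ d p → lin 8 (λ Sh Sf St t' u m' t s' → (Sh ≼ Sf) ∷ (Sh ⊕ u ≑ t') ∷ (Sf ≐ St) ∷ (St ⊕ s' ≐ t) ∷ (m' ⊕ t ≐ s' ⊕ t') ∷ [] ⊢ m' ≼ u)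
             (S h t') (S f t') (S f t) t' u m' t s' (dom {h} {f} (d (s≤s z≤n)) t') p St' St m'+t }
        where
        low' : ∀ k → s' ≤ k → k < t' → Lam (suc X) k ≡ suc X
        low' k p l with k <? t
        ... | yes u rewrite low k (≤-trans T₁.lo≤ p) u | T₁.isOne k p u = +-comm X 1
        ... | no u rewrite high k (≮⇒≥ u) (≤-trans l T₂.≤hi) | T₂.isZero k (≮⇒≥ u) l = cong suc (+-identityʳ X)
        high' : ∀ k → t' ≤ k → k < n → Lam (suc X) k ≡ suc (suc X)
        high' k p l rewrite high k (≤-trans T₂.lo≤ p) l | T₂.isOne k p l = cong suc (+-comm X 1)
        B01' : ∀ k → B' k ≤ 1
        B01' k with s' ≤? k
        ... | yes u rewrite B0 k (≤-trans m≤s'' u) = ≤-trans (m∸n≤m (th s' k) (th m' k)) (th-01 s' k)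
        ... | no u rewrite th-no (≰⇒> u) | 0∸n≡0 (th m' k) | +-identityʳ (B k) = B01 k
        B0' : ∀ k → m' ≤ k → B' k ≡ 0
        B0' k u rewrite B0 k (≤-trans m≤s'' (≤-trans s'≤m' u)) | th-yes u | th-yes (≤-trans s'≤m' u) = refl

    inv : ∀ X → Inv X
    inv zero = base
    inv (suc X) = Next.next X (inv X)

  interlace : Interlace wk n (rs (suc w) N) (rs w K)
  interlace k l = subst (rs w K k ≤_) (sym eq') (≤-trans (m≤m+n _ (B k)) (m≤m+n _ (th t k))) ,
      subst (_≤ suc (rs w K k)) (sym eq') (subst (S (tr K k) w + B k + th t k ≤_) (+-comm (rs w K k) 1)
         (≤-trans (≡⇒≤ (+-assoc (S (tr K k) w) (B k) (th t k))) (+-monoʳ-≤ (S (tr K k) w) one)))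
    where
    open Inv (inv w)
    eq' = eq k l
    one : B k + th t k ≤ 1
    one with t ≤? k
    ... | yes p rewrite B0 k (≤-trans m≤t p) = th-01 t k
    ... | no p rewrite th-no (≰⇒> p) | +-identityʳ (B k) = B01 k

-- Replacing the first column by a new last column

ext : ℕ → Mat → (ℕ → ℕ) → Mat
ext w H d i k with <-cmp i w
... | tri< _ _ _ = H i k
... | tri≈ _ _ _ = d k
... | tri> _ _ _ = 0

ext-< : ∀ {w} H d {i} → i < w → ∀ k → ext w H d i k ≡ H i k
ext-< {w} H d {i} l k with <-cmp i w
... | tri< _ _ _ = refl
... | tri≈ p _ _ = ⊥-elim (p l)
... | tri> p _ _ = ⊥-elim (p l)

ext-≡ : ∀ {w} H d k → ext w H d w k ≡ d k
ext-≡ {w} H d k with <-cmp w w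
... | tri< p _ _ = ⊥-elim (<-irrefl refl p)
... | tri≈ _ _ _ = refl
... | tri> _ _ p = ⊥-elim (<-irrefl refl p)

ext-> : ∀ {w} H d {i} → w < i → ∀ k → ext w H d i k ≡ 0
ext-> {w} H d {i} l k with <-cmp i w
... | tri< _ _ p = ⊥-elim (p l)
... | tri≈ _ _ p = ⊥-elim (p l)
... | tri> _ _ _ = refl

module Rotation (κ : Kind) (w n : ℕ) where

  module N = NF κ (suc w) n
  module N' = NF κ w n

  -- Kept as a relation because half a turn exchanges `x` and `y`: what is proved for given `x` then
  -- holds for given `y`.
  Rel : Mat → Mat → Set
  Rel x y = N.CZ x y × N'.RZ (tail x) (init w y)

  private
    interlace : ∀ κ {N K} → Good κ (suc w) n N → (∀ j → 1 ≤ j → HC κ j N) → RHigh κ n N → DH κ w n K →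
        (∀ i → cs n K i ≡ cs n (tail N) i) → Interlace κ n (rs (suc w) N) (rs w K)
    interlace st {N} {K} g c r dh q = StrictInterlace.interlace w n N K (proj₁ g) c r dh q
    interlace wk {N} {K} g c r dh q = WeakInterlace.interlace w n N K g c r dh q

    -- Column normalisation of the tail, with the first column fixed, changes neither the row sums
    -- of `H` nor those of the row normal form of its tail. This reduces the claim to the explicit
    -- matrices of `StrictInterlace` and `WeakInterlace`.
    high-interlace : ∀ {H K u} → N.G H → RHigh κ n H → N'.RPath u (tail H) K → RHigh κ n K → Interlace κ n (rs (suc w) H) (rs w K)
    high-interlace {H} {K} g hi p hiK =
      let (_ , M , path , hc) = nc κ 1 g
          z = N.C-path-Z (N.strip path)
          gM = N.CZ-G g z
          gt = tail-Good κ g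
          zt = CPath-tail κ path
          (K' , p' , zK) = N'.transport gt zt p
          gMt = tail-Good κ gM
          gK = N'.R-pathG gt p
          dh : DH κ w n K'
          dh = N'.R-pathG gMt p' , N'.CHigh-path gMt p' (λ j → hc (suc j) (s≤s z≤n)) , N'.RHigh-CZ gK zK hiK
          i = interlace κ gM hc (N.RHigh-CZ g z hi) dh (λ i → sym (N'.cs-path gMt p' i))
      in resp′ κ (N.rs-CZ g z) (N'.rs-CZ gK zK) i
      where
      resp′ : ∀ κ {a a' b b'} → (∀ k → a k ≡ a' k) → (∀ k → b k ≡ b' k) → Interlace κ n a' b' → Interlace κ n a b
      resp′ st p q i k l = subst₂ _≤_ (sym (q k)) (sym (p k)) (proj₁ (i k l)) , λ l' → subst₂ _≤_ (sym (p (suc k))) (sym (q k)) (proj₂ (i k l) l')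
      resp′ wk p q i k l = subst₂ _≤_ (sym (q k)) (sym (p k)) (proj₁ (i k l)) , subst₂ (λ x y → x ≤ suc y) (sym (p k)) (sym (q k)) (proj₂ (i k l))

  -- The new column is the strip between the row sums of `H` and `K`, so that `E` has the row sums
  -- of `H`. For `st` the interlacing makes `E` row-highest again; for `wk` it makes the new entries
  -- at most one, and highestness comes from `K` and from the row sums of `H`.
  module Extend (H K : Mat) (gH : N.G H) (gK : N'.G K) (hH : RHigh κ n H) (hK : RHigh κ n K)
      (int : Interlace κ n (rs (suc w) H) (rs w K)) where

    private
      d : ℕ → ℕ
      d k = rs (suc w) H k ∸ rs w K k

    E : Mat
    E = ext w K d

    private
      mu≤lam : ∀ κ → Interlace κ n (rs (suc w) H) (rs w K) → ∀ k → k < n → rs w K k ≤ rs (suc w) H k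
      mu≤lam st i k l = proj₁ (i k l)
      mu≤lam wk i k l = proj₁ (i k l)

      lam0 : ∀ k → n ≤ k → rs (suc w) H k ≡ 0
      lam0 k l = S-zero (tr H k) (suc w) (λ i _ → proj₁ gH i k (inj₂ l))

      prefix : ∀ k x → x ≤ w → S (tr E k) x ≡ S (tr K k) x
      prefix k x l = S-cong x (λ i m → ext-< K d (≤-trans m l) k)

      whole : ∀ k → k < n → S (tr E k) (suc w) ≡ rs (suc w) H k
      whole k l = trans (cong₂ _+_ (prefix k w ≤-refl) (ext-≡ {w} K d k)) (m+[n∸m]≡n (mu≤lam κ int k l))

      wh : ∀ k x → k < n → w ≤ x → S (tr E k) (suc x) ≡ rs (suc w) H k
      wh k x l m = trans (S-const (tr E k) (suc w) (λ i p → ext-> K d p k) (suc x) (s≤s m)) (whole k l)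

    rs-E : ∀ k → rs (suc w) E k ≡ rs (suc w) H k
    rs-E k with k <? n
    ... | yes l = whole k l
    ... | no l = trans (cong₂ _+_ (prefix k w ≤-refl) (ext-≡ {w} K d k))
        (trans (cong₂ _+_ (S-zero (tr K k) w (λ i _ → proj₁ gK i k (inj₂ (≮⇒≥ l)))) (trans (cong (_∸ rs w K k) (lam0 k (≮⇒≥ l))) (0∸n≡0 (rs w K k)))) (sym (lam0 k (≮⇒≥ l))))

    private
      win : Win (suc w) n E
      win i k (inj₁ l) = ext-> K d l k
      win i k (inj₂ l) with <-cmp i w
      ... | tri< _ _ _ = proj₁ gK i k (inj₂ l)
      ... | tri≈ _ _ _ = trans (cong (_∸ rs w K k) (lam0 k l)) (0∸n≡0 (rs w K k))
      ... | tri> _ _ _ = refl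

      adm : ∀ κ → Interlace κ n (rs (suc w) H) (rs w K) → Adm κ K → Adm κ E
      adm st _ _ = tt
      adm wk it z i k with <-cmp i w
      ... | tri< _ _ _ = z i k
      ... | tri> _ _ _ = z≤n
      ... | tri≈ _ _ _ with k <? n
      ... | yes l = m≤n+o⇒m∸n≤o (rs (suc w) H k) (rs w K k) (subst (rs (suc w) H k ≤_) (+-comm 1 (rs w K k)) (proj₂ (it k l)))
      ... | no l rewrite lam0 k (≮⇒≥ l) | 0∸n≡0 (rs w K k) = z≤n

    good : N.G E
    good = win , adm κ int (proj₂ gK)

    init-E : init w E ≈ K
    init-E i k with i <? w
    ... | yes l = ext-< K d l k
    ... | no l = sym (proj₁ gK i k (inj₁ (≮⇒≥ l)))

    high : RHigh κ n E
    high i l = go κ int hH hK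
      where
      go : ∀ κ → Interlace κ n (rs (suc w) H) (rs w K) → RHigh κ n H → RHigh κ n K → HR κ i E
      go st it _ hi x with suc x ≤? w
      ... | yes p = subst₂ _≤_ (sym (prefix (suc i) (suc x) p)) (sym (prefix i x (<⇒≤ p))) (hi i l x)
      ... | no p = ≤-trans (≡⇒≤ (wh (suc i) x l (≮⇒≥ p))) (≤-trans (proj₂ (it i (<⇒≤ l)) l)
          (≤-trans (≡⇒≤ (sym (prefix i w ≤-refl))) (S-mono (tr E i) (≮⇒≥ p))))
      go wk it hi' hi x with suc x ≤? w
      ... | yes p = subst₂ _≤_ (sym (prefix i (suc x) p)) (sym (prefix (suc i) (suc x) p)) (hi i l x)
      ... | no p = subst₂ _≤_ (sym (wh i x (<⇒≤ l) (≮⇒≥ p))) (sym (wh (suc i) x l (≮⇒≥ p))) (hi' i l w)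

  abstract
    -- For row-highest matrices the answer is `E`. The row path from `x` to its normal form `H` is
    -- carried back along the column zigzag from `H` to `E`, and its new source is `y`.
    rel-total : ∀ x → N.G x → ∃ λ y → N.G y × Rel x y
    rel-total x g =
      let (_ , H , p , hH) = nr κ g
          gH = N.R-pathG g p
          (_ , K , p' , hK) = nr κ (tail-Good κ gH)
          gK = N'.R-pathG (tail-Good κ gH) p'
          int = high-interlace gH hH p' hK
          module X = Extend H K gH gK hH hK int
          z = N.CZ-high gH X.good hH X.high (λ k → sym (X.rs-E k))
          (y , gy , q , z') = N.transport-back g z p
      in y , gy , z' , N'.RZ-trans (RPath-tail κ p) (N'.RZ-trans (N'.R-path-Z p')
           (N'.RZ-trans (done (≈-sym X.init-E)) (N'.RZ-sym (init-Good κ gy) (RPath-init κ q))))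

    private
      init-high : ∀ {E} → N.G E → RHigh κ n E → RHigh κ n (init w E)
      init-high {E} gE h i l x = go κ h
        where
        pre : ∀ k x → x ≤ w → S (tr (init w E) k) x ≡ S (tr E k) x
        pre k x m = S-cong x (λ i p → init-in E (≤-trans p m) k)
        post : ∀ k x → w ≤ x → S (tr (init w E) k) x ≡ S (tr E k) w
        post k x m = trans (S-const (tr (init w E) k) w (λ i p → init-out E p k) x m) (pre k w ≤-refl)
        go : ∀ κ → RHigh κ n E → closing κ (tr (init w E) (rowFrom κ i)) x ≤ opening κ (tr (init w E) (rowTo κ i)) x
        go st h with ≤-<-connex w x
        ... | inj₂ p = subst₂ _≤_ (sym (pre (suc i) (suc x) p)) (sym (pre i x (<⇒≤ p))) (h i l x)
        ... | inj₁ p = subst₂ _≤_ (sym (post (suc i) (suc x) (≤-suc p))) (sym (post i x p)) (end w)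
          where
          end : ∀ w → S (tr E (suc i)) w ≤ S (tr E i) w
          end zero = z≤n
          end (suc v) = ≤-trans (h i l v) (m≤m+n _ _)
        go wk h with ≤-<-connex w x
        ... | inj₂ p = subst₂ _≤_ (sym (pre i (suc x) p)) (sym (pre (suc i) (suc x) p)) (h i l x)
        ... | inj₁ p = subst₂ _≤_ (sym (post i (suc x) (≤-suc p))) (sym (post (suc i) (suc x) (≤-suc p))) (end w)
          where
          end : ∀ w → S (tr E i) w ≤ S (tr E (suc i)) w
          end zero = z≤n
          end (suc v) = h i l v

      last-column : ∀ {A B} → N.G A → N.G B → init w A ≈ init w B → (∀ k → rs (suc w) A k ≡ rs (suc w) B k) → A ≈ B
      last-column {A} {B} gA gB p q i k with <-cmp i w
      ... | tri< l _ _ = trans (sym (init-in A l k)) (trans (p i k) (init-in B l k))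
      ... | tri> _ _ l = trans (proj₁ gA i k (inj₁ l)) (sym (proj₁ gB i k (inj₁ l)))
      ... | tri≈ _ refl _ = +-cancelˡ-≡ (S (tr A k) w) _ _ (trans (q k) (cong (_+ B w k)
          (S-cong w (λ i l → trans (sym (init-in B l k)) (trans (sym (p i k)) (init-in A l k))))))

    -- The row normal forms of `y` and `y'` agree: without the last column they are row-highest in
    -- the same row class, and the row sums fix the last column. With the common column class this
    -- gives `y ≈ y'`.
    rel-unique : ∀ {x x' y y'} → N.G x → N.G x' → x ≈ x' → Rel x y → Rel x' y' → y ≈ y'
    rel-unique {x} {x'} {y} {y'} gx gx' e (z , t) (z' , t') =
      let gy  = N.CZ-G gx z
          gy' = N.CZ-G gx' z'
          yy' : N.CZ y y'
          yy' = N.CZ-trans (N.CZ-sym gx z) (N.CZ-trans (done e) z')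
          (_ , A , p , hA) = nr κ gy
          (_ , B , p' , hB) = nr κ gy'
          gA = N.R-pathG gy p
          gB = N.R-pathG gy' p'
          gi = init-Good κ gy
          gi' = init-Good κ gy'
          ii' : N'.RZ (init w y) (init w y')
          ii' = N'.RZ-trans (N'.RZ-sym (tail-Good κ gx) t) (N'.RZ-trans (done (tail-cong e)) t')
          iAB : N'.RZ (init w A) (init w B)
          iAB = N'.RZ-trans (N'.RZ-sym gi (RPath-init κ p)) (N'.RZ-trans ii' (RPath-init κ p'))
          eq = N'.RZ-high (init-Good κ gA) iAB (init-high gA hA) (init-high gB hB)
      in N.PQ-unique gy yy' p p' hA (last-column gA gB eq (N.rs-nr gy yy' p p' hA hB))

    private
      CZ-rot : ∀ {A B} → N.G A → N.CZ A B → N.CZ (rot (suc w) n B) (rot (suc w) n A)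
      CZ-rot g (done p) = done (rot-cong {suc w} {n} (≈-sym p))
      CZ-rot g (fwd c z) = N.CZ-trans (CZ-rot (C-Good κ g c) z) (fwd (C-rot κ g c) (done ≈-refl))
      CZ-rot g (bwd g' c z) = N.CZ-trans (CZ-rot g' z) (bwd (rot-Good κ g) (C-rot κ g' c) (done ≈-refl))

      RZ-rot : ∀ {A B} → N'.G A → N'.RZ A B → N'.RZ (rot w n B) (rot w n A)
      RZ-rot g (done p) = done (rot-cong {w} {n} (≈-sym p))
      RZ-rot g (fwd c z) = N'.RZ-trans (RZ-rot (R-Good κ g c) z) (fwd (R-rot κ g c) (done ≈-refl))
      RZ-rot g (bwd g' c z) = N'.RZ-trans (RZ-rot g' z) (bwd (rot-Good κ g) (R-rot κ g' c) (done ≈-refl))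

      tail-rot : ∀ y → rot w n (init w y) ≈ tail (rot (suc w) n y)
      tail-rot y = window {w} {n} (rot-Win (init w y)) (proj₁ (tail-Good st (rot-Win {suc w} {n} y , tt)))
        (λ i k p q → trans (rot-in (init w y) p q) (trans (init-in y (rv< p) (rv n k)) (sym (rot-in {suc w} {n} y (s≤s p) q))))

      init-rot : ∀ x → init w (rot (suc w) n x) ≈ rot w n (tail x)
      init-rot x = window {w} {n} (proj₁ (init-Good st (rot-Win {suc w} {n} x , tt))) (rot-Win (tail x))
        (λ i k p q → trans (init-in (rot (suc w) n x) p k) (trans (rot-in {suc w} {n} x (≤-suc p) q)
          (trans (cong (λ z → x z (rv n k)) (+-∸-assoc 1 p)) (sym (rot-in {w} {n} (tail x) p q)))))

    -- Half a turn sends the tail of a matrix to the initial part of the turned one and reverses all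
    -- edges; hence both conditions are exchanged with their mirror images.
    Rel-rot : ∀ {x y} → N.G x → Rel x y → Rel (rot (suc w) n y) (rot (suc w) n x)
    Rel-rot {x} {y} g (z , t) = CZ-rot g z ,
      N'.RZ-trans (done (≈-sym (tail-rot y))) (N'.RZ-trans (RZ-rot (tail-Good κ g) t) (done (≈-sym (init-rot x))))

    rel-total' : ∀ y → N.G y → ∃ λ x → N.G x × Rel x y
    rel-total' y g =
      let (x , gx , z , t) = rel-total (rot (suc w) n y) (rot-Good κ g)
          (z' , t') = Rel-rot (rot-Good κ g) (z , t)
          rr = rot-rot {suc w} {n} (proj₁ g)
      in rot (suc w) n x , rot-Good κ gx , N.CZ-trans z' (done rr) , N'.RZ-trans t' (done (init-cong {w} rr))

    rel-unique' : ∀ {x x' y y'} → N.G x → N.G x' → y ≈ y' → Rel x y → Rel x' y' → x ≈ x'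
    rel-unique' {x} {x'} {y} {y'} gx gx' e r r' =
      ≈-trans (≈-sym (rot-rot {suc w} {n} (proj₁ gx))) (≈-trans (rot-cong {suc w} {n}
        (rel-unique (rot-Good κ (N.CZ-G gx (proj₁ r))) (rot-Good κ (N.CZ-G gx' (proj₁ r'))) (rot-cong {suc w} {n} e) (Rel-rot gx r) (Rel-rot gx' r')))
        (rot-rot {suc w} {n} (proj₁ gx')))

  Rel-resp : ∀ {x x' y y'} → N.G x' → x ≈ x' → y ≈ y' → Rel x y → Rel x' y'
  Rel-resp g p q (z , t) = N.CZ-trans (done (≈-sym p)) (N.CZ-trans z (done q)) ,
    N'.RZ-trans (done (tail-cong (≈-sym p))) (N'.RZ-trans t (done (init-cong {w} q)))

-- Families of chains as unordered lists of cells

cnt : Pos → List Pos → ℕ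
cnt c [] = 0
cnt c (x ∷ xs) = δ c (proj₁ x) (proj₂ x) + cnt c xs

cntF : Pos → List (List Pos) → ℕ
cntF c [] = 0
cntF c (xs ∷ xss) = cnt c xs + cntF c xss

size : List (List Pos) → ℕ
size [] = 0
size (xs ∷ xss) = length xs + size xss

δ-refl : ∀ c → δ c (proj₁ c) (proj₂ c) ≡ 1
δ-refl (a , b) rewrite e-refl a | e-refl b = refl

δ-≢ : ∀ c x → c ≢ x → δ c (proj₁ x) (proj₂ x) ≡ 0
δ-≢ (a , b) (a' , b') neq with a ≟ a'
... | no p rewrite e-≢ a a' p = refl
... | yes refl with b ≟ b'
... | no p rewrite e-≢ b b' p = *-zeroʳ (e a a)
... | yes refl = ⊥-elim (neq refl)

_≟ₚ_ : (c d : Pos) → Dec (c ≡ d)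
(a , b) ≟ₚ (a' , b') with a ≟ a' | b ≟ b'
... | yes refl | yes refl = yes refl
... | no p | _ = no (λ { refl → p refl })
... | _ | no p = no (λ { refl → p refl })

cnt-∈ : ∀ {c xs} → c ∈ xs → 0 < cnt c xs
cnt-∈ {c} (here refl) rewrite δ-refl c = s≤s z≤n
cnt-∈ (there p) = ≤-trans (cnt-∈ p) (m≤n+m _ _)

cnt-∉ : ∀ c xs → (∀ {x} → x ∈ xs → c ≢ x) → cnt c xs ≡ 0
cnt-∉ c [] h = refl
cnt-∉ c (x ∷ xs) h rewrite δ-≢ c x (h (here refl)) = cnt-∉ c xs (h ∘ there)

∈-cnt : ∀ c xs → 0 < cnt c xs → c ∈ xs
∈-cnt c (x ∷ xs) p with c ≟ₚ x
... | yes refl = here refl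
... | no neq rewrite δ-≢ c x neq = there (∈-cnt c xs p)

cnt-++ : ∀ c xs ys → cnt c (xs ++ ys) ≡ cnt c xs + cnt c ys
cnt-++ c [] ys = refl
cnt-++ c (x ∷ xs) ys rewrite cnt-++ c xs ys = sym (+-assoc (δ c (proj₁ x) (proj₂ x)) _ _)

data Pick {A : Set} (x : A) : List A → List A → Set where
  here : ∀ {xs} → Pick x (x ∷ xs) xs
  there : ∀ {y xs ys} → Pick x xs ys → Pick x (y ∷ xs) (y ∷ ys)

pick : ∀ {A : Set} {x : A} {xs} → x ∈ xs → ∃ (Pick x xs)
pick (here refl) = _ , here
pick (there p) = _ , there (proj₂ (pick p))

module _ {A : Set} {x : A} where

  pick-length : ∀ {xs ys} → Pick x xs ys → length xs ≡ suc (length ys)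
  pick-length here = refl
  pick-length (there p) = cong suc (pick-length p)

  pick-All : ∀ {P : A → Set} {xs ys} → Pick x xs ys → All P xs → P x × All P ys
  pick-All here (p ∷ ps) = p , ps
  pick-All (there q) (p ∷ ps) = proj₁ (pick-All q ps) , p ∷ proj₂ (pick-All q ps)

  pick-∈ : ∀ {xs ys y} → Pick x xs ys → y ∈ ys → y ∈ xs
  pick-∈ here i = there i
  pick-∈ (there p) (here refl) = here refl
  pick-∈ (there p) (there i) = there (pick-∈ p i)

  pick-other : ∀ {xs ys y} → Pick x xs ys → y ∈ xs → y ≡ x ⊎ y ∈ ys
  pick-other here (here p) = inj₁ p
  pick-other here (there i) = inj₂ i
  pick-other (there q) (here p) = inj₂ (here p)
  pick-other (there q) (there i) with pick-other q i
  ... | inj₁ p = inj₁ p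
  ... | inj₂ j = inj₂ (there j)

  pick-AllPairs : ∀ {R : A → A → Set} → (∀ {a b} → R a b → R b a) → ∀ {xs ys} → Pick x xs ys → AllPairs R xs → AllPairs R (x ∷ ys)
  pick-AllPairs s here h = h
  pick-AllPairs s (there p) (h ∷ hs) with pick-AllPairs s p hs | pick-All p h
  ... | q ∷ qs | r , rs = (s r ∷ q) ∷ rs ∷ qs

pick-cnt : ∀ {x xs ys} → Pick x xs ys → ∀ c → cnt c xs ≡ δ c (proj₁ x) (proj₂ x) + cnt c ys
pick-cnt here c = refl
pick-cnt {x} (there {y} p) c rewrite pick-cnt p c =
  lin≡ 3 (λ a b d → [] ⊢ a ⊕ (b ⊕ d) ≐ b ⊕ (a ⊕ d)) (δ c (proj₁ y) (proj₂ y)) (δ c (proj₁ x) (proj₂ x)) _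

pick-cntF : ∀ {x xs ys} → Pick x xs ys → ∀ c → cntF c xs ≡ cnt c x + cntF c ys
pick-cntF here c = refl
pick-cntF {x} (there {y} p) c rewrite pick-cntF p c =
  lin≡ 3 (λ a b d → [] ⊢ a ⊕ (b ⊕ d) ≐ b ⊕ (a ⊕ d)) (cnt c y) (cnt c x) _

pick-size : ∀ {x xs ys} → Pick x xs ys → size xs ≡ length x + size ys
pick-size here = refl
pick-size {x} (there {y} p) rewrite pick-size p =
  lin≡ 3 (λ a b d → [] ⊢ a ⊕ (b ⊕ d) ≐ b ⊕ (a ⊕ d)) (length y) (length x) _

module _ {P : Pos → Set} (P? : Decidable P) where

  cnt-filter : ∀ c xs → cnt c (filter P? xs) + cnt c (filter (¬? ∘ P?) xs) ≡ cnt c xs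
  cnt-filter c [] = refl
  cnt-filter c (x ∷ xs) with does (P? x)
  ... | true = trans (+-assoc (δ c (proj₁ x) (proj₂ x)) _ _) (cong (δ c (proj₁ x) (proj₂ x) +_) (cnt-filter c xs))
  ... | false = trans (lin≡ 3 (λ a b d → [] ⊢ a ⊕ (b ⊕ d) ≐ b ⊕ (a ⊕ d)) (cnt c (filter P? xs)) (δ c (proj₁ x) (proj₂ x)) (cnt c (filter (¬? ∘ P?) xs)))
      (cong (δ c (proj₁ x) (proj₂ x) +_) (cnt-filter c xs))

  length-filter± : ∀ xs → length (filter P? xs) + length (filter (¬? ∘ P?) xs) ≡ length xs
  length-filter± [] = refl
  length-filter± (x ∷ xs) with does (P? x)
  ... | true = cong suc (length-filter± xs)
  ... | false = trans (+-suc _ _) (cong suc (length-filter± xs))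

AllPairs-++ : ∀ {R : Pos → Pos → Set} {xs ys} → AllPairs R xs → AllPairs R ys → All (λ x → All (R x) ys) xs → AllPairs R (xs ++ ys)
AllPairs-++ = AllPairsP.++⁺

-- Pairwise comparable units can be sorted into a chain, so no order is recorded. Exchanging the
-- tails of two chains then amounts to filtering.
Valid : (Pos → Pos → Set) → (Pos → ℕ) → List (List Pos) → Set
Valid R F fam = All (AllPairs R) fam × (∀ c → cntF c fam ≤ F c)

Better : (Pos → Pos → Set) → (Pos → ℕ) → (k s : ℕ) → Set
Better R F k s = ∃ λ fam → length fam ≡ k × Valid R F fam × s ≤ size fam

sumL : ∀ {A : Set} → (A → ℕ) → List A → ℕ
sumL f [] = 0
sumL f (x ∷ xs) = f x + sumL f xs

sumL-mono : ∀ {A : Set} {f g : A → ℕ} xs → (∀ {x} → x ∈ xs → f x ≤ g x) → sumL f xs ≤ sumL g xs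
sumL-mono [] h = z≤n
sumL-mono (x ∷ xs) h = +-mono-≤ (h (here refl)) (sumL-mono xs (h ∘ there))

sumL-+ : ∀ {A : Set} (f g : A → ℕ) xs → sumL (λ x → f x + g x) xs ≡ sumL f xs + sumL g xs
sumL-+ f g [] = refl
sumL-+ f g (x ∷ xs) rewrite sumL-+ f g xs = lin≡ 4 (λ a b c d → [] ⊢ (a ⊕ b) ⊕ (c ⊕ d) ≐ (a ⊕ c) ⊕ (b ⊕ d)) (f x) (g x) (sumL f xs) (sumL g xs)

sumL-0 : ∀ {A : Set} {f : A → ℕ} xs → (∀ {x} → x ∈ xs → f x ≡ 0) → sumL f xs ≡ 0
sumL-0 [] h = refl
sumL-0 (x ∷ xs) h = cong₂ _+_ (h (here refl)) (sumL-0 xs (h ∘ there))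

sumL-∈ : ∀ {A : Set} (f : A → ℕ) {xs x} → x ∈ xs → f x ≤ sumL f xs
sumL-∈ f (here refl) = m≤m+n _ _
sumL-∈ f (there p) = ≤-trans (sumL-∈ f p) (m≤n+m _ _)

sumL-< : ∀ {A : Set} (f g : A → ℕ) xs → sumL f xs < sumL g xs → ∃ λ x → x ∈ xs × f x < g x
sumL-< f g (x ∷ xs) l with f x <? g x
... | yes p = x , here refl , p
... | no p with sumL-< f g xs (lin 4 (λ a b c d → (con 1 ⊕ (a ⊕ c) ≼ b ⊕ d) ∷ (b ≼ a) ∷ [] ⊢ con 1 ⊕ c ≼ d) (f x) (g x) (sumL f xs) (sumL g xs) l (≮⇒≥ p))
... | y , i , q = y , there i , q

sumL-cntF : ∀ {A : Set} (h : A → Pos) xs fam → sumL (λ x → cntF (h x) fam) xs ≡ sumL (λ c → sumL (λ x → cnt (h x) c) xs) fam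
sumL-cntF h xs [] = sumL-0 xs (λ _ → refl)
sumL-cntF h xs (c ∷ fam) = trans (sumL-+ (λ x → cnt (h x) c) (λ x → cntF (h x) fam) xs) (cong (λ v → _ + v) (sumL-cntF h xs fam))

-- Orders with a direction and a strictness

data Dir : Set where
  up dn : Dir

_<[_]_ _≤[_]_ : ℕ → Dir → ℕ → Set
a <[ up ] b = a < b
a <[ dn ] b = b < a
a ≤[ up ] b = a ≤ b
a ≤[ dn ] b = b ≤ a

rel : Bool → Dir → ℕ → ℕ → Set
rel true d a b = a <[ d ] b
rel false d a b = a ≤[ d ] b

neg? : Bool → Bool
neg? true = false
neg? false = true

module Oriented (d : Dir) where

  ≤-tr : ∀ {a b c} → a ≤[ d ] b → b ≤[ d ] c → a ≤[ d ] c
  ≤-tr = go d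
    where
    go : ∀ d {a b c} → a ≤[ d ] b → b ≤[ d ] c → a ≤[ d ] c
    go up p q = ≤-trans p q
    go dn p q = ≤-trans q p

  ≤<-tr : ∀ {a b c} → a ≤[ d ] b → b <[ d ] c → a <[ d ] c
  ≤<-tr = go d
    where
    go : ∀ d {a b c} → a ≤[ d ] b → b <[ d ] c → a <[ d ] c
    go up p q = ≤-trans (s≤s p) q
    go dn p q = ≤-trans q p

  <≤-tr : ∀ {a b c} → a <[ d ] b → b ≤[ d ] c → a <[ d ] c
  <≤-tr = go d
    where
    go : ∀ d {a b c} → a <[ d ] b → b ≤[ d ] c → a <[ d ] c
    go up p q = ≤-trans p q
    go dn p q = ≤-trans (s≤s q) p

  <⇒≤' : ∀ {a b} → a <[ d ] b → a ≤[ d ] b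
  <⇒≤' = go d
    where
    go : ∀ d {a b} → a <[ d ] b → a ≤[ d ] b
    go up p = <⇒≤ p
    go dn p = <⇒≤ p

  ≤-rf : ∀ {a b} → a ≡ b → a ≤[ d ] b
  ≤-rf = go d
    where
    go : ∀ d {a b} → a ≡ b → a ≤[ d ] b
    go up refl = ≤-refl
    go dn refl = ≤-refl

  irr : ∀ {a b} → a <[ d ] b → b ≤[ d ] a → ⊥
  irr = go d
    where
    go : ∀ d {a b} → a <[ d ] b → b ≤[ d ] a → ⊥
    go up p q = <⇒≱ p q
    go dn p q = <⇒≱ p q

  tot : ∀ a b → a ≤[ d ] b ⊎ b <[ d ] a
  tot = go d
    where
    go : ∀ d a b → a ≤[ d ] b ⊎ b <[ d ] a
    go up a b = ≤-<-connex a b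
    go dn a b = ≤-<-connex b a

  ≤≢⇒< : ∀ {a b} → a ≤[ d ] b → a ≢ b → a <[ d ] b
  ≤≢⇒< = go d
    where
    go : ∀ d {a b} → a ≤[ d ] b → a ≢ b → a <[ d ] b
    go up p q = ≤∧≢⇒< p q
    go dn p q = ≤∧≢⇒< p (q ∘ sym)

  <⇒≢' : ∀ {a b} → a <[ d ] b → a ≢ b
  <⇒≢' p refl = irr p (≤-rf refl)

  ≤? : ∀ a b → Dec (a ≤[ d ] b)
  ≤? a b with tot a b
  ... | inj₁ p = yes p
  ... | inj₂ p = no (irr p)

  -- The relation of chains, strict or weak, and its complement.
  module Strictness (s : Bool) where

    _≺_ _◁_ : ℕ → ℕ → Set
    _≺_ = rel s d
    _◁_ = rel (neg? s) d

    ≺⇒≤ : ∀ {a b} → a ≺ b → a ≤[ d ] b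
    ≺⇒≤ = go s
      where
      go : ∀ s {a b} → rel s d a b → a ≤[ d ] b
      go true p = <⇒≤' p
      go false p = p

    <⇒≺ : ∀ {a b} → a <[ d ] b → a ≺ b
    <⇒≺ = go s
      where
      go : ∀ s {a b} → a <[ d ] b → rel s d a b
      go true p = p
      go false p = <⇒≤' p

    ≤≺ : ∀ {a b c} → a ≤[ d ] b → b ≺ c → a ≺ c
    ≤≺ = go s
      where
      go : ∀ s {a b c} → a ≤[ d ] b → rel s d b c → rel s d a c
      go true p q = ≤<-tr p q
      go false p q = ≤-tr p q

    ≺≤ : ∀ {a b c} → a ≺ b → b ≤[ d ] c → a ≺ c
    ≺≤ = go s
      where
      go : ∀ s {a b c} → rel s d a b → b ≤[ d ] c → rel s d a c
      go true p q = <≤-tr p q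
      go false p q = ≤-tr p q

    ≺≺ : ∀ {a b c} → a ≺ b → b ≺ c → a ≺ c
    ≺≺ p q = ≺≤ p (≺⇒≤ q)

    ◁⇒≤ : ∀ {a b} → a ◁ b → a ≤[ d ] b
    ◁⇒≤ = go s
      where
      go : ∀ s {a b} → rel (neg? s) d a b → a ≤[ d ] b
      go true p = p
      go false p = <⇒≤' p

    ≺or◁ : ∀ a b → a ≺ b ⊎ b ◁ a
    ≺or◁ = go s
      where
      go : ∀ s a b → rel s d a b ⊎ rel (neg? s) d b a
      go false a b = tot a b
      go true a b with tot b a
      ... | inj₁ p = inj₂ p
      ... | inj₂ p = inj₁ p

    ≺◁ : ∀ {a b} → a ≺ b → b ◁ a → ⊥
    ≺◁ = go s
      where
      go : ∀ s {a b} → rel s d a b → rel (neg? s) d b a → ⊥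
      go true p q = irr p q
      go false p q = irr q p

    ≺◁< : ∀ {a b c} → a ≺ b → b ◁ c → a <[ d ] c
    ≺◁< = go s
      where
      go : ∀ s {a b c} → rel s d a b → rel (neg? s) d b c → a <[ d ] c
      go true p q = <≤-tr p q
      go false p q = ≤<-tr p q

    ◁<< : ∀ {a b c} → a ◁ b → b <[ d ] c → a <[ d ] c
    ◁<< p q = ≤<-tr (◁⇒≤ p) q

    ≺? : ∀ a b → Dec (a ≺ b)
    ≺? a b with ≺or◁ a b
    ... | inj₁ p = yes p
    ... | inj₂ p = no (λ q → ≺◁ q p)

    ◁? : ∀ a b → Dec (a ◁ b)
    ◁? a b with ≺or◁ b a
    ... | inj₁ p = no (λ q → ≺◁ p q)
    ... | inj₂ p = yes p

-- Rerouting families of chains when a unit crosses to the adjacent line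

δ-sym : ∀ c x → δ c (proj₁ x) (proj₂ x) ≡ δ x (proj₁ c) (proj₂ c)
δ-sym c x with c ≟ₚ x
... | yes refl = refl
... | no neq = trans (δ-≢ c x neq) (sym (δ-≢ x c (neq ∘ sym)))

-- Coordinates in which a unit crosses from the line B to the adjacent line A.
record Setting : Set where
  field
    d : Dir
    sc sp : Bool
    cr po : Pos → ℕ
    cell : ℕ → ℕ → Pos
    cr-cell : ∀ a p → cr (cell a p) ≡ a
    po-cell : ∀ a p → po (cell a p) ≡ p
    cell-η : ∀ c → cell (cr c) (po c) ≡ c
    A B y : ℕ
    A<B : A <[ d ] B
    adj : ∀ x → x ≤[ d ] A ⊎ B ≤[ d ] x
    -- The filling without the moving unit, which is at `cell B y` before and at `cell A y` after
    -- the move.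
    G : Pos → ℕ
    rank : ℕ → ℕ

  Before Cmp : Pos → Pos → Set
  Before c e = rel sc d (cr c) (cr e) × rel sp d (po c) (po e)
  Cmp c e = Before c e ⊎ Before e c

  Cmp-sym : ∀ {c e} → Cmp c e → Cmp e c
  Cmp-sym (inj₁ p) = inj₂ p
  Cmp-sym (inj₂ p) = inj₁ p

  Crossed : Pos → ℕ
  Crossed c = G c + δ (cell A y) (proj₁ c) (proj₂ c)

-- A chain strict in the crossing direction meets each line at most once. The chain through `u` may
-- use `cell A y` instead unless it already has a unit `a` on `A`. In that case the bracket of `a`
-- offers enough units on `B` between `a` and `u`: either one is free, or some other chain uses one
-- of them and no unit of `A` in the bracket. Exchanging left parts with that chain moves the
-- conflict further away.
module RerouteStrict (T : Setting) (scT : Setting.sc T ≡ true) where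

  open Setting T

  open Oriented d
  open Strictness sp

  record Bracket (z : ℕ) : Set where
    field
      rsA rsB : List ℕ
      inB : ∀ {s} → s ∈ rsB → z ≺ s × s ≤[ d ] y
      covA : ∀ x → z ≤[ d ] x → x ≺ y → x ∈ rsA
      uniqueB : Unique rsB
      sums : sumL (λ x → G (cell A x)) rsA ≤ sumL (λ s → G (cell B s)) rsB

  private
    Before' : Pos → Pos → Set
    Before' c e = cr c <[ d ] cr e × po c ≺ po e

    to : ∀ {c e} → Before' c e → Before c e
    to {c} {e} (p , q) = subst (λ s → rel s d (cr c) (cr e)) (sym scT) p , q

    from : ∀ {c e} → Before c e → Before' c e
    from {c} {e} (p , q) = subst (λ s → rel s d (cr c) (cr e)) scT p , q

    before : ∀ {c e} → cr c <[ d ] cr e → Cmp c e → Before' c e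
    before l (inj₁ p) = from p
    before l (inj₂ p) = ⊥-elim (irr l (<⇒≤' (proj₁ (from p))))

    cr≢ : ∀ {c e} → Cmp c e → cr c ≢ cr e
    cr≢ (inj₁ p) = <⇒≢' (proj₁ (from p))
    cr≢ (inj₂ p) q = <⇒≢' (proj₁ (from p)) (sym q)

    left? : Decidable (λ c → cr c ≤[ d ] A)
    left? c = ≤? (cr c) A

    right : ∀ {c} → ¬ (cr c ≤[ d ] A) → B ≤[ d ] cr c
    right {c} p with adj (cr c)
    ... | inj₁ q = ⊥-elim (p q)
    ... | inj₂ q = q

    u : Pos
    u = cell B y

  module _ (br : ∀ z → z ≺ y → 0 < G (cell A z) → Bracket z)
      (rank< : ∀ {x z} → x <[ d ] z → 0 < G (cell A x) → 0 < G (cell A z) → rank x < rank z) where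

    private
      Goal : List Pos → List (List Pos) → Set
      Goal C rest = Better Cmp Crossed (suc (length rest)) (suc (length C) + size rest)

      V : List Pos → List (List Pos) → Pos → ℕ
      V C rest c = cnt c C + cntF c rest

    -- `C` is the chain through `u` with `u` left out. The induction is on a bound for the `rank` of
    -- its unit on `A`, which drops with each exchange.
    go : ∀ n C rest → (∀ {a} → a ∈ C → cr a ≡ A → rank (po a) < n) → AllPairs Cmp (u ∷ C) → All (AllPairs Cmp) rest →
        (∀ c → V C rest c ≤ G c) → Goal C rest
    go n C rest fuel (hu ∷ hC) hr use with any? (λ c → cr c ≟ A) C
    ... | no none = (cell A y ∷ C) ∷ rest , refl , ((All.tabulate ok ∷ hC) ∷ hr , le) , ≤-refl
      where
      ok : ∀ {c} → c ∈ C → Cmp (cell A y) c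
      ok {c} i with adj (cr c) | All.lookup hu i
      ... | inj₁ l | q = inj₂ (to (subst (cr c <[ d ]_) (sym (cr-cell A y)) (≤≢⇒< l (λ p → none (Any.map (λ { refl → p }) i))) ,
          subst (po c ≺_) (trans (po-cell B y) (sym (po-cell A y))) (proj₂ (before (subst (cr c <[ d ]_) (sym (cr-cell B y)) (≤<-tr l A<B)) (Cmp-sym q)))))
      ... | inj₂ l | q = inj₁ (to (subst (_<[ d ] cr c) (sym (cr-cell A y)) (<≤-tr A<B l) ,
          subst (_≺ po c) (trans (po-cell B y) (sym (po-cell A y))) (proj₂ (before (subst (_<[ d ] cr c) (sym (cr-cell B y)) (≤≢⇒< l (λ p → cr≢ q (trans (cr-cell B y) p)))) q))))
      le : ∀ c → cntF c ((cell A y ∷ C) ∷ rest) ≤ Crossed c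
      le c rewrite δ-sym c (cell A y) = subst₂ _≤_ (trans (+-comm (V C rest c) _) (sym (+-assoc (δ (cell A y) (proj₁ c) (proj₂ c)) _ _))) refl (+-monoˡ-≤ _ (use c))
    go n C rest fuel (hu ∷ hC) hr use | yes hasA with Any.satisfied hasA | pick-of hasA
      where
      pick-of : ∀ {xs} → Any (λ c → cr c ≡ A) xs → ∃₂ λ a ys → Pick a xs ys × a ∈ xs × cr a ≡ A
      pick-of (here p) = _ , _ , here , here refl , p
      pick-of (there p) with pick-of p
      ... | a , ys , q , i , e = a , _ , there q , there i , e
    ... | _ | a , C⁼ , pk , a∈ , cra = finish n fuel
      where
      z = po a
      a≡ : a ≡ cell A z
      a≡ = trans (sym (cell-η a)) (cong (λ x → cell x z) cra)
      hu⁼ : Cmp u a × All (Cmp u) C⁼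
      hu⁼ = pick-All pk hu
      ha : All (Cmp a) C⁼ × AllPairs Cmp C⁼
      ha with pick-AllPairs Cmp-sym pk hC
      ... | p ∷ q = p , q
      z≺y : z ≺ y
      z≺y = subst (z ≺_) (po-cell B y) (proj₂ (before (subst₂ _<[ d ]_ (sym cra) (sym (cr-cell B y)) A<B) (Cmp-sym (proj₁ hu⁼))))
      GA : 0 < G (cell A z)
      GA = ≤-trans (≤-trans (cnt-∈ (subst (_∈ C) a≡ a∈)) (m≤m+n _ _)) (use (cell A z))
      open Bracket (br z z≺y GA)
      splitL : ∀ {c} → c ∈ C⁼ → cr c ≤[ d ] A → Before' c a
      splitL {c} i l = before (≤≢⇒< (subst (cr c ≤[ d ]_) (sym cra) l) (λ p → cr≢ (All.lookup (proj₁ ha) i) (sym p))) (Cmp-sym (All.lookup (proj₁ ha) i))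
      splitR : ∀ {c} → c ∈ C⁼ → B ≤[ d ] cr c → B <[ d ] cr c × y ≺ po c
      splitR {c} i l = proj₁ q' , proj₂ q'
        where
        q = before (≤≢⇒< (subst (_≤[ d ] cr c) (sym (cr-cell B y)) l) (λ p → cr≢ (All.lookup (proj₂ hu⁼) i) p)) (All.lookup (proj₂ hu⁼) i)
        q' = subst₂ (λ x w → x <[ d ] cr c × w ≺ po c) (cr-cell B y) (po-cell B y) q
      finish : ∀ n → (∀ {a} → a ∈ C → cr a ≡ A → rank (po a) < n) → Goal C rest
      finish zero fuel with fuel a∈ cra
      ... | ()
      finish (suc n) fuel with any? (λ s → V C rest (cell B s) <? G (cell B s)) rsB
      -- A free unit of `B` inside the bracket is used in place of `u`, and the chain keeps `a`.
      ... | yes free = let (s , s∈ , lt) = find free in viaFree s s∈ lt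
        where
        find : ∀ {xs} → Any (λ s → V C rest (cell B s) < G (cell B s)) xs → ∃ λ s → s ∈ xs × V C rest (cell B s) < G (cell B s)
        find (here p) = _ , here refl , p
        find (there p) = let (s , i , q) = find p in s , there i , q
        viaFree : ∀ s → s ∈ rsB → V C rest (cell B s) < G (cell B s) → Goal C rest
        viaFree s s∈ lt = (cell B s ∷ a ∷ C⁼) ∷ rest , refl ,
            (((inj₂ (to (subst₂ _<[ d ]_ (sym cra) (sym (cr-cell B s)) A<B , subst (z ≺_) (sym (po-cell B s)) (proj₁ (inB s∈)))) ∷ All.tabulate ok) ∷ proj₁ ha ∷ proj₂ ha) ∷ hr , le) ,
            ≡⇒≤ (cong (λ x → suc x + size rest) (pick-length pk))
          where
          ok : ∀ {c} → c ∈ C⁼ → Cmp (cell B s) c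
          ok {c} i with adj (cr c)
          ... | inj₁ l = inj₂ (to (subst (cr c <[ d ]_) (sym (cr-cell B s)) (≤<-tr l A<B) ,
              subst (po c ≺_) (sym (po-cell B s)) (≺≺ (proj₂ (splitL i l)) (proj₁ (inB s∈)))))
          ... | inj₂ l = inj₁ (to (subst (_<[ d ] cr c) (sym (cr-cell B s)) (proj₁ (splitR i l)) ,
              subst (_≺ po c) (sym (po-cell B s)) (≤≺ (proj₂ (inB s∈)) (proj₂ (splitR i l)))))
          le : ∀ c → cntF c ((cell B s ∷ a ∷ C⁼) ∷ rest) ≤ Crossed c
          le c with cell B s ≟ₚ c
          ... | yes refl rewrite δ-refl (cell B s) | sym (pick-cnt pk (cell B s)) = ≤-trans lt (m≤m+n _ _)
          ... | no neq rewrite δ-≢ c (cell B s) (neq ∘ sym) | sym (pick-cnt pk c) = ≤-trans (use c) (m≤m+n _ _)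
      -- All units of the bracket on `B` are in use, none of them by `C`, while `C` uses `a` on `A`.
      -- By counting, some other chain has more of its units in the `B` part than in the `A` part.
      ... | no full = let (D , D∈ , lt) = sumL-< (λ c → sumL (λ x → cnt (cell A x) c) rsA) (λ c → sumL (λ s → cnt (cell B s) c) rsB) rest less' in viaD D D∈ lt
        where
        noB : ∀ s → cnt (cell B s) C ≡ 0
        noB s = cnt-∉ (cell B s) C (λ i p → cr≢ (All.lookup hu i) (trans (cr-cell B y) (sym (trans (cong cr (sym p)) (cr-cell B s)))))
        hasz : 1 ≤ sumL (λ x → cnt (cell A x) C) rsA
        hasz = ≤-trans (cnt-∈ (subst (_∈ C) a≡ a∈)) (sumL-∈ (λ x → cnt (cell A x) C) (covA z (≤-rf refl) z≺y))
        less' : sumL (λ c → sumL (λ x → cnt (cell A x) c) rsA) rest < sumL (λ c → sumL (λ s → cnt (cell B s) c) rsB) rest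
        less' = lin 6 (λ f fr g gr GA GB → (con 1 ≼ f) ∷ (g ≐ con 0) ∷ (f ⊕ fr ≼ GA) ∷ (GA ≼ GB) ∷ (GB ≼ g ⊕ gr) ∷ [] ⊢ con 1 ⊕ fr ≼ gr)
          (sumL (λ x → cnt (cell A x) C) rsA) (sumL (λ c → sumL (λ x → cnt (cell A x) c) rsA) rest)
          (sumL (λ s → cnt (cell B s) C) rsB) (sumL (λ c → sumL (λ s → cnt (cell B s) c) rsB) rest)
          (sumL (λ x → G (cell A x)) rsA) (sumL (λ s → G (cell B s)) rsB)
          hasz (sumL-0 rsB (λ {s} _ → noB s))
          (subst (_≤ sumL (λ x → G (cell A x)) rsA) (sumL-cntF (cell A) rsA (C ∷ rest)) (sumL-mono rsA (λ {x} _ → use (cell A x))))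
          sums
          (subst (sumL (λ s → G (cell B s)) rsB ≤_) (sumL-cntF (cell B) rsB (C ∷ rest)) (sumL-mono rsB (λ {s} i → ≮⇒≥ (λ l → full (Any.map (λ { refl → l }) i)))))
        viaD : ∀ D → D ∈ rest → sumL (λ x → cnt (cell A x) D) rsA < sumL (λ s → cnt (cell B s) D) rsB → Goal C rest
        viaD D D∈ lt = let (s , s∈ , q) = positive rsB (≤-trans (s≤s z≤n) lt) in viaB s s∈ (∈-cnt (cell B s) D q)
          where
          positive : ∀ {f : ℕ → ℕ} xs → 0 < sumL f xs → ∃ λ s → s ∈ xs × 0 < f s
          positive {f} (x ∷ xs) p with f x in eq
          ... | suc _ = x , here refl , subst (0 <_) (sym eq) (s≤s z≤n)
          ... | zero = let (s , i , q) = positive xs p in s , there i , q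
          hD : AllPairs Cmp D
          hD = All.lookup hr D∈
          viaB : ∀ s → s ∈ rsB → cell B s ∈ D → Goal C rest
          viaB s s∈ b∈ = subst₂ (Better Cmp Crossed) len siz (go n C' rest' fuel' hC' hrest' use')
            where
            b = cell B s
            D⁻ = proj₁ (pick b∈)
            pkD : Pick b D D⁻
            pkD = proj₂ (pick b∈)
            rest⁻ = proj₁ (pick D∈)
            pkR : Pick D rest rest⁻
            pkR = proj₂ (pick D∈)
            hb : All (Cmp b) D⁻ × AllPairs Cmp D⁻
            hb with pick-AllPairs Cmp-sym pkD hD
            ... | p ∷ q = p , q
            dL : ∀ {c} → c ∈ D⁻ → cr c ≤[ d ] A → po c ≺ s
            dL {c} i l = subst (po c ≺_) (po-cell B s) (proj₂ (before (subst (cr c <[ d ]_) (sym (cr-cell B s)) (≤<-tr l A<B)) (Cmp-sym (All.lookup (proj₁ hb) i))))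
            dR : ∀ {c} → c ∈ D⁻ → B ≤[ d ] cr c → B <[ d ] cr c × s ≺ po c
            dR {c} i l = subst₂ (λ x w → x <[ d ] cr c × w ≺ po c) (cr-cell B s) (po-cell B s)
              (before (≤≢⇒< (subst (_≤[ d ] cr c) (sym (cr-cell B s)) l) (λ p → cr≢ (All.lookup (proj₁ hb) i) p)) (All.lookup (proj₁ hb) i))
            L R' : List Pos → List Pos
            L xs = filter left? xs
            R' xs = filter (¬? ∘ left?) xs
            inL : ∀ {c} xs → c ∈ L xs → c ∈ xs × cr c ≤[ d ] A
            inL xs i = ∈-filter⁻ left? {xs = xs} i
            inR : ∀ {c} xs → c ∈ R' xs → c ∈ xs × B ≤[ d ] cr c
            inR {c} xs i = let (j , p) = ∈-filter⁻ (¬? ∘ left?) {xs = xs} i in j , right {c} p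
            -- The unit `u` stays with the left part of `D`; the units `a` and `b` join the left
            -- part of `C` with the right part of `D`.
            C' = L D⁻ ++ R' C⁼
            D' = a ∷ b ∷ L C⁼ ++ R' D⁻
            rest' = D' ∷ rest⁻
            hC' : AllPairs Cmp (u ∷ C')
            hC' = AllP.++⁺ (All.tabulate (λ {c} i → let (j , l) = inL D⁻ i in
                        inj₂ (to (subst (cr c <[ d ]_) (sym (cr-cell B y)) (≤<-tr l A<B) , subst (po c ≺_) (sym (po-cell B y)) (≺≤ (dL j l) (proj₂ (inB s∈)))))))
                      (All.tabulate (λ i → All.lookup (proj₂ hu⁼) (proj₁ (inR C⁼ i))))
                  ∷ AllPairs-++ (AllPairsP.filter⁺ left? (proj₂ hb)) (AllPairsP.filter⁺ (¬? ∘ left?) (proj₂ ha))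
                      (All.tabulate (λ {c} i → All.tabulate (λ {c'} i' → let (j , l) = inL D⁻ i ; (j' , l') = inR C⁼ i' in
                        inj₁ (to (≤<-tr l (<≤-tr A<B l') , ≺≺ (≺≤ (dL j l) (proj₂ (inB s∈))) (proj₂ (splitR j' l')))))))
            hD' : AllPairs Cmp D'
            hD' = (inj₁ (to (subst₂ _<[ d ]_ (sym cra) (sym (cr-cell B s)) A<B , subst (z ≺_) (sym (po-cell B s)) (proj₁ (inB s∈))))
                ∷ AllP.++⁺ (All.tabulate (λ i → All.lookup (proj₁ ha) (proj₁ (inL C⁼ i))))
                    (All.tabulate (λ {c} i → let (j , l) = inR D⁻ i in
                      inj₁ (to (subst (_<[ d ] cr c) (sym cra) (<≤-tr A<B l) , ≺≺ (proj₁ (inB s∈)) (proj₂ (dR j l)))))))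
                  ∷ AllP.++⁺ (All.tabulate (λ {c} i → let (j , l) = inL C⁼ i in
                          inj₂ (to (subst (cr c <[ d ]_) (sym (cr-cell B s)) (≤<-tr l A<B) , subst (po c ≺_) (sym (po-cell B s)) (≺≺ (proj₂ (splitL j l)) (proj₁ (inB s∈)))))))
                        (All.tabulate (λ i → All.lookup (proj₁ hb) (proj₁ (inR D⁻ i))))
                  ∷ AllPairs-++ (AllPairsP.filter⁺ left? (proj₂ ha)) (AllPairsP.filter⁺ (¬? ∘ left?) (proj₂ hb))
                      (All.tabulate (λ {c} i → All.tabulate (λ {c'} i' → let (j , l) = inL C⁼ i ; (j' , l') = inR D⁻ i' in
                        inj₁ (to (≤<-tr l (<≤-tr A<B l') , ≺≺ (≺≺ (proj₂ (splitL j l)) (proj₁ (inB s∈))) (proj₂ (dR j' l')))))))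
            hrest' : All (AllPairs Cmp) rest'
            hrest' = hD' ∷ proj₂ (pick-All pkR hr)
            same : ∀ c → V C' rest' c ≡ V C rest c
            same c rewrite cnt-++ c (L D⁻) (R' C⁼) | cnt-++ c (L C⁼) (R' D⁻) | pick-cntF pkR c | pick-cnt pkD c | pick-cnt pk c
                | sym (cnt-filter left? c D⁻) | sym (cnt-filter left? c C⁼) =
              lin≡ 7 (λ a b p q r s w → [] ⊢ p ⊕ s ⊕ ((a ⊕ (b ⊕ (r ⊕ q))) ⊕ w) ≐ a ⊕ (r ⊕ s) ⊕ ((b ⊕ (p ⊕ q)) ⊕ w))
                (δ c (proj₁ a) (proj₂ a)) (δ c (proj₁ b) (proj₂ b)) (cnt c (L D⁻)) (cnt c (R' D⁻)) (cnt c (L C⁼)) (cnt c (R' C⁼)) (cntF c rest⁻)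
            use' : ∀ c → V C' rest' c ≤ G c
            use' c = subst (_≤ G c) (sym (same c)) (use c)
            len : suc (length rest') ≡ suc (length rest)
            len = cong suc (sym (pick-length pkR))
            siz : suc (length C') + size rest' ≡ suc (length C) + size rest
            siz rewrite length-++ (L D⁻) {R' C⁼} | length-++ (L C⁼) {R' D⁻} | pick-size pkR | pick-length pkD | pick-length pk
                | sym (length-filter± left? D⁻) | sym (length-filter± left? C⁼) =
              lin≡ 5 (λ p q r s w → [] ⊢ con 1 ⊕ (p ⊕ s) ⊕ (con 2 ⊕ (r ⊕ q) ⊕ w) ≐ con 2 ⊕ (r ⊕ s) ⊕ ((con 1 ⊕ (p ⊕ q)) ⊕ w))
                (length (L D⁻)) (length (R' D⁻)) (length (L C⁼)) (length (R' C⁼)) (size rest⁻)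
            noA : sumL (λ x → cnt (cell A x) D) rsA ≡ 0
            noA = n<1⇒n≡0 (≤-trans lt one)
              where
              δsum : ∀ {xs} → Unique xs → sumL (λ s' → δ (cell B s') (proj₁ b) (proj₂ b)) xs ≤ 1
              δsum [] = z≤n
              δsum {x ∷ xs} (p ∷ q) with x ≟ s
              ... | yes refl = subst (λ w → w + sumL (λ s' → δ (cell B s') (proj₁ b) (proj₂ b)) xs ≤ 1) (sym (δ-refl b))
                  (s≤s (≡⇒≤ (sumL-0 xs (λ {s'} i → δ-≢ (cell B s') b (λ e → All.lookup p i (trans (sym (po-cell B x)) (trans (sym (cong po e)) (po-cell B s'))))))))
              ... | no neq = subst (λ w → w + sumL (λ s' → δ (cell B s') (proj₁ b) (proj₂ b)) xs ≤ 1)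
                  (sym (δ-≢ (cell B x) b (λ e → neq (trans (sym (po-cell B x)) (trans (cong po e) (po-cell B s)))))) (δsum q)
              one : sumL (λ s' → cnt (cell B s') D) rsB ≤ 1
              one = ≤-trans (sumL-mono rsB (λ {s'} _ → ≡⇒≤ (trans (pick-cnt pkD (cell B s')) (trans (cong (δ (cell B s') (proj₁ b) (proj₂ b) +_)
                  (cnt-∉ (cell B s') D⁻ (λ {x} i e → cr≢ (All.lookup (proj₁ hb) i) (trans (cr-cell B s) (trans (sym (cr-cell B s')) (cong cr e)))))) (+-identityʳ _)))))
                    (δsum uniqueB)
            fuel' : ∀ {a'} → a' ∈ C' → cr a' ≡ A → rank (po a') < n
            fuel' {a'} i e with ∈-++⁻ (L D⁻) i
            ... | inj₂ j = ⊥-elim (irr A<B (subst (B ≤[ d ]_) e (proj₂ (inR C⁼ j))))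
            ... | inj₁ j = ≤-trans (rank< below' GA' GA) (≤-pred (fuel a∈ cra))
              where
              j' = inL D⁻ j
              a'∈D = pick-∈ pkD (proj₁ j')
              a'≡ : a' ≡ cell A (po a')
              a'≡ = trans (sym (cell-η a')) (cong (λ x → cell x (po a')) e)
              GA' : 0 < G (cell A (po a'))
              GA' = ≤-trans (≤-trans (cnt-∈ (subst (_∈ D) a'≡ a'∈D)) (≤-trans (≤-trans (m≤m+n _ _) (≡⇒≤ (sym (pick-cntF pkR (cell A (po a')))))) (m≤n+m _ _))) (use (cell A (po a')))
              below' : po a' <[ d ] z
              -- A unit of `D` on `A` from `z` on would lie in `rsA`, where `D` has none; so the new
              -- conflict lies before `z`.
              below' with tot z (po a')
              ... | inj₂ q = q
              ... | inj₁ q = ⊥-elim (<-irrefl (sym noA) (≤-trans (cnt-∈ (subst (_∈ D) a'≡ a'∈D))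
                  (sumL-∈ (λ x → cnt (cell A x) D) (covA (po a') q (≺≤ (dL (proj₁ j') (proj₂ j')) (proj₂ (inB s∈)))))))

-- A weak chain may have several units on one line. Those on `B` that do not fit together with `v`
-- are the obstacle; let `z` be the position of the first. If no other chain uses the units of `A`
-- between `z` and `y`, these replace the bad units, and the bracket says that there are enough.
-- Otherwise a chain `D` using one of them either accepts `v` itself or exchanges tails with `C`.
module RerouteWeak (T : Setting) (scF : Setting.sc T ≡ false)
    (zeroA : Setting.sp T ≡ true → Setting.G T (Setting.cell T (Setting.A T) (Setting.y T)) ≡ 0)
    (oneA : Setting.sp T ≡ true → ∀ x → Setting.G T (Setting.cell T (Setting.A T) x) ≤ 1) where

  open Setting T

  open Oriented d
  open Strictness sp

  record Bracket (z : ℕ) : Set where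
    field
      rsA rsB : List ℕ
      inA : ∀ {x} → x ∈ rsA → z ◁ x × x ≤[ d ] y
      covB : ∀ s → z ≤[ d ] s → s ◁ y → s ∈ rsB
      uniqueA : Unique rsA
      sums : sumL (λ s → G (cell B s)) rsB ≤ sumL (λ x → G (cell A x)) rsA

  private
    Before' : Pos → Pos → Set
    Before' c e = cr c ≤[ d ] cr e × po c ≺ po e

    to : ∀ {c e} → Before' c e → Before c e
    to {c} {e} (p , q) = subst (λ s → rel s d (cr c) (cr e)) (sym scF) p , q

    from : ∀ {c e} → Before c e → Before' c e
    from {c} {e} (p , q) = subst (λ s → rel s d (cr c) (cr e)) scF p , q

    before : ∀ {c e} → cr c <[ d ] cr e → Cmp c e → Before' c e
    before l (inj₁ p) = from p
    before l (inj₂ p) = ⊥-elim (irr l (proj₁ (from p)))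

    left? : Decidable (λ c → cr c ≤[ d ] A)
    left? c = ≤? (cr c) A

    right : ∀ {c} → ¬ (cr c ≤[ d ] A) → B ≤[ d ] cr c
    right {c} p with adj (cr c)
    ... | inj₁ q = ⊥-elim (p q)
    ... | inj₂ q = q

    -- The cells of `B` that are not comparable with `v`: they lie beyond `A` in the crossing
    -- direction, but their position does not follow `y`.
    Low : Pos → Set
    Low c = cr c ≡ B × po c ◁ y

    low? : Decidable Low
    low? c = (cr c ≟ B) ×-dec ◁? (po c) y

    u v : Pos
    u = cell B y
    v = cell A y

    before? : ∀ c e → Dec (Before c e)
    before? c e with ≤? (cr c) (cr e) | ≺? (po c) (po e)
    ... | yes p | yes q = yes (to (p , q))
    ... | no p | _ = no (λ b → p (proj₁ (from b)))
    ... | yes _ | no q = no (λ b → q (proj₂ b))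

    cmp? : ∀ c e → Dec (Cmp c e)
    cmp? c e = before? c e ⊎-dec before? e c

    minimal : ∀ {xs} → Any Low xs → ∃ λ b → b ∈ xs × Low b × (∀ {c} → c ∈ xs → Low c → po b ≤[ d ] po c)
    minimal {x ∷ xs} a with any? low? xs
    minimal {x ∷ xs} (there a) | no n = ⊥-elim (n a)
    minimal {x ∷ xs} (here p) | no n = x , here refl , p ,
      λ { (here refl) _ → ≤-rf refl ; (there i) q → ⊥-elim (n (Any.map (λ { refl → q }) i)) }
    minimal {x ∷ xs} a | yes a' with minimal a' | low? x
    ... | b , i , p , m | no ¬p = b , there i , p , λ { (here refl) q → ⊥-elim (¬p q) ; (there j) q → m j q }
    ... | b , i , p , m | yes px with tot (po x) (po b)
    ... | inj₁ l = x , here refl , px , λ { (here refl) _ → ≤-rf refl ; (there j) q → ≤-tr l (m j q) }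
    ... | inj₂ l = b , there i , p , λ { (here refl) _ → <⇒≤' l ; (there j) q → m j q }

    rep : (ℕ → ℕ) → List ℕ → List Pos
    rep g [] = []
    rep g (x ∷ xs) = replicate (g x) (cell A x) ++ rep g xs

    rep-∈ : ∀ g xs {c} → c ∈ rep g xs → ∃ λ x → x ∈ xs × c ≡ cell A x × 0 < g x
    rep-∈ g (x ∷ xs) i with ∈-++⁻ (replicate (g x) (cell A x)) i
    ... | inj₂ j = let (x' , k , p) = rep-∈ g xs j in x' , there k , p
    ... | inj₁ j = x , here refl , replicate-∈ (g x) j
      where
      replicate-∈ : ∀ k {c e : Pos} → c ∈ replicate k e → c ≡ e × 0 < k
      replicate-∈ (suc k) (here p) = p , s≤s z≤n
      replicate-∈ (suc k) (there j) = proj₁ (replicate-∈ k j) , s≤s z≤n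

    length-rep : ∀ g xs → length (rep g xs) ≡ sumL g xs
    length-rep g [] = refl
    length-rep g (x ∷ xs) = trans (length-++ (replicate (g x) (cell A x))) (cong₂ _+_ (length-replicate (g x)) (length-rep g xs))

    cnt-replicate : ∀ k c → cnt c (replicate k c) ≡ k
    cnt-replicate zero c = refl
    cnt-replicate (suc k) c rewrite δ-refl c = cong suc (cnt-replicate k c)

    cnt-rep : ∀ g xs → Unique xs → ∀ x → cnt (cell A x) (rep g xs) ≤ g x
    cnt-rep g [] _ x = z≤n
    cnt-rep g (x' ∷ xs) (p ∷ q) x rewrite cnt-++ (cell A x) (replicate (g x') (cell A x')) (rep g xs) with x ≟ x'
    ... | yes refl = ≡⇒≤ (trans (cong₂ _+_ (cnt-replicate (g x) (cell A x))
        (cnt-∉ (cell A x) (rep g xs) (λ i e → let (x'' , j , e' , _) = rep-∈ g xs i in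
           All.lookup p j (trans (sym (po-cell A x)) (trans (cong po (trans e e')) (po-cell A x'')))))) (+-identityʳ _))
    ... | no neq = ≤-trans (≡⇒≤ (cong (_+ cnt (cell A x) (rep g xs))
        (cnt-∉ (cell A x) (replicate (g x') (cell A x')) (λ i e → neq (trans (sym (po-cell A x)) (trans (cong po (trans e (rep-eq (g x') i))) (po-cell A x'))))))) (cnt-rep g xs q x)
      where
      rep-eq : ∀ k {c e : Pos} → c ∈ replicate k e → c ≡ e
      rep-eq (suc k) (here p) = p
      rep-eq (suc k) (there j) = rep-eq k j

    column-cmp : ∀ {x x'} → x ≢ x' → Cmp (cell A x) (cell A x')
    column-cmp {x} {x'} neq with tot x x'
    ... | inj₁ l = inj₁ (to (≤-rf (trans (cr-cell A x) (sym (cr-cell A x'))) , <⇒≺ (subst₂ _<[ d ]_ (sym (po-cell A x)) (sym (po-cell A x')) (≤≢⇒< l neq))))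
    ... | inj₂ l = inj₂ (to (≤-rf (trans (cr-cell A x') (sym (cr-cell A x))) , <⇒≺ (subst₂ _<[ d ]_ (sym (po-cell A x')) (sym (po-cell A x)) l)))

    spCase : sp ≡ true ⊎ sp ≡ false
    spCase = go sp
      where
      go : ∀ s → s ≡ true ⊎ s ≡ false
      go true = inj₁ refl
      go false = inj₂ refl

    self-cmp : sp ≡ false → ∀ c → Cmp c c
    self-cmp q c = inj₁ (to (≤-rf refl , subst (λ s → rel s d (po c) (po c)) (sym q) (≤-rf refl)))

    rep-AllPairs : ∀ xs → Unique xs → AllPairs Cmp (rep (λ x → G (cell A x)) xs)
    rep-AllPairs [] _ = []
    rep-AllPairs (x ∷ xs) (p ∷ q) = AllPairs-++ (same (G (cell A x)) (λ e → oneA e x)) (rep-AllPairs xs q)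
        (All.tabulate (λ i → All.tabulate (λ j → let (x' , k , e' , _) = rep-∈ _ xs j in
          subst₂ Cmp (sym (rep-eq (G (cell A x)) i)) (sym e') (column-cmp (All.lookup p k)))))
      where
      rep-eq : ∀ k {c e : Pos} → c ∈ replicate k e → c ≡ e
      rep-eq (suc k) (here p) = p
      rep-eq (suc k) (there j) = rep-eq k j
      short : ∀ k → k ≤ 1 → AllPairs Cmp (replicate k (cell A x))
      short zero _ = []
      short (suc _) (s≤s z≤n) = [] ∷ []
      long : ∀ k → sp ≡ false → AllPairs Cmp (replicate k (cell A x))
      long zero eq = []
      long (suc k) eq = All.tabulate (λ i → subst (Cmp (cell A x)) (sym (rep-eq k i)) (self-cmp eq (cell A x))) ∷ long k eq
      same : ∀ k → (sp ≡ true → k ≤ 1) → AllPairs Cmp (replicate k (cell A x))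
      same k h with spCase
      ... | inj₁ eq = short k (h eq)
      ... | inj₂ eq = long k eq

  module _ (br : ∀ z → z ◁ y → 0 < G (cell B z) → Bracket z)
      (rank< : ∀ {z s} → z <[ d ] s → 0 < G (cell B z) → 0 < G (cell B s) → rank s < rank z) where

    private
      Goal : List Pos → List (List Pos) → Set
      Goal C rest = Better Cmp Crossed (suc (length rest)) (suc (length C) + size rest)

      V : List Pos → List (List Pos) → Pos → ℕ
      V C rest c = cnt c C + cntF c rest

      leftOf : ∀ {c} → Cmp u c → cr c ≤[ d ] A → po c ≺ y
      leftOf {c} q l = subst (po c ≺_) (po-cell B y) (proj₂ (before (subst (cr c <[ d ]_) (sym (cr-cell B y)) (≤<-tr l A<B)) (Cmp-sym q)))

      rightOf : ∀ {c} → Cmp u c → B ≤[ d ] cr c → ¬ Low c → y ≺ po c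
      rightOf {c} q l nl with cr c ≟ B
      ... | no neq = subst (_≺ po c) (po-cell B y) (proj₂ (before (subst (_<[ d ] cr c) (sym (cr-cell B y)) (≤≢⇒< l (neq ∘ sym))) q))
      ... | yes p with ≺or◁ y (po c)
      ... | inj₁ w = w
      ... | inj₂ w = ⊥-elim (nl (p , w))

      vCmp : ∀ {c} → Cmp u c → ¬ Low c → Cmp v c
      vCmp {c} q nl with adj (cr c)
      ... | inj₁ l = inj₂ (to (subst (cr c ≤[ d ]_) (sym (cr-cell A y)) l , subst (po c ≺_) (sym (po-cell A y)) (leftOf q l)))
      ... | inj₂ l = inj₁ (to (subst (_≤[ d ] cr c) (sym (cr-cell A y)) (≤-tr (<⇒≤' A<B) l) , subst (_≺ po c) (sym (po-cell A y)) (rightOf q l nl)))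

    go : ∀ n C rest → (∀ {c} → c ∈ C → Low c → rank (po c) < n) → AllPairs Cmp (u ∷ C) → All (AllPairs Cmp) rest →
        (∀ c → V C rest c ≤ G c) → Goal C rest
    go n C rest fuel (hu ∷ hC) hr use with any? low? C
    ... | no none = (v ∷ C) ∷ rest , refl , ((All.tabulate (λ i → vCmp (All.lookup hu i) (λ p → none (Any.map (λ { refl → p }) i))) ∷ hC) ∷ hr , le) , ≤-refl
      where
      le : ∀ c → cntF c ((v ∷ C) ∷ rest) ≤ Crossed c
      le c rewrite δ-sym c v = subst₂ _≤_ (trans (+-comm (V C rest c) _) (sym (+-assoc (δ v (proj₁ c) (proj₂ c)) _ _))) refl (+-monoˡ-≤ _ (use c))
    ... | yes hasLow = let (b , b∈ , lb , mn) = minimal hasLow in atMin b b∈ lb mn n fuel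
      where
      atMin : ∀ b → b ∈ C → Low b → (∀ {c} → c ∈ C → Low c → po b ≤[ d ] po c) → ∀ n → (∀ {c} → c ∈ C → Low c → rank (po c) < n) → Goal C rest
      atMin b b∈ lb mn zero fuel with fuel b∈ lb
      ... | ()
      atMin b b∈ (crb , zy) mn (suc n) fuel = search
        where
        z = po b
        b≡ : b ≡ cell B z
        b≡ = trans (sym (cell-η b)) (cong (λ x → cell x z) crb)
        GB : 0 < G (cell B z)
        GB = ≤-trans (≤-trans (cnt-∈ (subst (_∈ C) b≡ b∈)) (m≤m+n _ _)) (use (cell B z))
        open Bracket (br z zy GB)
        C⁼ = proj₁ (pick b∈)
        pk : Pick b C C⁼
        pk = proj₂ (pick b∈)
        hb : All (Cmp b) C⁼ × AllPairs Cmp C⁼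
        hb with pick-AllPairs Cmp-sym pk hC
        ... | p ∷ q = p , q
        ∈C : ∀ {c} → c ∈ C → c ≡ b ⊎ c ∈ C⁼
        ∈C i = pick-other pk i
        leftC : ∀ {c} → c ∈ C → cr c ≤[ d ] A → po c ≺ z
        leftC {c} i l with ∈C i
        ... | inj₁ refl = ⊥-elim (irr A<B (subst (_≤[ d ] A) crb l))
        ... | inj₂ j = proj₂ (before (subst (cr c <[ d ]_) (sym crb) (≤<-tr l A<B)) (Cmp-sym (All.lookup (proj₁ hb) j)))
        Mid : Pos → Set
        Mid c = cr c ≡ A × z ◁ po c × po c ≤[ d ] y
        mid? : Decidable Mid
        mid? c = (cr c ≟ A) ×-dec (◁? z (po c) ×-dec ≤? (po c) y)

        module None (none : ∀ {D c} → D ∈ rest → c ∈ D → ¬ Mid c) where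
          keep new : List Pos
          keep = filter (¬? ∘ low?) C
          new = rep (λ x → G (cell A x)) rsA
          inK : ∀ {c} → c ∈ keep → c ∈ C × ¬ Low c
          inK i = ∈-filter⁻ (¬? ∘ low?) {xs = C} i
          new-pos : ∀ {c} → c ∈ new → ∃ λ x → c ≡ cell A x × z ◁ x × x ≤[ d ] y × 0 < G (cell A x)
          new-pos i = let (x , j , e , g) = rep-∈ _ rsA i in x , e , proj₁ (inA j) , proj₂ (inA j) , g
          keep-new : ∀ {c c'} → c ∈ keep → c' ∈ new → Cmp c c'
          keep-new {c} {c'} i i' with new-pos i' | adj (cr c) | inK i
          ... | x , refl , zx , xy , _ | inj₁ l | j , nl = inj₁ (to (subst (cr c ≤[ d ]_) (sym (cr-cell A x)) l , subst (po c ≺_) (sym (po-cell A x)) (≺≤ (leftC j l) (◁⇒≤ zx))))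
          ... | x , refl , zx , xy , _ | inj₂ l | j , nl = inj₂ (to (subst (_≤[ d ] cr c) (sym (cr-cell A x)) (≤-tr (<⇒≤' A<B) l) ,
                 subst (_≺ po c) (sym (po-cell A x)) (≤≺ xy (rightOf (All.lookup hu j) l nl))))
          v-new : ∀ {c} → c ∈ new → Cmp v c
          v-new {c} i with new-pos i
          ... | x , refl , zx , xy , g with y ≟ x
          ... | no neq = column-cmp neq
          ... | yes refl with spCase
          ... | inj₁ eq = ⊥-elim (<⇒≢ g (sym (zeroA eq)))
          ... | inj₂ eq = self-cmp eq v
          chain : AllPairs Cmp (v ∷ keep ++ new)
          chain = AllP.++⁺ (All.tabulate (λ i → vCmp (All.lookup hu (proj₁ (inK i))) (proj₂ (inK i)))) (All.tabulate v-new)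
              ∷ AllPairs-++ (AllPairsP.filter⁺ (¬? ∘ low?) hC) (rep-AllPairs rsA uniqueA) (All.tabulate (λ i → All.tabulate (keep-new i)))
          cntF-0 : ∀ c fam → (∀ {D} → D ∈ fam → cnt c D ≡ 0) → cntF c fam ≡ 0
          cntF-0 c [] h = refl
          cntF-0 c (x ∷ fam) h = cong₂ _+_ (h (here refl)) (cntF-0 c fam (h ∘ there))
          cnt-keep : ∀ c → cnt c keep ≤ cnt c C
          cnt-keep c = ≤-trans (m≤n+m _ _) (≡⇒≤ (cnt-filter low? c C))
          body : ∀ c → cnt c (keep ++ new) + cntF c rest ≤ G c
          body c rewrite cnt-++ c keep new with cnt c new in eq
          ... | zero rewrite +-identityʳ (cnt c keep) = ≤-trans (+-monoˡ-≤ _ (cnt-keep c)) (use c)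
          ... | suc m with new-pos (∈-cnt c new (subst (0 <_) (sym eq) (s≤s z≤n)))
          ... | x , refl , zx , xy , g = ≤-trans (≡⇒≤ (trans (cong₂ _+_ (cong (_+ suc m) k0) r0) (+-identityʳ _)))
              (subst (_≤ G (cell A x)) eq (cnt-rep _ rsA uniqueA x))
            where
            mid : Mid (cell A x)
            mid = cr-cell A x , subst (z ◁_) (sym (po-cell A x)) zx , subst (_≤[ d ] y) (sym (po-cell A x)) xy
            k0 : cnt (cell A x) keep ≡ 0
            k0 = cnt-∉ (cell A x) keep (λ { i refl → ≺◁ (leftC (proj₁ (inK i)) (≤-rf (cr-cell A x))) (proj₁ (proj₂ mid)) })
            r0 : cntF (cell A x) rest ≡ 0
            r0 = cntF-0 (cell A x) rest (λ {D} i → cnt-∉ (cell A x) D (λ { j refl → none i j mid }))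
          le : ∀ c → cntF c ((v ∷ keep ++ new) ∷ rest) ≤ Crossed c
          le c rewrite δ-sym c v = subst₂ _≤_ (trans (+-comm (cnt c (keep ++ new) + cntF c rest) _) (sym (+-assoc (δ v (proj₁ c) (proj₂ c)) _ _))) refl (+-monoˡ-≤ _ (body c))
          lows : List Pos
          lows = filter low? C
          count-lows : ∀ xs → (∀ {c} → c ∈ xs → c ∈ C × Low c) → length xs ≤ sumL (λ s → cnt (cell B s) xs) rsB
          count-lows [] h = z≤n
          count-lows (x ∷ xs) h = ≤-trans (+-mono-≤ one (count-lows xs (h ∘ there)))
              (≡⇒≤ (sym (sumL-+ (λ s → δ (cell B s) (proj₁ x) (proj₂ x)) (λ s → cnt (cell B s) xs) rsB)))
            where
            lx = h (here refl)
            x≡ : cell B (po x) ≡ x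
            x≡ = trans (cong (λ w → cell w (po x)) (sym (proj₁ (proj₂ lx)))) (cell-η x)
            one : 1 ≤ sumL (λ s → δ (cell B s) (proj₁ x) (proj₂ x)) rsB
            one = ≤-trans (≡⇒≤ (sym (trans (cong (λ w → δ w (proj₁ x) (proj₂ x)) x≡) (δ-refl x))))
                (sumL-∈ (λ s → δ (cell B s) (proj₁ x) (proj₂ x)) (covB (po x) (mn (proj₁ lx) (proj₂ lx)) (proj₂ (proj₂ lx))))
          lost : length lows ≤ length new
          lost = ≤-trans (count-lows lows (λ i → ∈-filter⁻ low? {xs = C} i))
              (≤-trans (sumL-mono rsB (λ {s} _ → ≤-trans (≤-trans (m≤m+n _ _) (≡⇒≤ (cnt-filter low? (cell B s) C))) (≤-trans (m≤m+n _ _) (use (cell B s)))))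
              (≤-trans sums (≡⇒≤ (sym (length-rep _ rsA)))))
          result : Goal C rest
          result = (v ∷ keep ++ new) ∷ rest , refl , (chain ∷ hr , le) ,
            lin 6 (λ c kn k n l s → (l ⊕ k ≑ c) ∷ (kn ≑ k ⊕ n) ∷ (l ≼ n) ∷ [] ⊢ con 1 ⊕ c ⊕ s ≼ con 1 ⊕ kn ⊕ s)
              (length C) (length (keep ++ new)) (length keep) (length new) (length lows) (size rest)
              (length-filter± low? C) (length-++ keep) lost

        module Some (D : List Pos) (D∈ : D ∈ rest) (a : Pos) (a∈ : a ∈ D) (ma : Mid a) where
          cra = proj₁ ma
          za = proj₁ (proj₂ ma)
          ay = proj₂ (proj₂ ma)
          rest⁻ = proj₁ (pick D∈)
          pkR : Pick D rest rest⁻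
          pkR = proj₂ (pick D∈)
          hD : AllPairs Cmp D
          hD = All.lookup hr D∈
          D⁻ = proj₁ (pick a∈)
          pkD : Pick a D D⁻
          pkD = proj₂ (pick a∈)
          hD⁻ : All (Cmp a) D⁻ × AllPairs Cmp D⁻
          hD⁻ with pick-AllPairs Cmp-sym pkD hD
          ... | p ∷ q = p , q
          ∈D : ∀ {c} → c ∈ D → c ≡ a ⊎ c ∈ D⁻
          ∈D i = pick-other pkD i
          GA : ∀ {c} → c ∈ D → cr c ≡ A → 0 < G (cell A (po c))
          GA {c} i p = ≤-trans (≤-trans (cnt-∈ (subst (_∈ D) (trans (sym (cell-η c)) (cong (λ x → cell x (po c)) p)) i))
            (≤-trans (≤-trans (m≤m+n _ _) (≡⇒≤ (sym (pick-cntF pkR (cell A (po c)))))) (m≤n+m _ _))) (use (cell A (po c)))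

          -- `C` gives up `u` and `D` takes `v`, so the total size is unchanged.
          insert : All (Cmp v) D → Goal C rest
          insert ok = C ∷ (v ∷ D) ∷ rest⁻ , cong suc (sym (pick-length pkR)) , (hC ∷ (ok ∷ hD) ∷ proj₂ (pick-All pkR hr) , le) ,
              subst (λ s → suc (length C + s) ≤ length C + (suc (length D) + size rest⁻)) (sym (pick-size pkR)) (≡⇒≤ (sym (+-suc (length C) _)))
            where
            le : ∀ c → cntF c (C ∷ (v ∷ D) ∷ rest⁻) ≤ Crossed c
            le c rewrite δ-sym c v = ≤-trans (≡⇒≤ (lin≡ 4 (λ a b d e → [] ⊢ a ⊕ ((b ⊕ d) ⊕ e) ≐ (a ⊕ (d ⊕ e)) ⊕ b) (cnt c C) (δ v (proj₁ c) (proj₂ c)) (cnt c D) (cntF c rest⁻)))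
               (+-monoˡ-≤ _ (subst (λ s → cnt c C + s ≤ G c) (pick-cntF pkR c) (use c)))

          -- The cell `e'` that keeps `v` out of `D` lies on `B` or beyond and does not follow `y`.
          -- Hence all units of `D` on `A` lie before `y`, and the left part of `D` can be followed
          -- by `u`.
          module Blocked (e' : Pos) (e∈ : e' ∈ D) (bad : ¬ Cmp v e') where
            <y : ∀ {w} → w ≤[ d ] y → (sp ≡ true → w ≢ y) → w ≺ y
            <y {w} l neq = go' sp neq
              where
              go' : ∀ s → (s ≡ true → w ≢ y) → rel s d w y
              go' true neq = ≤≢⇒< l (neq refl)
              go' false neq = l
            Amiss : ∀ {c} → c ∈ D → cr c ≡ A → sp ≡ true → po c ≢ y
            Amiss {c} i p q r = <⇒≢ (GA i p) (sym (trans (cong (G ∘ cell A) r) (zeroA q)))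
            bef-v : ∀ {c} → cr c ≤[ d ] A → po c ≺ y → Cmp v c
            bef-v {c} l p = inj₂ (to (subst (cr c ≤[ d ]_) (sym (cr-cell A y)) l , subst (po c ≺_) (sym (po-cell A y)) p))
            e∈⁻ : e' ∈ D⁻
            e∈⁻ with ∈D e∈
            ... | inj₂ j = j
            ... | inj₁ refl = ⊥-elim (bad (bef-v (≤-rf cra) (<y ay (Amiss a∈ cra))))
            a-before-e : Before' a e'
            a-before-e with All.lookup (proj₁ hD⁻) e∈⁻
            ... | inj₁ p = from p
            ... | inj₂ p = ⊥-elim (bad (bef-v (subst (cr e' ≤[ d ]_) cra (proj₁ (from p))) (≺≤ (proj₂ p) ay)))
            ey : po e' ◁ y
            ey with ≺or◁ y (po e')
            ... | inj₂ q = q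
            ... | inj₁ q = ⊥-elim (bad (inj₁ (to (subst (_≤[ d ] cr e') (trans cra (sym (cr-cell A y))) (proj₁ a-before-e) , subst (_≺ po e') (sym (po-cell A y)) q))))
            eB : B ≤[ d ] cr e'
            eB with adj (cr e')
            ... | inj₂ q = q
            ... | inj₁ q = ⊥-elim (bad (bef-v q (<y (◁⇒≤ ey) (Amiss e∈ (antisym' q (subst (_≤[ d ] cr e') cra (proj₁ a-before-e)))))))
              where
              antisym' : ∀ {x w} → x ≤[ d ] w → w ≤[ d ] x → x ≡ w
              antisym' {x} {w} p q with x ≟ w
              ... | yes r = r
              ... | no r = ⊥-elim (irr (≤≢⇒< p r) q)
            A<y : ∀ {c} → c ∈ D → cr c ≡ A → po c <[ d ] y
            A<y {c} i p = ≺◁< (proj₂ (look (proj₂ (pick i)) (pick-AllPairs Cmp-sym (proj₂ (pick i)) hD))) ey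
              where
              look : ∀ {ys} → Pick c D ys → AllPairs Cmp (c ∷ ys) → Before' c e'
              look pk' (h ∷ _) with pick-other pk' e∈
              ... | inj₁ refl = ⊥-elim (irr A<B (subst (B ≤[ d ]_) p eB))
              ... | inj₂ j = before (subst (_<[ d ] cr e') (sym p) (<≤-tr A<B eB)) (All.lookup h j)
            -- cells of the chain C that stay below some unit of D on the line A
            Under : Pos → Set
            Under c = cr c ≤[ d ] A ⊎ (cr c ≡ B × Any (λ w → cr w ≡ A × po c ≤[ d ] po w) D)
            under? : Decidable Under
            under? c = left? c ⊎-dec ((cr c ≟ B) ×-dec any? (λ w → (cr w ≟ A) ×-dec ≤? (po c) (po w)) D)
            over : ∀ {c} → ¬ Under c → B ≤[ d ] cr c × (cr c ≡ B → ∀ {w} → w ∈ D → cr w ≡ A → po w <[ d ] po c)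
            over {c} nu = right {c} (nu ∘ inj₁) , λ p {w} i q → [ (λ l → ⊥-elim (nu (inj₂ (p , Any.map (λ { refl → q , l }) i)))) , id ]′ (tot (po c) (po w))
            aR : ∀ {c} → c ∈ D⁻ → ¬ (cr c ≤[ d ] A) → Before' a c
            aR {c} i l = before (subst (_<[ d ] cr c) (sym cra) (<≤-tr A<B (right {c} l))) (All.lookup (proj₁ hD⁻) i)
            dBefore : ∀ {w c} → w ∈ D → cr w ≡ A → c ∈ D → ¬ (cr c ≤[ d ] A) → po w ≺ po c
            dBefore {w} {c} i p j l = proj₂ (lookB (proj₂ (pick i)) (pick-AllPairs Cmp-sym (proj₂ (pick i)) hD))
              where
              lookB : ∀ {ys} → Pick w D ys → AllPairs Cmp (w ∷ ys) → Before' w c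
              lookB pk' (h ∷ _) with pick-other pk' j
              ... | inj₁ refl = ⊥-elim (l (≤-rf p))
              ... | inj₂ j' = before (subst (_<[ d ] cr c) (sym p) (<≤-tr A<B (right {c} l))) (All.lookup h j')
            U O L R' : List Pos → List Pos
            U = filter under?
            O = filter (¬? ∘ under?)
            L = filter left?
            R' = filter (¬? ∘ left?)
            -- The low units kept beside `u` lie beyond every unit of `D` on `A`, in particular
            -- beyond `a` and so beyond `z`. This lowers `rank`.
            C' = L D ++ O C
            D' = U C ++ R' D
            rest' = D' ∷ rest⁻
            -- a cell of the tail of C lies after all cells of D on the left
            after : ∀ {c w} → (B ≤[ d ] cr c) → (cr c ≡ B → ∀ {w} → w ∈ D → cr w ≡ A → po w <[ d ] po c) → (cr c ≢ B → y ≺ po c) →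
                w ∈ D → cr w ≤[ d ] A → Before' w c
            after {c} {w} cB h h' i l = ≤-tr l (≤-tr (<⇒≤' A<B) cB) , pos
              where
              viaA : ∀ {w} → w ∈ D → cr w ≡ A → po w ≺ po c
              viaA {w} i p with cr c ≟ B
              ... | yes q = <⇒≺ (h q i p)
              ... | no q = ≤≺ (<⇒≤' (A<y i p)) (h' q)
              pos : po w ≺ po c
              pos with cr w ≟ A
              ... | yes p = viaA i p
              ... | no p with ∈D i
              ... | inj₁ refl = ⊥-elim (p cra)
              ... | inj₂ j = ≺≺ (proj₂ (before (subst (cr w <[ d ]_) (sym cra) (≤≢⇒< l p)) (Cmp-sym (All.lookup (proj₁ hD⁻) j)))) (viaA a∈ cra)
            tailC : ∀ {c} → c ∈ O C → (B ≤[ d ] cr c) × (cr c ≡ B → ∀ {w} → w ∈ D → cr w ≡ A → po w <[ d ] po c) × (cr c ≢ B → y ≺ po c)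
            tailC {c} i = let (j , nu) = ∈-filter⁻ (¬? ∘ under?) {xs = C} i ; (p , q) = over nu in
              p , q , λ neq → rightOf (All.lookup hu j) p (λ lw → neq (proj₁ lw))
            hC' : AllPairs Cmp (u ∷ C')
            hC' = AllP.++⁺ (All.tabulate (λ {w} i → let (j , l) = ∈-filter⁻ left? {xs = D} i in
                      inj₂ (to (after (≤-rf (sym (cr-cell B y))) (λ _ {w} k p → subst (po w <[ d ]_) (sym (po-cell B y)) (A<y k p)) (λ neq → ⊥-elim (neq (cr-cell B y))) j l))))
                    (All.tabulate (λ i → All.lookup hu (proj₁ (∈-filter⁻ (¬? ∘ under?) {xs = C} i))))
                ∷ AllPairs-++ (AllPairsP.filter⁺ left? hD) (AllPairsP.filter⁺ (¬? ∘ under?) hC)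
                    (All.tabulate (λ i → All.tabulate (λ i' → let (j , l) = ∈-filter⁻ left? {xs = D} i ; (p , q , r) = tailC i' in inj₁ (to (after p q r j l)))))
            hD' : AllPairs Cmp D'
            hD' = AllPairs-++ (AllPairsP.filter⁺ under? hC) (AllPairsP.filter⁺ (¬? ∘ left?) hD)
                (All.tabulate (λ {c} i → All.tabulate (λ {w} i' → let (j , un) = ∈-filter⁻ under? {xs = C} i ; (j' , l) = ∈-filter⁻ (¬? ∘ left?) {xs = D} i' in
                  inj₁ (to (meet j un j' l)))))
              where
              meet : ∀ {c w} → c ∈ C → Under c → w ∈ D → ¬ (cr w ≤[ d ] A) → Before' c w
              meet {c} {w} i (inj₁ l) j nl = ≤-tr l (≤-tr (<⇒≤' A<B) (right {w} nl)) , ≺≺ (≺≤ (leftC i l) (◁⇒≤ za)) (dBefore a∈ cra j nl)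
              meet {c} {w} i (inj₂ (p , any)) j nl = subst (_≤[ d ] cr w) (sym p) (right {w} nl) , found any (λ k → k)
                where
                found : ∀ {xs} → Any (λ x → cr x ≡ A × po c ≤[ d ] po x) xs → (∀ {x} → x ∈ xs → x ∈ D) → po c ≺ po w
                found (here (q , r)) emb = ≤≺ r (dBefore (emb (here refl)) q j nl)
                found (there x) emb = found x (emb ∘ there)
            same : ∀ c → V C' rest' c ≡ V C rest c
            same c rewrite cnt-++ c (L D) (O C) | cnt-++ c (U C) (R' D) | pick-cntF pkR c
                | sym (cnt-filter left? c D) | sym (cnt-filter under? c C) =
              lin≡ 5 (λ l o u r w → [] ⊢ l ⊕ o ⊕ ((u ⊕ r) ⊕ w) ≐ (u ⊕ o) ⊕ ((l ⊕ r) ⊕ w)) (cnt c (L D)) (cnt c (O C)) (cnt c (U C)) (cnt c (R' D)) (cntF c rest⁻)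
            siz : suc (length C') + size rest' ≡ suc (length C) + size rest
            siz rewrite length-++ (L D) {O C} | length-++ (U C) {R' D} | pick-size pkR
                | sym (length-filter± left? D) | sym (length-filter± under? C) =
              lin≡ 5 (λ l o u r w → [] ⊢ con 1 ⊕ (l ⊕ o) ⊕ ((u ⊕ r) ⊕ w) ≐ con 1 ⊕ (u ⊕ o) ⊕ ((l ⊕ r) ⊕ w)) (length (L D)) (length (O C)) (length (U C)) (length (R' D)) (size rest⁻)
            fuel' : ∀ {c} → c ∈ C' → Low c → rank (po c) < n
            fuel' {c} i (p , q) with ∈-++⁻ (L D) i
            ... | inj₁ j = ⊥-elim (irr A<B (subst (_≤[ d ] A) p (proj₂ (∈-filter⁻ left? {xs = D} j))))
            ... | inj₂ j = ≤-trans (rank< (◁<< za (proj₁ (proj₂ (tailC j)) p a∈ cra)) GB Gc) (≤-pred (fuel b∈ (crb , zy)))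
              where
              c∈C = proj₁ (∈-filter⁻ (¬? ∘ under?) {xs = C} j)
              Gc : 0 < G (cell B (po c))
              Gc = ≤-trans (≤-trans (cnt-∈ (subst (_∈ C) (trans (sym (cell-η c)) (cong (λ x → cell x (po c)) p)) c∈C)) (m≤m+n _ _)) (use (cell B (po c)))
            result : Goal C rest
            result = subst₂ (Better Cmp Crossed) (cong suc (sym (pick-length pkR))) siz
              (go n C' rest' fuel' hC' (hD' ∷ proj₂ (pick-All pkR hr)) (λ c → subst (_≤ G c) (sym (same c)) (use c)))

          result : Goal C rest
          result with all? (cmp? v) D
          ... | yes ok = insert ok
          ... | no bad = let (e' , i , p) = witness D bad in Blocked.result e' i p
            where
            witness : ∀ xs → ¬ All (Cmp v) xs → ∃ λ x → x ∈ xs × ¬ Cmp v x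
            witness [] n = ⊥-elim (n [])
            witness (x ∷ xs) n with cmp? v x
            ... | no p = x , here refl , p
            ... | yes p = let (x' , i , q) = witness xs (λ ps → n (p ∷ ps)) in x' , there i , q

        search : Goal C rest
        search with any? (any? mid?) rest
        ... | no none = None.result (λ i j m → none (Any.map (λ { refl → Any.map (λ { refl → m }) j }) i))
        ... | yes some = let (D , i , s) = findL some ; (a , j , m) = findL s in Some.result D i a j m
          where
          findL : ∀ {A : Set} {P : A → Set} {xs} → Any P xs → ∃ λ x → x ∈ xs × P x
          findL (here p) = _ , here refl , p
          findL (there p) = let (x , i , q) = findL p in x , there i , q

-- Bracket inequalities as sums over intervals

rng : ℕ → ℕ → List ℕ
rng a zero = []
rng a (suc m) = a ∷ rng (suc a) m

rng-∈ : ∀ {a m x} → x ∈ rng a m → a ≤ x × x < a + m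
rng-∈ {a} {suc m} (here refl) = ≤-refl , m<m+n a (s≤s z≤n)
rng-∈ {a} {suc m} {x} (there i) with rng-∈ i
... | p , q = <⇒≤ p , subst (x <_) (sym (+-suc a m)) q

∈-rng : ∀ {a m x} → a ≤ x → x < a + m → x ∈ rng a m
∈-rng {a} {zero} p q = ⊥-elim (<⇒≱ q (subst (_≤ _) (sym (+-identityʳ a)) p))
∈-rng {a} {suc m} {x} p q with ≤-split p
... | inj₂ refl = here refl
... | inj₁ l = there (∈-rng l (subst (x <_) (+-suc a m) q))

rng-unique : ∀ a m → Unique (rng a m)
rng-unique a zero = []
rng-unique a (suc m) = All.tabulate (λ i e → <-irrefl e (proj₁ (rng-∈ i))) ∷ rng-unique (suc a) m

sum-rng : ∀ f a m → sumL f (rng a m) + S f a ≡ S f (a + m)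
sum-rng f a zero = cong (S f) (sym (+-identityʳ a))
sum-rng f a (suc m) = trans (lin≡ 3 (λ p q r → [] ⊢ p ⊕ q ⊕ r ≐ q ⊕ (r ⊕ p)) (f a) (sumL f (rng (suc a) m)) (S f a))
  (trans (sum-rng f (suc a) m) (cong (S f) (sym (+-suc a m))))

record Interval (f : ℕ → ℕ) (a b : ℕ) : Set where
  field
    list : List ℕ
    sound : ∀ {x} → x ∈ list → a ≤ x × x < b
    compl : ∀ {x} → a ≤ x → x < b → x ∈ list
    unique : Unique list
    total' : sumL f list + S f a ≡ S f b

interval : ∀ f {a b} → a ≤ b → Interval f a b
interval f {a} {b} l = record
  { list = rng a (b ∸ a)
  ; sound = λ {x} i → proj₁ (rng-∈ i) , subst (x <_) (m+[n∸m]≡n l) (proj₂ (rng-∈ i))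
  ; compl = λ {x} p q → ∈-rng p (subst (x <_) (sym (m+[n∸m]≡n l)) q)
  ; unique = rng-unique a _
  ; total' = trans (sum-rng f a (b ∸ a)) (cong (S f) (m+[n∸m]≡n l)) }

-- Whether a unit must differ in position from the unit with which it is matched.
ε : Kind → Bool
ε st = true
ε wk = false

-- The bracket of `z`: between `z` and `y` there are at most as many units of `P` as of `Q`, each
-- side with the end points that the matching rule admits.
record LB (κ : Kind) (d : Dir) (P Q : ℕ → ℕ) (y z : ℕ) : Set where
  field
    Lp Lq : List ℕ
    ofP : ∀ {x} → x ∈ Lp → z ≤[ d ] x × rel (ε κ) d x y
    toP : ∀ {x} → z ≤[ d ] x → rel (ε κ) d x y → x ∈ Lp
    ofQ : ∀ {x} → x ∈ Lq → rel (ε κ) d z x × x ≤[ d ] y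
    uniqueQ : Unique Lq
    sums : sumL P Lp ≤ sumL Q Lq

-- Before the minimiser the units of `b` outnumber those of `a`, and deleting the moving unit from
-- `b` uses up the strictness of `bef`. After the minimiser it is the other way round, by `aft`.
module Brackets (κ : Kind) (a b : ℕ → ℕ) (y : ℕ) (f : FMκ κ a b y) (wk0 : κ ≡ wk → a y ≡ 0 × b y ≡ 1) where

  bG : ℕ → ℕ
  bG k = b k ∸ e y k

  private
    b-src : 0 < b y
    b-src = first-src κ f

    bG+ : ∀ k → bG k + e y k ≡ b k
    bG+ k = m∸n+n≡m (le k)
      where
      le : ∀ k → e y k ≤ b k
      le k with y ≟ k
      ... | yes refl rewrite e-refl y = b-src
      ... | no p rewrite e-≢ y k p = z≤n

    SbG : ∀ k → S bG k + lt y k ≡ S b k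
    SbG k = trans (cong (S bG k +_) (sym (S-e y k))) (trans (sym (S-+ bG (e y) k)) (S-≗ bG+ k))

    SbG0 : ∀ {k} → k ≤ y → S bG k ≡ S b k
    SbG0 {k} l = trans (sym (+-identityʳ _)) (trans (cong (S bG k +_) (sym (lt-no l))) (SbG k))

    SbG1 : ∀ {k} → y < k → suc (S bG k) ≡ S b k
    SbG1 {k} l = trans (+-comm 1 _) (trans (cong (S bG k +_) (sym (lt-yes l))) (SbG k))

    ineq : ∀ {P Q a₁ b₁ a₂ b₂} (I : Interval P a₁ b₁) (I′ : Interval Q a₂ b₂) → S P b₁ + S Q a₂ ≤ S P a₁ + S Q b₂ →
        sumL P (Interval.list I) ≤ sumL Q (Interval.list I′)
    ineq {P} {Q} {a₁} {b₁} {a₂} {b₂} I I′ h = lin 6 (λ s t Pa Pb Qa Qb → (s ⊕ Pa ≐ Pb) ∷ (t ⊕ Qa ≑ Qb) ∷ (Pb ⊕ Qa ≼ Pa ⊕ Qb) ∷ [] ⊢ s ≼ t)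
      (sumL P (Interval.list I)) (sumL Q (Interval.list I′)) (S P a₁) (S P b₁) (S Q a₂) (S Q b₂) (Interval.total' I) (Interval.total' I′) h

  before : ∀ z → rel (ε κ) up z y → LB κ up a bG y z
  before z = go κ f wk0
    where
    go : ∀ κ → FMκ κ a b y → (κ ≡ wk → a y ≡ 0 × b y ≡ 1) → rel (ε κ) up z y → LB κ up a bG y z
    go st f _ l = record { Lp = I.list ; Lq = I′.list ; ofP = I.sound ; toP = I.compl
        ; ofQ = λ i → proj₁ (I′.sound i) , ≤-pred (proj₂ (I′.sound i)) ; uniqueQ = I′.unique
        ; sums = ineq I I′ (lin 6 (λ ay az bz by gz gy → (con 1 ⊕ ay ⊕ bz ≼ az ⊕ by) ∷ (gz ≐ bz) ∷ (con 1 ⊕ gy ≑ by) ∷ [] ⊢ ay ⊕ gz ≼ az ⊕ gy)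
            (S a y) (S a z) (S b (suc z)) (S b (suc y)) (S bG (suc z)) (S bG (suc y)) (bef f z l) (SbG0 l) (SbG1 ≤-refl)) }
      where
      I = interval a (<⇒≤ l)
      I′ = interval bG (≤-suc l)
      module I = Interval I
      module I′ = Interval I′
    go wk f w l = record { Lp = I.list ; Lq = I′.list ; ofP = λ i → proj₁ (I.sound i) , ≤-pred (proj₂ (I.sound i)) ; toP = λ p q → I.compl p (s≤s q)
        ; ofQ = λ i → proj₁ (I′.sound i) , ≤-pred (proj₂ (I′.sound i)) ; uniqueQ = I′.unique
        ; sums = ineq I I′ (lin 6 (λ ay az bz by gz gy → (con 1 ⊕ ay ⊕ bz ≼ az ⊕ by) ∷ (gz ≐ bz) ∷ (con 1 ⊕ gy ≑ by) ∷ [] ⊢ ay ⊕ gz ≼ az ⊕ gy)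
            (S a (suc y)) (S a z) (S b z) (S b (suc y)) (S bG z) (S bG (suc y)) (be z l) (SbG0 l) (SbG1 ≤-refl)) }
      where
      I = interval a (≤-suc l)
      I′ = interval bG (≤-suc l)
      module I = Interval I
      module I′ = Interval I′
      be : ∀ k → k ≤ y → S a (suc y) + S b k < S a k + S b (suc y)
      be zero l = subst (λ z → suc z ≤ S b (suc y)) (sym (+-identityʳ _)) (neg f)
      be (suc k) l = bef f k l

  after : ∀ z → rel (ε κ) dn z y → LB κ dn bG a y z
  after z = go κ f wk0
    where
    go : ∀ κ → FMκ κ a b y → (κ ≡ wk → a y ≡ 0 × b y ≡ 1) → rel (ε κ) dn z y → LB κ dn bG a y z
    go st f _ l = record { Lp = I.list ; Lq = I′.list
        ; ofP = λ i → ≤-pred (proj₂ (I.sound i)) , proj₁ (I.sound i) ; toP = λ p q → I.compl q (s≤s p)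
        ; ofQ = λ i → proj₂ (I′.sound i) , proj₁ (I′.sound i) ; uniqueQ = I′.unique
        ; sums = ineq I I′ (lin 6 (λ ay az bz by gz gy → (ay ⊕ bz ≼ az ⊕ by) ∷ (con 1 ⊕ gz ≐ bz) ∷ (con 1 ⊕ gy ≑ by) ∷ [] ⊢ gz ⊕ ay ≼ gy ⊕ az)
            (S a y) (S a z) (S b (suc z)) (S b (suc y)) (S bG (suc z)) (S bG (suc y)) (aft f z (<⇒≤ l)) (SbG1 (≤-suc l)) (SbG1 ≤-refl)) }
      where
      I = interval bG {suc y} {suc z} (s≤s (<⇒≤ l))
      I′ = interval a (<⇒≤ l)
      module I = Interval I
      module I′ = Interval I′
    go wk f w l = record { Lp = I.list ; Lq = I′.list
        ; ofP = λ i → ≤-pred (proj₂ (I.sound i)) , proj₁ (I.sound i) ; toP = λ p q → I.compl q (s≤s p)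
        ; ofQ = λ i → ≤-pred (proj₂ (I′.sound i)) , proj₁ (I′.sound i) ; uniqueQ = I′.unique
        ; sums = ineq I I′ (lin 8 (λ ay az bz by gz gy p q → (ay ⊕ p ⊕ bz ≼ az ⊕ (by ⊕ q)) ∷ (con 1 ⊕ gz ≐ bz) ∷ (gy ≑ by) ∷ (p ≑ con 0) ∷ (q ≐ con 1) ∷ [] ⊢ gz ⊕ ay ≼ gy ⊕ az)
            (S a y) (S a (suc z)) (S b (suc z)) (S b y) (S bG (suc z)) (S bG y) (a y) (b y) (aft f z l) (SbG1 (s≤s l)) (SbG0 ≤-refl) (proj₁ (w refl)) (proj₂ (w refl))) }
      where
      I = interval bG {y} {suc z} (≤-suc l)
      I′ = interval a {y} {suc z} (≤-suc l)
      module I = Interval I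
      module I′ = Interval I′

module _ (T : Setting) where

  open Setting T

  private
    u : Pos
    u = cell B y

  -- A family that does not need the unit u at all stays valid; otherwise the rerouting starts with a chain through u.
  start : (∀ C rest → AllPairs Cmp (u ∷ C) → All (AllPairs Cmp) rest → (∀ c → cnt c C + cntF c rest ≤ G c) →
      Better Cmp Crossed (suc (length rest)) (suc (length C) + size rest)) →
          ∀ fam → Valid Cmp (λ c → G c + δ u (proj₁ c) (proj₂ c)) fam → Better Cmp Crossed (length fam) (size fam)
  start core fam (h , use) with cntF u fam ≤? G u
  ... | yes p = fam , refl , (h , λ c → ≤-trans (low c) (m≤m+n _ _)) , ≤-refl
    where
    low : ∀ c → cntF c fam ≤ G c
    low c with u ≟ₚ c
    ... | yes refl = p
    ... | no neq = subst (λ w → cntF c fam ≤ w) (trans (cong (G c +_) (δ-≢ u c neq)) (+-identityʳ _)) (use c)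
  ... | no p = let (C , C∈ , u∈) = find fam (≤-trans (s≤s z≤n) (≰⇒> p)) in via C C∈ u∈
    where
    find : ∀ fam → 0 < cntF u fam → ∃ λ C → C ∈ fam × u ∈ C
    find (C ∷ fam) l with 0 <? cnt u C
    ... | yes q = C , here refl , ∈-cnt u C q
    ... | no q = let (D , i , j) = find fam (subst (λ w → 0 < w + cntF u fam) (n<1⇒n≡0 (s≤s (≮⇒≥ q))) l) in D , there i , j
    via : ∀ C → C ∈ fam → u ∈ C → Better Cmp Crossed (length fam) (size fam)
    via C C∈ u∈ = subst₂ (Better Cmp Crossed) (sym (pick-length pf)) (sym (trans (pick-size pf) (cong (_+ size rest) (pick-length pu))))
                    (core C⁻ rest (pick-AllPairs Cmp-sym pu (proj₁ (pick-All pf h))) (proj₂ (pick-All pf h)) use')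
      where
      rest = proj₁ (pick C∈)
      pf : Pick C fam rest
      pf = proj₂ (pick C∈)
      C⁻ = proj₁ (pick u∈)
      pu : Pick u C C⁻
      pu = proj₂ (pick u∈)
      use' : ∀ c → cnt c C⁻ + cntF c rest ≤ G c
      use' c = +-cancelʳ-≤ (δ u (proj₁ c) (proj₂ c)) _ _ (≤-trans (≡⇒≤ (trans
        (lin≡ 3 (λ a b d → [] ⊢ a ⊕ b ⊕ d ≐ d ⊕ a ⊕ b) (cnt c C⁻) (cntF c rest) (δ u (proj₁ c) (proj₂ c)))
        (trans (cong (λ w → w + cnt c C⁻ + cntF c rest) (sym (δ-sym c u)))
          (trans (cong (_+ cntF c rest) (sym (pick-cnt pu c))) (sym (pick-cntF pf c)))))) (use c))

-- The effect of one crystal move on the chains in a rectangle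

opp : Dir → Dir
opp up = dn
opp dn = up

<-opp : ∀ d {a b} → a <[ d ] b → b <[ opp d ] a
<-opp up p = p
<-opp dn p = p

≤-opp : ∀ d {a b} → a ≤[ d ] b → b ≤[ opp d ] a
≤-opp up p = p
≤-opp dn p = p

<-opp' : ∀ d {a b} → a <[ opp d ] b → b <[ d ] a
<-opp' up p = p
<-opp' dn p = p

≤-opp' : ∀ d {a b} → a ≤[ opp d ] b → b ≤[ d ] a
≤-opp' up p = p
≤-opp' dn p = p

rel-opp' : ∀ s d {a b} → rel s (opp d) a b → rel s d b a
rel-opp' true d p = <-opp' d p
rel-opp' false d p = ≤-opp' d p

rel-opp : ∀ s d {a b} → rel s d a b → rel s (opp d) b a
rel-opp true d p = <-opp d p
rel-opp false d p = ≤-opp d p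

rk : Dir → ℕ → ℕ → ℕ
rk up M x = x
rk dn M x = M ∸ x

rk< : ∀ d M {x z} → x <[ d ] z → x < M → z < M → rk d M x < rk d M z
rk< up M l p q = l
rk< dn M l p q = ∸-monoʳ-< l (<⇒≤ p)

-- An increasing map ψ from [0,n) to the positions of a line.
record Chart (d' d : Dir) (n : ℕ) (ψ : ℕ → ℕ) : Set where
  field
    mono : ∀ {k m} → k < n → m < n → k <[ d' ] m → ψ k <[ d ] ψ m
    surj : ∀ {k m} p → k < n → m < n → ψ k ≤[ d ] p → p ≤[ d ] ψ m → ∃ λ x → x < n × p ≡ ψ x

  private
    module O' = Oriented d'
    module O = Oriented d

  mono≤ : ∀ {k m} → k < n → m < n → k ≤[ d' ] m → ψ k ≤[ d ] ψ m
  mono≤ {k} {m} p q l with k ≟ m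
  ... | yes refl = O.≤-rf refl
  ... | no neq = O.<⇒≤' (mono p q (O'.≤≢⇒< l neq))

  refl≤ : ∀ {k m} → k < n → m < n → ψ k ≤[ d ] ψ m → k ≤[ d' ] m
  refl≤ {k} {m} p q l with O'.tot k m
  ... | inj₁ r = r
  ... | inj₂ r = ⊥-elim (O.irr (mono q p r) l)

  refl< : ∀ {k m} → k < n → m < n → ψ k <[ d ] ψ m → k <[ d' ] m
  refl< {k} {m} p q l with O'.tot m k
  ... | inj₂ r = r
  ... | inj₁ r = ⊥-elim (O.irr l (mono≤ q p r))

  mono-rel : ∀ s {k m} → k < n → m < n → rel s d' k m → rel s d (ψ k) (ψ m)
  mono-rel true = mono
  mono-rel false = mono≤

  refl-rel : ∀ s {k m} → k < n → m < n → rel s d (ψ k) (ψ m) → rel s d' k m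
  refl-rel true = refl<
  refl-rel false = refl≤

  inj : ∀ {k m} → k < n → m < n → ψ k ≡ ψ m → k ≡ m
  inj {k} {m} p q e with k ≟ m
  ... | yes r = r
  ... | no neq with O'.tot k m
  ... | inj₁ r = ⊥-elim (O.<⇒≢' (mono p q (O'.≤≢⇒< r neq)) e)
  ... | inj₂ r = ⊥-elim (O.<⇒≢' (mono q p r) (sym e))

Chart-opp : ∀ {d' d n ψ} → Chart d' d n ψ → Chart (opp d') (opp d) n ψ
Chart-opp {d'} {d} c = record
  { mono = λ p q l → <-opp d (Chart.mono c q p (<-opp' d' l))
  ; surj = λ x p q l l' → Chart.surj c x q p (≤-opp' d l') (≤-opp' d l) }

record Transfer (s : Bool) (d : Dir) (g h : ℕ → ℕ) (y z : ℕ) : Set where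
  field
    Lg Lh : List ℕ
    toG : ∀ x → z ≤[ d ] x → rel s d x y → x ∈ Lg
    ofH : ∀ {x} → x ∈ Lh → rel s d z x × x ≤[ d ] y
    uniqueH : Unique Lh
    sums : sumL g Lg ≤ sumL h Lh

sumL-map : ∀ (f : ℕ → ℕ) (ψ : ℕ → ℕ) xs → sumL f (map ψ xs) ≡ sumL (f ∘ ψ) xs
sumL-map f ψ [] = refl
sumL-map f ψ (x ∷ xs) = cong (f (ψ x) +_) (sumL-map f ψ xs)

module _ {κ d' d n ψ y' P Q} (c : Chart d' d n ψ) (y< : y' < n) (g h : ℕ → ℕ)
    (lb : ∀ z → rel (ε κ) d' z y' → LB κ d' P Q y' z)
    (occ : ∀ p → 0 < g p → ∃ λ k → k < n × p ≡ ψ k)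
    (le : ∀ k → k < n → g (ψ k) ≤ P k)
    (ge : ∀ z k → z < n → k < n → 0 < g (ψ z) → z ≤[ d' ] k → k ≤[ d' ] y' → Q k ≤ h (ψ k)) where

  private
    module Ch = Chart c
    module O' = Oriented d'
    module O'' = O'.Strictness (ε κ)
    module O = Oriented d
    module Os = O.Strictness (ε κ)

    between : ∀ {z x} → z < n → z ≤[ d' ] x → x ≤[ d' ] y' → x < n
    between {z} {x} p l m = go d' l m
      where
      go : ∀ d' → z ≤[ d' ] x → x ≤[ d' ] y' → x < n
      go up l m = ≤-trans (s≤s m) y<
      go dn l m = ≤-trans (s≤s l) p

  transfer : ∀ z → rel (ε κ) d z (ψ y') → 0 < g z → Transfer (ε κ) d g h (ψ y') z
  transfer z l pos with occ z pos
  ... | k , k< , refl = record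
    { Lg = map ψ Lp ; Lh = map ψ Lq
    ; toG = λ x p q → let (m , m< , e) = Ch.surj x k< y< p (Os.≺⇒≤ q) in
        subst (_∈ map ψ Lp) (sym e) (∈-map⁺ ψ (toP (Ch.refl≤ k< m< (subst (ψ k ≤[ d ]_) e p)) (Ch.refl-rel (ε κ) m< y< (subst (λ w → rel (ε κ) d w (ψ y')) e q))))
    ; ofH = λ i → let (m , j , e) = ∈-map⁻ ψ i ; (p , q) = ofQ j ; m< = between k< (O''.≺⇒≤ p) q in
        subst (λ w → rel (ε κ) d (ψ k) w × w ≤[ d ] ψ y') (sym e) (Ch.mono-rel (ε κ) k< m< p , Ch.mono≤ m< y< q)
    ; uniqueH = uniq Lq uniqueQ (λ i → let (p , q) = ofQ i in between k< (O''.≺⇒≤ p) q)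
    ; sums = ≤-trans (≡⇒≤ (sumL-map g ψ Lp)) (≤-trans (sumL-mono Lp (λ {x} i → let (p , q) = ofP i in le x (between k< p (O''.≺⇒≤ q))))
        (≤-trans sums' (≤-trans (sumL-mono Lq (λ {x} i → let (p , q) = ofQ i in ge k x k< (between k< (O''.≺⇒≤ p) q) pos (O''.≺⇒≤ p) q)) (≡⇒≤ (sym (sumL-map h ψ Lq)))))) }
    where
    open LB (lb k (Ch.refl-rel (ε κ) k< y< l)) renaming (sums to sums')
    uniq : ∀ xs → Unique xs → (∀ {x} → x ∈ xs → x < n) → Unique (map ψ xs)
    uniq [] [] b = []
    uniq (x ∷ xs) (p ∷ ps) b = All.tabulate (λ i e → let (m , j , e') = ∈-map⁻ ψ i in All.lookup p j (Ch.inj (b (here refl)) (b (there j)) (trans e e'))) ∷ uniq xs ps (b ∘ there)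

-- The Greene-type invariants of `F'` are at least those of `F`.
Sub : (Pos → Pos → Set) → (F F' : Pos → ℕ) → Set
Sub R F F' = ∀ fam → Valid R F fam → Better R F' (length fam) (size fam)

Sub-≤ : ∀ {R F F'} → (∀ c → F c ≤ F' c) → Sub R F F'
Sub-≤ h fam (v , use) = fam , refl , (v , λ c → ≤-trans (use c) (h c)) , ≤-refl

Sub-trans : ∀ {R F F' F''} → Sub R F F' → Sub R F' F'' → Sub R F F''
Sub-trans s s' fam v = let (fam' , l , v' , z) = s fam v ; (fam'' , l' , v'' , z') = s' fam' v' in
  fam'' , trans l' l , v'' , ≤-trans z z'

Sub-rel : ∀ {R R' F F'} → (∀ {c e} → R c e → R' c e) → (∀ {c e} → R' c e → R c e) → Sub R F F' → Sub R' F F'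
Sub-rel f g s fam (v , use) = let (fam' , l , (v' , use') , z) = s fam (All.map (AllPairs.map g) v , use) in
  fam' , l , (All.map (AllPairs.map f) v' , use') , z

record Coordinates : Set where
  field
    cr po : Pos → ℕ
    cell : ℕ → ℕ → Pos
    cr-cell : ∀ a p → cr (cell a p) ≡ a
    po-cell : ∀ a p → po (cell a p) ≡ p
    cell-η : ∀ c → cell (cr c) (po c) ≡ c

xy yx : Coordinates
xy = record { cr = proj₁ ; po = proj₂ ; cell = _,_ ; cr-cell = λ _ _ → refl ; po-cell = λ _ _ → refl ; cell-η = λ _ → refl }
yx = record { cr = proj₂ ; po = proj₁ ; cell = λ a p → p , a ; cr-cell = λ _ _ → refl ; po-cell = λ _ _ → refl ; cell-η = λ _ → refl }

-- Strict and weak chains need the brackets in opposite orientations.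
data Mode (κ : Kind) : (sc sp : Bool) (d' : Dir) → Set where
  strict : Mode κ true (ε κ) up
  weak : ∀ {sp} → neg? sp ≡ ε κ → Mode κ false sp dn

-- The predicate `K` cuts the two lines down to a rectangle. The bracket of a unit inside it
-- involves only positions between that unit and the moved one. As `K` is convex, they all lie in
-- the rectangle, so the inequality of the full lines restricts to it.
module LineEdge (X : Coordinates) (κ : Kind) (sc sp : Bool) (d' d : Dir) (mode : Mode κ sc sp d')
    (α β : ℕ) (α<β : α <[ d ] β) (adj : ∀ x → x ≤[ d ] α ⊎ β ≤[ d ] x)
    (n : ℕ) (ψ : ℕ → ℕ) (chart : Chart d' d n ψ) (M : ℕ) (bnd : ∀ k → k < n → ψ k < M)
    (a b : ℕ → ℕ) (y' : ℕ) (y< : y' < n) (f : FMκ κ a b y') (wk0 : κ ≡ wk → a y' ≡ 0 × b y' ≡ 1)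
    (F₁ F₂ : Pos → ℕ)
    (K : ℕ → Bool) (conv : ∀ {k l m} → k ≤ l → l ≤ m → K k ≡ true → K m ≡ true → K l ≡ true)
    (inA : ∀ k → k < n → F₁ (Coordinates.cell X α (ψ k)) ≡ (if K (ψ k) then a k else 0))
    (inB : ∀ k → k < n → F₁ (Coordinates.cell X β (ψ k)) ≡ (if K (ψ k) then b k else 0))
    (outA : ∀ p → 0 < F₁ (Coordinates.cell X α p) → ∃ λ k → k < n × p ≡ ψ k)
    (outB : ∀ p → 0 < F₁ (Coordinates.cell X β p) → ∃ λ k → k < n × p ≡ ψ k)
    (one : κ ≡ wk → ∀ c → F₁ c ≤ 1)
    (Ky : K (ψ y') ≡ true)
    (mv : ∀ c → F₂ c + δ (Coordinates.cell X β (ψ y')) (proj₁ c) (proj₂ c) ≡ F₁ c + δ (Coordinates.cell X α (ψ y')) (proj₁ c) (proj₂ c)) where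

  open Coordinates X

  private
    u v : Pos
    u = cell β (ψ y')
    v = cell α (ψ y')
    open Brackets κ a b y' f wk0
    module O = Oriented d

    G : Pos → ℕ
    G c = F₁ c ∸ δ u (proj₁ c) (proj₂ c)

    Rc : Pos → Pos → Set
    Rc c e = (rel sc d (cr c) (cr e) × rel sp d (po c) (po e)) ⊎ (rel sc d (cr e) (cr c) × rel sp d (po e) (po c))

    G≤F₁ : ∀ c → G c ≤ F₁ c
    G≤F₁ c = m∸n≤m (F₁ c) (δ u (proj₁ c) (proj₂ c))

    u≢ : ∀ p → u ≢ cell α p
    u≢ p e = O.<⇒≢' α<β (trans (sym (cr-cell α p)) (trans (cong cr (sym e)) (cr-cell β _)))

    δu : ∀ k → k < n → δ u (proj₁ (cell β (ψ k))) (proj₂ (cell β (ψ k))) ≡ e y' k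
    δu k l with y' ≟ k
    ... | yes refl = trans (δ-refl u) (sym (e-refl y'))
    ... | no neq = trans (δ-≢ u (cell β (ψ k)) (λ q → neq (Chart.inj chart y< l (trans (sym (po-cell β _)) (trans (cong po q) (po-cell β _)))))) (sym (e-≢ y' k neq))

    GA : ∀ p → G (cell α p) ≡ F₁ (cell α p)
    GA p = cong (F₁ (cell α p) ∸_) (δ-≢ u (cell α p) (u≢ p))

    GA' : ∀ k → k < n → G (cell α (ψ k)) ≡ (if K (ψ k) then a k else 0)
    GA' k l = trans (GA (ψ k)) (inA k l)

    GB' : ∀ k → k < n → G (cell β (ψ k)) ≡ (if K (ψ k) then bG k else 0)
    GB' k l rewrite inB k l | δu k l with K (ψ k)
    ... | true = refl
    ... | false = 0∸n≡0 (e y' k)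

    if≤ : ∀ {x} c → (if c then x else 0) ≤ x
    if≤ true = ≤-refl
    if≤ false = z≤n

    ifK : ∀ {x} c → 0 < (if c then x else 0) → c ≡ true
    ifK true _ = refl

    Kbetween : ∀ d' {z k} → z < n → k < n → Chart d' d n ψ → K (ψ z) ≡ true → z ≤[ d' ] k → k ≤[ d' ] y' → K (ψ k) ≡ true
    Kbetween d' {z} {k} z< k< c Kz l m = go d (Chart.mono≤ c z< k< l) (Chart.mono≤ c k< y< m)
      where
      go : ∀ d → ψ z ≤[ d ] ψ k → ψ k ≤[ d ] ψ y' → K (ψ k) ≡ true
      go up p q = conv p q Kz Ky
      go dn p q = conv q p Ky Kz

    occA : ∀ p → 0 < G (cell α p) → ∃ λ k → k < n × p ≡ ψ k
    occA p l = outA p (≤-trans l (≡⇒≤ (GA p)))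

    occB : ∀ p → 0 < G (cell β p) → ∃ λ k → k < n × p ≡ ψ k
    occB p l = outB p (≤-trans l (G≤F₁ _))

    leA : ∀ k → k < n → G (cell α (ψ k)) ≤ a k
    leA k l = ≤-trans (≡⇒≤ (GA' k l)) (if≤ (K (ψ k)))

    leB : ∀ k → k < n → G (cell β (ψ k)) ≤ bG k
    leB k l = ≤-trans (≡⇒≤ (GB' k l)) (if≤ (K (ψ k)))

    KA : ∀ {z} → z < n → 0 < G (cell α (ψ z)) → K (ψ z) ≡ true
    KA {z} l p = ifK (K (ψ z)) (≤-trans p (≡⇒≤ (GA' z l)))

    KB : ∀ {z} → z < n → 0 < G (cell β (ψ z)) → K (ψ z) ≡ true
    KB {z} l p = ifK (K (ψ z)) (≤-trans p (≡⇒≤ (GB' z l)))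

    geA : ∀ k → k < n → K (ψ k) ≡ true → a k ≤ G (cell α (ψ k))
    geA k l q = ≡⇒≤ (sym (trans (GA' k l) (cong (λ c → if c then a k else 0) q)))

    geB : ∀ k → k < n → K (ψ k) ≡ true → bG k ≤ G (cell β (ψ k))
    geB k l q = ≡⇒≤ (sym (trans (GB' k l) (cong (λ c → if c then bG k else 0) q)))

    transferA : ∀ {d' d₁} → Chart d' d₁ n ψ → Chart d' d n ψ ⊎ Chart (opp d') d n ψ →
        (∀ z → rel (ε κ) d' z y' → LB κ d' a bG y' z) →
        (∀ {z k} → z < n → k < n → K (ψ z) ≡ true → z ≤[ d' ] k → k ≤[ d' ] y' → K (ψ k) ≡ true) →
        ∀ z → rel (ε κ) d₁ z (ψ y') → 0 < G (cell α z) → Transfer (ε κ) d₁ (λ p → G (cell α p)) (λ p → G (cell β p)) (ψ y') z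
    transferA c _ lb kb = transfer c y< (λ p → G (cell α p)) (λ p → G (cell β p)) lb occA leA
      (λ z k z< k< pos l m → geB k k< (kb z< k< (KA z< pos) l m))

    transferB : ∀ {d' d₁} → Chart d' d₁ n ψ → (∀ z → rel (ε κ) d' z y' → LB κ d' bG a y' z) →
        (∀ {z k} → z < n → k < n → K (ψ z) ≡ true → z ≤[ d' ] k → k ≤[ d' ] y' → K (ψ k) ≡ true) →
        ∀ z → rel (ε κ) d₁ z (ψ y') → 0 < G (cell β z) → Transfer (ε κ) d₁ (λ p → G (cell β p)) (λ p → G (cell α p)) (ψ y') z
    transferB c lb kb = transfer c y< (λ p → G (cell β p)) (λ p → G (cell α p)) lb occB leB
      (λ z k z< k< pos l m → geA k k< (kb z< k< (KB z< pos) l m))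

    setting : (d₁ : Dir) (A B : ℕ) → A <[ d₁ ] B → (∀ x → x ≤[ d₁ ] A ⊎ B ≤[ d₁ ] x) → Dir → Setting
    setting d₁ A B l ad dr = record { d = d₁ ; sc = sc ; sp = sp ; cr = cr ; po = po ; cell = cell ; cr-cell = cr-cell ; po-cell = po-cell
      ; cell-η = cell-η ; A = A ; B = B ; y = ψ y' ; A<B = l ; adj = ad ; G = G ; rank = rk dr M }

    adjᵒ : ∀ x → x ≤[ opp d ] β ⊎ α ≤[ opp d ] x
    adjᵒ x with adj x
    ... | inj₁ l = inj₂ (≤-opp d l)
    ... | inj₂ l = inj₁ (≤-opp d l)

    F₁≥1 : 1 ≤ F₁ u
    F₁≥1 rewrite inB y' y< | Ky = first-src κ f

    δ≤F₁ : ∀ c → δ u (proj₁ c) (proj₂ c) ≤ F₁ c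
    δ≤F₁ c with u ≟ₚ c
    ... | yes refl rewrite δ-refl u = F₁≥1
    ... | no neq rewrite δ-≢ u c neq = z≤n

    F₁≤ : ∀ c → F₁ c ≤ G c + δ u (proj₁ c) (proj₂ c)
    F₁≤ c = m≤n+m∸n' (F₁ c) (δ u (proj₁ c) (proj₂ c))
      where
      m≤n+m∸n' : ∀ m k → m ≤ (m ∸ k) + k
      m≤n+m∸n' m k = subst (m ≤_) (+-comm k (m ∸ k)) (m≤n+m∸n m k)

    F₂≡ : ∀ c → F₂ c ≡ G c + δ v (proj₁ c) (proj₂ c)
    F₂≡ c = +-cancelʳ-≡ (δ u (proj₁ c) (proj₂ c)) _ _ (trans (mv c) (trans (cong (_+ δ v (proj₁ c) (proj₂ c)) (sym (m∸n+n≡m (δ≤F₁ c))))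
      (lin≡ 3 (λ g u v → [] ⊢ g ⊕ u ⊕ v ≐ g ⊕ v ⊕ u) (G c) (δ u (proj₁ c) (proj₂ c)) (δ v (proj₁ c) (proj₂ c)))))

    F₁≥ : ∀ c → G c + δ u (proj₁ c) (proj₂ c) ≤ F₁ c
    F₁≥ c = ≡⇒≤ (m∸n+n≡m (δ≤F₁ c))

    rankA : ∀ d₁ {x z} → x <[ d₁ ] z → 0 < G (cell α x) → 0 < G (cell α z) → rk d₁ M x < rk d₁ M z
    rankA d₁ {x} {z} l p q = rk< d₁ M l (bound occA p) (bound occA q)
      where
      bound : ∀ {x} → (∀ p → 0 < G (cell α p) → ∃ λ k → k < n × p ≡ ψ k) → 0 < G (cell α x) → x < M
      bound o p = let (k , k< , e) = o _ p in subst (_< M) (sym e) (bnd k k<)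

    rankB : ∀ d₁ {x z} → x <[ d₁ ] z → 0 < G (cell β x) → 0 < G (cell β z) → rk d₁ M x < rk d₁ M z
    rankB d₁ {x} {z} l p q = rk< d₁ M l (bound occB p) (bound occB q)
      where
      bound : ∀ {x} → (∀ p → 0 < G (cell β p) → ∃ λ k → k < n × p ≡ ψ k) → 0 < G (cell β x) → x < M
      bound o p = let (k , k< , e) = o _ p in subst (_< M) (sym e) (bnd k k<)

    κwk : sp ≡ true → neg? sp ≡ ε κ → κ ≡ wk
    κwk refl = go κ
      where
      go : ∀ κ → false ≡ ε κ → κ ≡ wk
      go wk _ = refl

    G≤1 : κ ≡ wk → ∀ c → G c ≤ 1
    G≤1 k c = ≤-trans (G≤F₁ c) (one k c)

    opp-chart : ∀ d' → Chart (opp d') (opp d) n ψ → ∀ {z k} → z < n → k < n → K (ψ z) ≡ true → z ≤[ opp d' ] k → k ≤[ opp d' ] y' → K (ψ k) ≡ true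
    opp-chart d' c {z} {k} z< k< Kz l m = go d (Chart.mono≤ c z< k< l) (Chart.mono≤ c k< y< m)
      where
      go : ∀ d → ψ z ≤[ opp d ] ψ k → ψ k ≤[ opp d ] ψ y' → K (ψ k) ≡ true
      go dn p q = conv p q Kz Ky
      go up p q = conv q p Ky Kz

    weaken : ∀ {F F' : Pos → ℕ} {Rl k s} → (∀ c → F c ≤ F' c) → Better Rl F k s → Better Rl F' k s
    weaken h (fam , l , (w , use) , z) = fam , l , (w , λ c → ≤-trans (use c) (h c)) , z

  forward : Sub Rc F₁ F₂
  forward = go mode chart
    where
    go : Mode κ sc sp d' → Chart d' d n ψ → Sub Rc F₁ F₂
    go strict c fam (h , use) = weaken (λ w → ≡⇒≤ (sym (F₂≡ w))) (start T core fam (h , λ w → ≤-trans (use w) (F₁≤ w)))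
      where
      T = setting d α β α<β adj d
      module RS = RerouteStrict T refl
      core : ∀ C rest → AllPairs (Setting.Cmp T) (u ∷ C) → All (AllPairs (Setting.Cmp T)) rest → (∀ c → cnt c C + cntF c rest ≤ G c) → _
      core C rest hc hr us = RS.go br (rankA d) (suc (sumL (λ w → rk d M (po w)) C)) C rest
          (λ {w} i _ → s≤s (sumL-∈ (λ w → rk d M (po w)) i)) hc hr us
        where
        br : ∀ z → rel (ε κ) d z (ψ y') → 0 < G (cell α z) → RS.Bracket z
        br z l p = let t = transferA c (inj₁ c) before (λ z< k< → Kbetween up z< k< c) z l p in
          record { rsA = Transfer.Lg t ; rsB = Transfer.Lh t ; inB = Transfer.ofH t ; covA = Transfer.toG t ; uniqueB = Transfer.uniqueH t ; sums = Transfer.sums t }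
    go (weak eq) c fam (h , use) = weaken (λ w → ≡⇒≤ (sym (F₂≡ w))) (start T core fam (h , λ w → ≤-trans (use w) (F₁≤ w)))
      where
      T = setting d α β α<β adj (opp d)
      zeroA : sp ≡ true → G v ≡ 0
      zeroA q = trans (GA' y' y<) (trans (cong (λ c → if c then a y' else 0) Ky) (proj₁ (wk0 (κwk q eq))))
      module RW = RerouteWeak T refl zeroA (λ q x → G≤1 (κwk q eq) (cell α x))
      core : ∀ C rest → AllPairs (Setting.Cmp T) (u ∷ C) → All (AllPairs (Setting.Cmp T)) rest → (∀ c → cnt c C + cntF c rest ≤ G c) → _
      core C rest hc hr us = RW.go br (λ l p q → rankB (opp d) (<-opp d l) q p) (suc (sumL (λ w → rk (opp d) M (po w)) C)) C rest
          (λ {w} i _ → s≤s (sumL-∈ (λ w → rk (opp d) M (po w)) i)) hc hr us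
        where
        br : ∀ z → rel (neg? sp) d z (ψ y') → 0 < G (cell β z) → RW.Bracket z
        br z l p = let t = transferB c after (λ z< k< → Kbetween dn z< k< c) z (subst (λ s → rel s d z (ψ y')) eq l) p in
          record { rsA = Transfer.Lh t ; rsB = Transfer.Lg t ; inA = λ i → let (p , q) = Transfer.ofH t i in subst (λ s → rel s d z _) (sym eq) p , q
                 ; covB = λ s p q → Transfer.toG t s p (subst (λ w → rel w d s (ψ y')) eq q) ; uniqueA = Transfer.uniqueH t ; sums = Transfer.sums t }

  -- With all orders reversed the unit again crosses from the farther line to the nearer one. The
  -- rerouting is the same, with `before` and `after` exchanged.
  backward : Sub Rc F₂ F₁
  backward = go mode chart
    where
    ro : ∀ {c e} → Setting.Cmp (setting (opp d) β α (<-opp d α<β) adjᵒ d) c e → Rc c e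
    ro (inj₁ (p , q)) = inj₂ (rel-opp' sc d p , rel-opp' sp d q)
    ro (inj₂ (p , q)) = inj₁ (rel-opp' sc d p , rel-opp' sp d q)
    or : ∀ {c e} → Rc c e → Setting.Cmp (setting (opp d) β α (<-opp d α<β) adjᵒ d) c e
    or (inj₁ (p , q)) = inj₂ (rel-opp sc d p , rel-opp sp d q)
    or (inj₂ (p , q)) = inj₁ (rel-opp sc d p , rel-opp sp d q)
    go : Mode κ sc sp d' → Chart d' d n ψ → Sub Rc F₂ F₁
    go strict c = Sub-rel ro or (λ fam (h , use) → weaken F₁≥ (start T core fam (h , λ w → ≤-trans (use w) (≡⇒≤ (F₂≡ w)))))
      where
      T = setting (opp d) β α (<-opp d α<β) adjᵒ (opp d)
      module RS = RerouteStrict T refl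
      core : ∀ C rest → AllPairs (Setting.Cmp T) (v ∷ C) → All (AllPairs (Setting.Cmp T)) rest → (∀ c → cnt c C + cntF c rest ≤ G c) → _
      core C rest hc hr us = RS.go br (rankB (opp d)) (suc (sumL (λ w → rk (opp d) M (po w)) C)) C rest
          (λ {w} i _ → s≤s (sumL-∈ (λ w → rk (opp d) M (po w)) i)) hc hr us
        where
        br : ∀ z → rel (ε κ) (opp d) z (ψ y') → 0 < G (cell β z) → RS.Bracket z
        br z l p = let t = transferB (Chart-opp c) after (opp-chart up (Chart-opp c)) z l p in
          record { rsA = Transfer.Lg t ; rsB = Transfer.Lh t ; inB = Transfer.ofH t ; covA = Transfer.toG t ; uniqueB = Transfer.uniqueH t ; sums = Transfer.sums t }
    go (weak eq) c = Sub-rel ro or (λ fam (h , use) → weaken F₁≥ (start T core fam (h , λ w → ≤-trans (use w) (≡⇒≤ (F₂≡ w)))))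
      where
      T = setting (opp d) β α (<-opp d α<β) adjᵒ d
      by' : κ ≡ wk → bG y' ≡ 0
      by' q rewrite proj₂ (wk0 q) | e-refl y' = refl
      zeroA : sp ≡ true → G u ≡ 0
      zeroA q = trans (GB' y' y<) (trans (cong (λ c → if c then bG y' else 0) Ky) (by' (κwk q eq)))
      module RW = RerouteWeak T refl zeroA (λ q x → G≤1 (κwk q eq) (cell β x))
      core : ∀ C rest → AllPairs (Setting.Cmp T) (v ∷ C) → All (AllPairs (Setting.Cmp T)) rest → (∀ c → cnt c C + cntF c rest ≤ G c) → _
      core C rest hc hr us = RW.go br (λ l p q → rankA d (<-opp' d l) q p) (suc (sumL (λ w → rk d M (po w)) C)) C rest
          (λ {w} i _ → s≤s (sumL-∈ (λ w → rk d M (po w)) i)) hc hr us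
        where
        br : ∀ z → rel (neg? sp) (opp d) z (ψ y') → 0 < G (cell α z) → RW.Bracket z
        br z l p = let t = transferA (Chart-opp c) (inj₂ c) before (opp-chart dn (Chart-opp c)) z (subst (λ s → rel s (opp d) z (ψ y')) eq l) p in
          record { rsA = Transfer.Lh t ; rsB = Transfer.Lg t ; inA = λ i → let (p , q) = Transfer.ofH t i in subst (λ s → rel s (opp d) z _) (sym eq) p , q
                 ; covB = λ s p q → Transfer.toG t s p (subst (λ w → rel w (opp d) s (ψ y')) eq q) ; uniqueA = Transfer.uniqueH t ; sums = Transfer.sums t }

-- Boxes of a filling as matrices, for the four types of chains

open import Defs using (ChainType; ne; NE; nE; Ne; Partition; partSum; Shape)

sX sY : ChainType → Bool
sX ne = true
sX NE = false
sX nE = false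
sX Ne = true
sY ne = true
sY NE = false
sY nE = true
sY Ne = false

StepT CmpT : ChainType → Pos → Pos → Set
StepT t c e = rel (sX t) up (proj₁ c) (proj₁ e) × rel (sY t) up (proj₂ c) (proj₂ e)
CmpT t c e = StepT t c e ⊎ StepT t e c

-- The crystal structure used for the columns of a filling; for weak chains the window is read upside down.
kind : ChainType → Kind
kind ne = st
kind NE = st
kind nE = wk
kind Ne = wk

φ : ChainType → ℕ → ℕ → ℕ
φ ne n k = k
φ Ne n k = k
φ NE n k = rv n k
φ nE n k = rv n k

φ< : ∀ t {n k} → k < n → φ t n k < n
φ< ne l = l
φ< Ne l = l
φ< NE l = rv< l
φ< nE l = rv< l

φ-inv : ∀ t {n k} → k < n → φ t n (φ t n k) ≡ k
φ-inv ne l = refl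
φ-inv Ne l = refl
φ-inv NE l = rv-inv l
φ-inv nE l = rv-inv l

Grid : Set
Grid = ℕ → ℕ → ℕ

at : Grid → Pos → ℕ
at F c = F (proj₁ c) (proj₂ c)

res : (J K : ℕ → Bool) → Grid → Grid
res J K F x y = if J x ∧ K y then F x y else 0

InW : ℕ → ℕ → ℕ → Set
InW l w x = l ≤ x × x < l + w

InW-offset : ∀ {l w x} → InW l w x → x ∸ l < w
InW-offset {l} {w} (p , q) = +-cancelˡ-< l _ _ (subst (_< l + w) (sym (m+[n∸m]≡n p)) q)

inW? : ∀ l w x → Dec (InW l w x)
inW? l w x = (l ≤? x) ×-dec (x <? l + w)

record Box : Set where
  constructor box
  field
    l w b n : ℕ

module Window (t : ChainType) (Bx : Box) where
  open Box Bx

  W : Grid → Mat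
  W F i k with i <? w | k <? n
  ... | yes _ | yes _ = F (l + i) (b + φ t n k)
  ... | _ | _ = 0

  W-in : ∀ F {i k} → i < w → k < n → W F i k ≡ F (l + i) (b + φ t n k)
  W-in F {i} {k} p q with i <? w | k <? n
  ... | yes _ | yes _ = refl
  ... | no r | _ = ⊥-elim (r p)
  ... | yes _ | no r = ⊥-elim (r q)

  W-Win : ∀ F → Win w n (W F)
  W-Win F i k m with i <? w | k <? n
  ... | no _ | _ = refl
  ... | yes _ | no _ = refl
  W-Win F i k (inj₁ m) | yes p | yes q = ⊥-elim (<⇒≱ p m)
  W-Win F i k (inj₂ m) | yes p | yes q = ⊥-elim (<⇒≱ q m)

  E : Grid → Mat → Grid
  E H X x y with inW? l w x | inW? b n y
  ... | yes _ | yes _ = X (x ∸ l) (φ t n (y ∸ b))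
  ... | _ | _ = H x y

  E-in : ∀ H X {x y} → InW l w x → InW b n y → E H X x y ≡ X (x ∸ l) (φ t n (y ∸ b))
  E-in H X {x} {y} p q with inW? l w x | inW? b n y
  ... | yes _ | yes _ = refl
  ... | no r | _ = ⊥-elim (r p)
  ... | yes _ | no r = ⊥-elim (r q)

  E-out : ∀ H X {x y} → ¬ (InW l w x × InW b n y) → E H X x y ≡ H x y
  E-out H X {x} {y} p with inW? l w x | inW? b n y
  ... | yes q | yes q' = ⊥-elim (p (q , q'))
  ... | no r | _ = refl
  ... | yes _ | no r = refl

  E-cong : ∀ {H X X'} → X ≈ X' → ∀ x y → E H X x y ≡ E H X' x y
  E-cong p x y with inW? l w x | inW? b n y
  ... | yes _ | yes _ = p _ _
  ... | no _ | _ = refl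
  ... | yes _ | no _ = refl

  cellOf : ∀ {i k} → i < w → k < n → InW l w (l + i) × InW b n (b + φ t n k)
  cellOf {i} {k} p q = (m≤m+n l i , +-monoʳ-< l p) , (m≤m+n b _ , +-monoʳ-< b (φ< t q))

  E-at : ∀ H X {i k} → i < w → k < n → E H X (l + i) (b + φ t n k) ≡ X i k
  E-at H X {i} {k} p q = trans (E-in H X (proj₁ (cellOf p q)) (proj₂ (cellOf p q)))
    (cong₂ X (m+n∸m≡n l i) (trans (cong (φ t n) (m+n∸m≡n b _)) (φ-inv t q)))

  E-W : ∀ F x y → E F (W F) x y ≡ F x y
  E-W F x y with inW? l w x | inW? b n y
  ... | no _ | _ = refl
  ... | yes _ | no _ = refl
  ... | yes (p , p') | yes (q , q') = trans (W-in F x< (φ< t y<))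
      (cong₂ F (m+[n∸m]≡n p) (trans (cong (b +_) (φ-inv t y<)) (m+[n∸m]≡n q)))
    where
    x< : x ∸ l < w
    x< = +-cancelˡ-< l _ _ (subst (_< l + w) (sym (m+[n∸m]≡n p)) p')
    y< : y ∸ b < n
    y< = +-cancelˡ-< b _ _ (subst (_< b + n) (sym (m+[n∸m]≡n q)) q')

  E-Mv : ∀ {H X X' i k i' k'} → i < w → k < n → i' < w → k' < n → Mv (i , k) (i' , k') X X' → ∀ x y →
      E H X' x y + δ (l + i , b + φ t n k) x y ≡ E H X x y + δ (l + i' , b + φ t n k') x y
  E-Mv {H} {X} {X'} {i} {k} {i'} {k'} p q p' q' m x y with inW? l w x | inW? b n y
  ... | no r | _ = cong (H x y +_) (trans (δout p q (λ z → r (proj₁ z))) (sym (δout p' q' (λ z → r (proj₁ z)))))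
    where
    δout : ∀ {i k} → i < w → k < n → ¬ (InW l w x × InW b n y) → δ (l + i , b + φ t n k) x y ≡ 0
    δout {i} {k} p q nin = δ-≢ (l + i , b + φ t n k) (x , y) (λ { refl → nin (cellOf p q) })
  ... | yes _ | no r = cong (H x y +_) (trans (δout p q (λ z → r (proj₂ z))) (sym (δout p' q' (λ z → r (proj₂ z)))))
    where
    δout : ∀ {i k} → i < w → k < n → ¬ (InW l w x × InW b n y) → δ (l + i , b + φ t n k) x y ≡ 0
    δout {i} {k} p q nin = δ-≢ (l + i , b + φ t n k) (x , y) (λ { refl → nin (cellOf p q) })
  ... | yes (u , u') | yes (v , v') = trans (cong (X' x° y° +_) (δin p q)) (trans (un m x° y°) (cong (X x° y° +_) (sym (δin p' q'))))
    where
    x° = x ∸ l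
    y° = φ t n (y ∸ b)
    y< : y ∸ b < n
    y< = +-cancelˡ-< b _ _ (subst (_< b + n) (sym (m+[n∸m]≡n v)) v')
    δin : ∀ {i k} → i < w → k < n → δ (l + i , b + φ t n k) x y ≡ δ (i , k) (x ∸ l) (φ t n (y ∸ b))
    δin {i} {k} p q with (i , k) ≟ₚ (x ∸ l , φ t n (y ∸ b))
    ... | yes refl = trans (cong (λ c → δ c x y) (cong₂ _,_ (m+[n∸m]≡n u) (trans (cong (b +_) (φ-inv t y<)) (m+[n∸m]≡n v)))) (trans (δ-refl (x , y)) (sym (δ-refl (i , k))))
    ... | no neq = trans (δ-≢ (l + i , b + φ t n k) (x , y) (λ { refl → neq (cong₂ _,_ (sym (m+n∸m≡n l i)) (trans (sym (φ-inv t q)) (cong (φ t n) (sym (m+n∸m≡n b _))))) })) (sym (δ-≢ (i , k) (x ∸ l , φ t n (y ∸ b)) neq))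

≡⇒Sub : ∀ {R F F'} → (∀ c → F c ≡ F' c) → Sub R F F'
≡⇒Sub h = Sub-≤ (λ c → ≡⇒≤ (h c))

Both : (Pos → Pos → Set) → (F F' : Pos → ℕ) → Set
Both R F F' = Sub R F F' × Sub R F' F

Both-trans : ∀ {R F F' F''} → Both R F F' → Both R F' F'' → Both R F F''
Both-trans (p , q) (p' , q') = Sub-trans p p' , Sub-trans q' q

Both-sym : ∀ {R F F'} → Both R F F' → Both R F' F
Both-sym (p , q) = q , p

≡⇒Both : ∀ {R F F'} → (∀ c → F c ≡ F' c) → Both R F F'
≡⇒Both h = ≡⇒Sub h , ≡⇒Sub (λ c → sym (h c))

res-cong : ∀ J K {F F'} → (∀ x y → J x ≡ true → K y ≡ true → F x y ≡ F' x y) → ∀ c → at (res J K F) c ≡ at (res J K F') c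
res-cong J K h (x , y) with J x in p | K y in q
... | true | true = h x y p q
... | true | false = refl
... | false | _ = refl

res-Mv : ∀ J K {F F' s d} → J (proj₁ s) ≡ true → K (proj₂ s) ≡ true → J (proj₁ d) ≡ true → K (proj₂ d) ≡ true →
    (∀ x y → F' x y + δ s x y ≡ F x y + δ d x y) →
    ∀ c → at (res J K F') c + δ s (proj₁ c) (proj₂ c) ≡ at (res J K F) c + δ d (proj₁ c) (proj₂ c)
res-Mv J K {F} {F'} {s} {d} js ks jd kd h (x , y) with J x in p | K y in q
... | true | true = h x y
... | true | false = trans (off s js ks) (sym (off d jd kd))
  where
  off : ∀ s → J (proj₁ s) ≡ true → K (proj₂ s) ≡ true → δ s x y ≡ 0
  off s j k = δ-≢ s (x , y) (λ { refl → contr (trans (sym k) q) })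
    where
    contr : true ≡ false → ⊥
    contr ()
... | false | _ = trans (off s js ks) (sym (off d jd kd))
  where
  off : ∀ s → J (proj₁ s) ≡ true → K (proj₂ s) ≡ true → δ s x y ≡ 0
  off s j k = δ-≢ s (x , y) (λ { refl → contr (trans (sym j) p) })
    where
    contr : true ≡ false → ⊥
    contr ()

Convex : (ℕ → Bool) → Set
Convex K = ∀ {k l m} → k ≤ l → l ≤ m → K k ≡ true → K m ≡ true → K l ≡ true

shift-chart : ∀ d l w → Chart d d w (l +_)
shift-chart d l w = record { mono = λ _ _ → mono d ; surj = surj d }
  where
  mono : ∀ d {k m} → k <[ d ] m → (l + k) <[ d ] (l + m)
  mono up p = +-monoʳ-< l p
  mono dn p = +-monoʳ-< l p
  mid : ∀ {k m} p → m < w → l + k ≤ p → p ≤ l + m → ∃ λ x → x < w × p ≡ l + x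
  mid {k} {m} p m< u v = p ∸ l , ≤-trans (s≤s (≤-trans (∸-monoˡ-≤ l v) (≡⇒≤ (m+n∸m≡n l m)))) m< , sym (m+[n∸m]≡n (≤-trans (m≤m+n l k) u))
  surj : ∀ d {k m} p → k < w → m < w → (l + k) ≤[ d ] p → p ≤[ d ] (l + m) → ∃ λ x → x < w × p ≡ l + x
  surj up p k< m< u v = mid p m< u v
  surj dn p k< m< u v = mid p k< v u

rv-chart : ∀ b n → Chart dn up n (λ k → b + rv n k)
rv-chart b n = record { mono = λ p q l → +-monoʳ-< b (rv-anti l p) ; surj = surj }
  where
  surj : ∀ {k m} p → k < n → m < n → b + rv n k ≤ p → p ≤ b + rv n m → ∃ λ x → x < n × p ≡ b + rv n x
  surj {k} {m} p k< m< u v = rv n (p ∸ b) , rv< p< , trans (sym (m+[n∸m]≡n (≤-trans (m≤m+n b _) u))) (cong (b +_) (sym (rv-inv p<)))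
    where
    p< : p ∸ b < n
    p< = ≤-trans (s≤s (≤-trans (∸-monoˡ-≤ b v) (≡⇒≤ (m+n∸m≡n b _)))) (rv< m<)

adj-up : ∀ α x → x ≤ α ⊎ suc α ≤ x
adj-up α x = ≤-<-connex x α

adj-dn : ∀ β x → suc β ≤ x ⊎ x ≤ β
adj-dn β x with ≤-<-connex x β
... | inj₁ l = inj₂ l
... | inj₂ l = inj₁ l

false≢true : false ≢ true
false≢true ()

if-pos : ∀ c {x : ℕ} → 0 < (if c then x else 0) → c ≡ true
if-pos true _ = refl

∧-true : ∀ {a b} → a ∧ b ≡ true → a ≡ true × b ≡ true
∧-true {true} {true} _ = refl , refl

wk-of : ∀ κ {a b y} → Adm κ (λ _ → b) → FMκ κ a b y → κ ≡ wk → a y ≡ 0 × b y ≡ 1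
wk-of wk {a} {b} z f refl = wk-vals {a} {b} (λ k → z 0 k) f

module Edges (t : ChainType) (Bx : Box) (H : Grid) (hz : kind t ≡ wk → ∀ x y → H x y ≤ 1) where
  open Box Bx
  open Window t Bx

  private
    κ = kind t

    E-one : ∀ {X} → Adm κ X → κ ≡ wk → ∀ x y → E H X x y ≤ 1
    E-one {X} ad q x y with inW? l w x | inW? b n y
    ... | yes _ | yes _ = adm q ad _ _
      where
      adm : ∀ {κ} → κ ≡ wk → Adm κ X → ∀ i k → X i k ≤ 1
      adm refl z = z
    ... | no _ | _ = hz q x y
    ... | yes _ | no _ = hz q x y

    res-one : ∀ J K {X} → Adm κ X → κ ≡ wk → ∀ c → at (res J K (E H X)) c ≤ 1
    res-one J K ad q (x , y) with J x ∧ K y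
    ... | true = E-one ad q x y
    ... | false = z≤n

  -- The rows of the rectangle are an interval of those of the box. If it misses the row of the
  -- moved unit, nothing visible happens; otherwise source and target are both visible and
  -- `LineEdge` applies.
  module ColumnEdge (J K : ℕ → Bool) (JW : ∀ x → InW l w x → J x ≡ true) (Kc : Convex K) (KI : ∀ y → K y ≡ true → InW b n y)
      {j X X'} (g : Good κ w n X) (c : C κ j X X') where
    private
      y' = C.at c
      src = C-src κ (proj₁ g) c
      j<' = <⇒≤ (proj₁ src)
      y< = proj₂ src

      line : ∀ i → i < w → ∀ k → k < n → at (res J K (E H X)) (l + i , b + φ t n k) ≡ (if K (b + φ t n k) then X i k else 0)
      line i i< k k< rewrite JW (l + i) (m≤m+n l i , +-monoʳ-< l i<) with K (b + φ t n k)
      ... | true = E-at H X i< k<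
      ... | false = refl

      out : ∀ x p → 0 < at (res J K (E H X)) (x , p) → ∃ λ k → k < n × p ≡ b + φ t n k
      out x p pos with KI p (proj₂ (∧-true {J x} (if-pos (J x ∧ K p) pos)))
      ... | u , v = φ t n (p ∸ b) , φ< t p< , trans (sym (m+[n∸m]≡n u)) (cong (b +_) (sym (φ-inv t p<)))
        where
        p< : p ∸ b < n
        p< = InW-offset (u , v)

      wkX : κ ≡ wk → X j y' ≡ 0 × X (suc j) y' ≡ 1
      wkX = wk-of κ (adm κ (proj₂ g)) (C.first c)
        where
        adm : ∀ κ → Adm κ X → Adm κ (λ _ → X (suc j))
        adm st _ = tt
        adm wk z i k = z (suc j) k

      same : K (b + φ t n y') ≡ false → ∀ w' → at (res J K (E H X)) w' ≡ at (res J K (E H X')) w'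
      same kf = res-cong J K (λ x y _ ky → sym (+-cancelʳ-≡ 0 _ _
        (trans (cong (E H X' x y +_) (sym (δ-≢ (l + suc j , b + φ t n y') (x , y) (λ { refl → false≢true (trans (sym kf) ky) }))))
        (trans (E-Mv (proj₁ src) y< j<' y< (C.mv c) x y)
        (cong (E H X x y +_) (δ-≢ (l + j , b + φ t n y') (x , y) (λ { refl → false≢true (trans (sym kf) ky) })))))))

      mv' : K (b + φ t n y') ≡ true → ∀ w' → at (res J K (E H X')) w' + δ (l + suc j , b + φ t n y') (proj₁ w') (proj₂ w')
          ≡ at (res J K (E H X)) w' + δ (l + j , b + φ t n y') (proj₁ w') (proj₂ w')
      mv' kt = res-Mv J K (JW _ (m≤m+n l _ , +-monoʳ-< l (proj₁ src))) kt (JW _ (m≤m+n l j , +-monoʳ-< l j<')) kt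
          (E-Mv (proj₁ src) y< j<' y< (C.mv c))

      module LE {sp sc d'} (mode : Mode κ sc sp d') (chart : Chart d' up n (λ k → b + φ t n k)) (kt : K (b + φ t n y') ≡ true) =
        LineEdge xy κ sc sp d' up mode (l + j) (l + suc j) (+-monoʳ-< l (n<1+n j)) (λ x → subst (λ z → x ≤ l + j ⊎ z ≤ x) (sym (+-suc l j)) (adj-up (l + j) x))
          n (λ k → b + φ t n k) chart (b + n) (λ k k< → +-monoʳ-< b (φ< t k<))
          (X j) (X (suc j)) y' y< (C.first c) wkX (at (res J K (E H X))) (at (res J K (E H X'))) K Kc
          (line j j<') (line (suc j) (proj₁ src)) (out (l + j)) (out (l + suc j)) (res-one J K (proj₂ g)) kt (mv' kt)

    result : Both (CmpT t) (at (res J K (E H X))) (at (res J K (E H X')))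
    result with K (b + φ t n y') in eq
    ... | false = ≡⇒Both (same eq)
    ... | true = main
      where
      main : Both (CmpT t) (at (res J K (E H X))) (at (res J K (E H X')))
      main = go t refl
        where
        go : ∀ t' → t' ≡ t → Both (CmpT t) (at (res J K (E H X))) (at (res J K (E H X')))
        go ne refl = LE.forward strict (shift-chart up b n) eq , LE.backward strict (shift-chart up b n) eq
        go Ne refl = LE.forward strict (shift-chart up b n) eq , LE.backward strict (shift-chart up b n) eq
        go NE refl = LE.forward (weak refl) (rv-chart b n) eq , LE.backward (weak refl) (rv-chart b n) eq
        go nE refl = LE.forward (weak refl) (rv-chart b n) eq , LE.backward (weak refl) (rv-chart b n) eq

  module RowEdge (J K : ℕ → Bool) (JW : ∀ x → J x ≡ true → InW l w x) (Jc : Convex J) (KI : ∀ y → InW b n y → K y ≡ true)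
      {i X X'} (g : Good κ w n X) (r : R κ n i X X') where
    private
      x' = R.at r
      bd = R.bound r
      x< = proj₁ (R-src κ (proj₁ g) r)
      from< = proj₂ (R-src κ (proj₁ g) r)
      to< = rowTo< κ bd

      line : ∀ k → k < n → ∀ i → i < w → at (res J K (E H X)) (l + i , b + φ t n k) ≡ (if J (l + i) then X i k else 0)
      line k k< i i< rewrite KI (b + φ t n k) (m≤m+n b _ , +-monoʳ-< b (φ< t k<)) with J (l + i)
      ... | true = E-at H X i< k<
      ... | false = refl

      out : ∀ y p → 0 < at (res J K (E H X)) (p , y) → ∃ λ k → k < w × p ≡ l + k
      out y p pos with JW p (proj₁ (∧-true {J p} (if-pos (J p ∧ K y) pos)))
      ... | u , v = p ∸ l , InW-offset (u , v) , sym (m+[n∸m]≡n u)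

      wkX : κ ≡ wk → X x' (rowTo κ i) ≡ 0 × X x' (rowFrom κ i) ≡ 1
      wkX = wk-of κ (adm κ (proj₂ g)) (R.first r)
        where
        adm : ∀ κ → Adm κ X → Adm κ (λ _ → tr X (rowFrom κ i))
        adm st _ = tt
        adm wk z _ k = z k _

      from to : ℕ
      from = b + φ t n (rowFrom κ i)
      to = b + φ t n (rowTo κ i)

      same : J (l + x') ≡ false → ∀ w' → at (res J K (E H X)) w' ≡ at (res J K (E H X')) w'
      same kf = res-cong J K (λ x y jx _ → sym (+-cancelʳ-≡ 0 _ _
        (trans (cong (E H X' x y +_) (sym (δ-≢ (l + x' , from) (x , y) (λ { refl → false≢true (trans (sym kf) jx) }))))
        (trans (E-Mv x< from< x< to< (R.mv r) x y)
        (cong (E H X x y +_) (δ-≢ (l + x' , to) (x , y) (λ { refl → false≢true (trans (sym kf) jx) })))))))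

      mv' : J (l + x') ≡ true → ∀ w' → at (res J K (E H X')) w' + δ (l + x' , from) (proj₁ w') (proj₂ w')
          ≡ at (res J K (E H X)) w' + δ (l + x' , to) (proj₁ w') (proj₂ w')
      mv' kt = res-Mv J K kt (KI _ (m≤m+n b _ , +-monoʳ-< b (φ< t from<))) kt (KI _ (m≤m+n b _ , +-monoʳ-< b (φ< t to<)))
          (E-Mv x< from< x< to< (R.mv r))

      module LE {sp sc d'} (mode : Mode κ sc sp d') (d : Dir) (chart : Chart d' d w (l +_))
          (lt' : to <[ d ] from) (ad : ∀ x → x ≤[ d ] to ⊎ from ≤[ d ] x) (kt : J (l + x') ≡ true) =
        LineEdge yx κ sc sp d' d mode to from lt' ad
          w (l +_) chart (l + w) (λ k k< → +-monoʳ-< l k<)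
          (tr X (rowTo κ i)) (tr X (rowFrom κ i)) x' x< (R.first r) wkX (at (res J K (E H X))) (at (res J K (E H X'))) J Jc
          (line _ to<) (line _ from<) (out to) (out from) (res-one J K (proj₂ g)) kt (mv' kt)

    private
      go : ∀ t' → t' ≡ t → J (l + x') ≡ true → Both (CmpT t) (at (res J K (E H X))) (at (res J K (E H X')))
      go ne refl eq = Sub-rel f f' (LE.forward strict up (shift-chart up l w) lt₁ ad eq) , Sub-rel f f' (LE.backward strict up (shift-chart up l w) lt₁ ad eq)
        where
        f : ∀ {c e} → _ → CmpT t c e
        f (inj₁ (p , q)) = inj₁ (q , p)
        f (inj₂ (p , q)) = inj₂ (q , p)
        f' : ∀ {c e} → CmpT t c e → _
        f' (inj₁ (p , q)) = inj₁ (q , p)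
        f' (inj₂ (p , q)) = inj₂ (q , p)
        lt₁ = +-monoʳ-< b (n<1+n i)
        ad : ∀ x → x ≤ b + i ⊎ b + suc i ≤ x
        ad x = subst (λ z → x ≤ b + i ⊎ z ≤ x) (sym (+-suc b i)) (adj-up (b + i) x)
      go nE refl eq = Sub-rel f f' (LE.forward strict up (shift-chart up l w) lt₁ ad eq) , Sub-rel f f' (LE.backward strict up (shift-chart up l w) lt₁ ad eq)
        where
        f : ∀ {c e} → _ → CmpT t c e
        f (inj₁ (p , q)) = inj₁ (q , p)
        f (inj₂ (p , q)) = inj₂ (q , p)
        f' : ∀ {c e} → CmpT t c e → _
        f' (inj₁ (p , q)) = inj₁ (q , p)
        f' (inj₂ (p , q)) = inj₂ (q , p)
        lt₁ = +-monoʳ-< b (rv-anti (n<1+n i) bd)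
        ad : ∀ x → x ≤ b + rv n (suc i) ⊎ b + rv n i ≤ x
        ad x = subst (λ z → x ≤ b + rv n (suc i) ⊎ z ≤ x) (trans (sym (+-suc b _)) (cong (b +_) (rv-suc bd))) (adj-up (b + rv n (suc i)) x)
      go NE refl eq = Sub-rel f f' (LE.forward (weak refl) dn (shift-chart dn l w) lt₁ ad eq) , Sub-rel f f' (LE.backward (weak refl) dn (shift-chart dn l w) lt₁ ad eq)
        where
        f : ∀ {c e} → _ → CmpT t c e
        f (inj₁ (p , q)) = inj₂ (q , p)
        f (inj₂ (p , q)) = inj₁ (q , p)
        f' : ∀ {c e} → CmpT t c e → _
        f' (inj₁ (p , q)) = inj₂ (q , p)
        f' (inj₂ (p , q)) = inj₁ (q , p)
        lt₁ = +-monoʳ-< b (rv-anti (n<1+n i) bd)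
        ad : ∀ x → b + rv n i ≤ x ⊎ x ≤ b + rv n (suc i)
        ad x = subst (λ z → z ≤ x ⊎ x ≤ b + rv n (suc i)) (trans (sym (+-suc b _)) (cong (b +_) (rv-suc bd))) (adj-dn (b + rv n (suc i)) x)
      go Ne refl eq = Sub-rel f f' (LE.forward (weak refl) dn (shift-chart dn l w) lt₁ ad eq) , Sub-rel f f' (LE.backward (weak refl) dn (shift-chart dn l w) lt₁ ad eq)
        where
        f : ∀ {c e} → _ → CmpT t c e
        f (inj₁ (p , q)) = inj₂ (q , p)
        f (inj₂ (p , q)) = inj₁ (q , p)
        f' : ∀ {c e} → CmpT t c e → _
        f' (inj₁ (p , q)) = inj₂ (q , p)
        f' (inj₂ (p , q)) = inj₁ (q , p)
        lt₁ = +-monoʳ-< b (n<1+n i)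
        ad : ∀ x → b + suc i ≤ x ⊎ x ≤ b + i
        ad x = subst (λ z → z ≤ x ⊎ x ≤ b + i) (sym (+-suc b i)) (adj-dn (b + i) x)

    result : Both (CmpT t) (at (res J K (E H X))) (at (res J K (E H X')))
    result with J (l + x') in eq
    ... | false = ≡⇒Both (same eq)
    ... | true = go t refl eq

  CZ-Both : ∀ J K → (∀ x → InW l w x → J x ≡ true) → Convex K → (∀ y → K y ≡ true → InW b n y) →
      ∀ {X X'} → Good κ w n X → NF.CZ κ w n X X' → Both (CmpT t) (at (res J K (E H X))) (at (res J K (E H X')))
  CZ-Both J K jw kc ki g (done p) = ≡⇒Both (res-cong J K (λ x y _ _ → E-cong p x y))
  CZ-Both J K jw kc ki g (fwd c z) = Both-trans (ColumnEdge.result J K jw kc ki g c) (CZ-Both J K jw kc ki (C-Good κ g c) z)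
  CZ-Both J K jw kc ki g (bwd g' c z) = Both-trans (Both-sym (ColumnEdge.result J K jw kc ki g' c)) (CZ-Both J K jw kc ki g' z)

  RZ-Both : ∀ J K → (∀ x → J x ≡ true → InW l w x) → Convex J → (∀ y → InW b n y → K y ≡ true) →
      ∀ {X X'} → Good κ w n X → NF.RZ κ w n X X' → Both (CmpT t) (at (res J K (E H X))) (at (res J K (E H X')))
  RZ-Both J K jw jc ki g (done p) = ≡⇒Both (res-cong J K (λ x y _ _ → E-cong p x y))
  RZ-Both J K jw jc ki g (fwd c z) = Both-trans (RowEdge.result J K jw jc ki g c) (RZ-Both J K jw jc ki (R-Good κ g c) z)
  RZ-Both J K jw jc ki g (bwd g' c z) = Both-trans (Both-sym (RowEdge.result J K jw jc ki g' c)) (RZ-Both J K jw jc ki g' z)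

-- Relabelling cells: transposition and shifts

SubR : (R R' : Pos → Pos → Set) → (F F' : Pos → ℕ) → Set
SubR R R' F F' = ∀ fam → Valid R F fam → Better R' F' (length fam) (size fam)

SubR-trans : ∀ {R R' R'' F F' F''} → SubR R R' F F' → SubR R' R'' F' F'' → SubR R R'' F F''
SubR-trans s s' fam v = let (fam' , l , v' , z) = s fam v ; (fam'' , l' , v'' , z') = s' fam' v' in
  fam'' , trans l' l , v'' , ≤-trans z z'

Sub-map : ∀ {R R' : Pos → Pos → Set} {F F' : Pos → ℕ} (g g⁻ : Pos → Pos) →
    (∀ {c e} → 0 < F c → 0 < F e → R c e → R' (g c) (g e)) →
    (∀ c → 0 < F c → g⁻ (g c) ≡ c) → (∀ c → 0 < F c → F c ≤ F' (g c)) → SubR R R' F F'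
Sub-map {R} {R'} {F} {F'} g g⁻ mono inv le fam (h , use) =
    map (map g) fam , len fam , (chains fam h (λ c i → pos c fam i) , λ c' → ≤-trans (bound c' fam (λ c i → pos c fam i)) (fin c')) , ≡⇒≤ (sym (siz fam))
  where
  member : Pos → List (List Pos) → Set
  member c fam = 0 < cntF c fam
  pos : ∀ c fam' → 0 < cntF c fam → 0 < F c
  pos c fam' i = ≤-trans i (use c)
  len : ∀ fam → length (map (map g) fam) ≡ length fam
  len [] = refl
  len (x ∷ fam) = cong suc (len fam)
  lenmap : ∀ (xs : List Pos) → length (map g xs) ≡ length xs
  lenmap [] = refl
  lenmap (x ∷ xs) = cong suc (lenmap xs)
  siz : ∀ fam → size (map (map g) fam) ≡ size fam
  siz [] = refl
  siz (x ∷ fam) = cong₂ _+_ (lenmap x) (siz fam)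
  cntF-∈ : ∀ {c C fam} → C ∈ fam → c ∈ C → 0 < cntF c fam
  cntF-∈ (here refl) j = ≤-trans (cnt-∈ j) (m≤m+n _ _)
  cntF-∈ (there i) j = ≤-trans (cntF-∈ i j) (m≤n+m _ _)
  all-map : ∀ {P : Pos → Set} xs → (∀ {x} → x ∈ xs → P (g x)) → All P (map g xs)
  all-map [] f = []
  all-map (x ∷ xs) f = f (here refl) ∷ all-map xs (f ∘ there)
  chain : ∀ xs → AllPairs R xs → (∀ {x} → x ∈ xs → 0 < F x) → AllPairs R' (map g xs)
  chain [] [] f = []
  chain (x ∷ xs) (p ∷ ps) f = all-map xs (λ i → mono (f (here refl)) (f (there i)) (All.lookup p i)) ∷ chain xs ps (f ∘ there)
  chains : ∀ fam → All (AllPairs R) fam → (∀ c → 0 < cntF c fam → 0 < F c) → All (AllPairs R') (map (map g) fam)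
  chains [] [] f = []
  chains (C ∷ fam) (p ∷ ps) f = chain C p (λ {x} i → f x (≤-trans (cnt-∈ i) (m≤m+n _ _))) ∷ chains fam ps (λ c i → f c (≤-trans i (m≤n+m _ _)))
  bound1 : ∀ c' xs → (∀ {x} → x ∈ xs → 0 < F x) → cnt c' (map g xs) ≤ cnt (g⁻ c') xs
  bound1 c' [] f = z≤n
  bound1 c' (x ∷ xs) f = +-mono-≤ one (bound1 c' xs (f ∘ there))
    where
    one : δ c' (proj₁ (g x)) (proj₂ (g x)) ≤ δ (g⁻ c') (proj₁ x) (proj₂ x)
    one with c' ≟ₚ g x
    ... | no neq rewrite δ-≢ c' (g x) neq = z≤n
    ... | yes refl rewrite inv x (f (here refl)) | δ-refl (g x) | δ-refl x = ≤-refl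
  -- For a cell outside the image of `g` the count at `g⁻ c'` says nothing about `F'`; hence the
  -- case distinction.
  bound : ∀ c' fam → (∀ c → 0 < cntF c fam → 0 < F c) → cntF c' (map (map g) fam) ≤ (if 0 <ᵇ cntF c' (map (map g) fam) then cntF (g⁻ c') fam else 0)
  bound c' fam f with cntF c' (map (map g) fam) in eq
  ... | zero = z≤n
  ... | suc m = subst (_≤ cntF (g⁻ c') fam) eq (go fam f)
    where
    go : ∀ fam → (∀ c → 0 < cntF c fam → 0 < F c) → cntF c' (map (map g) fam) ≤ cntF (g⁻ c') fam
    go [] f = z≤n
    go (C ∷ fam) f = +-mono-≤ (bound1 c' C (λ {x} i → f x (≤-trans (cnt-∈ i) (m≤m+n _ _)))) (go fam (λ c i → f c (≤-trans i (m≤n+m _ _))))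
  source : ∀ c' fam → 0 < cntF c' (map (map g) fam) → ∃ λ x → 0 < cntF x fam × g x ≡ c'
  source c' (C ∷ fam) l with 0 <? cnt c' (map g C)
  ... | yes p = let (x , i , e) = ∈-map⁻ g (∈-cnt c' (map g C) p) in x , ≤-trans (cnt-∈ i) (m≤m+n _ _) , sym e
  ... | no p with source c' fam (subst (λ z → 0 < z + cntF c' (map (map g) fam)) (n<1⇒n≡0 (s≤s (≮⇒≥ p))) l)
  ... | x , q , e = x , ≤-trans q (m≤n+m _ _) , e
  fin : ∀ c' → (if 0 <ᵇ cntF c' (map (map g) fam) then cntF (g⁻ c') fam else 0) ≤ F' c'
  fin c' with cntF c' (map (map g) fam) in eq
  ... | zero = z≤n
  ... | suc m with source c' fam (subst (0 <_) (sym eq) (s≤s z≤n))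
  ... | x , q , refl = ≤-trans (≡⇒≤ (cong (λ z → cntF z fam) (inv x (≤-trans q (use x))))) (≤-trans (use x) (le x (≤-trans q (use x))))

transposed : ChainType → ChainType
transposed ne = ne
transposed NE = NE
transposed nE = Ne
transposed Ne = nE

sX-tr : ∀ t → sX (transposed t) ≡ sY t
sX-tr ne = refl
sX-tr NE = refl
sX-tr nE = refl
sX-tr Ne = refl

sY-tr : ∀ t → sY (transposed t) ≡ sX t
sY-tr ne = refl
sY-tr NE = refl
sY-tr nE = refl
sY-tr Ne = refl

Sub-tr : ∀ {t F F'} → Sub (CmpT (transposed t)) (at F) (at F') → Sub (CmpT t) (at (λ x y → F y x)) (at (λ x y → F' y x))
Sub-tr {t} {F} {F'} s = SubR-trans (Sub-map {R' = CmpT (transposed t)} {F' = at F} swap swap (λ _ _ → f) (λ _ _ → refl) (λ _ _ → ≤-refl))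
    (SubR-trans s (Sub-map {R' = CmpT t} {F = at F'} {F' = at (λ x y → F' y x)} swap swap (λ _ _ → f') (λ _ _ → refl) (λ _ _ → ≤-refl)))
  where
  f : ∀ {c e} → CmpT t c e → CmpT (transposed t) (swap c) (swap e)
  f {c} {e} (inj₁ (p , q)) = inj₁ (subst (λ s → rel s up (proj₂ c) (proj₂ e)) (sym (sX-tr t)) q , subst (λ s → rel s up (proj₁ c) (proj₁ e)) (sym (sY-tr t)) p)
  f {c} {e} (inj₂ (p , q)) = inj₂ (subst (λ s → rel s up (proj₂ e) (proj₂ c)) (sym (sX-tr t)) q , subst (λ s → rel s up (proj₁ e) (proj₁ c)) (sym (sY-tr t)) p)
  f' : ∀ {c e} → CmpT (transposed t) c e → CmpT t (swap c) (swap e)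
  f' {c} {e} (inj₁ (p , q)) = inj₁ (subst (λ s → rel s up (proj₂ c) (proj₂ e)) (sY-tr t) q , subst (λ s → rel s up (proj₁ c) (proj₁ e)) (sX-tr t) p)
  f' {c} {e} (inj₂ (p , q)) = inj₂ (subst (λ s → rel s up (proj₂ e) (proj₂ c)) (sY-tr t) q , subst (λ s → rel s up (proj₁ e) (proj₁ c)) (sX-tr t) p)

Both-tr : ∀ {t F F'} → Both (CmpT (transposed t)) (at F) (at F') → Both (CmpT t) (at (λ x y → F y x)) (at (λ x y → F' y x))
Both-tr {t} {F} {F'} (p , q) = Sub-tr {t} {F} {F'} p , Sub-tr {t} {F'} {F} q

-- When the first column leaves, the columns behind it move one position to the left. For a
-- rectangle avoiding column `0` this only renames cells.
Both-shift : ∀ {t} J K F → J 0 ≡ false → Both (CmpT t) (at (res J K F)) (at (res (J ∘ suc) K (F ∘ suc)))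
Both-shift {t} J K F j0 =
    Sub-map (λ (x , y) → pred x , y) (λ (x , y) → suc x , y) mono inv le ,
    Sub-map (λ (x , y) → suc x , y) (λ (x , y) → pred x , y) (λ {c} {e} _ _ → mono' {c} {e}) (λ _ _ → refl) (λ _ _ → ≤-refl)
  where
  pos : ∀ {c} → 0 < at (res J K F) c → proj₁ c ≡ suc (pred (proj₁ c))
  pos {zero , y} p rewrite j0 = ⊥-elim (<-irrefl refl p)
  pos {suc x , y} p = refl
  r : ∀ s {a b} → rel s up (suc a) (suc b) → rel s up a b
  r true (s≤s p) = p
  r false (s≤s p) = p
  r' : ∀ s {a b} → rel s up a b → rel s up (suc a) (suc b)
  r' true p = s≤s p
  r' false p = s≤s p
  mono : ∀ {c e} → 0 < at (res J K F) c → 0 < at (res J K F) e → CmpT t c e → CmpT t (pred (proj₁ c) , proj₂ c) (pred (proj₁ e) , proj₂ e)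
  mono {c} {e} p q (inj₁ (u , v)) = inj₁ (r (sX t) (subst₂ (rel (sX t) up) (pos {c} p) (pos {e} q) u) , v)
  mono {c} {e} p q (inj₂ (u , v)) = inj₂ (r (sX t) (subst₂ (rel (sX t) up) (pos {e} q) (pos {c} p) u) , v)
  mono' : ∀ {c e} → CmpT t c e → CmpT t (suc (proj₁ c) , proj₂ c) (suc (proj₁ e) , proj₂ e)
  mono' (inj₁ (u , v)) = inj₁ (r' (sX t) u , v)
  mono' (inj₂ (u , v)) = inj₂ (r' (sX t) u , v)
  inv : ∀ c → 0 < at (res J K F) c → (suc (pred (proj₁ c)) , proj₂ c) ≡ c
  inv c p = cong (_, proj₂ c) (sym (pos {c} p))
  le : ∀ c → 0 < at (res J K F) c → at (res J K F) c ≤ at (res (J ∘ suc) K (F ∘ suc)) (pred (proj₁ c) , proj₂ c)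
  le (zero , y) p rewrite j0 = ⊥-elim (<-irrefl refl p)
  le (suc x , y) p = ≤-refl

S-fubini : ∀ (F : Grid) w n → S (λ i → S (F i) n) w ≡ S (λ k → S (tr F k) w) n
S-fubini F zero n = sym (S-zero (λ _ → 0) n (λ _ _ → refl))
S-fubini F (suc w) n = trans (cong (_+ S (F w) n) (S-fubini F w n)) (sym (S-+ (λ k → S (tr F k) w) (F w) n))

S-split : ∀ f a m → S f (a + m) ≡ S f a + S (λ i → f (a + i)) m
S-split f a zero = trans (cong (S f) (+-identityʳ a)) (sym (+-identityʳ _))
S-split f a (suc m) = trans (cong (S f) (+-suc a m)) (trans (cong (_+ f (a + m)) (S-split f a m)) (+-assoc (S f a) _ _))

splice : ∀ {f f'} a m N → a + m ≤ N → (∀ x → ¬ InW a m x → f' x ≡ f x) → S (λ i → f' (a + i)) m ≡ S (λ i → f (a + i)) m → S f' N ≡ S f N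
splice {f} {f'} a m N l out mid = begin
  S f' N ≡⟨ cong (S f') (sym (m+[n∸m]≡n l)) ⟩
  S f' (a + m + (N ∸ (a + m))) ≡⟨ S-split f' (a + m) _ ⟩
  S f' (a + m) + S (λ i → f' (a + m + i)) (N ∸ (a + m)) ≡⟨ cong₂ _+_ (trans (S-split f' a m) (trans (cong₂ _+_ (S-cong a (λ k p → out k (λ q → <⇒≱ p (proj₁ q)))) mid) (sym (S-split f a m))))
      (S-cong (N ∸ (a + m)) (λ k _ → out (a + m + k) (λ q → <⇒≱ (proj₂ q) (m≤m+n _ k)))) ⟩
  S f (a + m) + S (λ i → f (a + m + i)) (N ∸ (a + m)) ≡⟨ S-split f (a + m) _ ⟨
  S f (a + m + (N ∸ (a + m))) ≡⟨ cong (S f) (m+[n∸m]≡n l) ⟩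
  S f N ∎
  where open ≡-Reasoning

-- Moving the leftmost column of a box to its right end

-- `cyc⁻` sends a position after the move to the position from which its column came; `cyc` is its
-- inverse.
cyc⁻ cyc : ℕ → ℕ → ℕ → ℕ
cyc⁻ l w x with inW? l w x | x ≟ l + w
... | yes _ | _ = suc x
... | no _ | yes _ = l
... | no _ | no _ = x
cyc l w x with inW? (suc l) w x | x ≟ l
... | yes _ | _ = pred x
... | no _ | yes _ = l + w
... | no _ | no _ = x

module _ {l w : ℕ} where

  cyc⁻-in : ∀ {x} → InW l w x → cyc⁻ l w x ≡ suc x
  cyc⁻-in {x} p with inW? l w x
  ... | yes _ = refl
  ... | no q = ⊥-elim (q p)

  cyc⁻-last : cyc⁻ l w (l + w) ≡ l
  cyc⁻-last with inW? l w (l + w) | l + w ≟ l + w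
  ... | yes p | _ = ⊥-elim (<-irrefl refl (proj₂ p))
  ... | no _ | yes _ = refl
  ... | no _ | no q = ⊥-elim (q refl)

  cyc⁻-out : ∀ {x} → ¬ InW l (suc w) x → cyc⁻ l w x ≡ x
  cyc⁻-out {x} p with inW? l w x | x ≟ l + w
  ... | yes q | _ = ⊥-elim (p (proj₁ q , ≤-trans (proj₂ q) (+-monoʳ-≤ l (n≤1+n w))))
  ... | no _ | yes refl = ⊥-elim (p (m≤m+n l w , +-monoʳ-< l (n<1+n w)))
  ... | no _ | no _ = refl

  cyc-in : ∀ {x} → InW l w x → cyc l w (suc x) ≡ x
  cyc-in {x} (p , q) with inW? (suc l) w (suc x)
  ... | yes _ = refl
  ... | no r = ⊥-elim (r (s≤s p , s≤s q))

  cyc-first : cyc l w l ≡ l + w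
  cyc-first with inW? (suc l) w l | l ≟ l
  ... | yes p | _ = ⊥-elim (<-irrefl refl (proj₁ p))
  ... | no _ | yes _ = refl
  ... | no _ | no q = ⊥-elim (q refl)

  cyc-out : ∀ {x} → ¬ InW l (suc w) x → cyc l w x ≡ x
  cyc-out {x} p with inW? (suc l) w x | x ≟ l
  ... | yes q | _ = ⊥-elim (p (<⇒≤ (proj₁ q) , subst (x <_) (sym (+-suc l w)) (proj₂ q)))
  ... | no _ | yes refl = ⊥-elim (p (≤-refl , m<m+n l (s≤s z≤n)))
  ... | no _ | no _ = refl

  data Place (x : ℕ) : Set where
    inside : InW l w x → Place x
    last : x ≡ l + w → Place x
    outside : ¬ InW l (suc w) x → Place x

  place : ∀ x → Place x
  place x with inW? l w x | x ≟ l + w | inW? l (suc w) x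
  ... | yes p | _ | _ = inside p
  ... | no _ | yes p | _ = last p
  ... | no _ | no _ | no p = outside p
  ... | no p | no q | yes (u , v) = ⊥-elim (p (u , ≤∧≢⇒< (≤-pred (subst (x <_) (+-suc l w) v)) q))

  cyc-cyc⁻ : ∀ x → cyc l w (cyc⁻ l w x) ≡ x
  cyc-cyc⁻ x with place x
  ... | inside p rewrite cyc⁻-in p = cyc-in p
  ... | last refl rewrite cyc⁻-last = cyc-first
  ... | outside p rewrite cyc⁻-out p = cyc-out p

  data Place' (x : ℕ) : Set where
    first : x ≡ l → Place' x
    next : ∀ {x'} → InW l w x' → x ≡ suc x' → Place' x
    outside : ¬ InW l (suc w) x → Place' x

  place' : ∀ x → Place' x
  place' x with inW? l (suc w) x
  ... | no p = outside p
  ... | yes (p , q) with ≤-split p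
  ... | inj₂ refl = first refl
  place' (suc x) | yes (p , q) | inj₁ (s≤s l') = next (l' , ≤-pred (subst (suc x <_) (+-suc l w) q)) refl

  cyc⁻-cyc : ∀ x → cyc⁻ l w (cyc l w x) ≡ x
  cyc⁻-cyc x with place' x
  ... | first refl rewrite cyc-first = cyc⁻-last
  ... | next p refl rewrite cyc-in p = cyc⁻-in p
  ... | outside p rewrite cyc-out p = cyc⁻-out p

  cyc⁻-InW : ∀ x → InW l (suc w) (cyc⁻ l w x) → InW l (suc w) x
  cyc⁻-InW x q with place x
  ... | inside p = proj₁ p , ≤-trans (proj₂ p) (+-monoʳ-≤ l (n≤1+n w))
  ... | last refl = m≤m+n l w , +-monoʳ-< l (n<1+n w)
  ... | outside p = subst (InW l (suc w)) (cyc⁻-out p) q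

  cyc-InW : ∀ x → InW l (suc w) (cyc l w x) → InW l (suc w) x
  cyc-InW x q = cyc⁻-InW' (place' x)
    where
    cyc⁻-InW' : Place' x → InW l (suc w) x
    cyc⁻-InW' (first refl) = ≤-refl , m<m+n l (s≤s z≤n)
    cyc⁻-InW' (next {x'} p refl) = ≤-suc (proj₁ p) , subst (suc x' <_) (sym (+-suc l w)) (s≤s (proj₂ p))
    cyc⁻-InW' (outside p) = subst (InW l (suc w)) (cyc-out p) q

Entries : ChainType → Grid → Set
Entries t F = kind t ≡ wk → ∀ x y → F x y ≤ 1

S-rev : ∀ f n → S (λ k → f (rv n k)) n ≡ S f n
S-rev f n = trans (sym (trans (cong (λ z → S (λ k → f (rv n k)) n + S f z) (n∸n≡0 n)) (+-identityʳ _))) (S-rv (λ k → f (rv n k)) f (λ _ _ → refl) n ≤-refl)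

S-reverse : ∀ t f n → S (λ k → f (φ t n k)) n ≡ S f n
S-reverse ne f n = refl
S-reverse Ne f n = refl
S-reverse NE f n = S-rev f n
S-reverse nE f n = S-rev f n

module ColumnMove (t : ChainType) (l w b n : ℕ) where

  κ : Kind
  κ = kind t

  open Window t (box l (suc w) b n)
  module Ro = Rotation κ w n

  Inside : ℕ → ℕ → Set
  Inside x y = InW l (suc w) x × InW b n y

  -- Entries above, below and beside the box travel with their columns. Only in the rows of the
  -- moved column do the other columns change as well.
  record Move (F F' : Grid) : Set where
    field
      rel' : Ro.Rel (W F) (W F')
      away : ∀ x y → ¬ Inside x y → F' x y ≡ F (cyc⁻ l w x) y

  W-cong : ∀ {F G} → (∀ x y → F x y ≡ G x y) → W F ≈ W G
  W-cong p i k with i <? suc w | k <? n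
  ... | yes _ | yes _ = p _ _
  ... | no _ | _ = refl
  ... | yes _ | no _ = refl

  W-Good : ∀ {F} → Entries t F → Good κ (suc w) n (W F)
  W-Good {F} z = W-Win F , adm κ z
    where
    adm : ∀ κ → (κ ≡ wk → ∀ x y → F x y ≤ 1) → Adm κ (W F)
    adm st _ = tt
    adm wk z i k with i <? suc w | k <? n
    ... | yes _ | yes _ = z refl _ _
    ... | no _ | _ = z≤n
    ... | yes _ | no _ = z≤n

  W-E : ∀ H {X} → Win (suc w) n X → W (E H X) ≈ X
  W-E H {X} h = window (W-Win (E H X)) h (λ i k p q → trans (W-in (E H X) p q) (E-at H X p q))

  E-entries : ∀ H {X} → Entries t H → Good κ (suc w) n X → Entries t (E H X)
  E-entries H {X} z g q x y with inW? l (suc w) x | inW? b n y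
  ... | yes _ | yes _ = adm κ (proj₂ g) q _ _
    where
    adm : ∀ κ → Adm κ X → κ ≡ wk → ∀ i k → X i k ≤ 1
    adm wk z _ = z
  ... | no _ | _ = z q x y
  ... | yes _ | no _ = z q x y

  inside? : ∀ x y → Dec (Inside x y)
  inside? x y = inW? l (suc w) x ×-dec inW? b n y

  Inside-cyc⁻ : ∀ {x y} → ¬ Inside x y → ¬ Inside (cyc⁻ l w x) y
  Inside-cyc⁻ {x} p (q , r) = p (cyc⁻-InW x q , r)

  Inside-cyc : ∀ {x y} → ¬ Inside x y → ¬ Inside (cyc l w x) y
  Inside-cyc {x} p (q , r) = p (cyc-InW x q , r)

  W-value : ∀ F {x y} → Inside x y → F x y ≡ W F (x ∸ l) (φ t n (y ∸ b))
  W-value F {x} {y} (p , q) = trans (sym (E-W F x y)) (E-in F (W F) p q)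

  move-total : ∀ F → Entries t F → ∃ λ F' → Entries t F' × Move F F'
  move-total F z =
    let (Y , gY , r) = Ro.rel-total (W F) (W-Good z)
        H = λ x y → F (cyc⁻ l w x) y
    in E H Y , E-entries H (λ q x y → z q _ y) gY , record
      { rel' = Ro.Rel-resp (W-Good z) ≈-refl (≈-sym (W-E H (proj₁ gY))) r ; away = λ x y → E-out H Y }

  move-total' : ∀ F' → Entries t F' → ∃ λ F → Entries t F × Move F F'
  move-total' F' z =
    let (X , gX , r) = Ro.rel-total' (W F') (W-Good z)
        H = λ x y → F' (cyc l w x) y
        zE = E-entries H (λ q x y → z q _ y) gX
    in E H X , zE , record
      { rel' = Ro.Rel-resp (W-Good zE) (≈-sym (W-E H (proj₁ gX))) ≈-refl r
      ; away = λ x y p → sym (trans (E-out H X (Inside-cyc⁻ p)) (cong (λ v → F' v y) (cyc-cyc⁻ {l} {w} x))) }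

  move-unique : ∀ {F G F' G'} → Entries t F → Entries t G → (∀ x y → F x y ≡ G x y) → Move F F' → Move G G' → ∀ x y → F' x y ≡ G' x y
  move-unique {F} {G} {F'} {G'} z z' p m m' x y with inside? x y
  ... | no q = trans (Move.away m x y q) (trans (p _ y) (sym (Move.away m' x y q)))
  ... | yes q = trans (W-value F' q) (trans (Ro.rel-unique (W-Good z) (W-Good z') (W-cong p) (Move.rel' m) (Move.rel' m') (x ∸ l) (φ t n (y ∸ b))) (sym (W-value G' q)))

  move-unique' : ∀ {F G F' G'} → Entries t F → Entries t G → (∀ x y → F' x y ≡ G' x y) → Move F F' → Move G G' → ∀ x y → F x y ≡ G x y
  move-unique' {F} {G} {F'} {G'} z z' p m m' x y with inside? x y
  ... | no q = trans (back F F' m) (trans (p _ y) (sym (back G G' m')))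
    where
    back : ∀ F F' → Move F F' → F x y ≡ F' (cyc l w x) y
    back F F' m = sym (trans (Move.away m (cyc l w x) y (Inside-cyc q)) (cong (λ v → F v y) (cyc⁻-cyc {l} {w} x)))
  ... | yes q = trans (W-value F q) (trans (Ro.rel-unique' (W-Good z) (W-Good z') (W-cong p) (Move.rel' m) (Move.rel' m') (x ∸ l) (φ t n (y ∸ b))) (sym (W-value G q)))

  module _ {F F' : Grid} (z : Entries t F) (m : Move F F') where

    open Move m

    private
      g = W-Good z

      row-W : ∀ F k → k < n → rs (suc w) (W F) k ≡ S (λ i → F (l + i) (b + φ t n k)) (suc w)
      row-W F k k< = S-cong (suc w) (λ i p → W-in F p k<)

      col-W : ∀ F i → i < suc w → cs n (W F) i ≡ S (λ k → F (l + i) (b + k)) n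
      col-W F i p = trans (S-cong n (λ k q → W-in F p q)) (S-reverse t (λ k → F (l + i) (b + k)) n)

      rowsW : ∀ k → rs (suc w) (W F) k ≡ rs (suc w) (W F') k
      rowsW = Ro.N.rs-CZ g (proj₁ rel')

      colsW : ∀ i → i < w → cs n (W F') i ≡ cs n (W F) (suc i)
      colsW i l = trans (S-≗ (λ k → sym (init-in (W F') l k)) n) (sym (Ro.N'.cs-RZ (tail-Good κ g) (proj₂ rel') i))

      -- The totals agree by the row sums, and all other columns keep their sums; so the remaining
      -- column does too.
      colsW-last : cs n (W F') w ≡ cs n (W F) 0
      colsW-last = +-cancelˡ-≡ (S (λ i → cs n (W F) (suc i)) w) _ _
        (trans (cong (_+ cs n (W F') w) (sym (S-cong w colsW)))
        (trans (S-fubini (W F') (suc w) n) (trans (S-cong n (λ k _ → sym (rowsW k))) (trans (sym (S-fubini (W F) (suc w) n)) (sym (S-tail (cs n (W F)) w))))))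

    move-row : ∀ y N → l + suc w ≤ N → S (λ x → F' x y) N ≡ S (λ x → F x y) N
    move-row y N le with inW? b n y
    ... | yes q = splice l (suc w) N le (λ x p → trans (away x y (λ r → p (proj₁ r))) (cong (λ v → F v y) (cyc⁻-out p)))
        (trans (sym (eq F')) (trans (sym (rowsW k)) (eq F)))
      where
      k = φ t n (y ∸ b)
      y< : y ∸ b < n
      y< = InW-offset q
      eq : ∀ F → rs (suc w) (W F) k ≡ S (λ i → F (l + i) y) (suc w)
      eq F = trans (row-W F k (φ< t y<)) (S-cong (suc w) (λ i _ → cong (F (l + i)) (trans (cong (b +_) (φ-inv t y<)) (m+[n∸m]≡n (proj₁ q)))))
    ... | no q = splice l (suc w) N le (λ x p → trans (away x y (λ r → p (proj₁ r))) (cong (λ v → F v y) (cyc⁻-out p)))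
        (trans (cong₂ _+_ (S-cong w (λ i p → trans (away (l + i) y (λ r → q (proj₂ r))) (cong (λ v → F v y) (trans (cyc⁻-in (m≤m+n l i , +-monoʳ-< l p)) (sym (+-suc l i))))))
                    (trans (away (l + w) y (λ r → q (proj₂ r))) (cong (λ v → F v y) (trans (cyc⁻-last {l} {w}) (sym (+-identityʳ l))))))
          (S-tail (λ i → F (l + i) y) w))

    module _ {B h : ℕ} (le : B ≤ b) (le' : b + n ≤ B + h) where

      private
        reB : ∀ k → B + (b ∸ B + k) ≡ b + k
        reB k = trans (sym (+-assoc B (b ∸ B) k)) (cong (_+ k) (m+[n∸m]≡n le))
        fits : b ∸ B + n ≤ h
        fits = +-cancelˡ-≤ B _ _ (≤-trans (≡⇒≤ (reB n)) le')
        shiftW : ∀ {k} → InW b n (B + k) → InW (b ∸ B) n k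
        shiftW {k} (u , v) = +-cancelˡ-≤ B _ _ (≤-trans (≡⇒≤ (m+[n∸m]≡n le)) u) , +-cancelˡ-< B _ _ (≤-trans v (≡⇒≤ (sym (reB n))))

      move-col : ∀ x → S (λ k → F' x (B + k)) h ≡ S (λ k → F (cyc⁻ l w x) (B + k)) h
      move-col x with place {l} {w} x
      ... | outside p = S-cong h (λ k _ → away x (B + k) (λ r → p (proj₁ r)))
      ... | inside p = column (x ∸ l) (suc (x ∸ l)) i< (s≤s i<') (m+[n∸m]≡n (proj₁ p)) (trans (+-suc l _) (trans (cong suc (m+[n∸m]≡n (proj₁ p))) (sym (cyc⁻-in p)))) (colsW (x ∸ l) i<')
        where
        i<' : x ∸ l < w
        i<' = InW-offset p
        i< : x ∸ l < suc w
        i< = ≤-suc i<'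
        column : ∀ i i' → i < suc w → i' < suc w → l + i ≡ x → l + i' ≡ cyc⁻ l w x → cs n (W F') i ≡ cs n (W F) i' →
            S (λ k → F' x (B + k)) h ≡ S (λ k → F (cyc⁻ l w x) (B + k)) h
        column i i' p p' refl e q = splice (b ∸ B) n h fits (λ k r → away _ (B + k) (λ s → r (shiftW (proj₂ s))))
            (trans (S-cong n (λ k _ → cong (F' (l + i)) (reB k))) (trans (trans (sym (col-W F' i p)) (trans q (col-W F i' p')))
              (trans (cong (λ v → S (λ k → F v (b + k)) n) e) (S-cong n (λ k _ → cong (F (cyc⁻ l w (l + i))) (sym (reB k)))))))
      ... | last refl = column
        where
        column : S (λ k → F' (l + w) (B + k)) h ≡ S (λ k → F (cyc⁻ l w (l + w)) (B + k)) h
        column = splice (b ∸ B) n h fits (λ k r → away _ (B + k) (λ s → r (shiftW (proj₂ s))))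
            (trans (S-cong n (λ k _ → cong (F' (l + w)) (reB k))) (trans (trans (sym (col-W F' w (n<1+n w))) (trans colsW-last (col-W F 0 (s≤s z≤n))))
              (trans (cong (λ v → S (λ k → F v (b + k)) n) (trans (+-identityʳ l) (sym (cyc⁻-last {l} {w})))) (S-cong n (λ k _ → cong (F (cyc⁻ l w (l + w))) (sym (reB k)))))))

    -- The restriction cuts off rows only, where column edges are harmless; `full-height` is the
    -- counterpart with columns cut off and row edges.
    full-width : ∀ J K → (∀ x → InW l (suc w) x → J x ≡ true) → Convex K → (∀ y → K y ≡ true → InW b n y) →
        Both (CmpT t) (at (res J K F)) (at (res J K F'))
    full-width J K jw kc ki = Both-trans (≡⇒Both (res-cong J K (λ x y _ _ → sym (E-W F x y))))
        (Both-trans (Edges.CZ-Both t (box l (suc w) b n) F z J K jw kc ki g (proj₁ rel')) (≡⇒Both (res-cong J K same)))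
      where
      same : ∀ x y → J x ≡ true → K y ≡ true → E F (W F') x y ≡ F' x y
      same x y _ ky with inside? x y
      ... | yes q = trans (E-in F (W F') (proj₁ q) (proj₂ q)) (sym (W-value F' q))
      ... | no q = trans (E-out F (W F') q) (sym (trans (away x y q) (cong (λ v → F v y) (cyc⁻-out (λ r → q (r , ki y ky))))))

    full-height : ∀ J K → J 0 ≡ false → (∀ x → J (suc x) ≡ true → InW l w x) → Convex (J ∘ suc) → (∀ y → InW b n y → K y ≡ true) →
        Both (CmpT t) (at (res J K F)) (at (res (J ∘ suc) K F'))
    full-height J K j0 jw jc ki = Both-trans (Both-shift {t} J K F j0) (Both-trans (≡⇒Both (res-cong (J ∘ suc) K start'))
        (Both-trans (Edges.RZ-Both t (box l w b n) (F ∘ suc) (λ q x y → z q (suc x) y) (J ∘ suc) K jw jc ki (tail-Good κ g) (proj₂ rel'))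
        (≡⇒Both (res-cong (J ∘ suc) K end'))))
      where
      module V = Window t (box l w b n)
      start' : ∀ x y → J (suc x) ≡ true → K y ≡ true → F (suc x) y ≡ V.E (F ∘ suc) (tail (W F)) x y
      start' x y jx _ = go (inW? b n y)
        where
        next-in : InW l w x → InW l (suc w) (suc x)
        next-in (u , v) = ≤-suc u , subst (suc x <_) (sym (+-suc l w)) (s≤s v)
        go : Dec (InW b n y) → F (suc x) y ≡ V.E (F ∘ suc) (tail (W F)) x y
        go (no q) = sym (V.E-out (F ∘ suc) (tail (W F)) (λ r → q (proj₂ r)))
        go (yes q) = sym (trans (V.E-in (F ∘ suc) (tail (W F)) (jw x jx) q) (trans (cong (λ v → W F v (φ t n (y ∸ b))) (sym (+-∸-assoc 1 (proj₁ (jw x jx)))))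
            (sym (W-value F (next-in (jw x jx) , q)))))
      end' : ∀ x y → J (suc x) ≡ true → K y ≡ true → V.E (F ∘ suc) (init w (W F')) x y ≡ F' x y
      end' x y jx _ = go (inW? b n y)
        where
        i< : x ∸ l < w
        i< = InW-offset (jw x jx)
        wide : InW l w x → InW l (suc w) x
        wide (u , v) = u , ≤-trans v (+-monoʳ-≤ l (n≤1+n w))
        go : Dec (InW b n y) → V.E (F ∘ suc) (init w (W F')) x y ≡ F' x y
        go (no q) = trans (V.E-out (F ∘ suc) (init w (W F')) (λ r → q (proj₂ r))) (sym (trans (away x y (λ r → q (proj₂ r))) (cong (λ v → F v y) (cyc⁻-in (jw x jx)))))
        go (yes q) = trans (V.E-in (F ∘ suc) (init w (W F')) (jw x jx) q) (trans (init-in (W F') i< _) (sym (W-value F' (wide (jw x jx) , q))))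

    away-from : ∀ J K → (∀ x → J x ≡ true → ¬ InW l (suc w) x) → Both (CmpT t) (at (res J K F)) (at (res J K F'))
    away-from J K jw = ≡⇒Both (res-cong J K (λ x y jx _ → sym (trans (away x y (λ r → jw x jx (proj₁ r))) (cong (λ v → F v y) (cyc⁻-out (jw x jx))))))

-- Moon polyominoes as lists of columns

-- A column occupies the rows lo, …, lo + hgt - 1; its tag prescribes a column sum.
record Col : Set where
  constructor ⟨_,_,_⟩
  field
    lo hgt tag : ℕ
open Col

-- Stands for all positions beyond the end of a list. Being empty, it contains no column of positive
-- height, so it never enters a rectangle.
void : Col
void = ⟨ 0 , 0 , 0 ⟩

nth : List Col → ℕ → Col
nth [] x = void
nth (c ∷ L) zero = c
nth (c ∷ L) (suc x) = nth L x

nth-++ˡ : ∀ xs {ys x} → x < length xs → nth (xs ++ ys) x ≡ nth xs x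
nth-++ˡ (c ∷ xs) {x = zero} l = refl
nth-++ˡ (c ∷ xs) {x = suc x} (s≤s l) = nth-++ˡ xs l

nth-++ʳ : ∀ xs {ys} i → nth (xs ++ ys) (length xs + i) ≡ nth ys i
nth-++ʳ [] i = refl
nth-++ʳ (c ∷ xs) i = nth-++ʳ xs i

nth-∈ : ∀ L {x} → x < length L → nth L x ∈ L
nth-∈ (c ∷ L) {zero} l = here refl
nth-∈ (c ∷ L) {suc x} (s≤s l) = there (nth-∈ L l)

nth-out : ∀ L {x} → length L ≤ x → nth L x ≡ void
nth-out [] l = refl
nth-out (c ∷ L) (s≤s l) = nth-out L l

∈-nth : ∀ {L d} → d ∈ L → ∃ λ x → x < length L × nth L x ≡ d
∈-nth (here refl) = 0 , s≤s z≤n , refl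
∈-nth (there i)   = let (x , l , e) = ∈-nth i in suc x , s≤s l , e

infix 4 _⊆_ _⊆?_
record _⊆_ (d e : Col) : Set where
  constructor _,_
  field
    low : lo e ≤ lo d
    high : lo d + hgt d ≤ lo e + hgt e
infixr 4 _,_

_⊆?_ : ∀ d e → Dec (d ⊆ e)
d ⊆? e = map′ (λ (p , q) → p , q) (λ (p , q) → p , q) ((lo e ≤? lo d) ×-dec (lo d + hgt d ≤? lo e + hgt e))

⊆-refl : ∀ {d} → d ⊆ d
⊆-refl = ≤-refl , ≤-refl

⊆-trans : ∀ {d e f} → d ⊆ e → e ⊆ f → d ⊆ f
⊆-trans (p , q) (p' , q') = ≤-trans p' p , ≤-trans q q'

within : Col → ℕ → Set
within d y = InW (lo d) (hgt d) y

within? : ∀ d y → Dec (within d y)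
within? d y = inW? (lo d) (hgt d) y

⊆-within : ∀ {d e y} → d ⊆ e → within d y → within e y
⊆-within (p , q) (u , v) = ≤-trans p u , ≤-trans v q

-- With `rows d` this describes the maximal rectangle whose rows are those of the column `d`. Every
-- maximal rectangle is of this kind, `d` being its shortest column; so the rectangles are indexed
-- by columns, which the moves only permute or shift.
cols : List Col → Col → ℕ → Bool
cols L d x = does (d ⊆? nth L x)

rows : Col → ℕ → Bool
rows d y = does (within? d y)

does-yes : ∀ {A : Set} (d : Dec A) → A → does d ≡ true
does-yes (yes _) a = refl
does-yes (no n) a = ⊥-elim (n a)

does-no : ∀ {A : Set} (d : Dec A) → ¬ A → does d ≡ false
does-no (yes a) n = ⊥-elim (n a)
does-no (no _) n = refl

yes-does : ∀ {A : Set} (d : Dec A) → does d ≡ true → A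
yes-does (yes a) _ = a

rows-convex : ∀ d → Convex (rows d)
rows-convex d p q u v = does-yes (within? d _) (≤-trans (proj₁ (yes-does (within? d _) u)) p , ≤-trans (s≤s q) (proj₂ (yes-does (within? d _) v)))

⊆-void : ∀ {d} → 0 < hgt d → ¬ (d ⊆ void)
⊆-void {d} p (_ , q) = <⇒≱ p (≤-trans (m≤n+m (hgt d) (lo d)) q)

ind : Bool → ℕ
ind b = if b then 1 else 0

span : List Col → Col → ℕ
span L d = sumL (λ e → ind (does (d ⊆? e))) L

sumL-↭ : ∀ {A : Set} (f : A → ℕ) {xs ys} → xs ↭ ys → sumL f xs ≡ sumL f ys
sumL-↭ f Perm.refl = refl
sumL-↭ f (Perm.prep x p) = cong (f x +_) (sumL-↭ f p)
sumL-↭ f (Perm.swap x y p) = trans (cong (λ z → f x + (f y + z)) (sumL-↭ f p)) (lin≡ 3 (λ a b c → [] ⊢ a ⊕ (b ⊕ c) ≐ b ⊕ (a ⊕ c)) (f x) (f y) _)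
sumL-↭ f (Perm.trans p q) = trans (sumL-↭ f p) (sumL-↭ f q)

sumL-nth : ∀ f L → sumL f L ≡ S (λ x → f (nth L x)) (length L)
sumL-nth f [] = refl
sumL-nth f (c ∷ L) = trans (+-comm (f c) _) (trans (cong (_+ f c) (sumL-nth f L)) (S-tail (λ x → f (nth (c ∷ L) x)) (length L)))

ChainOK : ChainType → Grid → Partition → Set
ChainOK t F p = ∀ k → 1 ≤ k →
  (∃ λ fam → length fam ≡ k × Valid (CmpT t) (at F) fam × size fam ≡ partSum k p) ×
  (∀ fam → length fam ≡ k → Valid (CmpT t) (at F) fam → size fam ≤ partSum k p)

ChainOK-Both : ∀ {t F F' p} → Both (CmpT t) (at F) (at F') → ChainOK t F p → ChainOK t F' p
ChainOK-Both {t} {F} {F'} {p} (s , s') ok k l =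
  let ((fam , e , v , z) , ub) = ok k l
      (fam' , e' , v' , z') = s fam v
      ub' : ∀ fam → length fam ≡ k → Valid (CmpT t) (at F') fam → size fam ≤ partSum k p
      ub' fam e v = let (fam'' , e'' , v'' , z'') = s' fam v in ≤-trans z'' (ub fam'' (trans e'' e) v'')
  in (fam' , trans e' e , v' , ≤-antisym (ub' fam' (trans e' e) v') (≤-trans (≡⇒≤ (sym z)) z')) , ub'

GoodL : ChainType → List Col → Shape → Grid → Set
GoodL t L Λ F = ∀ {d} → d ∈ L → ChainOK t (res (cols L d) (rows d) F) (Λ (hgt d) (span L d))

Legal : ChainType → List Col → Grid → Set
Legal t L F = (∀ x y → ¬ within (nth L x) y → F x y ≡ 0) × Entries t F

_≐G_ : Grid → Grid → Set
F ≐G F' = ∀ x y → F x y ≡ F' x y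

-- A bijection between legal fillings up to pointwise equality, given by its graph. One relation
-- serves all `Λ` and all prescribed sums at once; `Q` records what it does to sums.
record Eqv (t : ChainType) (Q : Grid → Grid → Set) (L L' : List Col) : Set₁ where
  field
    Rel : Grid → Grid → Set
    to-rel : ∀ F → Legal t L F → ∃ λ F' → Legal t L' F' × Rel F F'
    from-rel : ∀ F' → Legal t L' F' → ∃ λ F → Legal t L F × Rel F F'
    uniq : ∀ {F G F' G'} → Legal t L F → Legal t L G → Legal t L' F' → Legal t L' G' → F ≐G G → Rel F F' → Rel G G' → F' ≐G G'
    uniq' : ∀ {F G F' G'} → Legal t L F → Legal t L G → Legal t L' F' → Legal t L' G' → F' ≐G G' → Rel F F' → Rel G G' → F ≐G G
    good : ∀ {F F'} → Legal t L F → Legal t L' F' → Rel F F' → ∀ Λ → GoodL t L Λ F → GoodL t L' Λ F'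
    good' : ∀ {F F'} → Legal t L F → Legal t L' F' → Rel F F' → ∀ Λ → GoodL t L' Λ F' → GoodL t L Λ F
    extra : ∀ {F F'} → Legal t L F → Legal t L' F' → Rel F F' → Q F F'

Eqv-trans : ∀ {t Q Q' Q'' L L' L''} → (∀ {F F' F''} → Q F F' → Q' F' F'' → Q'' F F'') → Eqv t Q L L' → Eqv t Q' L' L'' → Eqv t Q'' L L''
Eqv-trans {t} {L' = L'} h A B = record
  { Rel = λ F F'' → ∃ λ F' → Legal t L' F' × A.Rel F F' × B.Rel F' F''
  ; to-rel = λ F o → let (F' , o' , r) = A.to-rel F o ; (F'' , o'' , r') = B.to-rel F' o' in F'' , o'' , F' , o' , r , r'
  ; from-rel = λ F'' o'' → let (F' , o' , r') = B.from-rel F'' o'' ; (F , o , r) = A.from-rel F' o' in F , o , F' , o' , r , r'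
  ; uniq = λ { o g o'' g'' p (_ , o' , r , s) (_ , g' , r' , s') → B.uniq o' g' o'' g'' (A.uniq o g o' g' p r r') s s' }
  ; uniq' = λ { o g o'' g'' p (_ , o' , r , s) (_ , g' , r' , s') → A.uniq' o g o' g' (B.uniq' o' g' o'' g'' p s s') r r' }
  ; good = λ { o o'' (_ , o' , r , s) Λ g → B.good o' o'' s Λ (A.good o o' r Λ g) }
  ; good' = λ { o o'' (_ , o' , r , s) Λ g → A.good' o o' r Λ (B.good' o' o'' s Λ g) }
  ; extra = λ { o o'' (_ , o' , r , s) → h (A.extra o o' r) (B.extra o' o'' s) } }
  where
  module A = Eqv A
  module B = Eqv B

Eqv-sym : ∀ {t Q Q' L L'} → (∀ {F F'} → Q F F' → Q' F' F) → Eqv t Q L L' → Eqv t Q' L' L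
Eqv-sym h A = record
  { Rel = λ F' F → A.Rel F F' ; to-rel = A.from-rel ; from-rel = A.to-rel
  ; uniq = λ o' g' o g → A.uniq' o g o' g'
  ; uniq' = λ o' g' o g → A.uniq o g o' g'
  ; good = λ o' o → A.good' o o' ; good' = λ o' o → A.good o o'
  ; extra = λ o' o r → h (A.extra o o' r) }
  where module A = Eqv A

GoodL-cong : ∀ {t L Λ F F'} → F ≐G F' → GoodL t L Λ F → GoodL t L Λ F'
GoodL-cong {t} {L} {Λ} {F} {F'} p g {d} i = ChainOK-Both {t} {res (cols L d) (rows d) F} {res (cols L d) (rows d) F'} {Λ (hgt d) (span L d)} (≡⇒Both (res-cong (cols L d) (rows d) (λ x y _ _ → p x y))) (g i)

Eqv-refl : ∀ {t Q L} → (∀ {F F'} → F ≐G F' → Q F F') → Eqv t Q L L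
Eqv-refl {t} {L = L} h = record
  { Rel = _≐G_ ; to-rel = λ F o → F , o , λ _ _ → refl ; from-rel = λ F o → F , o , λ _ _ → refl
  ; uniq = λ _ _ _ _ p r r' x y → trans (sym (r x y)) (trans (p x y) (r' x y))
  ; uniq' = λ _ _ _ _ p r r' x y → trans (r x y) (trans (p x y) (sym (r' x y)))
  ; good = λ _ _ r Λ → GoodL-cong {t} {L} {Λ} r ; good' = λ _ _ r Λ → GoodL-cong {t} {L} {Λ} (λ x y → sym (r x y)) ; extra = λ _ _ → h }

-- Convexity of rows: between two columns containing d, all columns contain d.
Conv : Col → Col → Col → Set
Conv a b e = ∀ d → 0 < hgt d → d ⊆ a → d ⊆ e → d ⊆ b

RowConvex : List Col → Set
RowConvex [] = ⊤
RowConvex (a ∷ L) = AllPairs (Conv a) L × RowConvex L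

pick-AllPairs⁻ : ∀ {A : Set} {R : A → A → Set} {x xs ys} → Pick x xs ys → AllPairs R xs → AllPairs R ys
pick-AllPairs⁻ here (p ∷ ps) = ps
pick-AllPairs⁻ (there q) (p ∷ ps) = proj₂ (pick-All q p) ∷ pick-AllPairs⁻ q ps

pick-RowConvex : ∀ {x xs ys} → Pick x xs ys → RowConvex xs → RowConvex ys
pick-RowConvex here (p , ps) = ps
pick-RowConvex (there q) (p , ps) = pick-AllPairs⁻ q p , pick-RowConvex q ps

pick-++ : ∀ {A : Set} {x : A} xs {ys} → Pick x (xs ++ x ∷ ys) (xs ++ ys)
pick-++ [] = here
pick-++ (y ∷ xs) = there (pick-++ xs)

AllPairs-nth : ∀ {R : Col → Col → Set} L {i j} → AllPairs R L → i < j → j < length L → R (nth L i) (nth L j)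
AllPairs-nth (a ∷ L) {zero} {suc j} (p ∷ ps) l (s≤s m) = All.lookup p (nth-∈ L m)
AllPairs-nth (a ∷ L) {suc i} {suc j} (p ∷ ps) (s≤s l) (s≤s m) = AllPairs-nth L ps l m

RowConvex-nth : ∀ L {i j k} → RowConvex L → i < j → j < k → k < length L → Conv (nth L i) (nth L j) (nth L k)
RowConvex-nth (a ∷ L) {zero} {suc j} {suc k} (p , ps) l (s≤s m) (s≤s q) = AllPairs-nth L p m q
RowConvex-nth (a ∷ L) {suc i} {suc j} {suc k} (p , ps) (s≤s l) (s≤s m) (s≤s q) = RowConvex-nth L ps l m q

-- Tags travel with their columns, so this condition on both sides encodes `c` and its permuted
-- version.
Fit : List Col → Grid → Set
Fit L F = ∀ x → S (λ k → F x (lo (nth L x) + k)) (hgt (nth L x)) ≡ tag (nth L x)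

SameSums : (L L' : List Col) → Grid → Grid → Set
SameSums L L' F F' = (∀ y → S (λ x → F x y) (length L) ≡ S (λ x → F' x y) (length L')) × (Fit L F → Fit L' F') × (Fit L' F' → Fit L F)

-- Moving one column to the right past columns that contain it

module Insertion (t : ChainType) (xs : List Col) (c : Col) (ys zs : List Col) where

  L L' : List Col
  L = xs ++ c ∷ (ys ++ zs)
  L' = xs ++ (ys ++ c ∷ zs)

  private
    l w : ℕ
    l = length xs
    w = length ys

    L↭L' : L ↭ L'
    L↭L' = ++⁺ˡ' xs (↭-sym (shift c ys zs))
      where
      ++⁺ˡ' : ∀ (xs : List Col) {ys zs} → ys ↭ zs → xs ++ ys ↭ xs ++ zs
      ++⁺ˡ' [] p = p
      ++⁺ˡ' (x ∷ xs) p = Perm.prep x (++⁺ˡ' xs p)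

    len : length L ≡ length L'
    len = ↭-length L↭L'

    at-ys : ∀ {zs} i → i < w → nth (xs ++ (ys ++ zs)) (l + i) ≡ nth ys i
    at-ys i p = trans (nth-++ʳ xs i) (nth-++ˡ ys p)

    L-c : nth L l ≡ c
    L-c = trans (cong (nth L) (sym (+-identityʳ l))) (nth-++ʳ xs 0)

    L-ys : ∀ i → i < w → nth L (suc (l + i)) ≡ nth ys i
    L-ys i p = trans (cong (nth L) (sym (+-suc l i))) (trans (nth-++ʳ xs (suc i)) (nth-++ˡ ys p))

    L-zs : ∀ i → nth L (suc (l + (w + i))) ≡ nth zs i
    L-zs i = trans (cong (nth L) (sym (+-suc l (w + i)))) (trans (nth-++ʳ xs (suc (w + i))) (nth-++ʳ ys i))

    L'-zs : ∀ i → nth L' (suc (l + (w + i))) ≡ nth zs i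
    L'-zs i = trans (cong (nth L') (trans (sym (+-suc l (w + i))) (cong (l +_) (sym (+-suc w i))))) (trans (nth-++ʳ xs (w + suc i)) (nth-++ʳ ys (suc i)))

    nth-cyc : ∀ x → nth L' x ≡ nth L (cyc⁻ l w x)
    nth-cyc x with place {l} {w} x
    ... | inside (p , q) rewrite cyc⁻-in {l} {w} (p , q) = trans (cong (nth L') (sym (m+[n∸m]≡n p))) (trans (at-ys (x ∸ l) i<) (trans (sym (L-ys (x ∸ l) i<)) (cong (nth L ∘ suc) (m+[n∸m]≡n p))))
      where
      i< : x ∸ l < w
      i< = InW-offset (p , q)
    ... | last refl rewrite cyc⁻-last {l} {w} = trans (trans (cong (λ v → nth L' (l + v)) (sym (+-identityʳ w))) (trans (nth-++ʳ xs (w + 0)) (nth-++ʳ ys 0))) (sym L-c)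
    ... | outside p rewrite cyc⁻-out {l} {w} p with x <? l
    ... | yes q = trans (nth-++ˡ xs q) (sym (nth-++ˡ xs q))
    ... | no q = trans (cong (nth L') (sym pos≡)) (trans (L'-zs i) (trans (sym (L-zs i)) (cong (nth L) pos≡)))
      where
      i = x ∸ suc (l + w)
      big : suc (l + w) ≤ x
      big = ≰⇒> (λ r → p (≮⇒≥ q , subst (x <_) (sym (+-suc l w)) (s≤s r)))
      pos≡ : suc (l + (w + i)) ≡ x
      pos≡ = trans (cong suc (sym (+-assoc l w i))) (m+[n∸m]≡n big)

    box≤ : l + suc w ≤ length L
    box≤ = ≤-trans (+-monoʳ-≤ l (s≤s (≤-trans (m≤m+n w (length zs)) (≡⇒≤ (sym (length-++ ys)))))) (≡⇒≤ (sym (length-++ xs)))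

  module _ (pos : ∀ {d} → d ∈ L → 0 < hgt d) (nested : ∀ {d e} → d ∈ L → e ∈ L → d ⊆ e ⊎ e ⊆ d)
      (cys : ∀ {d} → d ∈ ys → c ⊆ d) (zsc : ∀ {d} → d ∈ zs → d ⊆ c) (rc : RowConvex (xs ++ c ∷ ys)) where

    open ColumnMove t l w (lo c) (hgt c)

    private
      c∈L : c ∈ L
      c∈L = ∈-++⁺ʳ xs (here refl)

      inbox : ∀ {x} → InW l (suc w) x → c ⊆ nth L x
      inbox {x} p with place' {l} {w} x
      ... | first refl = subst (c ⊆_) (sym L-c) ⊆-refl
      ... | outside q = ⊥-elim (q p)
      ... | next {x'} (u , v) refl = subst (c ⊆_) (sym (trans (cong (nth L ∘ suc) (sym (m+[n∸m]≡n u))) (L-ys (x' ∸ l) i<))) (cys (nth-∈ ys i<))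
        where
        i< : x' ∸ l < w
        i< = InW-offset (u , v)

      inbox' : ∀ {x} → InW l (suc w) x → c ⊆ nth L' x
      inbox' {x} p = subst (c ⊆_) (sym (nth-cyc x)) (inbox (perm (place {l} {w} x)))
        where
        perm : Place {l} {w} x → InW l (suc w) (cyc⁻ l w x)
        perm (inside (u , v)) = subst (InW l (suc w)) (sym (cyc⁻-in {l} {w} (u , v))) (≤-suc u , subst (suc x <_) (sym (+-suc l w)) (s≤s v))
        perm (last refl) = subst (InW l (suc w)) (sym (cyc⁻-last {l} {w})) (≤-refl , m<m+n l (s≤s z≤n))
        perm (outside q) = ⊥-elim (q p)

      behind : ∀ {x} → l + suc w ≤ x → nth L x ≡ void ⊎ nth L x ⊆ c
      behind {x} p with x <? length L
      ... | no q = inj₁ (nth-out L (≮⇒≥ q))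
      ... | yes q = inj₂ (subst (_⊆ c) (sym nth≡) (zsc (nth-∈ zs i<)))
        where
        i = x ∸ (l + suc w)
        x≡ : suc (l + (w + i)) ≡ x
        x≡ = trans (lin≡ 3 (λ l w i → [] ⊢ con 1 ⊕ (l ⊕ (w ⊕ i)) ≐ l ⊕ (con 1 ⊕ w) ⊕ i) l w i) (m+[n∸m]≡n p)
        nth≡ : nth L x ≡ nth zs i
        nth≡ = trans (cong (nth L) (sym x≡)) (L-zs i)
        i< : i < length zs
        i< = +-cancelˡ-< (l + suc w) _ _ (subst₂ _<_ (sym (m+[n∸m]≡n p))
            (trans (length-++ xs) (trans (cong (λ z → l + suc z) (length-++ ys)) (sym (+-assoc l (suc w) (length zs))))) q)

      span' : ∀ d → span L d ≡ span L' d
      span' d = sumL-↭ (λ e → ind (does (d ⊆? e))) L↭L'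

      cols-cyc : ∀ d x → cols L' d x ≡ cols L d (cyc⁻ l w x)
      cols-cyc d x = cong (λ e → does (d ⊆? e)) (nth-cyc x)

      Legal⇒ : ∀ {F F'} → Legal t L F → Entries t F' → Move F F' → Legal t L' F'
      Legal⇒ {F} {F'} (s , _) z m = supp , z
        where
        supp : ∀ x y → ¬ within (nth L' x) y → F' x y ≡ 0
        supp x y nw with inside? x y
        ... | yes (p , q) = ⊥-elim (nw (⊆-within (inbox' p) q))
        ... | no q = trans (Move.away m x y q) (s _ y (λ v → nw (subst (λ e → within e y) (sym (nth-cyc x)) v)))

      Legal⇐ : ∀ {F F'} → Legal t L' F' → Entries t F → Move F F' → Legal t L F
      Legal⇐ {F} {F'} (s , _) z m = supp , z
        where
        supp : ∀ x y → ¬ within (nth L x) y → F x y ≡ 0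
        supp x y nw with inside? x y
        ... | yes (p , q) = ⊥-elim (nw (⊆-within (inbox p) q))
        ... | no q = trans (sym (trans (Move.away m (cyc l w x) y (Inside-cyc q)) (cong (λ v → F v y) (cyc⁻-cyc {l} {w} x))))
            (s _ y (λ v → nw (subst (λ e → within e y) (trans (nth-cyc (cyc l w x)) (cong (nth L) (cyc⁻-cyc {l} {w} x))) v)))

      -- If `d ⊆ c`, the rectangle of `d` contains all columns of the box. Otherwise `c ⊆ d` by
      -- nestedness, and neither `c` nor the columns behind the box belong to the rectangle of `d`;
      -- by convexity its columns then lie all in `ys` or all in `xs`.
      both : ∀ {F F'} → Entries t F → Move F F' → ∀ {d} → d ∈ L →
          Both (CmpT t) (at (res (cols L d) (rows d) F)) (at (res (cols L' d) (rows d) F'))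
      both {F} {F'} z m {d} d∈ with d ⊆? c
      ... | yes dc = Both-trans (full-width z m (cols L d) (rows d) (λ x p → does-yes (d ⊆? nth L x) (⊆-trans dc (inbox p))) (rows-convex d)
          (λ y p → ⊆-within dc (yes-does (within? d y) p)))
              (≡⇒Both (λ (x , y) → cong (λ b → if b ∧ rows d y then F' x y else 0) (same x)))
        where
        same : ∀ x → cols L d x ≡ cols L' d x
        same x with inW? l (suc w) x
        ... | yes p = trans (does-yes (d ⊆? nth L x) (⊆-trans dc (inbox p))) (sym (does-yes (d ⊆? nth L' x) (⊆-trans dc (inbox' p))))
        ... | no p = sym (trans (cols-cyc d x) (cong (cols L d) (cyc⁻-out {l} {w} p)))
      ... | no ndc = atYs (any? (d ⊆?_) ys)
        where
        dpos = pos d∈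
        cd : c ⊆ d
        cd with nested d∈ c∈L
        ... | inj₁ p = ⊥-elim (ndc p)
        ... | inj₂ p = p
        notc : ∀ {x} → l ≡ x → cols L d x ≡ false
        notc refl = does-no (d ⊆? nth L l) (λ p → ndc (subst (d ⊆_) L-c p))
        notzs : ∀ {x} → l + suc w ≤ x → cols L d x ≡ false
        notzs {x} p with behind p
        ... | inj₁ e = does-no (d ⊆? nth L x) (λ q → ⊆-void dpos (subst (d ⊆_) e q))
        ... | inj₂ q = does-no (d ⊆? nth L x) (λ r → ndc (⊆-trans r q))
        nth-box : ∀ {x} → x < l + suc w → nth L x ≡ nth (xs ++ c ∷ ys) x
        nth-box {x} p = trans (cong (λ v → nth v x) (sym (++-assoc xs (c ∷ ys) zs))) (nth-++ˡ (xs ++ c ∷ ys) (subst (x <_) (sym (length-++ xs)) p))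
        convex3 : ∀ {i j k} → i < j → j < k → k < l + suc w → d ⊆ nth L i → d ⊆ nth L k → d ⊆ nth L j
        convex3 {i} {j} {k} p q r u v = subst (d ⊆_) (sym (nth-box (<-trans q r)))
          (RowConvex-nth (xs ++ c ∷ ys) rc p q (subst (k <_) (sym (length-++ xs)) r) d dpos
             (subst (d ⊆_) (nth-box (<-trans p (<-trans q r))) u) (subst (d ⊆_) (nth-box r) v))
        atYs : Dec (Any (d ⊆_) ys) → Both (CmpT t) (at (res (cols L d) (rows d) F)) (at (res (cols L' d) (rows d) F'))
        atYs (no none) = Both-trans (away-from z m (cols L d) (rows d) (λ x p q → false≢true (trans (sym (nobox q)) p)))
            (≡⇒Both (λ (x , y) → cong (λ b → if b ∧ rows d y then F' x y else 0) (same x)))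
          where
          nobox : ∀ {x} → InW l (suc w) x → cols L d x ≡ false
          nobox {x} p with place' {l} {w} x
          ... | first refl = notc refl
          ... | outside q = ⊥-elim (q p)
          ... | next {x'} (u , v) refl = does-no (d ⊆? nth L (suc x')) (λ r → none (Any.map (λ { refl → r' r }) (nth-∈ ys i<)))
            where
            i< : x' ∸ l < w
            i< = InW-offset (u , v)
            r' : d ⊆ nth L (suc x') → d ⊆ nth ys (x' ∸ l)
            r' = subst (d ⊆_) (trans (cong (nth L ∘ suc) (sym (m+[n∸m]≡n u))) (L-ys (x' ∸ l) i<))
          same : ∀ x → cols L d x ≡ cols L' d x
          same x with place {l} {w} x
          ... | outside p = sym (trans (cols-cyc d x) (cong (cols L d) (cyc⁻-out {l} {w} p)))
          ... | inside (u , v) = trans (nobox (u , ≤-trans v (+-monoʳ-≤ l (n≤1+n w)))) (sym (trans (cols-cyc d x) (trans (cong (cols L d) (cyc⁻-in {l} {w} (u , v))) (nobox (≤-suc u , subst (suc x <_) (sym (+-suc l w)) (s≤s v))))))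
          ... | last refl = trans (nobox (m≤m+n l w , +-monoʳ-< l (n<1+n w))) (sym (trans (cols-cyc d x) (trans (cong (cols L d) (cyc⁻-last {l} {w})) (notc refl))))
        atYs (yes some) = Both-trans (full-height z m (cols L d) (rows d) (left0 l refl) inY conv' (λ y p → does-yes (within? d y) (⊆-within cd p)))
            (≡⇒Both (λ (x , y) → cong (λ b → if b ∧ rows d y then F' x y else 0) (same x)))
          where
          witness : ∃ λ i → i < w × d ⊆ nth ys i
          witness = let (e , i∈ , p) = find some ; (i , l , q) = ∈-nth i∈ in i , l , subst (d ⊆_) (sym q) p
            where
            find : ∀ {xs : List Col} → Any (d ⊆_) xs → ∃ λ e → e ∈ xs × d ⊆ e
            find (here p) = _ , here refl , p
            find (there p) = let (e , i , q) = find p in e , there i , q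
          -- If a column of `xs` and one of `ys` contained `d`, convexity would force `c` between
          -- them to contain it.
          left : ∀ {x} → x < l → cols L d x ≡ false
          left {x} p = does-no (d ⊆? nth L x) (λ q → let (i , i< , r) = witness in
            ndc (subst (d ⊆_) L-c (convex3 p (s≤s (m≤m+n l i)) (subst (suc (l + i) <_) (sym (+-suc l w)) (s≤s (+-monoʳ-< l i<))) q (subst (d ⊆_) (sym (L-ys i i<)) r))))
          left≤ : ∀ {x} → x ≤ l → cols L d x ≡ false
          left≤ p with ≤-split p
          ... | inj₁ q = left q
          ... | inj₂ refl = notc refl
          left0 : ∀ l' → l' ≡ l → cols L d 0 ≡ false
          left0 l' refl = left≤ z≤n
          inY : ∀ x → cols L d (suc x) ≡ true → InW l w x
          inY x p with l ≤? x | x <? l + w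
          ... | yes u | yes v = u , v
          ... | no u | _ = ⊥-elim (false≢true (trans (sym (left≤ (≰⇒> u))) p))
          ... | yes _ | no v = ⊥-elim (false≢true (trans (sym (notzs (subst (_≤ suc x) (sym (+-suc l w)) (s≤s (≮⇒≥ v))))) p))
          conv' : Convex (cols L d ∘ suc)
          conv' {k} {j} {m} p q u v with ≤-split p | ≤-split q
          ... | inj₂ refl | _ = u
          ... | inj₁ _ | inj₂ refl = v
          ... | inj₁ p' | inj₁ q' = does-yes (d ⊆? nth L (suc j)) (convex3 (s≤s p') (s≤s q') (subst (suc m <_) (sym (+-suc l w)) (s≤s (proj₂ (inY m v))))
              (yes-does (d ⊆? nth L (suc k)) u) (yes-does (d ⊆? nth L (suc m)) v))
          same : ∀ x → cols L d (suc x) ≡ cols L' d x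
          same x with place {l} {w} x
          ... | inside p = sym (trans (cols-cyc d x) (cong (cols L d) (cyc⁻-in {l} {w} p)))
          ... | last refl = trans (notzs (≡⇒≤ (+-suc l w))) (sym (trans (cols-cyc d x) (trans (cong (cols L d) (cyc⁻-last {l} {w})) (notc refl))))
          ... | outside p with x <? l
          ... | yes q = trans (left≤ q) (sym (trans (cols-cyc d x) (trans (cong (cols L d) (cyc⁻-out {l} {w} p)) (left q))))
          ... | no q = trans (notzs (≤-suc big)) (sym (trans (cols-cyc d x) (trans (cong (cols L d) (cyc⁻-out {l} {w} p)) (notzs big))))
            where
            big : l + suc w ≤ x
            big = ≮⇒≥ (λ r → p (≮⇒≥ q , r))

      good→ : ∀ {F F'} → Entries t F → Move F F' → ∀ Λ → GoodL t L Λ F → GoodL t L' Λ F'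
      good→ {F} {F'} z m Λ g {d} i = subst (λ v → ChainOK t G' (Λ (hgt d) v)) (span' d) (ChainOK-Both {t} {G} {G'} {Λ (hgt d) (span L d)} (both z m i') (g i'))
        where
        i' = ∈-resp-↭ (↭-sym L↭L') i
        G G' : Grid
        G = res (cols L d) (rows d) F
        G' = res (cols L' d) (rows d) F'

      good← : ∀ {F F'} → Entries t F → Move F F' → ∀ Λ → GoodL t L' Λ F' → GoodL t L Λ F
      good← {F} {F'} z m Λ g {d} i = subst (λ v → ChainOK t G (Λ (hgt d) v)) (sym (span' d)) (ChainOK-Both {t} {G'} {G} {Λ (hgt d) (span L' d)} (Both-sym (both z m i)) (g (∈-resp-↭ L↭L' i)))
        where
        G G' : Grid
        G = res (cols L d) (rows d) F
        G' = res (cols L' d) (rows d) F'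

      sums : ∀ {F F'} → Legal t L F → Legal t L' F' → Move F F' → SameSums L L' F F'
      sums {F} {F'} (s , z) (s' , _) m = (λ y → trans (sym (move-row z m y (length L) box≤)) (cong (S (λ x → F' x y)) len)) ,
          (λ f x → trans (col-sum x) (trans (f (cyc⁻ l w x)) (cong tag (sym (nth-cyc x))))) ,
          (λ f x → trans (sym (trans (col-sum (cyc l w x)) (cong (λ v → S (λ k → F v (lo (nth L v) + k)) (hgt (nth L v))) (cyc⁻-cyc {l} {w} x))))
              (trans (f (cyc l w x)) (cong tag (trans (nth-cyc (cyc l w x)) (cong (nth L) (cyc⁻-cyc {l} {w} x))))))
        where
        col-sum : ∀ x → S (λ k → F' x (lo (nth L' x) + k)) (hgt (nth L' x)) ≡ S (λ k → F (cyc⁻ l w x) (lo (nth L (cyc⁻ l w x)) + k)) (hgt (nth L (cyc⁻ l w x)))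
        col-sum x rewrite nth-cyc x = go (inW? l (suc w) x)
          where
          d = nth L (cyc⁻ l w x)
          go : Dec (InW l (suc w) x) → S (λ k → F' x (lo d + k)) (hgt d) ≡ S (λ k → F (cyc⁻ l w x) (lo d + k)) (hgt d)
          go (yes p) = let q = subst (c ⊆_) (nth-cyc x) (inbox' p) in move-col z m (_⊆_.low q) (_⊆_.high q) x
          go (no p) = S-cong (hgt d) (λ k _ → Move.away m x _ (λ r → p (proj₁ r)))

    step : Eqv t (SameSums L L') L L'
    step = record
      { Rel = Move
      ; to-rel = λ F o → let (F' , z' , m) = move-total F (proj₂ o) in F' , Legal⇒ o z' m , m
      ; from-rel = λ F' o → let (F , z , m) = move-total' F' (proj₂ o) in F , Legal⇐ o z m , m
      ; uniq = λ o g _ _ p m m' → move-unique (proj₂ o) (proj₂ g) p m m'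
      ; uniq' = λ o g _ _ p m m' → move-unique' (proj₂ o) (proj₂ g) p m m'
      ; good = λ o _ m Λ → good→ (proj₂ o) m Λ
      ; good' = λ o _ m Λ → good← (proj₂ o) m Λ
      ; extra = sums }

-- Sorting the columns

SameSums-trans : ∀ {L L' L'' F F' F''} → SameSums L L' F F' → SameSums L' L'' F' F'' → SameSums L L'' F F''
SameSums-trans (r , f , g) (r' , f' , g') = (λ y → trans (r y) (r' y)) , f' ∘ f , g ∘ g'

SameSums-sym : ∀ {L L' F F'} → SameSums L L' F F' → SameSums L' L F' F
SameSums-sym (r , f , g) = (λ y → sym (r y)) , g , f

SameSums-refl : ∀ {L F F'} → F ≐G F' → SameSums L L F F'
SameSums-refl {L} p = (λ y → S-cong (length L) (λ x _ → p x y)) ,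
  (λ f x → trans (S-cong (hgt (nth L x)) (λ k _ → sym (p x _))) (f x)) , (λ f x → trans (S-cong (hgt (nth L x)) (λ k _ → p x _)) (f x))

smallest : ∀ L → (∀ {d e} → d ∈ L → e ∈ L → d ⊆ e ⊎ e ⊆ d) → 0 < length L → ∃ λ c → c ∈ L × (∀ {e} → e ∈ L → c ⊆ e)
smallest (a ∷ []) h l = a , here refl , λ { (here refl) → ⊆-refl }
smallest (a ∷ b ∷ L) h l with smallest (b ∷ L) (λ i j → h (there i) (there j)) (s≤s z≤n)
... | c , c∈ , m with h (here refl) (there c∈)
... | inj₁ p = a , here refl , λ { (here refl) → ⊆-refl ; (there i) → ⊆-trans p (m i) }
... | inj₂ p = c , there c∈ , λ { (here refl) → p ; (there i) → m i }

record Moon (P T : List Col) : Set where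
  field
    pos : ∀ {d} → d ∈ P ++ T → 0 < hgt d
    nested : ∀ {d e} → d ∈ P ++ T → e ∈ P ++ T → d ⊆ e ⊎ e ⊆ d
    convex : RowConvex P
    tail⊆ : ∀ {d e} → d ∈ P → e ∈ T → e ⊆ d

-- Selection sort: the smallest column of the unsorted part goes to the end of that part.
module Select (t : ChainType) (xs : List Col) (c : Col) (ys T : List Col) (mo : Moon (xs ++ c ∷ ys) T) (min : ∀ {e} → e ∈ xs ++ c ∷ ys → c ⊆ e) where

  open Moon mo

  private
    e₁ : (xs ++ c ∷ ys) ++ T ≡ xs ++ c ∷ (ys ++ T)
    e₁ = ++-assoc xs (c ∷ ys) T
    e₂ : (xs ++ ys) ++ (c ∷ T) ≡ xs ++ (ys ++ c ∷ T)
    e₂ = ++-assoc xs ys (c ∷ T)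
    emb : ∀ {d} → d ∈ xs ++ c ∷ (ys ++ T) → d ∈ (xs ++ c ∷ ys) ++ T
    emb = subst (_ ∈_) (sym e₁)

  eqv : Eqv t (SameSums ((xs ++ c ∷ ys) ++ T) ((xs ++ ys) ++ (c ∷ T))) ((xs ++ c ∷ ys) ++ T) ((xs ++ ys) ++ (c ∷ T))
  eqv = subst₂ (λ A B → Eqv t (SameSums A B) A B) (sym e₁) (sym e₂)
    (Insertion.step t xs c ys T (λ i → pos (emb i)) (λ i j → nested (emb i) (emb j)) (λ i → min (∈-++⁺ʳ xs (there i))) (λ i → tail⊆ (∈-++⁺ʳ xs (here refl)) i) convex)

  moon : Moon (xs ++ ys) (c ∷ T)
  moon = record { pos = λ i → pos (back i) ; nested = λ i j → nested (back i) (back j) ; convex = pick-RowConvex (pick-++ xs) convex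
      ; tail⊆ = λ { i (here refl) → min (pick-∈ (pick-++ xs) i) ; i (there j) → tail⊆ (pick-∈ (pick-++ xs) i) j } }
    where
    back : ∀ {d} → d ∈ (xs ++ ys) ++ (c ∷ T) → d ∈ (xs ++ c ∷ ys) ++ T
    back {d} i with ∈-++⁻ (xs ++ ys) i
    ... | inj₁ j = ∈-++⁺ˡ (pick-∈ (pick-++ xs) j)
    ... | inj₂ (here refl) = ∈-++⁺ˡ (∈-++⁺ʳ xs (here refl))
    ... | inj₂ (there j) = ∈-++⁺ʳ (xs ++ c ∷ ys) j

-- Both arrangements move the very same column at each stage. So they meet in one list even if
-- columns with different tags occupy the same rows, and the second sorting is then run backwards.
rearrange : ∀ t n P P' T → length P ≡ n → P ↭ P' → Moon P T → Moon P' T → Eqv t (SameSums (P ++ T) (P' ++ T)) (P ++ T) (P' ++ T)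
rearrange t zero [] [] T e p mo mo' = Eqv-refl (SameSums-refl {T})
rearrange t zero [] (_ ∷ _) T e p mo mo' with ↭-length p
... | ()
rearrange t (suc n) P P' T e p mo mo' =
  let (c , c∈ , mn) = smallest P (λ i j → Moon.nested mo (∈-++⁺ˡ i) (∈-++⁺ˡ j)) (subst (0 <_) (sym e) (s≤s z≤n))
      (xs , ys , q) = ∈-∃++ c∈
      (xs' , ys' , q') = ∈-∃++ (∈-resp-↭ p c∈)
  in go xs c ys xs' ys' q q' mn e p mo mo'
  where
  go : ∀ {P P'} xs c ys xs' ys' → P ≡ xs ++ c ∷ ys → P' ≡ xs' ++ c ∷ ys' → (∀ {e} → e ∈ P → c ⊆ e) → length P ≡ suc n → P ↭ P' →
      Moon P T → Moon P' T → Eqv t (SameSums (P ++ T) (P' ++ T)) (P ++ T) (P' ++ T)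
  go xs c ys xs' ys' refl refl mn e p mo mo' =
    Eqv-trans (λ {F} {F'} {F''} → SameSums-trans {(xs ++ c ∷ ys) ++ T} {(xs ++ ys) ++ (c ∷ T)} {(xs' ++ c ∷ ys') ++ T} {F} {F'} {F''}) A.eqv
      (Eqv-trans (λ {F} {F'} {F''} → SameSums-trans {(xs ++ ys) ++ (c ∷ T)} {(xs' ++ ys') ++ (c ∷ T)} {(xs' ++ c ∷ ys') ++ T} {F} {F'} {F''}) (rearrange t n (xs ++ ys) (xs' ++ ys') (c ∷ T)
        (suc-injective (trans (sym (pick-length (pick-++ {x = c} xs))) e)) (drop-mid xs xs' p) A.moon B.moon)
      (Eqv-sym (λ {F} {F'} → SameSums-sym {(xs' ++ c ∷ ys') ++ T} {(xs' ++ ys') ++ (c ∷ T)} {F} {F'}) B.eqv))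
    where
    module A = Select t xs c ys T mo mn
    module B = Select t xs' c ys' T mo' (λ i → mn (∈-resp-↭ (↭-sym p) i))

-- Reduction to Ferrers shapes for the count by total sum

TotalSame : (L L' : List Col) → Grid → Grid → Set
TotalSame L L' F F' = ∃ λ N₀ → ∀ N → N₀ ≤ N → S (λ x → S (F x) N) (length L) ≡ S (λ x → S (F' x) N) (length L')

TotalSame-trans : ∀ {L L' L'' F F' F''} → TotalSame L L' F F' → TotalSame L' L'' F' F'' → TotalSame L L'' F F''
TotalSame-trans (a , f) (b , g) = a + b , λ N p → trans (f N (≤-trans (m≤m+n a b) p)) (g N (≤-trans (m≤n+m b a) p))

TotalSame-sym : ∀ {L L' F F'} → TotalSame L L' F F' → TotalSame L' L F' F
TotalSame-sym (a , f) = a , λ N p → sym (f N p)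

TotalSame-refl : ∀ {L F F'} → F ≐G F' → TotalSame L L F F'
TotalSame-refl {L} p = 0 , λ N _ → S-cong (length L) (λ x _ → S-cong N (λ y _ → p x y))

SameSums⇒TotalSame : ∀ {L L' F F'} → SameSums L L' F F' → TotalSame L L' F F'
SameSums⇒TotalSame {L} {L'} {F} {F'} (r , _) = 0 , λ N _ → trans (S-fubini F (length L) N) (trans (S-cong N (λ y _ → r y)) (sym (S-fubini F' (length L') N)))

Eqv-map : ∀ {t Q Q' L L'} → (∀ {F F'} → Q F F' → Q' F F') → Eqv t Q L L' → Eqv t Q' L L'
Eqv-map h A = record { Rel = A.Rel ; to-rel = A.to-rel ; from-rel = A.from-rel ; uniq = A.uniq ; uniq' = A.uniq' ; good = A.good ; good' = A.good'
    ; extra = λ o o' r → h (A.extra o o' r) }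
  where module A = Eqv A

Sorted : List Col → Set
Sorted = AllPairs (λ d c → c ⊆ d)

AllPairs-cross : ∀ {A : Set} {R : A → A → Set} xs {ys x y} → AllPairs R (xs ++ ys) → x ∈ xs → y ∈ ys → R x y
AllPairs-cross (_ ∷ xs) (p ∷ ps) (here refl) j = All.lookup p (∈-++⁺ʳ xs j)
AllPairs-cross (_ ∷ xs) (p ∷ ps) (there i) j = AllPairs-cross xs ps i j

AllPairs-++⁻ʳ : ∀ {A : Set} {R : A → A → Set} xs {ys} → AllPairs R (xs ++ ys) → AllPairs R ys
AllPairs-++⁻ʳ [] ps = ps
AllPairs-++⁻ʳ (_ ∷ xs) (p ∷ ps) = AllPairs-++⁻ʳ xs ps

nth-AllPairs : ∀ {R : Col → Col → Set} L → (∀ {i j} → i < j → j < length L → R (nth L i) (nth L j)) → AllPairs R L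
nth-AllPairs [] h = []
nth-AllPairs {R} (a ∷ L) h = All.tabulate (λ {d} i → let (j , l , q) = ∈-nth i in subst (R a) q (h {0} {suc j} (s≤s z≤n) (s≤s l))) ∷ nth-AllPairs L (λ {i} {j} p q → h {suc i} {suc j} (s≤s p) (s≤s q))

Sorted-nth : ∀ L {i j} → Sorted L → i ≤ j → j < length L → nth L j ⊆ nth L i
Sorted-nth L s p q with ≤-split p
... | inj₁ r = AllPairs-nth L s r q
... | inj₂ refl = ⊆-refl

down : Col → Col
down d = ⟨ pred (lo d) , hgt d , tag d ⟩

nth-map : ∀ L i → nth (map down L) i ≡ down (nth L i)
nth-map [] i = refl
nth-map (c ∷ L) zero = refl
nth-map (c ∷ L) (suc i) = nth-map L i

does-⇔ : ∀ {A B : Set} (a : Dec A) (b : Dec B) → (A → B) → (B → A) → does a ≡ does b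
does-⇔ (yes x) b f g = sym (does-yes b (f x))
does-⇔ (no x) b f g = sym (does-no b (x ∘ g))

res-swap : ∀ J K F c → at (res J K F) c ≡ at (λ x y → res K J (λ y x → F x y) y x) c
res-swap J K F (x , y) = cong (λ b → if b then F x y else 0) (∧-comm (J x) (K y))

-- The columns of A stand on row 0 and cover rows 0, …, w, the columns of Z lie within rows 1, …, w:
-- moving row 0 of the rectangle A × [0, w] to its top lowers the columns of Z by one.
module RowStep (t : ChainType) (A Z : List Col) (w : ℕ) (lowA : ∀ {d} → d ∈ A → lo d ≡ 0 × suc w ≤ hgt d)
    (highZ : ∀ {d} → d ∈ Z → 1 ≤ lo d × lo d + hgt d ≤ suc w) (sorted : Sorted (A ++ Z)) (pos : ∀ {d} → d ∈ A ++ Z → 0 < hgt d) where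

  L L' : List Col
  L = A ++ Z
  L' = A ++ map down Z

  ℓ : ℕ
  ℓ = length A

  module CM = ColumnMove (transposed t) 0 w 0 ℓ

  -- What becomes of a column. Containment between two columns is the same before and after the
  -- step, and this makes the maximal rectangles correspond with equal heights and widths.
  data Paired (d d' : Col) : Set where
    low : lo d ≡ 0 → suc w ≤ hgt d → d' ≡ d → Paired d d'
    high : 1 ≤ lo d → lo d + hgt d ≤ suc w → d' ≡ down d → Paired d d'
    none : d ≡ void → d' ≡ void → Paired d d'

  private
    len : length L' ≡ length L
    len = trans (length-++ A) (trans (cong (ℓ +_) (length-map down Z)) (sym (length-++ A)))

    nth-A : ∀ {x} → x < ℓ → nth L' x ≡ nth L x
    nth-A p = trans (nth-++ˡ A p) (sym (nth-++ˡ A p))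

    at-Z : ∀ {x} → ℓ ≤ x → nth L x ≡ nth Z (x ∸ ℓ)
    at-Z {x} p = trans (cong (nth L) (sym (m+[n∸m]≡n p))) (nth-++ʳ A (x ∸ ℓ))

    nth-Z : ∀ {x} → ℓ ≤ x → nth L' x ≡ down (nth L x)
    nth-Z {x} p = trans (cong (nth L') (sym (m+[n∸m]≡n p))) (trans (nth-++ʳ A (x ∸ ℓ)) (trans (nth-map Z (x ∸ ℓ)) (cong down (sym (at-Z p)))))

    low-A : ∀ {x} → x < ℓ → lo (nth L x) ≡ 0 × suc w ≤ hgt (nth L x)
    low-A {x} p = subst (λ d → lo d ≡ 0 × suc w ≤ hgt d) (sym (nth-++ˡ A p)) (lowA (nth-∈ A p))

    high-Z : ∀ {x} → ℓ ≤ x → (1 ≤ lo (nth L x) × lo (nth L x) + hgt (nth L x) ≤ suc w) ⊎ nth L x ≡ void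
    high-Z {x} p with x ∸ ℓ <? length Z
    ... | yes q = inj₁ (subst (λ d → 1 ≤ lo d × lo d + hgt d ≤ suc w) (sym (at-Z p)) (highZ (nth-∈ Z q)))
    ... | no q = inj₂ (trans (at-Z p) (nth-out Z (≮⇒≥ q)))

    paired : ∀ x → Paired (nth L x) (nth L' x)
    paired x with ≤-<-connex ℓ x
    ... | inj₂ p = low (proj₁ (low-A p)) (proj₂ (low-A p)) (nth-A p)
    ... | inj₁ p with high-Z p
    ... | inj₁ (a , b) = high a b (nth-Z p)
    ... | inj₂ q = none q (trans (nth-Z p) (cong down q))

    hgt≡ : ∀ {d d'} → Paired d d' → hgt d' ≡ hgt d
    hgt≡ (low _ _ refl) = refl
    hgt≡ (high _ _ refl) = refl
    hgt≡ (none refl refl) = refl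

    ⊆→ : ∀ {d d' c c'} → 0 < hgt d → Paired d d' → Paired c c' → d ⊆ c → d' ⊆ c'
    ⊆→ p (none refl _) k s = ⊥-elim (<-irrefl refl p)
    ⊆→ p k (none refl _) s = ⊥-elim (⊆-void p s)
    ⊆→ p (low _ _ refl) (low _ _ refl) s = s
    ⊆→ p (low a _ refl) (high b _ refl) (s , _) = ⊥-elim (<⇒≱ b (≤-trans s (≡⇒≤ a)))
    ⊆→ {d} p (high _ b refl) (low u v refl) s = ≤-trans (≡⇒≤ u) z≤n , ≤-trans (+-monoˡ-≤ (hgt d) pred[n]≤n) (≤-trans b (≤-trans v (m≤n+m _ _)))
    ⊆→ {⟨ suc a , h , _ ⟩} {c = ⟨ suc b , h' , _ ⟩} p (high _ _ refl) (high _ _ refl) (s≤s s , s≤s s') = s , s'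

    ⊆← : ∀ {d d' c c'} → 0 < hgt d → Paired d d' → Paired c c' → d' ⊆ c' → d ⊆ c
    ⊆← p (none refl _) k s = ⊥-elim (<-irrefl refl p)
    ⊆← p k (none _ refl) s = ⊥-elim (⊆-void (subst (0 <_) (sym (hgt≡ k)) p) s)
    ⊆← p (low _ _ refl) (low _ _ refl) s = s
    ⊆← {d} {c = ⟨ suc b , h' , _ ⟩} p (low _ a refl) (high _ v refl) (_ , s) = ⊥-elim (<⇒≱ v (≤-trans a (≤-trans (m≤n+m _ (lo d)) s)))
    ⊆← {d} p (high _ b refl) (low u v refl) s = ≤-trans (≡⇒≤ u) z≤n , ≤-trans b (≤-trans v (m≤n+m _ _))
    ⊆← {⟨ suc a , h , _ ⟩} {c = ⟨ suc b , h' , _ ⟩} p (high _ _ refl) (high _ _ refl) (s , s') = s≤s s , s≤s s'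

    pos-nth : ∀ {x} → x < length L → 0 < hgt (nth L x)
    pos-nth p = pos (nth-∈ L p)

  pos' : ∀ {d} → d ∈ L' → 0 < hgt d
  pos' i = let (x , p , q) = ∈-nth i in subst (λ d → 0 < hgt d) q (subst (0 <_) (sym (hgt≡ (paired x))) (pos-nth (subst (x <_) len p)))

  sorted' : Sorted L'
  sorted' = nth-AllPairs L' (λ {i} {j} p q → let q' = subst (j <_) len q in ⊆→ (pos-nth q') (paired j) (paired i) (AllPairs-nth L sorted p q'))

  private
    cols≡ : ∀ {d d'} → 0 < hgt d → Paired d d' → ∀ x → cols L d x ≡ cols L' d' x
    cols≡ {d} {d'} p k x = does-⇔ (d ⊆? nth L x) (d' ⊆? nth L' x) (⊆→ p k (paired x)) (⊆← p k (paired x))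

    span≡ : ∀ {d d'} → 0 < hgt d → Paired d d' → span L d ≡ span L' d'
    span≡ {d} {d'} p k = trans (sumL-nth (λ c → ind (does (d ⊆? c))) L)
      (trans (S-cong (length L) (λ x _ → cong ind (cols≡ p k x))) (trans (cong (S (λ x → ind (cols L' d' x))) (sym len)) (sym (sumL-nth (λ c → ind (does (d' ⊆? c))) L'))))

    in-range : ∀ {d} → 0 < hgt d → ∀ {x} → d ⊆ nth L x → x < length L
    in-range {d} p {x} s with x <? length L
    ... | yes q = q
    ... | no q = ⊥-elim (⊆-void p (subst (d ⊆_) (nth-out L (≮⇒≥ q)) s))

    cols-convex : ∀ {d} → 0 < hgt d → Convex (cols L d)
    cols-convex {d} p {i} {j} {k} u v _ b = does-yes (d ⊆? nth L j) (⊆-trans s (Sorted-nth L sorted v (in-range p s)))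
      where s = yes-does (d ⊆? nth L k) b

    shift→ : ∀ {x y} → ℓ ≤ x → within (nth L x) (cyc⁻ 0 w y) → within (nth L' x) y
    shift→ {x} {y} p q = subst (λ d → within d y) (sym (nth-Z p)) (go (nth L x) (high-Z p) (place {0} {w} y) q)
      where
      go : ∀ d → (1 ≤ lo d × lo d + hgt d ≤ suc w) ⊎ d ≡ void → Place {0} {w} y → within d (cyc⁻ 0 w y) → within (down d) y
      go d (inj₂ refl) _ (_ , ())
      go ⟨ suc a , h , _ ⟩ (inj₁ (_ , b)) (inside r) q = let (u , v) = subst (InW (suc a) h) (cyc⁻-in {0} {w} r) q in ≤-pred u , ≤-pred v
      go ⟨ suc a , h , _ ⟩ (inj₁ (_ , b)) (last refl) q = ⊥-elim (<⇒≱ (s≤s z≤n) (proj₁ (subst (InW (suc a) h) (cyc⁻-last {0} {w}) q)))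
      go ⟨ suc a , h , _ ⟩ (inj₁ (_ , b)) (outside r) q = ⊥-elim (r (z≤n , ≤-trans (proj₂ (subst (InW (suc a) h) (cyc⁻-out {0} {w} r) q)) b))

    shift← : ∀ {x y} → ℓ ≤ x → within (nth L' x) y → within (nth L x) (cyc⁻ 0 w y)
    shift← {x} {y} p q = go (nth L x) (high-Z p) (place {0} {w} y) (subst (λ d → within d y) (nth-Z p) q)
      where
      go : ∀ d → (1 ≤ lo d × lo d + hgt d ≤ suc w) ⊎ d ≡ void → Place {0} {w} y → within (down d) y → within d (cyc⁻ 0 w y)
      go d (inj₂ refl) _ (_ , ())
      go ⟨ suc a , h , _ ⟩ (inj₁ (_ , b)) (inside r) (u , v) = subst (InW (suc a) h) (sym (cyc⁻-in {0} {w} r)) (s≤s u , s≤s v)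
      go ⟨ suc a , h , _ ⟩ (inj₁ (_ , b)) (last refl) (u , v) = ⊥-elim (<⇒≱ (s≤s v) b)
      go ⟨ suc a , h , _ ⟩ (inj₁ (_ , b)) (outside r) (u , v) = ⊥-elim (r (z≤n , ≤-trans (≤-trans v (n≤1+n _)) b))

    covered : ∀ {x y} → x < ℓ → y < suc w → within (nth L x) y
    covered {x} {y} p q = let (u , v) = low-A p in ≤-trans (≡⇒≤ u) z≤n , ≤-trans q (≤-trans v (m≤n+m _ _))

  _⊺ : Grid → Grid
  (F ⊺) y x = F x y

  Rows : Grid → Grid → Set
  Rows F F' = CM.Move (F ⊺) (F' ⊺)

  Entries-⊺ : ∀ {F} → Entries t F → Entries (transposed t) (F ⊺)
  Entries-⊺ z e x y = z (k t e) y x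
    where
    k : ∀ t → kind (transposed t) ≡ wk → kind t ≡ wk
    k nE _ = refl
    k Ne _ = refl

  Entries-⊺⁻ : ∀ {F} → Entries (transposed t) F → Entries t (F ⊺)
  Entries-⊺⁻ z e x y = z (k t e) y x
    where
    k : ∀ t → kind t ≡ wk → kind (transposed t) ≡ wk
    k nE _ = refl
    k Ne _ = refl

  private
    Legal⇒ : ∀ {F F'} → Legal t L F → Entries t F' → Rows F F' → Legal t L' F'
    Legal⇒ {F} {F'} (s , _) z m = supp , z
      where
      supp : ∀ x y → ¬ within (nth L' x) y → F' x y ≡ 0
      supp x y nw with CM.inside? y x
      ... | yes ((_ , p) , (_ , q)) = ⊥-elim (nw (subst (λ d → within d y) (sym (nth-A q)) (covered q p)))
      ... | no q with ≤-<-connex ℓ x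
      ... | inj₁ p = trans (CM.Move.away m y x q) (s x _ (λ v → nw (shift→ p v)))
      ... | inj₂ p = trans (CM.Move.away m y x q) (trans (cong (F x) (cyc⁻-out {0} {w} (λ r → q (r , z≤n , p)))) (s x y (λ v → nw (subst (λ d → within d y) (sym (nth-A p)) v))))

    Legal⇐ : ∀ {F F'} → Legal t L' F' → Entries t F → Rows F F' → Legal t L F
    Legal⇐ {F} {F'} (s , _) z m = supp , z
      where
      supp : ∀ x y → ¬ within (nth L x) y → F x y ≡ 0
      supp x y nw with CM.inside? y x
      ... | yes ((_ , p) , (_ , q)) = ⊥-elim (nw (covered q p))
      ... | no q with ≤-<-connex ℓ x
      ... | inj₁ p = trans back (s x _ (λ v → nw (subst (within (nth L x)) (cyc⁻-cyc {0} {w} y) (shift← p v))))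
        where
        back : F x y ≡ F' x (cyc 0 w y)
        back = sym (trans (CM.Move.away m (cyc 0 w y) x (CM.Inside-cyc q)) (cong (F x) (cyc⁻-cyc {0} {w} y)))
      ... | inj₂ p = trans (sym (trans (CM.Move.away m y x q) (cong (F x) (cyc⁻-out {0} {w} (λ r → q (r , z≤n , p)))))) (s x y (λ v → nw (subst (λ d → within d y) (nth-A p) v)))

    -- After transposition row `0` is the moved line and the columns of `A` bound its length. The
    -- rectangle of a column of `A` contains the rows `0 … w` and lies within `A`; that of a column
    -- of `Z` avoids row `0` and contains all of `A`.
    both : ∀ {F F'} → Entries t F → Rows F F' → ∀ {d d'} → 0 < hgt d → Paired d d' →
        Both (CmpT t) (at (res (cols L d) (rows d) F)) (at (res (cols L' d') (rows d') F'))
    both z m p (none refl _) = ⊥-elim (<-irrefl refl p)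
    both {F} {F'} z m {d} p k@(low a b refl) =
      Both-trans (≡⇒Both (res-swap (cols L d) (rows d) F))
      (Both-trans (Both-tr {t} {res (rows d) (cols L d) (F ⊺)} {res (rows d) (cols L d) (F' ⊺)}
        (CM.full-width (Entries-⊺ z) m (rows d) (cols L d) (λ y q → does-yes (within? d y) (≤-trans (≡⇒≤ a) z≤n , ≤-trans (proj₂ q) (≤-trans b (m≤n+m _ _)))) (λ {i} {j} {k} → cols-convex {d} p {i} {j} {k}) left))
      (≡⇒Both (λ (x , y) → trans (sym (res-swap (cols L d) (rows d) F' (x , y))) (cong (λ b → if b ∧ rows d y then F' x y else 0) (cols≡ p k x)))))
      where
      left : ∀ x → cols L d x ≡ true → InW 0 ℓ x
      left x c with ≤-<-connex ℓ x
      ... | inj₂ q = z≤n , q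
      ... | inj₁ q with high-Z q
      ... | inj₁ (u , _) = ⊥-elim (<⇒≱ u (≤-trans (_⊆_.low (yes-does (d ⊆? nth L x) c)) (≡⇒≤ a)))
      ... | inj₂ u = ⊥-elim (⊆-void p (subst (d ⊆_) u (yes-does (d ⊆? nth L x) c)))
    both {F} {F'} z m {⟨ suc a , h , g ⟩} p k@(high _ b refl) =
      Both-trans (≡⇒Both (res-swap (cols L d) (rows d) F))
      (Both-trans (Both-tr {t} {res (rows d) (cols L d) (F ⊺)} {res (rows d ∘ suc) (cols L d) (F' ⊺)}
        (CM.full-height (Entries-⊺ z) m (rows d) (cols L d) (does-no (within? d 0) (λ { (() , _) }))
          (λ y q → z≤n , ≤-pred (≤-trans (proj₂ (yes-does (within? d (suc y)) q)) b)) (λ q r → rows-convex d (s≤s q) (s≤s r))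
          (λ x q → does-yes (d ⊆? nth L x) (≤-trans (≡⇒≤ (proj₁ (low-A (proj₂ q)))) z≤n , ≤-trans b (≤-trans (proj₂ (low-A (proj₂ q))) (m≤n+m _ _))))))
      (≡⇒Both (λ (x , y) → trans (sym (res-swap (cols L d) (rows d ∘ suc) F' (x , y))) (cong₂ (λ b c → if b ∧ c then F' x y else 0) (cols≡ p k x)
         (does-⇔ (within? d (suc y)) (within? (down d) y) (λ { (s≤s u , s≤s v) → u , v }) (λ { (u , v) → s≤s u , s≤s v }))))))
      where
      d : Col
      d = ⟨ suc a , h , g ⟩

    ok→ : ∀ {F F'} → Entries t F → Rows F F' → ∀ Λ → GoodL t L Λ F → GoodL t L' Λ F'
    ok→ {F} {F'} z m Λ g i with ∈-nth i
    ... | x , q , refl = subst₂ (λ h v → ChainOK t G' (Λ h v)) (sym (hgt≡ (paired x))) (span≡ (pos-nth q') (paired x))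
        (ChainOK-Both {t} {G} {G'} {Λ (hgt (nth L x)) (span L (nth L x))} (both z m (pos-nth q') (paired x)) (g (nth-∈ L q')))
      where
      q' = subst (x <_) len q
      G G' : Grid
      G = res (cols L (nth L x)) (rows (nth L x)) F
      G' = res (cols L' (nth L' x)) (rows (nth L' x)) F'

    ok← : ∀ {F F'} → Entries t F → Rows F F' → ∀ Λ → GoodL t L' Λ F' → GoodL t L Λ F
    ok← {F} {F'} z m Λ g i with ∈-nth i
    ... | x , q , refl = subst₂ (λ h v → ChainOK t G (Λ h v)) (hgt≡ (paired x)) (sym (span≡ (pos-nth q) (paired x)))
        (ChainOK-Both {t} {G'} {G} {Λ (hgt (nth L' x)) (span L' (nth L' x))} (Both-sym (both z m (pos-nth q) (paired x))) (g (nth-∈ L' (subst (x <_) (sym len) q))))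
      where
      G G' : Grid
      G = res (cols L (nth L x)) (rows (nth L x)) F
      G' = res (cols L' (nth L' x)) (rows (nth L' x)) F'

  step : Eqv t (TotalSame L L') L L'
  step = record
    { Rel = Rows
    ; to-rel = λ F o → let (F' , z' , m) = CM.move-total (F ⊺) (Entries-⊺ (proj₂ o)) in F' ⊺ , Legal⇒ o (Entries-⊺⁻ z') m , m
    ; from-rel = λ F' o → let (F , z , m) = CM.move-total' (F' ⊺) (Entries-⊺ (proj₂ o)) in F ⊺ , Legal⇐ o (Entries-⊺⁻ z) m , m
    ; uniq = λ o g _ _ p m m' x y → CM.move-unique (Entries-⊺ (proj₂ o)) (Entries-⊺ (proj₂ g)) (λ x y → p y x) m m' y x
    ; uniq' = λ o g _ _ p m m' x y → CM.move-unique' (Entries-⊺ (proj₂ o)) (Entries-⊺ (proj₂ g)) (λ x y → p y x) m m' y x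
    ; good = λ o _ m Λ → ok→ (proj₂ o) m Λ
    ; good' = λ o _ m Λ → ok← (proj₂ o) m Λ
    -- Totals are comparable only when all rows taking part in the move are counted.
    ; extra = λ o o' m → suc w , λ N p → trans (S-cong (length L) (λ x _ → sym (CM.move-row (Entries-⊺ (proj₂ o)) m x N p))) (cong (S _) (sym len)) }

ground : Col → Col
ground d = ⟨ 0 , hgt d , tag d ⟩

-- `A` collects the columns that stand on row `0`, and `a` is contained in all of them. A row step
-- lowers the whole rest by one; once the first column of the rest reaches row `0`, it joins `A` as
-- the new `a`.
align : ∀ t m k A a Z → length Z ≡ m → lo (nth Z 0) ≡ k → (∀ {d} → d ∈ A → lo d ≡ 0 × a ⊆ d) → a ∈ A → Sorted (A ++ Z) → (∀ {d} → d ∈ A ++ Z → 0 < hgt d) →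
    Eqv t (TotalSame (A ++ Z) (A ++ map ground Z)) (A ++ Z) (A ++ map ground Z)
align t m k A a [] l e low i s p = Eqv-refl (TotalSame-refl {A ++ []})
align t (suc m) zero A a (⟨ zero , h , g ⟩ ∷ Z) l refl low i s p =
  subst₂ (λ X Y → Eqv t (TotalSame X Y) X Y) (++-assoc A (z ∷ []) Z) (++-assoc A (z ∷ []) (map ground Z))
    (align t m (lo (nth Z 0)) (A ++ z ∷ []) z Z (suc-injective l) refl low' (∈-++⁺ʳ A (here refl)) (subst Sorted (sym (++-assoc A (z ∷ []) Z)) s) (λ j → p (subst (_ ∈_) (++-assoc A (z ∷ []) Z) j)))
  where
  z : Col
  z = ⟨ zero , h , g ⟩
  low' : ∀ {d} → d ∈ A ++ z ∷ [] → lo d ≡ 0 × z ⊆ d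
  low' j with ∈-++⁻ A j
  ... | inj₁ q = proj₁ (low q) , AllPairs-cross A s q (here refl)
  ... | inj₂ (here refl) = refl , ⊆-refl
align t (suc m) (suc k) A a (z ∷ Z) l e low i s p =
  subst (λ V → Eqv t (TotalSame (A ++ z ∷ Z) (A ++ V)) (A ++ z ∷ Z) (A ++ V)) (sym (map-∘ (z ∷ Z)))
    (Eqv-trans (λ {F} {F'} {F''} → TotalSame-trans {A ++ z ∷ Z} {A ++ map down (z ∷ Z)} {A ++ map ground (map down (z ∷ Z))} {F} {F'} {F''}) St.step
      (align t (suc m) k A a (map down (z ∷ Z)) (trans (length-map down (z ∷ Z)) l) (cong pred e) low i St.sorted' St.pos'))
  where
  -- The rows `0 … w` are those of `a`: every column of `A` contains them, and by sortedness every
  -- column of the rest lies within them.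
  w : ℕ
  w = pred (hgt a)
  w≡ : suc w ≡ hgt a
  w≡ = suc-pred (hgt a) {{>-nonZero (p (∈-++⁺ˡ i))}}
  lowA : ∀ {d} → d ∈ A → lo d ≡ 0 × suc w ≤ hgt d
  lowA {d} j = let (u , v) = low j in u , ≤-trans (≡⇒≤ w≡) (≤-trans (m≤n+m (hgt a) (lo a)) (≤-trans (_⊆_.high v) (≡⇒≤ (cong (_+ hgt d) u))))
  highZ : ∀ {d} → d ∈ z ∷ Z → 1 ≤ lo d × lo d + hgt d ≤ suc w
  highZ {d} j = lift j , ≤-trans (_⊆_.high (AllPairs-cross A s i j)) (≡⇒≤ (trans (cong (_+ hgt a) (proj₁ (low i))) (sym w≡)))
    where
    lift : d ∈ z ∷ Z → 1 ≤ lo d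
    lift (here refl) = subst (1 ≤_) (sym e) (s≤s z≤n)
    lift (there j) = ≤-trans (subst (1 ≤_) (sym e) (s≤s z≤n)) (_⊆_.low (AllPairs-cross (z ∷ []) (AllPairs-++⁻ʳ A s) (here refl) j))
  module St = RowStep t A (z ∷ Z) w lowA highZ s p

record Lunar (P : List Col) : Set where
  field
    pos : ∀ {d} → d ∈ P → 0 < hgt d
    nested : ∀ {d e} → d ∈ P → e ∈ P → d ⊆ e ⊎ e ⊆ d
    convex : RowConvex P

permute : ∀ t {P P'} → P ↭ P' → Lunar P → Lunar P' → Eqv t (SameSums P P') P P'
permute t {P} {P'} p m m' = subst₂ (λ X Y → Eqv t (SameSums X Y) X Y) (++-identityʳ P) (++-identityʳ P')
  (rearrange t (length P) P P' [] refl p (moon m) (moon m'))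
  where
  moon : ∀ {P} → Lunar P → Moon P []
  moon {P} m = record { pos = pos ∘ out ; nested = λ i j → nested (out i) (out j) ; convex = convex ; tail⊆ = λ _ () }
    where
    open Lunar m
    out : ∀ {d} → d ∈ P ++ [] → d ∈ P
    out = subst (_ ∈_) (++-identityʳ P)

sort : ∀ n L → length L ≡ n → (∀ {d e} → d ∈ L → e ∈ L → d ⊆ e ⊎ e ⊆ d) → ∃ λ P → L ↭ P × Sorted P
sort zero [] l h = [] , ↭-refl , []
sort (suc n) L l h with smallest L h (subst (0 <_) (sym l) (s≤s z≤n))
... | c , c∈ , mn with ∈-∃++ c∈
... | xs , ys , refl =
  let (P , p , s) = sort n (xs ++ ys) (suc-injective (trans (sym (pick-length (pick-++ {x = c} xs))) l)) (λ i j → h (pick-∈ (pick-++ xs) i) (pick-∈ (pick-++ xs) j))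
  in P ++ c ∷ [] , ↭-trans (shift c xs ys) (↭-trans (Perm.prep c p) (∷↭∷ʳ c P)) ,
     AllPairsP.++⁺ s ([] ∷ []) (All.tabulate (λ i → mn (pick-∈ (pick-++ xs) (∈-resp-↭ (↭-sym p) i)) ∷ []))

Sorted⇒RowConvex : ∀ {L} → Sorted L → RowConvex L
Sorted⇒RowConvex [] = tt
Sorted⇒RowConvex (_ ∷ s) = AllPairs.map (λ p d _ _ q → ⊆-trans q p) s , Sorted⇒RowConvex s

Sorted⇒nested : ∀ {L d e} → Sorted L → d ∈ L → e ∈ L → d ⊆ e ⊎ e ⊆ d
Sorted⇒nested (_ ∷ s) (here refl) (here refl) = inj₁ ⊆-refl
Sorted⇒nested (p ∷ s) (here refl) (there j) = inj₂ (All.lookup p j)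
Sorted⇒nested (p ∷ s) (there i) (here refl) = inj₁ (All.lookup p i)
Sorted⇒nested (p ∷ s) (there i) (there j) = Sorted⇒nested s i j

-- Heights are measured from the lowest bottom of the polyomino. After sorting, the first column
-- contains all others and so starts at row `0`.
Grounded : List Col → Set
Grounded L = ∀ {d} → d ∈ L → ∃ λ c → c ∈ L × lo c ≡ 0

flatten : ∀ t {L} → Lunar L → Grounded L → ∃ λ G → Eqv t (TotalSame L G) L G × map ground L ↭ G × Lunar G
flatten t {L} mo gr with sort (length L) L refl (Lunar.nested mo)
... | [] , p , s = [] , Eqv-map (λ {F} {F'} → SameSums⇒TotalSame {L} {[]} {F} {F'}) (permute t p mo (record { pos = λ () ; nested = λ () ; convex = tt })) , PermP.map⁺ ground p , record { pos = λ () ; nested = λ () ; convex = tt }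
... | P@(a ∷ Z) , p , s@(sa ∷ _) = map ground P ,
    Eqv-trans (λ {F} {F'} {F''} → TotalSame-trans {L} {P} {map ground P} {F} {F'} {F''}) (Eqv-map (SameSums⇒TotalSame {L} {P}) (permute t p mo moP))
      (subst (λ d → Eqv t (TotalSame P (d ∷ map ground Z)) P (d ∷ map ground Z)) (cong (λ l → ⟨ l , hgt a , tag a ⟩) lo-a)
        (align t (length Z) (lo (nth Z 0)) (a ∷ []) a Z refl refl (λ { (here refl) → lo-a , ⊆-refl }) (here refl) s posP)) ,
    PermP.map⁺ ground p , moG
  where
  posP : ∀ {d} → d ∈ P → 0 < hgt d
  posP i = Lunar.pos mo (∈-resp-↭ (↭-sym p) i)
  moP : Lunar P
  moP = record { pos = posP ; nested = Sorted⇒nested s ; convex = Sorted⇒RowConvex s }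
  lo-a : lo a ≡ 0
  lo-a = let (c , i , q) = gr (∈-resp-↭ (↭-sym p) (here refl)) in n≤0⇒n≡0 (≤-trans (below (∈-resp-↭ p i)) (≡⇒≤ q))
    where
    below : ∀ {c} → c ∈ P → lo a ≤ lo c
    below (here refl) = ≤-refl
    below (there i) = _⊆_.low (All.lookup sa i)
  sG : Sorted (map ground P)
  sG = AllPairsP.map⁺ (AllPairs.map (λ {d} {c} (u , v) → z≤n , lin 4 (λ a b h k → (a ≼ b) ∷ (b ⊕ k ≼ a ⊕ h) ∷ [] ⊢ k ≼ h) (lo d) (lo c) (hgt d) (hgt c) u v) s)
  moG : Lunar (map ground P)
  moG = record { pos = λ i → let (d , j , q) = ∈-map⁻ ground i in subst (λ c → 0 < hgt c) (sym q) (posP j) ; nested = Sorted⇒nested sG ; convex = Sorted⇒RowConvex sG }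

-- `ground` remembers only the height and the tag of a column. Two Ferrers shapes of equal content
-- are thus permutations of one list, and `permute` joins them.
sameContent : ∀ t {L L'} → Lunar L → Lunar L' → Grounded L → Grounded L' → map ground L ↭ map ground L' → Eqv t (TotalSame L L') L L'
sameContent t {L} {L'} mo mo' gr gr' p =
  let (G , A , q , mG) = flatten t mo gr ; (G' , A' , q' , mG') = flatten t mo' gr'
  in Eqv-trans (λ {F} {F'} {F''} → TotalSame-trans {L} {G} {L'} {F} {F'} {F''}) A
       (Eqv-trans (λ {F} {F'} {F''} → TotalSame-trans {G} {G'} {L'} {F} {F'} {F''}) (Eqv-map (SameSums⇒TotalSame {G} {G'}) (permute t (↭-trans (↭-sym q) (↭-trans p q')) mG mG'))
         (Eqv-sym (λ {F} {F'} → TotalSame-sym {L'} {G'} {F} {F'}) A'))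

-- Maximal rectangles and the columns that span them

Slab : List Col → ℕ → ℕ → Col → Set
Slab L l w d = 0 < w × 0 < hgt d × l + w ≤ length L × (∀ x → InW l w x → d ⊆ nth L x)

Maximal : List Col → ℕ → ℕ → Col → Set
Maximal L l w d = Slab L l w d × (∀ {l' w' d'} → Slab L l' w' d' → l' ≤ l → l + w ≤ l' + w' → d ⊆ d' → w' ≡ w × hgt d' ≡ hgt d)

record IsInterval (J : ℕ → Bool) (N l w : ℕ) : Set where
  field
    nonempty : 0 < w
    bounded : l + w ≤ N
    below : ∀ x → x < N → J x ≡ true → InW l w x
    above : ∀ x → InW l w x → J x ≡ true
    count : S (ind ∘ J) N ≡ w

true-or-false : ∀ b → b ≡ true ⊎ b ≡ false
true-or-false true = inj₁ refl
true-or-false false = inj₂ refl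

convex⇒interval : ∀ {J} → Convex J → ∀ N → (∀ x → x < N → J x ≡ false) × S (ind ∘ J) N ≡ 0 ⊎ ∃ λ l → ∃ λ w → IsInterval J N l w
convex⇒interval c zero = inj₁ ((λ _ ()) , refl)
convex⇒interval {J} c (suc N) with convex⇒interval {J} c N | true-or-false (J N)
... | inj₁ (h , z) | inj₂ q = inj₁ (none , cong₂ (λ a b → a + ind b) z q)
  where
  none : ∀ x → x < suc N → J x ≡ false
  none x p with ≤-split (≤-pred p)
  ... | inj₁ r = h x r
  ... | inj₂ refl = q
... | inj₁ (h , z) | inj₁ q = inj₂ (N , 1 , record { nonempty = s≤s z≤n ; bounded = ≡⇒≤ (+-comm N 1) ; below = only
    ; above = λ x (u , v) → subst (λ x → J x ≡ true) (≤-antisym u (≤-pred (≤-trans v (≡⇒≤ (+-comm N 1))))) q ; count = cong₂ (λ a b → a + ind b) z q })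
  where
  only : ∀ x → x < suc N → J x ≡ true → InW N 1 x
  only x p e with ≤-split (≤-pred p)
  ... | inj₁ r = ⊥-elim (false≢true (trans (sym (h x r)) e))
  ... | inj₂ refl = ≤-refl , ≡⇒≤ (+-comm 1 N)
... | inj₂ (l , w , I) | inj₂ q = inj₂ (l , w , record { nonempty = nonempty ; bounded = ≤-suc bounded ; below = only ; above = above ; count = trans (cong₂ (λ a b → a + ind b) count q) (+-identityʳ w) })
  where
  open IsInterval I
  only : ∀ x → x < suc N → J x ≡ true → InW l w x
  only x p e with ≤-split (≤-pred p)
  ... | inj₁ r = below x r e
  ... | inj₂ refl = ⊥-elim (false≢true (trans (sym q) e))
... | inj₂ (l , w , I) | inj₁ q = inj₂ (l , suc w , record { nonempty = s≤s z≤n ; bounded = ≡⇒≤ (trans (+-suc l w) (cong suc end)) ; below = only ; above = all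
    ; count = trans (cong₂ (λ a b → a + ind b) count q) (+-comm w 1) })
  where
  open IsInterval I
  end : l + w ≡ N
  end with ≤-split bounded
  ... | inj₂ r = r
  ... | inj₁ r = ⊥-elim (<-irrefl refl (proj₂ (below (l + w) r (c (m≤m+n l w) (<⇒≤ r) (above l (≤-refl , m<m+n l nonempty)) q))))
  only : ∀ x → x < suc N → J x ≡ true → InW l (suc w) x
  only x p e with ≤-split (≤-pred p)
  ... | inj₁ r = proj₁ (below x r e) , ≤-trans (proj₂ (below x r e)) (+-monoʳ-≤ l (n≤1+n w))
  ... | inj₂ refl = ≤-trans (m≤m+n l w) (≡⇒≤ end) , ≡⇒≤ (sym (trans (+-suc l w) (cong suc end)))
  all : ∀ x → InW l (suc w) x → J x ≡ true
  all x (u , v) with ≤-split (≤-pred (≤-trans v (≡⇒≤ (+-suc l w))))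
  ... | inj₁ r = above x (u , r)
  ... | inj₂ r = subst (λ x → J x ≡ true) (sym (trans r end)) q

⊆-antisym-hgt : ∀ {d e} → d ⊆ e → e ⊆ d → hgt d ≡ hgt e
⊆-antisym-hgt {d} {e} (a , b) (a' , b') =
  ≤-antisym (lin 4 (λ x y h k → (x ≼ y) ∷ (y ⊕ h ≼ x ⊕ k) ∷ [] ⊢ h ≼ k) (lo e) (lo d) (hgt d) (hgt e) a b)
      (lin 4 (λ x y h k → (y ≼ x) ∷ (x ⊕ k ≼ y ⊕ h) ∷ [] ⊢ k ≼ h) (lo e) (lo d) (hgt d) (hgt e) a' b')

⊆-≡-lo : ∀ {d e} → d ⊆ e → hgt e ≡ hgt d → lo d ≡ lo e
⊆-≡-lo {d} {e} (a , b) p = ≤-antisym (+-cancelʳ-≤ (hgt e) _ _ (≤-trans (≡⇒≤ (cong (lo d +_) p)) b)) a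

module Rectangles {L : List Col} (mo : Lunar L) where

  open Lunar mo

  cols-range : ∀ {d} → 0 < hgt d → ∀ {x} → d ⊆ nth L x → x < length L
  cols-range {d} p {x} s with x <? length L
  ... | yes q = q
  ... | no q = ⊥-elim (⊆-void p (subst (d ⊆_) (nth-out L (≮⇒≥ q)) s))

  cols-Convex : ∀ {d} → 0 < hgt d → Convex (cols L d)
  cols-Convex {d} p {i} {j} {k} u v a b with ≤-split u | ≤-split v
  ... | inj₂ refl | _ = a
  ... | inj₁ _ | inj₂ refl = b
  ... | inj₁ u' | inj₁ v' = does-yes (d ⊆? nth L j) (RowConvex-nth L convex u' v' (cols-range p s) d p (yes-does (d ⊆? nth L i) a) s)
    where s = yes-does (d ⊆? nth L k) b

  -- The maximal rectangle whose rows are those of the column d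
  record Spanned (d : Col) (l w : ℕ) : Set where
    field
      wide : w ≡ span L d
      inside→ : ∀ x → cols L d x ≡ true → InW l w x
      inside← : ∀ x → InW l w x → cols L d x ≡ true

  -- A rectangle containing this one has `d` among its columns, so its rows are those of `d`. All
  -- its columns contain `d`, so they were counted already.
  column-rectangle : ∀ {d} → d ∈ L → ∃ λ l → ∃ λ w → Maximal L l w d × Spanned d l w
  column-rectangle {d} i with convex⇒interval {cols L d} (λ {a} {b} {c} → cols-Convex {d} (pos i) {a} {b} {c}) (length L) | ∈-nth i
  ... | inj₁ (h , _) | x , p , q = ⊥-elim (false≢true (trans (sym (h x p)) (does-yes (d ⊆? nth L x) (subst (d ⊆_) (sym q) ⊆-refl))))
  ... | inj₂ (l , w , I) | x₀ , p₀ , q₀ = l , w , (slab , maximal) ,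
      record { wide = trans (sym count) (sym (sumL-nth (λ c → ind (does (d ⊆? c))) L)) ; inside→ = λ x e → below x (cols-range (pos i) (yes-does (d ⊆? nth L x) e)) e ; inside← = above }
    where
    open IsInterval I
    slab : Slab L l w d
    slab = nonempty , pos i , bounded , λ x p → yes-does (d ⊆? nth L x) (above x p)
    maximal : ∀ {l' w' d'} → Slab L l' w' d' → l' ≤ l → l + w ≤ l' + w' → d ⊆ d' → w' ≡ w × hgt d' ≡ hgt d
    maximal {l'} {suc w'} {d'} (_ , p , _ , h) u v s = ≤-antisym w≤ (+-cancelˡ-≤ l _ _ (≤-trans v (+-monoˡ-≤ (suc w') u))) , ⊆-antisym-hgt d'⊆ s
      where
      at₀ : InW l w x₀
      at₀ = below x₀ p₀ (does-yes (d ⊆? nth L x₀) (subst (d ⊆_) (sym q₀) ⊆-refl))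
      d'⊆ : d' ⊆ d
      d'⊆ = subst (d' ⊆_) q₀ (h x₀ (≤-trans u (proj₁ at₀) , ≤-trans (proj₂ at₀) v))
      back : ∀ x → InW l' (suc w') x → InW l w x
      back x r = let s' = ⊆-trans s (h x r) in below x (cols-range (pos i) s') (does-yes (d ⊆? nth L x) s')
      w≤ : suc w' ≤ w
      w≤ = +-cancelˡ-≤ l _ _ (≤-trans (+-monoˡ-≤ (suc w') (proj₁ (back l' (≤-refl , m<m+n l' (s≤s z≤n)))))
             (≤-trans (≡⇒≤ (+-suc l' w')) (proj₂ (back (l' + w') (m≤m+n l' w' , +-monoʳ-< l' (n<1+n w'))))))

  narrowest : ∀ l w → l + suc w ≤ length L → ∃ λ x → InW l (suc w) x × (∀ x' → InW l (suc w) x' → nth L x ⊆ nth L x')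
  narrowest l zero p = l , (≤-refl , m<m+n l (s≤s z≤n)) , λ x (u , v) → subst (λ x → nth L l ⊆ nth L x) (≤-antisym u (≤-pred (≤-trans v (≡⇒≤ (+-comm l 1))))) ⊆-refl
  narrowest l (suc w) p with narrowest l w (≤-trans (+-monoʳ-≤ l (n≤1+n (suc w))) p)
  ... | x , (u , v) , h with nested (nth-∈ L (≤-trans v (≤-trans (+-monoʳ-≤ l (n≤1+n (suc w))) p))) (nth-∈ L (≤-trans (+-monoʳ-< l (n<1+n (suc w))) p))
  ... | inj₁ s = x , (u , ≤-trans v (+-monoʳ-≤ l (n≤1+n (suc w)))) , least
    where
    least : ∀ x' → InW l (suc (suc w)) x' → nth L x ⊆ nth L x'
    least x' (a , b) with ≤-split (≤-pred (≤-trans b (≡⇒≤ (+-suc l (suc w)))))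
    ... | inj₁ r = h x' (a , r)
    ... | inj₂ refl = s
  ... | inj₂ s = l + suc w , (m≤m+n l (suc w) , +-monoʳ-< l (n<1+n (suc w))) , least
    where
    least : ∀ x' → InW l (suc (suc w)) x' → nth L (l + suc w) ⊆ nth L x'
    least x' (a , b) with ≤-split (≤-pred (≤-trans b (≡⇒≤ (+-suc l (suc w)))))
    ... | inj₁ r = ⊆-trans s (h x' (a , r))
    ... | inj₂ refl = ⊆-refl

  -- The rows of a rectangle lie in its shortest column, and the rectangle of that column contains
  -- it; maximality makes the two coincide.
  rectangle-column : ∀ {l w d} → Maximal L l w d → ∃ λ c → c ∈ L × lo c ≡ lo d × hgt c ≡ hgt d × Spanned c l w
  rectangle-column {l} {suc w} {d} ((_ , p , q , h) , mx) with narrowest l w q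
  ... | x , r , least with column-rectangle (nth-∈ L (≤-trans (proj₂ r) q))
  ... | l₂ , w₂ , (sl , _) , Sp with mx sl l≤ end (h x r)
    where
    open Spanned Sp
    back : ∀ x' → InW l (suc w) x' → InW l₂ w₂ x'
    back x' r' = inside→ x' (does-yes (nth L x ⊆? nth L x') (least x' r'))
    l≤ : l₂ ≤ l
    l≤ = proj₁ (back l (≤-refl , m<m+n l (s≤s z≤n)))
    end : l + suc w ≤ l₂ + w₂
    end = ≤-trans (≡⇒≤ (+-suc l w)) (proj₂ (back (l + w) (m≤m+n l w , +-monoʳ-< l (n<1+n w))))
  ... | refl , e = nth L x , nth-∈ L (≤-trans (proj₂ r) q) , sym (⊆-≡-lo (h x r) e) , e , subst (λ l → Spanned (nth L x) l (suc w)) l≡ Sp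
    where
    open Spanned Sp
    back : ∀ x' → InW l (suc w) x' → InW l₂ (suc w) x'
    back x' r' = inside→ x' (does-yes (nth L x ⊆? nth L x') (least x' r'))
    l≡ : l₂ ≡ l
    l≡ = ≤-antisym (proj₁ (back l (≤-refl , m<m+n l (s≤s z≤n))))
      (+-cancelʳ-≤ (suc w) _ _ (≤-trans (≡⇒≤ (+-suc l w)) (proj₂ (back (l + w) (m≤m+n l w , +-monoʳ-< l (n<1+n w))))))

-- Translation from integer rows to natural coordinates

open import Defs
open import Data.Integer using (+_)

extend : ∀ {n} → (Fin n → ℕ) → ℕ → ℕ
extend {zero} f x = 0
extend {suc n} f zero = f Fin.zero
extend {suc n} f (suc x) = extend (f ∘ Fin.suc) x

extend-toℕ : ∀ {n} (f : Fin n → ℕ) i → extend f (toℕ i) ≡ f i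
extend-toℕ f Fin.zero = refl
extend-toℕ f (Fin.suc i) = extend-toℕ (f ∘ Fin.suc) i

extend-out : ∀ {n} (f : Fin n → ℕ) {x} → n ≤ x → extend f x ≡ 0
extend-out {zero} f l = refl
extend-out {suc n} f (s≤s l) = extend-out (f ∘ Fin.suc) l

sum-tabulate : ∀ {n} (f : Fin n → ℕ) → sum (tabulate f) ≡ S (extend f) n
sum-tabulate {zero} f = refl
sum-tabulate {suc n} f = trans (+-comm (f Fin.zero) _) (trans (cong (_+ f Fin.zero) (sum-tabulate (f ∘ Fin.suc))) (S-tail (extend f) n))

sum-allFin : ∀ {n} (f : Fin n → ℕ) → sum (map f (allFin n)) ≡ S (extend f) n
sum-allFin f = trans (cong sum (map-tabulate id f)) (sum-tabulate f)

sum-upTo : ∀ (f : ℕ → ℕ) n → sum (map f (upTo n)) ≡ S f n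
sum-upTo f n = trans (cong sum (map-upTo f n)) (go f n)
  where
  go : ∀ f n → sum (applyUpTo f n) ≡ S f n
  go f zero = refl
  go f (suc n) = trans (+-comm (f 0) _) (trans (cong (_+ f 0) (go (f ∘ suc) n)) (S-tail f n))

nth-tabulate : ∀ {n} (f : Fin n → Col) i → nth (tabulate f) (toℕ i) ≡ f i
nth-tabulate f Fin.zero = refl
nth-tabulate f (Fin.suc i) = nth-tabulate (f ∘ Fin.suc) i

nth-allFin : ∀ {n} (f : Fin n → Col) i → nth (map f (allFin n)) (toℕ i) ≡ f i
nth-allFin f i = trans (cong (λ L → nth L (toℕ i)) (map-tabulate id f)) (nth-tabulate f i)

length-allFin : ∀ {n} (f : Fin n → Col) → length (map f (allFin n)) ≡ n
length-allFin {n} f = trans (length-map f (allFin n)) (length-tabulate id)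

⊆-from : ∀ {d e} → 0 < hgt d → (∀ k → within d k → within e k) → d ⊆ e
⊆-from {⟨ a , suc h , _ ⟩} {e} p f = proj₁ (f a (≤-refl , m<m+n a (s≤s z≤n))) ,
  ≤-trans (≡⇒≤ (+-suc a h)) (proj₂ (f (a + h) (m≤m+n a h , +-monoʳ-< a (n<1+n h))))

nth-RowConvex : ∀ L → (∀ {i j k} → i < j → j < k → k < length L → Conv (nth L i) (nth L j) (nth L k)) → RowConvex L
nth-RowConvex [] h = tt
nth-RowConvex (a ∷ L) h = nth-AllPairs {λ c e → Conv a c e} L (λ {i} {j} p q → h {0} {suc i} {suc j} (s≤s z≤n) (s≤s p) (s≤s q)) ,
  nth-RowConvex L (λ {i} {j} {k} p q r → h {suc i} {suc j} {suc k} (s≤s p) (s≤s q) (s≤s r))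

StepT-trans : ∀ t {a b c} → StepT t a b → StepT t b c → StepT t a c
StepT-trans t (p , q) (p' , q') = Oriented.Strictness.≺≺ up (sX t) p p' , Oriented.Strictness.≺≺ up (sY t) q q'

insert-step : ∀ t {c ys} → All (CmpT t c) ys → AllPairs (StepT t) ys → ∃ λ zs → AllPairs (StepT t) zs × zs ↭ c ∷ ys
insert-step t {c} [] [] = c ∷ [] , [] ∷ [] , ↭-refl
insert-step t {c} {y ∷ ys} (inj₁ p ∷ _) (q ∷ qs) = c ∷ y ∷ ys , (p ∷ All.map (StepT-trans t p) q) ∷ q ∷ qs , ↭-refl
insert-step t {c} {y ∷ ys} (inj₂ p ∷ ps) (q ∷ qs) =
  let (zs , r , e) = insert-step t ps qs
  in y ∷ zs , All.tabulate (λ i → All.lookup (p ∷ q) (∈-resp-↭ e i)) ∷ r , ↭-trans (Perm.prep y e) (Perm.swap y c ↭-refl)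

-- Insertion along comparable cells; this restores the order that `Valid` forgets.
sort-chain : ∀ t {xs} → AllPairs (CmpT t) xs → ∃ λ ys → AllPairs (StepT t) ys × ys ↭ xs
sort-chain t [] = [] , [] , ↭-refl
sort-chain t {x ∷ xs} (p ∷ ps) =
  let (ys , q , e) = sort-chain t ps ; (zs , r , e') = insert-step t (All.tabulate (λ i → All.lookup p (∈-resp-↭ e i))) q
  in zs , r , ↭-trans e' (Perm.prep x e)

cnt-↭ : ∀ c {xs ys} → xs ↭ ys → cnt c xs ≡ cnt c ys
cnt-↭ c {xs} {ys} p = trans (as-sum xs) (trans (sumL-↭ (λ x → δ c (proj₁ x) (proj₂ x)) p) (sym (as-sum ys)))
  where
  as-sum : ∀ xs → cnt c xs ≡ sumL (λ x → δ c (proj₁ x) (proj₂ x)) xs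
  as-sum [] = refl
  as-sum (x ∷ xs) = cong (λ v → δ c (proj₁ x) (proj₂ x) + v) (as-sum xs)

cntF-∈ : ∀ {c xs} fam → xs ∈ fam → c ∈ xs → 0 < cntF c fam
cntF-∈ (_ ∷ fam) (here refl) j = ≤-trans (cnt-∈ j) (m≤m+n _ _)
cntF-∈ (_ ∷ fam) (there i) j = ≤-trans (cntF-∈ fam i j) (m≤n+m _ _)

∈-cntF : ∀ c fam → 0 < cntF c fam → ∃ λ xs → xs ∈ fam × c ∈ xs
∈-cntF c (xs ∷ fam) p with cnt c xs in q
... | suc _ = xs , here refl , ∈-cnt c xs (subst (0 <_) (sym q) (s≤s z≤n))
... | zero = let (ys , i , j) = ∈-cntF c fam p in ys , there i , j

-- Rows are counted from `B`. For a permutation of columns both polyominoes use the same `B`, so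
-- that their rows can be compared; for equal content each uses its own lowest bottom.
module Model (M : Poly) (moon : IsMoon M) (B : ℤ) (B≤ : ∀ i → B ℤ.≤ bot M i) (labels : Fin (m M) → ℕ) where

  open IsMoon moon

  alt : ℤ → ℕ
  alt y = ℤ.∣ y ℤ.- B ∣

  row : ℕ → ℤ
  row k = B ℤ.+ + k

  alt-row : ∀ k → alt (row k) ≡ k
  alt-row k = cong ℤ.∣_∣ {y = + k} (trans (cong (ℤ._- B) (ℤP.+-comm B (+ k))) (trans (ℤP.+-assoc (+ k) B (ℤ.- B)) (trans (cong (ℤ._+_ (+ k)) (ℤP.+-inverseʳ B)) (ℤP.+-identityʳ (+ k)))))

  row-alt : ∀ {y} → B ℤ.≤ y → row (alt y) ≡ y
  row-alt {y} p = trans (cong (ℤ._+_ B) (ℤP.0≤i⇒+∣i∣≡i (ℤP.i≤j⇒0≤j-i p))) (trans (ℤP.+-comm B (y ℤ.- B))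
    (trans (ℤP.+-assoc y (ℤ.- B) B) (trans (cong (ℤ._+_ y) (ℤP.+-inverseˡ B)) (ℤP.+-identityʳ y))))

  row-≤ : ∀ {j k} → j ≤ k → row j ℤ.≤ row k
  row-≤ p = ℤP.+-monoʳ-≤ B (ℤ.+≤+ p)

  row-< : ∀ {j k} → j < k → row j ℤ.< row k
  row-< p = ℤP.+-monoʳ-< B (ℤ.+<+ p)

  row-≤⁻ : ∀ {j k} → row j ℤ.≤ row k → j ≤ k
  row-≤⁻ {j} {k} p with ≤-<-connex j k
  ... | inj₁ q = q
  ... | inj₂ q = ⊥-elim (ℤP.<⇒≱ (row-< q) p)

  row-<⁻ : ∀ {j k} → row j ℤ.< row k → j < k
  row-<⁻ {j} {k} p with ≤-<-connex k j
  ... | inj₁ q = ⊥-elim (ℤP.<⇒≱ p (row-≤ q))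
  ... | inj₂ q = q

  row-+ : ∀ j h → row j ℤ.+ + h ≡ row (j + h)
  row-+ j h = ℤP.+-assoc B (+ j) (+ h)

  base-row : ∀ k → B ℤ.≤ row k
  base-row k = ℤP.i≤i+j B (+ k)

  rowView : ∀ y → (∃ λ k → y ≡ row k) ⊎ ¬ (B ℤ.≤ y)
  rowView y with B ℤ.≤? y
  ... | yes p = inj₁ (alt y , sym (row-alt p))
  ... | no p = inj₂ p

  col : Fin (m M) → Col
  col i = ⟨ alt (bot M i) , ht M i , labels i ⟩

  L : List Col
  L = map col (allFin (m M))

  nth-col : ∀ i → nth L (toℕ i) ≡ col i
  nth-col = nth-allFin col

  length-L : length L ≡ m M
  length-L = length-allFin col

  position : ∀ {x} → x < m M → ∃ λ (i : Fin (m M)) → toℕ i ≡ x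
  position p = fromℕ< p , FinP.toℕ-fromℕ< p

  row-lo : ∀ i → row (lo (col i)) ≡ bot M i
  row-lo i = row-alt (B≤ i)

  row-top : ∀ i → row (lo (col i) + hgt (col i)) ≡ bot M i ℤ.+ + ht M i
  row-top i = trans (sym (row-+ (lo (col i)) (ht M i))) (cong (ℤ._+ + ht M i) (row-lo i))

  InM⇒within : ∀ {i k} → InM M i (row k) → within (col i) k
  InM⇒within {i} {k} (p , q) = row-≤⁻ (subst (ℤ._≤ row k) (sym (row-lo i)) p) , row-<⁻ (subst (row k ℤ.<_) (sym (row-top i)) q)

  within⇒InM : ∀ {i k} → within (col i) k → InM M i (row k)
  within⇒InM {i} {k} (p , q) = subst (ℤ._≤ row k) (row-lo i) (row-≤ p) , subst (row k ℤ.<_) (row-top i) (row-< q)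

  InM-base : ∀ {i y} → InM M i y → B ℤ.≤ y
  InM-base {i} (p , _) = ℤP.≤-trans (B≤ i) p

  lunar : Lunar L
  lunar = record { pos = positive' ; nested = nested' ; convex = nth-RowConvex L convex' }
    where
    positive' : ∀ {d} → d ∈ L → 0 < hgt d
    positive' i with ∈-map⁻ col i
    ... | j , _ , refl = colNonEmpty j
    nested' : ∀ {d e} → d ∈ L → e ∈ L → d ⊆ e ⊎ e ⊆ d
    nested' i j with ∈-map⁻ col i | ∈-map⁻ col j
    ... | a , _ , refl | b , _ , refl with interFree a b
    ... | inj₁ h = inj₁ (⊆-from (colNonEmpty a) (λ k w → InM⇒within (h _ (within⇒InM w))))
    ... | inj₂ h = inj₂ (⊆-from (colNonEmpty b) (λ k w → InM⇒within (h _ (within⇒InM w))))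
    convex' : ∀ {i j k} → i < j → j < k → k < length L → Conv (nth L i) (nth L j) (nth L k)
    convex' {i} {j} {k} p q r d dp u v with position (≤-trans p (≤-trans (<⇒≤ (<-trans q (n<1+n k))) (subst (suc k ≤_) length-L r))) | position (<-trans q (subst (k <_) length-L r)) | position (subst (k <_) length-L r)
    ... | a , refl | b , refl | c , refl = subst (d ⊆_) (sym (nth-col b)) (⊆-from dp (λ y w →
        InM⇒within (rowConvex a b c (row y) (<⇒≤ p) (<⇒≤ q) (within⇒InM (⊆-within (subst (d ⊆_) (nth-col a) u) w)) (within⇒InM (⊆-within (subst (d ⊆_) (nth-col c) v) w)))))

  toGrid : Filling M → Grid
  toGrid F x y = extend (λ i → F i (row y)) x

  fromGrid : Grid → Filling M
  fromGrid G i y = if does (B ℤ.≤? y) then G (toℕ i) (alt y) else 0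

  toGrid-at : ∀ F i k → toGrid F (toℕ i) k ≡ F i (row k)
  toGrid-at F i k = extend-toℕ (λ i → F i (row k)) i

  toGrid-out : ∀ F {x} k → m M ≤ x → toGrid F x k ≡ 0
  toGrid-out F k p = extend-out (λ i → F i (row k)) p

  toGrid-cong : ∀ {F F'} → _≈F_ {M} F F' → toGrid F ≐G toGrid F'
  toGrid-cong {F} {F'} p x k with ≤-<-connex (m M) x
  ... | inj₁ q = trans (toGrid-out F k q) (sym (toGrid-out F' k q))
  ... | inj₂ q with position q
  ... | i , refl = trans (toGrid-at F i k) (trans (p i (row k)) (sym (toGrid-at F' i k)))

  fromGrid-row : ∀ G i k → fromGrid G i (row k) ≡ G (toℕ i) k
  fromGrid-row G i k = trans (cong (λ b → if b then G (toℕ i) (alt (row k)) else 0) (does-yes (B ℤ.≤? row k) (base-row k))) (cong (G (toℕ i)) (alt-row k))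

  fromGrid-below : ∀ G i {y} → ¬ (B ℤ.≤ y) → fromGrid G i y ≡ 0
  fromGrid-below G i {y} p = cong (λ b → if b then G (toℕ i) (alt y) else 0) (does-no (B ℤ.≤? y) p)

  fromGrid-cong : ∀ {G G'} → G ≐G G' → _≈F_ {M} (fromGrid G) (fromGrid G')
  fromGrid-cong {G} {G'} p i y = cong (λ v → if does (B ℤ.≤? y) then v else 0) (p (toℕ i) (alt y))

  legal : ∀ t {F} → Supported M F → EntryCond t M F → Legal t L (toGrid F)
  legal t {F} s z = supp , entries t z
    where
    supp : ∀ x y → ¬ within (nth L x) y → toGrid F x y ≡ 0
    supp x y nw with ≤-<-connex (m M) x
    ... | inj₁ q = toGrid-out F y q
    ... | inj₂ q with position q
    ... | i , refl = trans (toGrid-at F i y) (s i (row y) (λ h → nw (subst (λ d → within d y) (sym (nth-col i)) (InM⇒within h))))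
    bounded : (∀ i y → F i y ≤ 1) → ∀ x y → toGrid F x y ≤ 1
    bounded z x y with ≤-<-connex (m M) x
    ... | inj₁ q = subst (_≤ 1) (sym (toGrid-out F y q)) z≤n
    ... | inj₂ q with position q
    ... | i , refl = subst (_≤ 1) (sym (toGrid-at F i y)) (z i (row y))
    entries : ∀ t → EntryCond t M F → Entries t (toGrid F)
    entries ne z ()
    entries NE z ()
    entries nE z _ = bounded z
    entries Ne z _ = bounded z

  supported : ∀ {t G} → Legal t L G → Supported M (fromGrid G)
  supported {t} {G} (s , _) i y nw with rowView y
  ... | inj₂ p = fromGrid-below G i p
  ... | inj₁ (k , refl) = trans (fromGrid-row G i k) (s (toℕ i) k (λ w → nw (within⇒InM (subst (λ d → within d k) (nth-col i) w))))

  entryCond : ∀ t {G} → Legal t L G → EntryCond t M (fromGrid G)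
  entryCond t {G} (_ , z) = go t z
    where
    bounded : (∀ x y → G x y ≤ 1) → ∀ i y → fromGrid G i y ≤ 1
    bounded z i y with does (B ℤ.≤? y)
    ... | true = z _ _
    ... | false = z≤n
    go : ∀ t → Entries t G → EntryCond t M (fromGrid G)
    go ne z = tt
    go NE z = tt
    go nE z = bounded (z refl)
    go Ne z = bounded (z refl)

  from-toGrid : ∀ {F} → Supported M F → _≈F_ {M} (fromGrid (toGrid F)) F
  from-toGrid {F} s i y with rowView y
  ... | inj₂ p = trans (fromGrid-below (toGrid F) i p) (sym (s i y (λ h → p (InM-base h))))
  ... | inj₁ (k , refl) = trans (fromGrid-row (toGrid F) i k) (toGrid-at F i k)

  to-fromGrid : ∀ {t G} → Legal t L G → toGrid (fromGrid G) ≐G G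
  to-fromGrid {t} {G} (s , _) x k with ≤-<-connex (m M) x
  ... | inj₁ q = trans (toGrid-out (fromGrid G) k q) (sym (s x k (λ w → outside' (subst (λ d → within d k) (nth-out L (≤-trans (≡⇒≤ length-L) q)) w))))
    where
    outside' : ¬ within void k
    outside' (_ , ())
  ... | inj₂ q with position q
  ... | i , refl = trans (toGrid-at (fromGrid G) i k) (fromGrid-row G i k)

  rowSum-grid : ∀ F k → rowSum M F (row k) ≡ S (λ x → toGrid F x k) (length L)
  rowSum-grid F k = trans (sum-allFin (λ i → F i (row k))) (cong (S (λ x → toGrid F x k)) (sym length-L))

  rowSum-below : ∀ {F y} → (∀ i → F i y ≡ 0) → rowSum M F y ≡ 0
  rowSum-below {F} {y} h = trans (sum-allFin (λ i → F i y)) (S-zero _ (m M) zeroes)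
    where
    zeroes : ∀ x → x < m M → extend (λ i → F i y) x ≡ 0
    zeroes x p with position p
    ... | i , refl = trans (extend-toℕ (λ i → F i y) i) (h i)

  colSum-grid : ∀ F i → colSum M F i ≡ S (λ k → toGrid F (toℕ i) (lo (col i) + k)) (hgt (col i))
  colSum-grid F i = trans (sum-upTo (λ k → F i (bot M i ℤ.+ + k)) (ht M i)) (S-cong (ht M i) (λ k _ →
    trans (cong (F i) (trans (cong (ℤ._+ + k) (sym (row-lo i))) (row-+ (lo (col i)) k))) (sym (toGrid-at F i (lo (col i) + k)))))

-- Translation of the conditions on chains

module Chains (t : ChainType) (M : Poly) (moon : IsMoon M) (B : ℤ) (B≤ : ∀ i → B ℤ.≤ bot M i) (labels : Fin (m M) → ℕ) where

  open Model M moon B B≤ labels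
  open Rectangles lunar

  -- A cell at height k above the base row
  Low : Set
  Low = Fin (m M) × ℕ

  cell : Low → Cell (m M)
  cell (i , k) = i , row k

  posn : Low → Pos
  posn (i , k) = toℕ i , k

  posn-injective : ∀ {a b} → posn a ≡ posn b → a ≡ b
  posn-injective {i , k} {j , l} p = cong₂ _,_ (FinP.toℕ-injective (cong proj₁ p)) (cong proj₂ p)

  cell-injective : ∀ {a b} → cell a ≡ cell b → a ≡ b
  cell-injective {i , k} {j , l} p = cong₂ _,_ (cong proj₁ p) (trans (sym (alt-row k)) (trans (cong alt (cong proj₂ p)) (alt-row l)))

  StepL : Low → Low → Set
  StepL a b = StepT t (posn a) (posn b)

  step→ : ∀ {a b} → Step t (cell a) (cell b) → StepL a b
  step→ = go t
    where
    go : ∀ t {a b} → Step t (cell a) (cell b) → StepT t (posn a) (posn b)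
    go ne (p , q) = p , row-<⁻ q
    go NE (p , q) = p , row-≤⁻ q
    go nE (p , q) = p , row-<⁻ q
    go Ne (p , q) = p , row-≤⁻ q

  step← : ∀ {a b} → StepL a b → Step t (cell a) (cell b)
  step← = go t
    where
    go : ∀ t {a b} → StepT t (posn a) (posn b) → Step t (cell a) (cell b)
    go ne (p , q) = p , row-< q
    go NE (p , q) = p , row-≤ q
    go nE (p , q) = p , row-< q
    go Ne (p , q) = p , row-≤ q

  occ-∷ : ∀ (c x : Cell (m M)) xs → occ c (x ∷ xs) ≡ (if does (x ≟c c) then 1 else 0) + occ c xs
  occ-∷ c x xs with x ≟c c
  ... | yes _ = refl
  ... | no _ = refl

  occ-++ : ∀ (c : Cell (m M)) xs ys → occ c (xs ++ ys) ≡ occ c xs + occ c ys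
  occ-++ c xs ys = trans (cong length (filter-++ (λ x → x ≟c c) xs ys)) (length-++ (filter (λ x → x ≟c c) xs))

  occ-cnt : ∀ a zs → occ (cell a) (map cell zs) ≡ cnt (posn a) (map posn zs)
  occ-cnt a [] = refl
  occ-cnt a (z ∷ zs) = trans (occ-∷ (cell a) (cell z) (map cell zs)) (cong₂ _+_ (unit (posn a ≟ₚ posn z)) (occ-cnt a zs))
    where
    unit : Dec (posn a ≡ posn z) → (if does (cell z ≟c cell a) then 1 else 0) ≡ δ (posn a) (toℕ (proj₁ z)) (proj₂ z)
    unit (yes p) = trans (cong (λ b → if b then 1 else 0) (does-yes (cell z ≟c cell a) (cong cell (posn-injective (sym p))))) (sym (trans (cong (λ q → δ q (toℕ (proj₁ z)) (proj₂ z)) p) (δ-refl (posn z))))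
    unit (no p) = trans (cong (λ b → if b then 1 else 0) (does-no (cell z ≟c cell a) (λ q → p (cong posn (cell-injective (sym q)))))) (sym (δ-≢ (posn a) (posn z) p))

  cells : List (List Low) → List (List (Cell (m M)))
  cells = map (map cell)

  posns : List (List Low) → List (List Pos)
  posns = map (map posn)

  occ-cntF : ∀ a fam → occ (cell a) (concat (cells fam)) ≡ cntF (posn a) (posns fam)
  occ-cntF a [] = refl
  occ-cntF a (zs ∷ fam) = trans (occ-++ (cell a) (map cell zs) (concat (cells fam))) (cong₂ _+_ (occ-cnt a zs) (occ-cntF a fam))

  length-size : ∀ fam → length (concat (cells fam)) ≡ size (posns fam)
  length-size [] = refl
  length-size (zs ∷ fam) = trans (length-++ (map cell zs)) (cong₂ _+_ (trans (length-map cell zs) (sym (length-map posn zs))) (length-size fam))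

  record Region (R : Rect) (J K : ℕ → Bool) : Set where
    field
      of-rect : ∀ (i : Fin (m M)) y → InRect R (toℕ i) y → ∃ λ k → y ≡ row k × J (toℕ i) ≡ true × K k ≡ true
      to-rect : ∀ x k → J x ≡ true → K k ≡ true → InRect R x (row k)

  module _ {R : Rect} {J K : ℕ → Bool} (reg : Region R J K) (F : Filling M) where

    open Region reg

    G : Grid
    G = res J K (toGrid F)

    In : Low → Set
    In a = J (toℕ (proj₁ a)) ≡ true × K (proj₂ a) ≡ true

    -- An intermediate form between `ValidChains` and `Valid`: chains are ordered as in the former,
    -- and rows are natural numbers as in the latter.
    Fine : List (List Low) → Set
    Fine fam = All (λ zs → AllPairs StepL zs × All In zs) fam × (∀ a → cntF (posn a) (posns fam) ≤ F (proj₁ a) (row (proj₂ a)))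

    G-at : ∀ a → In a → at G (posn a) ≡ F (proj₁ a) (row (proj₂ a))
    G-at (i , k) (p , q) rewrite p | q = toGrid-at F i k

    lift : ∀ xs → All (λ c → InRect R (toℕ (proj₁ c)) (proj₂ c)) xs → ∃ λ zs → map cell zs ≡ xs × All In zs
    lift [] [] = [] , refl , []
    lift ((i , y) ∷ xs) (p ∷ ps) =
      let (k , q , j , h) = of-rect i y p ; (zs , r , a) = lift xs ps in (i , k) ∷ zs , cong₂ _∷_ (cong (i ,_) (sym q)) r , (j , h) ∷ a

    lift-chain : ∀ {xs} → Linked (Step t) xs → All (λ c → InRect R (toℕ (proj₁ c)) (proj₂ c)) xs → ∃ λ zs → map cell zs ≡ xs × AllPairs StepL zs × All In zs
    lift-chain {xs} l a with lift xs a
    ... | zs , refl , h = zs , refl , LinkedP.Linked⇒AllPairs (λ {a} {b} {c} → StepT-trans t {posn a} {posn b} {posn c}) (Linked.map (λ {a} {b} → step→ {a} {b}) (LinkedP.map⁻ l)) , h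

    lift-family : ∀ fam → All (λ xs → Linked (Step t) xs × All (λ c → InRect R (toℕ (proj₁ c)) (proj₂ c)) xs) fam →
        ∃ λ fam' → cells fam' ≡ fam × All (λ zs → AllPairs StepL zs × All In zs) fam'
    lift-family [] [] = [] , refl , []
    lift-family (xs ∷ fam) ((l , a) ∷ h) =
      let (zs , p , q) = lift-chain l a ; (fam' , p' , q') = lift-family fam h in zs ∷ fam' , cong₂ _∷_ p p' , q ∷ q'

    from-chains : ∀ {k} (cs : Vec (List (Cell (m M))) k) → ValidChains t M F R cs → ∃ λ fam → cells fam ≡ Vec.toList cs × Fine fam
    from-chains cs (h , b) = let (fam , p , q) = lift-family (Vec.toList cs) (VAllP.toList⁺ h) in
      fam , p , q , λ a → ≤-trans (≡⇒≤ (trans (sym (occ-cntF a fam)) (cong (λ f → occ (cell a) (concat f)) p))) (b (cell a))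

    to-chains : ∀ fam → Fine fam → ValidChains t M F R (Vec.fromList (cells fam))
    to-chains fam (h , b) = VAllP.fromList⁺ (AllP.map⁺ (All.map chain h)) , bound
      where
      chain : ∀ {zs} → AllPairs StepL zs × All In zs → Linked (Step t) (map cell zs) × All (λ c → InRect R (toℕ (proj₁ c)) (proj₂ c)) (map cell zs)
      chain (p , q) = LinkedP.AllPairs⇒Linked (AllPairsP.map⁺ (AllPairs.map (λ {a} {b} → step← {a} {b}) p)) , AllP.map⁺ (All.map (λ (u , v) → to-rect _ _ u v) q)
      bound : ∀ c → occ c (concat (Vec.toList (Vec.fromList (cells fam)))) ≤ F (proj₁ c) (proj₂ c)
      bound (i , y) rewrite VecP.toList∘fromList (cells fam) with rowView y
      ... | inj₁ (k , refl) = ≤-trans (≡⇒≤ (occ-cntF (i , k) fam)) (b (i , k))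
      -- No cell below the base row comes from a natural height, so it occurs zero times.
      ... | inj₂ p = ≤-trans (≡⇒≤ (never fam)) z≤n
        where
        never-chain : ∀ zs → occ (i , y) (map cell zs) ≡ 0
        never-chain [] = refl
        never-chain (z ∷ zs) = trans (occ-∷ (i , y) (cell z) (map cell zs)) (cong₂ _+_ (cong (λ b → if b then 1 else 0) (does-no (cell z ≟c (i , y))
            (λ q → p (subst (B ℤ.≤_) (cong proj₂ q) (base-row (proj₂ z)))))) (never-chain zs))
        never : ∀ fam → occ (i , y) (concat (cells fam)) ≡ 0
        never [] = refl
        never (zs ∷ fam) = trans (occ-++ (i , y) (map cell zs) (concat (cells fam))) (cong₂ _+_ (never-chain zs) (never fam))

    to-valid : ∀ fam → Fine fam → Valid (CmpT t) (at G) (posns fam)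
    to-valid fam (h , b) = AllP.map⁺ (All.map (λ (p , _) → AllPairsP.map⁺ (AllPairs.map inj₁ p)) h) , bound
      where
      bound : ∀ c → cntF c (posns fam) ≤ at G c
      bound c with cntF c (posns fam) in q
      ... | zero = z≤n
      ... | suc n with ∈-cntF c (posns fam) (subst (0 <_) (sym q) (s≤s z≤n))
      ... | xs , i , j with ∈-map⁻ (map posn) i
      ... | zs , i' , refl with ∈-map⁻ posn j
      ... | a , j' , refl = ≤-trans (≡⇒≤ (sym q)) (≤-trans (b a) (≡⇒≤ (sym (G-at a (All.lookup (proj₂ (All.lookup h i')) j')))))

    G-support : ∀ {c} → 0 < at G c → ∃ λ a → posn a ≡ c × In a
    G-support {x , k} p with J x in q | K k in r
    ... | false | _ = ⊥-elim (<-irrefl refl p)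
    ... | true | false = ⊥-elim (<-irrefl refl p)
    ... | true | true with ≤-<-connex (m M) x
    ... | inj₁ u = ⊥-elim (<-irrefl refl (subst (0 <_) (toGrid-out F k u) p))
    ... | inj₂ u with position u
    ... | i , refl = (i , k) , refl , q , r

    to-lows : ∀ ys → (∀ {c} → c ∈ ys → 0 < at G c) → ∃ λ zs → map posn zs ≡ ys × All In zs
    to-lows [] h = [] , refl , []
    to-lows (y ∷ ys) h = let (a , p , q) = G-support (h (here refl)) ; (zs , r , s) = to-lows ys (h ∘ there) in a ∷ zs , cong₂ _∷_ p r , q ∷ s

    to-lows-chain : ∀ {xs} → AllPairs (CmpT t) xs → (∀ {c} → c ∈ xs → 0 < at G c) → ∃ λ zs → AllPairs StepL zs × All In zs × map posn zs ↭ xs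
    to-lows-chain {xs} p h with sort-chain t p
    ... | ys , s , e with to-lows ys (λ i → h (∈-resp-↭ e i))
    ... | zs , refl , q = zs , AllPairsP.map⁻ s , q , e

    to-lows-family : ∀ fam → All (AllPairs (CmpT t)) fam → (∀ {xs c} → xs ∈ fam → c ∈ xs → 0 < at G c) →
        ∃ λ fam' → All (λ zs → AllPairs StepL zs × All In zs) fam' × length fam' ≡ length fam × size (posns fam') ≡ size fam × (∀ c → cntF c (posns fam') ≡ cntF c fam)
    to-lows-family [] [] h = [] , [] , refl , refl , λ _ → refl
    to-lows-family (xs ∷ fam) (p ∷ ps) h =
      let (zs , u , v , e) = to-lows-chain p (h (here refl)) ; (fam' , q , l , z , r) = to-lows-family fam ps (λ i → h (there i))
      in zs ∷ fam' , (u , v) ∷ q , cong suc l , cong₂ _+_ (↭-length e) z , λ c → cong₂ _+_ (cnt-↭ c e) (r c)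

    from-valid : ∀ fam → Valid (CmpT t) (at G) fam → ∃ λ fam' → Fine fam' × length fam' ≡ length fam × size (posns fam') ≡ size fam
    from-valid fam (p , b) =
      let (fam' , q , l , z , r) = to-lows-family fam p (λ {_} {c} i j → ≤-trans (cntF-∈ fam i j) (b c))
      in fam' , (q , bound fam' r q) , l , z
      where
      bound : ∀ fam' → (∀ c → cntF c (posns fam') ≡ cntF c fam) → All (λ zs → AllPairs StepL zs × All In zs) fam' → ∀ a → cntF (posn a) (posns fam') ≤ F (proj₁ a) (row (proj₂ a))
      bound fam' r q (i , k) = ≤-trans (≡⇒≤ (r (toℕ i , k))) (≤-trans (b (toℕ i , k)) (G≤ (J (toℕ i)) (K k)))
        where
        G≤ : ∀ u v → (if u ∧ v then toGrid F (toℕ i) k else 0) ≤ F i (row k)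
        G≤ true true = ≡⇒≤ (toGrid-at F i k)
        G≤ true false = z≤n
        G≤ false v = z≤n

    cond→ : ∀ {p} → ChainCond t M F R p → ChainOK t G p
    cond→ {p} ok k l with ok k l
    ... | (cs , v , s) , ub = attained , bounded
      where
      attained : ∃ λ fam → length fam ≡ k × Valid (CmpT t) (at G) fam × size fam ≡ partSum k p
      attained = let (fam , e , f) = from-chains cs v in
        posns fam , trans (length-map (map posn) fam) (trans (sym (length-map (map cell) fam)) (trans (cong length e) (VecP.length-toList cs))) , to-valid fam f ,
        trans (sym (length-size fam)) (trans (cong (length ∘ concat) e) s)
      bounded : ∀ fam → length fam ≡ k → Valid (CmpT t) (at G) fam → size fam ≤ partSum k p
      bounded fam e v with from-valid fam v
      ... | fam' , f , l , z with trans (length-map (map cell) fam') (trans l e)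
      ... | refl = ≤-trans (≡⇒≤ (trans (sym z) (trans (sym (length-size fam')) (cong (length ∘ concat) (sym (VecP.toList∘fromList (cells fam'))))))) (ub (Vec.fromList (cells fam')) (to-chains fam' f))

    cond← : ∀ {p} → ChainOK t G p → ChainCond t M F R p
    cond← {p} ok k l with ok k l
    ... | (fam , e , v , s) , ub = attained , bounded
      where
      attained : Σ (Vec (List (Cell (m M))) k) λ cs → ValidChains t M F R cs × (chainsSize cs ≡ partSum k p)
      attained with from-valid fam v
      ... | fam' , f , l , z with trans (length-map (map cell) fam') (trans l e)
      ... | refl = Vec.fromList (cells fam') , to-chains fam' f , trans (cong (length ∘ concat) (VecP.toList∘fromList (cells fam'))) (trans (length-size fam') (trans z s))
      bounded : ∀ cs → ValidChains t M F R cs → chainsSize cs ≤ partSum k p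
      bounded cs v = let (fam , e , f) = from-chains cs v in
        ≤-trans (≡⇒≤ (trans (cong (length ∘ concat) (sym e)) (length-size fam)))
          (ub (posns fam) (trans (length-map (map posn) fam) (trans (sym (length-map (map cell) fam)) (trans (cong length e) (VecP.length-toList cs)))) (to-valid fam f))

window-sum : ∀ f a h N → a + h ≤ N → (∀ k → ¬ InW a h k → f k ≡ 0) → S (λ k → f (a + k)) h ≡ S f N
window-sum f a h N l z = sym (trans (cong (S f) (sym (m+[n∸m]≡n l))) (trans (S-split f (a + h) (N ∸ (a + h))) (trans (cong₂ _+_ (S-split f a h) after)
    (trans (+-identityʳ _) (cong (_+ S (λ k → f (a + k)) h) before)))))
  where
  before : S f a ≡ 0
  before = S-zero f a (λ k p → z k (λ q → <⇒≱ p (proj₁ q)))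
  after : S (λ i → f (a + h + i)) (N ∸ (a + h)) ≡ 0
  after = S-zero _ (N ∸ (a + h)) (λ k _ → z _ (λ q → <⇒≱ (proj₂ q) (m≤m+n (a + h) k)))

-- Maximal rectangles of the given polyomino

module MaxRects (t : ChainType) (M : Poly) (moon : IsMoon M) (B : ℤ) (B≤ : ∀ i → B ℤ.≤ bot M i) (labels : Fin (m M) → ℕ) where

  open Model M moon B B≤ labels public
  open Rectangles lunar
  open Chains t M moon B B≤ labels using (Region; cond→; cond←)

  rectangle : ℕ → ℕ → Col → Rect
  rectangle l w d = record { left = l ; width = w ; bottom = row (lo d) ; height = hgt d }

  rowsOf : Rect → Col
  rowsOf R = ⟨ alt (bottom R) , height R , 0 ⟩

  rectangle-rowsOf : ∀ {R} → B ℤ.≤ bottom R → rectangle (left R) (width R) (rowsOf R) ≡ R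
  rectangle-rowsOf {R} p = cong (λ b → record { left = left R ; width = width R ; bottom = b ; height = height R }) (row-alt p)

  InRect⇒ : ∀ {l w d x k} → InRect (rectangle l w d) x (row k) → InW l w x × within d k
  InRect⇒ {d = d} {k = k} (a , b , u , v) = (a , b) , (row-≤⁻ u , row-<⁻ (subst (row k ℤ.<_) (row-+ (lo d) (hgt d)) v))

  InRect⇐ : ∀ {l w d x k} → InW l w x → within d k → InRect (rectangle l w d) x (row k)
  InRect⇐ {d = d} {k = k} (a , b) (u , v) = a , b , row-≤ u , subst (row k ℤ.<_) (sym (row-+ (lo d) (hgt d))) (row-< v)

  InRect-base : ∀ {l w d x y} → InRect (rectangle l w d) x y → B ℤ.≤ y
  InRect-base {d = d} (_ , _ , u , _) = ℤP.≤-trans (base-row (lo d)) u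

  RectIn⇒Slab : ∀ {l w d} → RectIn M (rectangle l w d) → Slab L l w d
  RectIn⇒Slab {l} {w} {d} (p , q , r , h) = p , q , subst (l + w ≤_) (sym length-L) r , covers
    where
    covers : ∀ x → InW l w x → d ⊆ nth L x
    covers x u with position (≤-trans (proj₂ u) r)
    ... | i , refl = subst (d ⊆_) (sym (nth-col i)) (⊆-from q (λ k v → InM⇒within (h i (row k) (InRect⇐ {l} {w} {d} u v))))

  Slab⇒RectIn : ∀ {l w d} → Slab L l w d → RectIn M (rectangle l w d)
  Slab⇒RectIn {l} {w} {d} (p , q , r , h) = p , q , subst (l + w ≤_) length-L r , contained
    where
    contained : ∀ i y → InRect (rectangle l w d) (toℕ i) y → InM M i y
    contained i y u with rowView y
    ... | inj₂ nb = ⊥-elim (nb (InRect-base {l} {w} {d} {toℕ i} u))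
    ... | inj₁ (k , refl) = let (a , b) = InRect⇒ {l} {w} {d} u in within⇒InM (⊆-within (subst (d ⊆_) (nth-col i) (h (toℕ i) a)) b)

  RectIn-base : ∀ {R} → RectIn M R → B ℤ.≤ bottom R
  RectIn-base {R} (p , q , r , h) with position (≤-trans (m<m+n (left R) p) r)
  ... | i , e = InM-base (h i (bottom R) (≡⇒≤ (sym e) , subst (_< left R + width R) (sym e) (m<m+n (left R) p) , ℤP.≤-refl ,
      subst (ℤ._< bottom R ℤ.+ + height R) (ℤP.+-identityʳ (bottom R)) (ℤP.+-monoʳ-< (bottom R) (ℤ.+<+ q))))

  MaxRect⇒Maximal : ∀ {l w d} → MaxRect M (rectangle l w d) → Maximal L l w d
  MaxRect⇒Maximal {l} {w} {d} (ri , mx) = RectIn⇒Slab ri , λ {l'} {w'} {d'} sl a b s → mx (rectangle l' w' d') (Slab⇒RectIn sl)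
    (a , b , row-≤ (_⊆_.low s) , subst₂ ℤ._≤_ (sym (row-+ (lo d) (hgt d))) (sym (row-+ (lo d') (hgt d'))) (row-≤ (_⊆_.high s)))

  Maximal⇒MaxRect : ∀ {l w d} → Maximal L l w d → MaxRect M (rectangle l w d)
  Maximal⇒MaxRect {l} {w} {d} (sl , mx) = Slab⇒RectIn sl , λ R' ri → subst Bound (rectangle-rowsOf (RectIn-base ri)) (bound (left R') (width R') (rowsOf R')) ri
    where
    Bound : Rect → Set
    Bound R' = RectIn M R' → SubRect (rectangle l w d) R' → (width R' ≡ w) × (height R' ≡ hgt d)
    bound : ∀ l' w' d' → Bound (rectangle l' w' d')
    bound l' w' d' ri (a , b , u , v) = mx (RectIn⇒Slab {l'} {w'} {d'} ri) a b (row-≤⁻ u , row-≤⁻ (subst₂ ℤ._≤_ (row-+ (lo d) (hgt d)) (row-+ (lo d') (hgt d')) v))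

  region : ∀ {l w c d} → Spanned c l w → lo c ≡ lo d → hgt c ≡ hgt d → Region (rectangle l w d) (cols L c) (rows c)
  region {l} {w} {c} {d} sp p q = record { of-rect = cell-in ; to-rect = λ x k u v → InRect⇐ {l} {w} {d} (Spanned.inside→ sp x u) (subst₂ (λ a b → InW a b k) p q (yes-does (within? c k) v)) }
    where
    cell-in : ∀ (i : Fin (m M)) y → InRect (rectangle l w d) (toℕ i) y → ∃ λ k → y ≡ row k × cols L c (toℕ i) ≡ true × rows c k ≡ true
    cell-in i y u with rowView y
    ... | inj₂ nb = ⊥-elim (nb (InRect-base {l} {w} {d} {toℕ i} u))
    ... | inj₁ (k , refl) = let (a , b) = InRect⇒ {l} {w} {d} u in
          k , refl , Spanned.inside← sp (toℕ i) a , does-yes (within? c k) (subst₂ (λ a b → InW a b k) (sym p) (sym q) b)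

  Chained : Shape → Filling M → Set
  Chained Λ F = ∀ R → MaxRect M R → ChainCond t M F R (Λ (height R) (width R))

  Chained⇒GoodL : ∀ Λ F → Chained Λ F → GoodL t L Λ (toGrid F)
  Chained⇒GoodL Λ F h {d} i =
    let (l , w , mx , sp) = column-rectangle i
    in subst (λ v → ChainOK t (res (cols L d) (rows d) (toGrid F)) (Λ (hgt d) v)) (Spanned.wide sp)
         (cond→ (region {d = d} sp refl refl) F {Λ (hgt d) w} (h (rectangle l w d) (Maximal⇒MaxRect mx)))

  -- Each maximal rectangle is spanned by one of its columns, so the conditions indexed by columns
  -- reach all rectangles.
  GoodL⇒Chained : ∀ Λ F → GoodL t L Λ (toGrid F) → Chained Λ F
  GoodL⇒Chained Λ F g R mx = subst Goal (rectangle-rowsOf (RectIn-base (proj₁ mx))) (chained (left R) (width R) (rowsOf R)) mx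
    where
    Goal : Rect → Set
    Goal R = MaxRect M R → ChainCond t M F R (Λ (height R) (width R))
    chained : ∀ l w d → Goal (rectangle l w d)
    chained l w d mx = let (c , i , p , q , sp) = rectangle-column (MaxRect⇒Maximal {l} {w} {d} mx) in
      cond← (region {l} {w} {c} {d} sp p q) F {Λ (hgt d) w} (subst₂ (λ h v → ChainOK t (res (cols L c) (rows c) (toGrid F)) (Λ h v)) q (sym (Spanned.wide sp)) (g i))

  HasMaxRect⇒ : ∀ {h w} → HasMaxRect M h w → ∃ λ d → d ∈ L × hgt d ≡ h × span L d ≡ w
  HasMaxRect⇒ (R , mx , refl , refl) =
    let (c , i , _ , q , sp) = rectangle-column (MaxRect⇒Maximal {left R} {width R} {rowsOf R} (subst (MaxRect M) (sym (rectangle-rowsOf (RectIn-base (proj₁ mx)))) mx))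
    in c , i , q , sym (Spanned.wide sp)

  HasMaxRect⇐ : ∀ {h w} → (∃ λ d → d ∈ L × hgt d ≡ h × span L d ≡ w) → HasMaxRect M h w
  HasMaxRect⇐ (d , i , refl , refl) = let (l , w , mx , sp) = column-rectangle i in rectangle l w d , Maximal⇒MaxRect mx , refl , Spanned.wide sp

  top : ℕ
  top = sumL (λ d → lo d + hgt d) L

  totalSum-grid : ∀ {F} → Legal t L (toGrid F) → ∀ N → top ≤ N → totalSum M F ≡ S (λ x → S (toGrid F x) N) (length L)
  totalSum-grid {F} (s , _) N p = trans (sum-allFin (colSum M F)) (trans (S-cong (m M) column) (cong (S (λ x → S (toGrid F x) N)) (sym length-L)))
    where
    column : ∀ x → x < m M → extend (colSum M F) x ≡ S (toGrid F x) N
    column x q with position q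
    ... | i , refl = trans (extend-toℕ (colSum M F) i) (trans (colSum-grid F i)
        (window-sum (toGrid F (toℕ i)) (lo (col i)) (hgt (col i)) N (≤-trans (sumL-∈ (λ d → lo d + hgt d) (∈-map⁺ col (∈-allFin i))) p)
          (λ k nw → s (toℕ i) k (λ v → nw (subst (λ d → within d k) (nth-col i) v)))))

  Fit⇒ : ∀ {F} → Fit L (toGrid F) → ∀ i → colSum M F i ≡ labels i
  Fit⇒ {F} f i = trans (colSum-grid F i) (subst (λ d → S (λ k → toGrid F (toℕ i) (lo d + k)) (hgt d) ≡ tag d) (nth-col i) (f (toℕ i)))

  Fit⇐ : ∀ {F} → (∀ i → colSum M F i ≡ labels i) → Fit L (toGrid F)
  Fit⇐ {F} h x with ≤-<-connex (m M) x
  ... | inj₁ q rewrite nth-out L {x} (≤-trans (≡⇒≤ length-L) q) = refl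
  ... | inj₂ q with position q
  ... | i , refl = subst (λ d → S (λ k → toGrid F (toℕ i) (lo d + k)) (hgt d) ≡ tag d) (sym (nth-col i)) (trans (sym (colSum-grid F i)) (h i))

-- From relations on grids to bijections of fillings

module Biject (t : ChainType) {M M' : Poly} (moon : IsMoon M) (moon' : IsMoon M') {B B' : ℤ} (B≤ : ∀ i → B ℤ.≤ bot M i) (B≤' : ∀ i → B' ℤ.≤ bot M' i)
    (labels : Fin (m M) → ℕ) (labels' : Fin (m M') → ℕ) where

  module A = MaxRects t M moon B B≤ labels
  module A' = MaxRects t M' moon' B' B≤' labels'

  module _ {Q : Grid → Grid → Set} (E : Eqv t Q A.L A'.L) (respˡ : ∀ {F G G'} → F ≐G G → Q F G' → Q G G') (respʳ : ∀ {F G G'} → G ≐G G' → Q F G → Q F G')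
      (X : Filling M → Set) (X' : Filling M' → Set)
      (X→ : ∀ {F F'} → Supported M F → Supported M' F' → Legal t A.L (A.toGrid F) → Legal t A'.L (A'.toGrid F') → Q (A.toGrid F) (A'.toGrid F') → X F → X' F')
      (X← : ∀ {F F'} → Supported M F → Supported M' F' → Legal t A.L (A.toGrid F) → Legal t A'.L (A'.toGrid F') → Q (A.toGrid F) (A'.toGrid F') → X' F' → X F) (Λ : Shape) where

    private
      module E = Eqv E

      P : Filling M → Set
      P F = GoodFilling t M Λ F × X F

      P' : Filling M' → Set
      P' F = GoodFilling t M' Λ F × X' F

      legalP : ∀ {F} → P F → Legal t A.L (A.toGrid F)
      legalP ((s , z , _) , _) = A.legal t s z

      legalP' : ∀ {F} → P' F → Legal t A'.L (A'.toGrid F)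
      legalP' ((s , z , _) , _) = A'.legal t s z

    -- The maps take the partners supplied by the relation. That they respect pointwise equality and
    -- are mutually inverse is the uniqueness of partners on either side.
    bijection : FBij M M' P P'
    bijection = record
      { to = λ F p → A'.fromGrid (proj₁ (forth p))
      ; from = λ G q → A.fromGrid (proj₁ (back q))
      ; to-Q = λ F p → let (G' , o' , r) = forth p ; s' = A'.supported {t} o' ; z' = A'.entryCond t o' ; e = A'.to-fromGrid {t} o' in
          (s' , z' , A'.GoodL⇒Chained Λ (A'.fromGrid G') (GoodL-cong {t} {A'.L} {Λ} (λ x y → sym (e x y)) (E.good (legalP p) o' r Λ (A.Chained⇒GoodL Λ F (proj₂ (proj₂ (proj₁ p))))))) ,
          X→ (proj₁ (proj₁ p)) s' (legalP p) (A'.legal t s' z') (respʳ (λ x y → sym (e x y)) (E.extra (legalP p) o' r)) (proj₂ p)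
      ; from-P = λ F' p → let (G , o , r) = back p ; s = A.supported {t} o ; z = A.entryCond t o ; e = A.to-fromGrid {t} o in
          (s , z , A.GoodL⇒Chained Λ (A.fromGrid G) (GoodL-cong {t} {A.L} {Λ} (λ x y → sym (e x y)) (E.good' o (legalP' p) r Λ (A'.Chained⇒GoodL Λ F' (proj₂ (proj₂ (proj₁ p))))))) ,
          X← s (proj₁ (proj₁ p)) (A.legal t s z) (legalP' p) (respˡ (λ x y → sym (e x y)) (E.extra o (legalP' p) r)) (proj₂ p)
      ; to-cong = λ F F' p p' h → let (_ , o , r) = forth p ; (_ , o' , r') = forth p' in
          A'.fromGrid-cong (E.uniq (legalP p) (legalP p') o o' (A.toGrid-cong h) r r')
      ; from-cong = λ F F' p p' h → let (_ , o , r) = back p ; (_ , o' , r') = back p' in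
          A.fromGrid-cong (E.uniq' o o' (legalP' p) (legalP' p') (A'.toGrid-cong h) r r')
      ; from-to = λ F p q i y → let (_ , o' , r) = forth p ; (_ , o , r') = back q in
          trans (A.fromGrid-cong (E.uniq' o (legalP p) (legalP' q) o' (A'.to-fromGrid {t} o') r' r) i y) (A.from-toGrid (proj₁ (proj₁ p)) i y)
      ; to-from = λ F' q p i y → let (_ , o , r) = back q ; (_ , o' , r') = forth p in
          trans (A'.fromGrid-cong (E.uniq (legalP p) o o' (legalP' q) (A.to-fromGrid {t} o) r' r) i y) (A'.from-toGrid (proj₁ (proj₁ q)) i y) }
      where
      forth : ∀ {F} → P F → ∃ λ G' → Legal t A'.L G' × E.Rel (A.toGrid F) G'
      forth {F} p = E.to-rel (A.toGrid F) (legalP p)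
      back : ∀ {F'} → P' F' → ∃ λ G → Legal t A.L G × E.Rel G (A'.toGrid F')
      back {F'} p = E.from-rel (A'.toGrid F') (legalP' p)

-- Permutations of columns and the two statements

unique-↭ : ∀ {A : Set} {xs ys : List A} → Unique xs → Unique ys → (∀ {x} → x ∈ xs → x ∈ ys) → (∀ {x} → x ∈ ys → x ∈ xs) → xs ↭ ys
unique-↭ {ys = []} [] v f g = ↭-refl
unique-↭ {ys = y ∷ ys} [] v f g with g (here refl)
... | ()
unique-↭ {xs = x ∷ xs} (u ∷ us) v f g with ∈-∃++ (f (here refl))
... | as , bs , refl with pick-AllPairs (λ p q → p (sym q)) (pick-++ {x = x} as) v
... | w ∷ ws = ↭-trans (Perm.prep x (unique-↭ us ws fwd' bwd')) (↭-sym (shift x as bs))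
  where
  fwd' : ∀ {z} → z ∈ xs → z ∈ as ++ bs
  fwd' i with pick-other (pick-++ as) (f (there i))
  ... | inj₁ refl = ⊥-elim (All.lookup u i refl)
  ... | inj₂ j = j
  bwd' : ∀ {z} → z ∈ as ++ bs → z ∈ xs
  bwd' i with g (pick-∈ (pick-++ as) i)
  ... | here refl = ⊥-elim (All.lookup w i refl)
  ... | there j = j

permute-allFin : ∀ {n} (σ : Permutation′ n) → allFin n ↭ map (σ ⟨$⟩ˡ_) (allFin n)
permute-allFin {n} σ = unique-↭ (allFin⁺ n) (map⁺ injective (allFin⁺ n)) (λ {i} _ → subst (_∈ map (σ ⟨$⟩ˡ_) (allFin n)) (inverseˡ σ) (∈-map⁺ (σ ⟨$⟩ˡ_) (∈-allFin (σ ⟨$⟩ʳ i)))) (λ {i} _ → ∈-allFin i)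
  where
  injective : ∀ {i j} → σ ⟨$⟩ˡ i ≡ σ ⟨$⟩ˡ j → i ≡ j
  injective p = trans (sym (inverseʳ σ)) (trans (cong (σ ⟨$⟩ʳ_) p) (inverseʳ σ))

-- The minimum is attained as soon as there is an index; `0` is a default for the empty polyomino.
least : ∀ {n} (f : Fin n → ℤ) → ∃ λ B → (∀ i → B ℤ.≤ f i) × (Fin n → ∃ λ j → f j ≡ B)
least {zero} f = ℤ.0ℤ , (λ ()) , λ ()
least {suc n} f with least (f ∘ Fin.suc)
... | B , h , a with ℤP.≤-total B (f Fin.zero)
... | inj₂ q = f Fin.zero , (λ { Fin.zero → ℤP.≤-refl ; (Fin.suc i) → ℤP.≤-trans q (h i) }) , λ _ → Fin.zero , refl
least {suc zero} f | B , h , a | inj₁ p = f Fin.zero , (λ { Fin.zero → ℤP.≤-refl }) , λ _ → Fin.zero , refl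
least {suc (suc n)} f | B , h , a | inj₁ p = B , (λ { Fin.zero → p ; (Fin.suc i) → h i }) , λ _ → let (j , q) = a Fin.zero in Fin.suc j , q

module _ (M : Poly) (σ : Permutation′ (m M)) (moon : IsMoon M) (moon' : IsMoon (permPoly M σ)) (t : ChainType) (c : Fin (m M) → ℕ) where

  private
    B : ℤ
    B = proj₁ (least (bot M))
    B≤ : ∀ i → B ℤ.≤ bot M i
    B≤ = proj₁ (proj₂ (least (bot M)))
    module T = Biject t moon moon' {B} {B} B≤ (λ j → B≤ (σ ⟨$⟩ˡ j)) c (permVec σ c)
    open T using (module A; module A')

    L↭L' : A.L ↭ A'.L
    L↭L' = ↭-trans (PermP.map⁺ A.col (permute-allFin σ)) (↭-reflexive (sym (map-∘ (allFin (m M)))))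

  sameMaxRects : (h w : ℕ) → HasMaxRect M h w ⇔ HasMaxRect (permPoly M σ) h w
  sameMaxRects h w = mk⇔
    (λ p → let (d , i , q , r) = A.HasMaxRect⇒ p in A'.HasMaxRect⇐ (d , ∈-resp-↭ L↭L' i , q , trans (sym (span≡ d)) r))
    (λ p → let (d , i , q , r) = A'.HasMaxRect⇒ p in A.HasMaxRect⇐ (d , ∈-resp-↭ (↭-sym L↭L') i , q , trans (span≡ d) r))
    where
    span≡ : ∀ d → span A.L d ≡ span A'.L d
    span≡ d = sumL-↭ (λ e → ind (does (d ⊆? e))) L↭L'

  permuted : ∀ Λ r → FBij M (permPoly M σ) (FRC t M Λ r c) (FRC t (permPoly M σ) Λ r (permVec σ c))
  permuted Λ r = T.bijection (permute t L↭L' A.lunar A'.lunar)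
      (λ {F} {G} {G'} p q → SameSums-trans {A.L} {A.L} {A'.L} {G} {F} {G'} (SameSums-refl {A.L} (λ x y → sym (p x y))) q)
      (λ {F} {G} {G'} p q → SameSums-trans {A.L} {A'.L} {A'.L} {F} {G} {G'} q (SameSums-refl {A'.L} p))
      (λ F → (∀ y → rowSum M F y ≡ r y) × (∀ i → colSum M F i ≡ c i)) (λ F → (∀ y → rowSum (permPoly M σ) F y ≡ r y) × (∀ i → colSum (permPoly M σ) F i ≡ permVec σ c i))
      (λ {F} {F'} s s' _ _ (e , f , _) (h , k) →
        (λ y → trans (sym (rows≡ {F} {F'} s s' e y)) (h y)) , A'.Fit⇒ {F'} (f (A.Fit⇐ {F} k)))
      (λ {F} {F'} s s' _ _ (e , _ , g) (h , k) →
        (λ y → trans (rows≡ {F} {F'} s s' e y) (h y)) , A.Fit⇒ {F} (g (A'.Fit⇐ {F'} k))) Λ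
    where
    rows≡ : ∀ {F F'} → Supported M F → Supported (permPoly M σ) F' → (∀ k → S (λ x → A.toGrid F x k) (length A.L) ≡ S (λ x → A'.toGrid F' x k) (length A'.L)) →
        ∀ y → rowSum M F y ≡ rowSum (permPoly M σ) F' y
    rows≡ {F} {F'} s s' e y with A.rowView y
    ... | inj₁ (k , refl) = trans (A.rowSum-grid F k) (trans (e k) (sym (A'.rowSum-grid F' k)))
    ... | inj₂ nb = trans (A.rowSum-below {F} (λ i → s i y (λ h → nb (A.InM-base h)))) (sym (A'.rowSum-below {F'} (λ i → s' i y (λ h → nb (A'.InM-base h)))))

module _ (t : ChainType) {M M' : Poly} (moon : IsMoon M) (moon' : IsMoon M') (content : SameContent M M') where

  private
    base : ∀ (M : Poly) → ∃ λ B → (∀ i → B ℤ.≤ bot M i) × (Fin (m M) → ∃ λ j → bot M j ≡ B)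
    base M = least (bot M)
    module T = Biject t moon moon' {proj₁ (base M)} {proj₁ (base M')} (proj₁ (proj₂ (base M))) (proj₁ (proj₂ (base M'))) (λ _ → 0) (λ _ → 0)
    open T using (module A; module A')

    alt-base : ∀ (B : ℤ) → ℤ.∣ B ℤ.- B ∣ ≡ 0
    alt-base B = cong ℤ.∣_∣ (ℤP.+-inverseʳ B)

    grounded : Grounded A.L
    grounded i with ∈-map⁻ A.col i
    ... | a , _ , _ = let (j , q) = proj₂ (proj₂ (base M)) a in A.col j , ∈-map⁺ A.col (∈-allFin j) , trans (cong A.alt q) (alt-base (proj₁ (base M)))

    grounded' : Grounded A'.L
    grounded' i with ∈-map⁻ A'.col i
    ... | a , _ , _ = let (j , q) = proj₂ (proj₂ (base M')) a in A'.col j , ∈-map⁺ A'.col (∈-allFin j) , trans (cong A'.alt q) (alt-base (proj₁ (base M')))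

    standing : ℕ → Col
    standing h = ⟨ 0 , h , 0 ⟩

    ground↭ : map ground A.L ↭ map ground A'.L
    ground↭ = ↭-trans (↭-reflexive (trans (sym (map-∘ (allFin (m M)))) (map-∘ (allFin (m M)))))
      (↭-trans (PermP.map⁺ standing content) (↭-reflexive (sym (trans (sym (map-∘ (allFin (m M')))) (map-∘ (allFin (m M')))))))

  rearranged : ∀ Λ n → FBij M M' (FN t M Λ n) (FN t M' Λ n)
  rearranged Λ n = T.bijection (sameContent t A.lunar A'.lunar grounded grounded' ground↭)
      (λ {F} {G} {G'} p q → TotalSame-trans {A.L} {A.L} {A'.L} {G} {F} {G'} (TotalSame-refl {A.L} (λ x y → sym (p x y))) q)
      (λ {F} {G} {G'} p q → TotalSame-trans {A.L} {A'.L} {A'.L} {F} {G} {G'} q (TotalSame-refl {A'.L} p))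
      (λ F → totalSum M F ≡ n) (λ F → totalSum M' F ≡ n)
      (λ {F} {F'} _ _ o o' q h → trans (sym (totals≡ {F} {F'} o o' q)) h) (λ {F} {F'} _ _ o o' q h → trans (totals≡ {F} {F'} o o' q) h) Λ
    where
    totals≡ : ∀ {F F'} → Legal t A.L (A.toGrid F) → Legal t A'.L (A'.toGrid F') → TotalSame A.L A'.L (A.toGrid F) (A'.toGrid F') → totalSum M F ≡ totalSum M' F'
    totals≡ {F} {F'} o o' (N₀ , e) = let N = N₀ + (A.top + A'.top) in
      trans (A.totalSum-grid {F} o N (≤-trans (m≤m+n A.top A'.top) (m≤n+m _ N₀)))
        (trans (e N (m≤m+n N₀ _)) (sym (A'.totalSum-grid {F'} o' N (≤-trans (m≤n+m A'.top A.top) (m≤n+m _ N₀)))))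

theorem5p3 : ((M : Poly) (σ : Permutation′ (m M)) → IsMoon M → IsMoon (permPoly M σ) →
    ((h w : ℕ) → HasMaxRect M h w ⇔ HasMaxRect (permPoly M σ) h w)
    × ((t : ChainType) (Λ : Shape) (r : ℤ → ℕ) (c : Fin (m M) → ℕ) →
       FBij M (permPoly M σ) (FRC t M Λ r c) (FRC t (permPoly M σ) Λ r (permVec σ c))))
           × ((t : ChainType) (M M' : Poly) → IsMoon M → IsMoon M' → SameContent M M' →
               (Λ : Shape) (n : ℕ) → FBij M M' (FN t M Λ n) (FN t M' Λ n))
-- Maximal rectangles depend neither on the type of chains nor on column sums; `ne` and the zero
-- vector merely instantiate the parameters.
theorem5p3 = (λ M σ moon moon' → sameMaxRects M σ moon moon' ne (λ _ → 0) , λ t Λ r c → permuted M σ moon moon' t c Λ r) ,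
    λ t M M' moon moon' content → rearranged t moon moon' content
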